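{- Let $g\ge 0$ be an integer. (i) If $g\le 5$, then the gonality sequence of a graph of genus $g$ is determined by $g$ and its first gonality; that is, if $G$ and $G'$ are graphs, both of genus $g$, with $\mathrm{gon}_1(G)=\mathrm{gon}_1(G')$, then $\mathrm{gon}_r(G)=\mathrm{gon}_r(G')$ for all $r\ge 1$. (ii) If $g\geq 6$, then there exist graphs $G$ and $H$ of genus $g$ with $\mathrm{gon}_1(G)=\mathrm{gon}_1(H)$ such that $G$ and $H$ do not have the same gonality sequence.
   Context: All graphs are finite, connected, loopless multigraphs with nonempty vertex set $V(G)$ and multiset of edges $E(G)$. The genus of $G$ is $g(G)=|E(G)|-|V(G)|+1$. A divisor on $G$ is an element $D=\sum_v D(v)\cdot v$ of the free abelian group on $V(G)$; its degree is $\deg(D)=\sum_v D(v)$; it is effective if $D(v)\ge 0$ for all $v$. The Laplacian matrix has diagonal entries $\mathrm{val}(v)$ (number of edges incident to $v$) and off-diagonal entries $-|E(v,w)|$ (minus the number of edges between $v$ and $w$). Divisors $D,D'$ are linearly equivalent, $D\sim D'$, if $D-D'$ is in the image of $\mathbb{Z}^{V(G)}$ under the Laplacian. The rank $r(D)$ is $-1$ if $D$ is not equivalent to any effective divisor; otherwise it is the largest integer $r\ge 0$ such that for every effective divisor $E$ of degree $r$, $D-E$ is equivalent to an effective divisor. For an integer $r\ge 1$, the $r$-th gonality is $\mathrm{gon}_r(G)=\min\{\deg(D): D \text{ a divisor on } G,\ r(D)\ge r\}$. The gonality sequence of $G$ is $\mathrm{gon}_1(G),\mathrm{gon}_2(G),\mathrm{gon}_3(G),\ldots$.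 -}

module Defs where

open import Data.Bool.Base using (if_then_else_)
open import Data.Fin.Base using (Fin)
import Data.Fin.Base as Fin
import Data.Fin.Properties as Fin
open import Data.Integer.Base using (ℤ; +_; -_; -1ℤ; 0ℤ; 1ℤ; _+_; _-_; _*_; _≤_)
import Data.Integer.Properties as ℤ
open import Data.Nat.Base as ℕ using (ℕ; suc)
import Data.Nat.Properties as ℕ
open import Data.Product.Base using (_×_; ∃-syntax; Σ-syntax)
open import Relation.Binary.Construct.Closure.ReflexiveTransitive using (Star)
open import Relation.Binary.PropositionalEquality.Core using (_≡_; _≢_)
open import Relation.Nullary.Decidable.Core using (does)
open import Relation.Nullary.Negation.Core using (¬_)

open import Algebra.Properties.CommutativeMonoid.Sum ℕ.+-0-commutativeMonoid
  using () renaming (sum to sumℕ)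
open import Algebra.Properties.CommutativeMonoid.Sum ℤ.+-0-commutativeMonoid
  using () renaming (sum to sumℤ)

-- The vertex set is Fin (suc n), so it is nonempty.  The multiset of edges is
-- given by its multiplicity function: mult v w is the number of edges joining
-- v and w.
record Graph : Set where
  field
    n         : ℕ

  Vertex : Set
  Vertex = Fin (suc n)

  field
    mult      : Vertex → Vertex → ℕ
    symmetric : ∀ v w → mult v w ≡ mult w v
    loopless  : ∀ v → mult v v ≡ 0

  Adjacent : Vertex → Vertex → Set
  Adjacent v w = 0 ℕ.< mult v w

  field
    connected : ∀ v w → Star Adjacent v w

module _ (G : Graph) where
  open Graph G

  ∣V∣ : ℕ
  ∣V∣ = suc n

  -- Each unordered pair {v , w} is counted once, as v < w.
  ∣E∣ : ℕ
  ∣E∣ = sumℕ λ v → sumℕ λ w → if does (v Fin.<? w) then mult v w else 0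

  genus : ℤ
  genus = + ∣E∣ - + ∣V∣ + 1ℤ

  val : Vertex → ℕ
  val v = sumℕ (mult v)

  laplacian : Vertex → Vertex → ℤ
  laplacian v w = if does (v Fin.≟ w) then + val v else - (+ mult v w)

  Divisor : Set
  Divisor = Vertex → ℤ

  deg : Divisor → ℤ
  deg D = sumℤ D

  Effective : Divisor → Set
  Effective D = ∀ v → 0ℤ ≤ D v

  infixl 6 _⊖_
  _⊖_ : Divisor → Divisor → Divisor
  (D ⊖ D′) v = D v - D′ v

  infix 4 _∼_
  _∼_ : Divisor → Divisor → Set
  D ∼ D′ = Σ[ f ∈ (Vertex → ℤ) ] ∀ v → (D ⊖ D′) v ≡ sumℤ λ w → laplacian v w * f w

  EquivalentToEffective : Divisor → Set
  EquivalentToEffective D = ∃[ D′ ] Effective D′ × D ∼ D′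

  SurvivesRemoving : Divisor → ℕ → Set
  SurvivesRemoving D r =
    ∀ E → Effective E → deg E ≡ + r → EquivalentToEffective (D ⊖ E)

  -- HasRank D ρ is the graph of the rank function: it says r(D) = ρ.
  data HasRank (D : Divisor) : ℤ → Set where
    rank-−1  : ¬ EquivalentToEffective D → HasRank D -1ℤ
    rank-max : ∀ {r} → EquivalentToEffective D →
               SurvivesRemoving D r →
               (∀ s → SurvivesRemoving D s → s ℕ.≤ r) →
               HasRank D (+ r)

  RankAtLeast : Divisor → ℕ → Set
  RankAtLeast D r = ∃[ ρ ] HasRank D ρ × + r ≤ ρ

  -- IsGon r d says gon_r(G) = d: the degree d is attained by a divisor of rank
  -- at least r, and no such divisor has smaller degree.
  IsGon : ℕ → ℤ → Set
  IsGon r d =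
    (∃[ D ] RankAtLeast D r × deg D ≡ d) ×
    (∀ D → RankAtLeast D r → d ≤ deg D)

-- gon_r(G) = gon_r(H) and gon_r(G) ≠ gon_r(H).  Both are stated positively, so
-- that each asserts that the two minima exist.
SameGon : Graph → Graph → ℕ → Set
SameGon G H r = ∃[ d ] IsGon G r d × IsGon H r d

DifferentGon : Graph → Graph → ℕ → Set
DifferentGon G H r = ∃[ d ] ∃[ d′ ] IsGon G r d × IsGon H r d′ × d ≢ d′

{-# OPTIONS --safe #-}
-- Firing a set of vertices is legal if no vertex of it goes into debt.  Dhar's burning
-- algorithm turns a divisor into an effective one or puts it below an acyclic
-- orientation; this decides effectivity and gives Riemann–Roch, hence Clifford's
-- inequality 2 r(D) ≤ deg D for special D.  In genus at most 5 duality then determines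
-- all gonalities from the first, except that in genus 5 one must know that a divisor D
-- of degree 4 and rank 2 forces a divisor of degree 2 and rank 1.
--
-- For the latter, leaves are deleted and a graph glued at a cut vertex is treated on its
-- two sides, so G may be taken 2-connected.  Removing a chip from an effective divisor
-- equivalent to D leaves, for every empty vertex w, a legal set avoiding w, and such
-- sets have at least two outgoing edges.  If branching vertices lie on both sides of a
-- pair of edges, two disjoint 2-edge-connected sets Z and Y with two outgoing edges
-- exist, and a single chip cannot leave such a set; this yields D ~ ∂Z + ∂Y, where ∂Z
-- consists of the ends in Z of those edges.  Either ∂Z ~ ∂Y, and ∂Z has rank 1, or both Z
-- and Y are cycles, which is too little for genus 5.  If no pair of edges separates
-- branching vertices, the legal sets with three outgoing edges show that G consists of
-- two vertices joined by six paths.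
--
-- The graphs of genus g ≥ 6 are paths u = v = w with 2 and g, respectively 3 and g - 1,
-- parallel edges: the first gonality is 3 for both, the second is 5, respectively 6.

module Submission where

open import Defs
open import Data.Bool.Base using (Bool; true; false; if_then_else_; not; _∧_; _∨_)
open import Data.Empty using (⊥; ⊥-elim)
open import Data.Fin.Base using (Fin; zero; suc; toℕ)
import Data.Fin.Base as Fin
import Data.Fin.Properties as Fin
import Data.Bool.Properties as Bool
open import Data.Integer.Base using (ℤ; +_; -[1+_]; -_; -1ℤ; 0ℤ; 1ℤ; _+_; _-_; _*_; _≤_; _<_; +≤+; +<+; -<+; -<-; ∣_∣; nonNegative)
import Data.Integer.Properties as ℤ
open import Data.Integer.DivMod using (_%ℕ_; _/ℕ_; n%ℕd<d; a≡a%ℕn+[a/ℕn]*n)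
open import Data.Integer.Tactic.RingSolver using (solve-∀)
open import Data.Nat.Base as ℕ using (ℕ; suc; zero; z≤n; s≤s)
import Data.Nat.Properties as ℕ
open import Data.Nat.Tactic.RingSolver using () renaming (solve-∀ to ℕ-solve-∀)
open import Data.Product.Base using (_×_; _,_; ∃-syntax; Σ-syntax; proj₁; proj₂)
open import Data.Fin.Subset.Properties using (anySubset?)
open import Data.Sum.Base using (_⊎_; inj₁; inj₂)
import Data.Vec.Base as Vec
import Data.Vec.Properties as Vec
open import Data.Unit.Base using (⊤; tt)
open import Function.Base using (_∘_)
open import Relation.Binary.Construct.Closure.ReflexiveTransitive using (Star; ε; _◅_; _◅◅_; reverse)
open import Relation.Binary.Definitions using (tri<; tri≈; tri>)
open import Relation.Binary.PropositionalEquality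
open import Relation.Nullary using (¬_; Dec; yes; no; does; ¬?)
open import Function.Bundles using (mk⇔)
open import Relation.Nullary.Decidable using (does-⇔; dec-true; dec-false; _×-dec_; _→-dec_)

open import Algebra.Properties.CommutativeMonoid.Sum ℕ.+-0-commutativeMonoid
  using () renaming (sum to sumℕ)
open import Algebra.Properties.CommutativeMonoid.Sum ℤ.+-0-commutativeMonoid
  using (sum; sum-cong-≗; ∑-distrib-+; ∑-comm; sum-replicate-zero; sum-remove)

-- Riemann's bound settles `r ≥ g`, the canonical divisor settles `g - 1`, and `K` minus a point or
-- multiples of a divisor of degree 2 settle `g - 2`. What remains is `2 ≤ r ≤ g - 3`, which for
-- `g ≤ 5` means `r = 2` and `g = 5`. There degree 5 is dual to degree 3 and rank 1, but degree 4 is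
-- dual to itself, because `K` has degree 8; duality is silent about it, and this case needs the
-- combinatorics of the graph.
--
-- The leverage is that the chip held back can be chosen. Each choice gives its own legal set, and
-- contradictions arise from combining these sets: a union has fewer outgoing edges at each of its
-- vertices, and submodularity bounds the cut of an intersection.
--
-- The number 8 is the sum of `valency - 2` over all vertices. Two cycles with two outgoing edges
-- each supply only 4 of it; vertices of valency 3 supply 1 each, so four chips cannot occupy all of
-- them; two branching vertices share it, and one of them has valency at least 6.
--
-- Case distinctions are constructive: burning decides effectivity up to equivalence, and vertex
-- sets can be enumerated.

sum-neg : ∀ {n} (f : Fin n → ℤ) → sum (λ i → - f i) ≡ - sum f
sum-neg {zero}  f = refl
sum-neg {suc n} f = trans (cong (_+_ (- f zero)) (sum-neg (f ∘ suc)))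
                          (sym (ℤ.neg-distrib-+ (f zero) (sum (f ∘ suc))))

sum-sub : ∀ {n} (f g : Fin n → ℤ) → sum (λ i → f i - g i) ≡ sum f - sum g
sum-sub f g = trans (∑-distrib-+ f (λ i → - g i)) (cong (_+_ (sum f)) (sum-neg g))

sum-*ˡ : ∀ {n} c (f : Fin n → ℤ) → sum (λ i → c * f i) ≡ c * sum f
sum-*ˡ {zero}  c f = sym (ℤ.*-zeroʳ c)
sum-*ˡ {suc n} c f = trans (cong (_+_ (c * f zero)) (sum-*ˡ c (f ∘ suc)))
                           (sym (ℤ.*-distribˡ-+ c (f zero) _))

sum-mono : ∀ {n} {f g : Fin n → ℤ} → (∀ i → f i ≤ g i) → sum f ≤ sum g
sum-mono {zero}  p = ℤ.≤-refl
sum-mono {suc n} p = ℤ.+-mono-≤ (p zero) (sum-mono (p ∘ suc))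

sum-nonneg : ∀ {n} {f : Fin n → ℤ} → (∀ i → 0ℤ ≤ f i) → 0ℤ ≤ sum f
sum-nonneg {n} {f} p = subst (_≤ sum f) (sum-replicate-zero n) (sum-mono {f = λ _ → 0ℤ} p)

term≤sum : ∀ {n} {f : Fin n → ℤ} → (∀ i → 0ℤ ≤ f i) → ∀ i → f i ≤ sum f
term≤sum {suc n} {f} p zero =
  subst (_≤ sum f) (ℤ.+-identityʳ _) (ℤ.+-monoʳ-≤ (f zero) (sum-nonneg (p ∘ suc)))
term≤sum {suc n} {f} p (suc i) =
  subst (_≤ sum f) (ℤ.+-identityˡ _) (ℤ.+-mono-≤ (p zero) (term≤sum (p ∘ suc) i))

sum-ℕ : ∀ {n} (f : Fin n → ℕ) → + sumℕ f ≡ sum (λ i → + f i)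
sum-ℕ {zero}  f = refl
sum-ℕ {suc n} f = trans (ℤ.pos-+ (f zero) _) (cong (_+_ (+ f zero)) (sum-ℕ (f ∘ suc)))

single : ∀ {n} → Fin n → ℤ → Fin n → ℤ
single i x j = if does (i Fin.≟ j) then x else 0ℤ

single-eq : ∀ {n} (i : Fin n) x → single i x i ≡ x
single-eq i x with i Fin.≟ i
... | yes _ = refl
... | no ¬p = ⊥-elim (¬p refl)

single-neq : ∀ {n} (i : Fin n) x {j} → i ≢ j → single i x j ≡ 0ℤ
single-neq i x {j} i≢j with i Fin.≟ j
... | yes p = ⊥-elim (i≢j p)
... | no _  = refl

sum-single : ∀ {n} (i : Fin n) x → sum (single i x) ≡ x
sum-single {suc n} zero x = begin
  x + sum (λ (j : Fin n) → 0ℤ)          ≡⟨ cong (_+_ x) (sum-replicate-zero n) ⟩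
  x + 0ℤ                                ≡⟨ ℤ.+-identityʳ x ⟩
  x                                     ∎
  where open ≡-Reasoning
sum-single {suc n} (suc i) x =
  trans (ℤ.+-identityˡ _) (trans (sum-cong-≗ shift) (sum-single i x))
  where
  shift : ∀ j → single (suc i) x (suc j) ≡ single i x j
  shift j with i Fin.≟ j
  ... | yes _ = refl
  ... | no  _ = refl

indicator : Bool → ℤ
indicator b = if b then 1ℤ else 0ℤ

1≤diff : ∀ {a b} → a < b → 1ℤ ≤ b - a
1≤diff {a} {b} a<b = subst (_≤ b - a) (cancel a) (ℤ.+-monoˡ-≤ (- a) (ℤ.i<j⇒suc[i]≤j a<b))
  where
  cancel : ∀ a → 1ℤ + a - a ≡ 1ℤ
  cancel = solve-∀

-- The order is a parameter because both integers and lexicographically ordered pairs are maximised.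
maximum : ∀ {n} {A : Set} (_⊑_ : A → A → Set) → (∀ x → x ⊑ x) →
          (∀ {x y z} → x ⊑ y → y ⊑ z → x ⊑ z) → (∀ x y → (x ⊑ y) ⊎ (y ⊑ x)) →
          (f : Fin (suc n) → A) → ∃[ i ] (∀ j → f j ⊑ f i)
maximum {zero} _⊑_ rfl trns tot f = zero , λ { zero → rfl _ }
maximum {suc n} _⊑_ rfl trns tot f with maximum _⊑_ rfl trns tot (f ∘ suc)
... | i , max with tot (f zero) (f (suc i))
...   | inj₁ le = suc i , λ { zero → le ; (suc j) → max j }
...   | inj₂ ge = zero , λ { zero → rfl _ ; (suc j) → trns (max j) ge }

status : ∀ b → (b ≡ true) ⊎ (b ≡ false)
status true  = inj₁ refl
status false = inj₂ refl

true≢false : ∀ {b} → b ≡ true → b ≡ false → ⊥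
true≢false refl ()

-- Sets are Boolean functions whereas the enumeration runs over vectors. Translating back gives only
-- a pointwise equal function, so `P` has to respect pointwise equality.
any-subset? : ∀ {n} (P : (Fin n → Bool) → Set) → (∀ {A B} → (∀ v → A v ≡ B v) → P A → P B) → (∀ A → Dec (P A)) → Dec (∃[ A ] P A)
any-subset? P resp P? = decide (anySubset? (λ s → P? (Vec.lookup s)))
  where
  decide : Dec (∃[ s ] P (Vec.lookup s)) → Dec (∃[ A ] P A)
  decide (yes (s , Ps)) = yes (Vec.lookup s , Ps)
  decide (no none) = no λ { (A , PA) → none (Vec.tabulate A , resp (λ v → sym (Vec.lookup∘tabulate A v)) PA) }

-- The Laplacian, linear equivalence and acyclic orientations

module Theory (G : Graph) where
  open Graph G

  m : Vertex → Vertex → ℤ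
  m v w = + mult v w

  m-sym : ∀ v w → m v w ≡ m w v
  m-sym v w = cong +_ (symmetric v w)

  m-loop : ∀ v → m v v ≡ 0ℤ
  m-loop v = cong +_ (loopless v)

  m≥0 : ∀ v w → 0ℤ ≤ m v w
  m≥0 v w = +≤+ z≤n

  -- Written with differences, the valency on the diagonal is absorbed and constants visibly lie in
  -- the kernel.
  lap : (Vertex → ℤ) → Vertex → ℤ
  lap f v = sum λ w → m v w * (f v - f w)

  laplacian-lap : ∀ f v → sum (λ w → laplacian G v w * f w) ≡ lap f v
  laplacian-lap f v = begin
    sum (λ w → laplacian G v w * f w)
      ≡⟨ sum-cong-≗ pointwise ⟩
    sum (λ w → single v (+ val G v * f v) w - m v w * f w)
      ≡⟨ sum-sub (single v (+ val G v * f v)) (λ w → m v w * f w) ⟩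
    sum (single v (+ val G v * f v)) - sum (λ w → m v w * f w)
      ≡⟨ cong (_- sum (λ w → m v w * f w)) (trans (sum-single v _) expand) ⟩
    sum (λ w → m v w * f v) - sum (λ w → m v w * f w)
      ≡⟨ sum-sub (λ w → m v w * f v) (λ w → m v w * f w) ⟨
    sum (λ w → m v w * f v - m v w * f w)
      ≡⟨ sum-cong-≗ (λ w → factor (m v w) (f v) (f w)) ⟩
    lap f v ∎
    where
    open ≡-Reasoning
    factor : ∀ a b c → a * b - a * c ≡ a * (b - c)
    factor = solve-∀
    expand : + val G v * f v ≡ sum (λ w → m v w * f v)
    expand = begin
      + val G v * f v             ≡⟨ cong (_* f v) (sum-ℕ (mult v)) ⟩
      sum (m v) * f v             ≡⟨ ℤ.*-comm (sum (m v)) (f v) ⟩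
      f v * sum (m v)             ≡⟨ sum-*ˡ (f v) (m v) ⟨
      sum (λ w → f v * m v w)     ≡⟨ sum-cong-≗ (λ w → ℤ.*-comm (f v) (m v w)) ⟩
      sum (λ w → m v w * f v)     ∎
    pointwise : ∀ w → laplacian G v w * f w ≡ single v (+ val G v * f v) w - m v w * f w
    pointwise w with v Fin.≟ w
    ... | yes refl = trans (sym (ℤ.+-identityʳ _))
                       (cong (λ z → + val G v * f v - z * f v) (sym (m-loop v)))
    ... | no _ = trans (sym (ℤ.neg-distribˡ-* (m v w) (f w))) (sym (ℤ.+-identityˡ _))

  m*≥0 : ∀ v w {x} → 0ℤ ≤ x → 0ℤ ≤ m v w * x
  m*≥0 v w {x} p = subst (_≤ m v w * x) (ℤ.*-zeroʳ (m v w)) (ℤ.*-monoˡ-≤-nonNeg (m v w) p)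

  lap-+ : ∀ f g v → lap (λ u → f u + g u) v ≡ lap f v + lap g v
  lap-+ f g v = trans (sum-cong-≗ λ w → eq (m v w) (f v) (f w) (g v) (g w))
    (∑-distrib-+ (λ w → m v w * (f v - f w)) (λ w → m v w * (g v - g w)))
    where
    eq : ∀ a b c d e → a * ((b + d) - (c + e)) ≡ a * (b - c) + a * (d - e)
    eq = solve-∀

  lap-neg : ∀ f v → lap (λ u → - f u) v ≡ - lap f v
  lap-neg f v = trans (sum-cong-≗ λ w → eq (m v w) (f v) (f w))
                      (sum-neg (λ w → m v w * (f v - f w)))
    where
    eq : ∀ a b c → a * (- b - - c) ≡ - (a * (b - c))
    eq = solve-∀

  lap-0 : ∀ v → lap (λ _ → 0ℤ) v ≡ 0ℤ
  lap-0 v = trans (sum-cong-≗ λ w → ℤ.*-zeroʳ (m v w)) (sum-replicate-zero (suc n))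

  -- Exchanging the two summations turns the sum into its own negative.
  sum-antisym : (h : Vertex → Vertex → ℤ) → (∀ v w → h v w ≡ - h w v) →
                sum (λ v → sum (h v)) ≡ 0ℤ
  sum-antisym h anti = half (begin
    S                                 ≡⟨ ∑-comm h ⟩
    sum (λ w → sum (λ v → h v w))     ≡⟨ sum-cong-≗ (λ w → sum-cong-≗ λ v → anti v w) ⟩
    sum (λ w → sum (λ v → - h w v))   ≡⟨ sum-cong-≗ (λ w → sum-neg (h w)) ⟩
    sum (λ w → - sum (h w))           ≡⟨ sum-neg (λ w → sum (h w)) ⟩
    - S                               ∎)
    where
    open ≡-Reasoning
    S = sum (λ v → sum (h v))
    half : ∀ {x} → x ≡ - x → x ≡ 0ℤ
    half {+ zero} eq = refl
    half {+ suc n} ()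
    half { -[1+ n ]} ()

  deg-lap : ∀ f → sum (lap f) ≡ 0ℤ
  deg-lap f = sum-antisym (λ v w → m v w * (f v - f w)) λ v w →
    trans (cong (_* (f v - f w)) (m-sym v w)) (eq (m w v) (f v) (f w))
    where
    eq : ∀ a b c → a * (b - c) ≡ - (a * (c - b))
    eq = solve-∀

  infix 4 _≋_
  -- The relation `_∼_` without subtraction. The function `f` is the script that leads from `D` to
  -- `D′` when every vertex `v` is fired `f v` times.
  _≋_ : Divisor G → Divisor G → Set
  D ≋ D′ = ∃[ f ] ∀ v → D v ≡ D′ v + lap f v

  to-∼ : ∀ {D D′} → D ≋ D′ → _∼_ G D D′
  to-∼ {D} {D′} (f , eq) = f , λ v → trans
    (trans (cong (_- D′ v) (eq v)) (cancel (D′ v) (lap f v))) (sym (laplacian-lap f v))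
    where
    cancel : ∀ a b → a + b - a ≡ b
    cancel = solve-∀

  from-∼ : ∀ {D D′} → _∼_ G D D′ → D ≋ D′
  from-∼ {D} {D′} (f , eq) = f , λ v → trans (regroup (D v) (D′ v))
    (cong (_+_ (D′ v)) (trans (eq v) (laplacian-lap f v)))
    where
    regroup : ∀ a b → a ≡ b + (a - b)
    regroup = solve-∀

  ≋-refl : ∀ {D} → D ≋ D
  ≋-refl {D} = (λ _ → 0ℤ) , λ v → trans (sym (ℤ.+-identityʳ _)) (cong (_+_ (D v)) (sym (lap-0 v)))

  ≋-trans : ∀ {D D′ D″} → D ≋ D′ → D′ ≋ D″ → D ≋ D″
  ≋-trans {D} {D′} {D″} (f , p) (g , q) = (λ u → g u + f u) , λ v → begin
    D v                        ≡⟨ p v ⟩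
    D′ v + lap f v             ≡⟨ cong (_+ lap f v) (q v) ⟩
    D″ v + lap g v + lap f v   ≡⟨ ℤ.+-assoc (D″ v) (lap g v) (lap f v) ⟩
    D″ v + (lap g v + lap f v) ≡⟨ cong (_+_ (D″ v)) (lap-+ g f v) ⟨
    D″ v + lap (λ u → g u + f u) v ∎
    where open ≡-Reasoning

  ≋-sym : ∀ {D D′} → D ≋ D′ → D′ ≋ D
  ≋-sym {D} {D′} (f , p) = (λ u → - f u) , λ v → trans (eq (D′ v) (lap f v))
    (cong₂ _+_ (sym (p v)) (sym (lap-neg f v)))
    where
    eq : ∀ a b → a ≡ (a + b) + - b
    eq = solve-∀

  ≋-+ : ∀ {A A′ B B′} → A ≋ A′ → B ≋ B′ → (λ v → A v + B v) ≋ (λ v → A′ v + B′ v)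
  ≋-+ {A} {A′} {B} {B′} (f , p) (g , q) = (λ u → f u + g u) , λ v → begin
    A v + B v                               ≡⟨ cong₂ _+_ (p v) (q v) ⟩
    A′ v + lap f v + (B′ v + lap g v)       ≡⟨ eq (A′ v) (lap f v) (B′ v) (lap g v) ⟩
    A′ v + B′ v + (lap f v + lap g v)       ≡⟨ cong (_+_ (A′ v + B′ v)) (lap-+ f g v) ⟨
    A′ v + B′ v + lap (λ u → f u + g u) v   ∎
    where
    open ≡-Reasoning
    eq : ∀ a b c d → a + b + (c + d) ≡ a + c + (b + d)
    eq = solve-∀

  ≋-deg : ∀ {D D′} → D ≋ D′ → deg G D ≡ deg G D′
  ≋-deg {D} {D′} (f , p) = begin
    sum D                      ≡⟨ sum-cong-≗ p ⟩
    sum (λ v → D′ v + lap f v) ≡⟨ ∑-distrib-+ D′ (lap f) ⟩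
    sum D′ + sum (lap f)       ≡⟨ cong (_+_ (sum D′)) (deg-lap f) ⟩
    sum D′ + 0ℤ                ≡⟨ ℤ.+-identityʳ _ ⟩
    sum D′                     ∎
    where open ≡-Reasoning

  -- The divisor of the acyclic orientation in which every edge points towards
  -- its endpoint of larger rank: indegree minus one.
  ν : (Vertex → ℤ) → Divisor G
  ν rk v = sum (λ w → if does (rk w ℤ.<? rk v) then m v w else 0ℤ) - 1ℤ

  Injective : (Vertex → ℤ) → Set
  Injective rk = ∀ {v w} → rk v ≡ rk w → v ≡ w

  -- At a vertex maximising f, and of least rank among those, the orientation
  -- divisor loses at least one chip along every incoming edge.
  ν-not-effective : ∀ rk {E} → Effective G E → ¬ (ν rk ≋ E)
  ν-not-effective rk {E} E≥0 (f , eq) =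
    ℤ.<⇒≱ {E v} {0ℤ} (ℤ.≤-<-trans E≤-1 (-<+ {0})) (E≥0 v)
    where
    _⊑_ : ℤ × ℤ → ℤ × ℤ → Set
    (a , b) ⊑ (c , d) = (a < c) ⊎ ((a ≡ c) × (d ≤ b))
    ⊑-trans : ∀ {x y z} → x ⊑ y → y ⊑ z → x ⊑ z
    ⊑-trans (inj₁ p) (inj₁ q) = inj₁ (ℤ.<-trans p q)
    ⊑-trans (inj₁ p) (inj₂ (refl , _)) = inj₁ p
    ⊑-trans (inj₂ (refl , _)) (inj₁ q) = inj₁ q
    ⊑-trans (inj₂ (refl , p)) (inj₂ (refl , q)) = inj₂ (refl , ℤ.≤-trans q p)
    ⊑-total : ∀ x y → (x ⊑ y) ⊎ (y ⊑ x)
    ⊑-total (a , b) (c , d) with ℤ.<-cmp a c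
    ... | tri< p _ _ = inj₁ (inj₁ p)
    ... | tri> _ _ p = inj₂ (inj₁ p)
    ... | tri≈ _ p _ with ℤ.≤-total b d
    ...   | inj₁ q = inj₂ (inj₂ (sym p , q))
    ...   | inj₂ q = inj₁ (inj₂ (p , q))
    best = maximum _⊑_ (λ _ → inj₂ (refl , ℤ.≤-refl)) ⊑-trans ⊑-total (λ v → f v , rk v)
    v = proj₁ best
    lower≤ : ∀ w → (if does (rk w ℤ.<? rk v) then m v w else 0ℤ) ≤ m v w * (f v - f w)
    lower≤ w with rk w ℤ.<? rk v | proj₂ best w
    ... | yes p | inj₂ (_ , q) = ⊥-elim (ℤ.<⇒≱ p q)
    ... | yes p | inj₁ q = subst (_≤ m v w * (f v - f w)) (ℤ.*-identityʳ (m v w))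
            (ℤ.*-monoˡ-≤-nonNeg (m v w) (1≤diff {f w} {f v} q))
    ... | no _ | inj₁ q = m*≥0 v w (ℤ.≤-trans (ℤ.i≤suc[i] 0ℤ) (1≤diff {f w} {f v} q))
    ... | no _ | inj₂ (q , _) = m*≥0 v w (ℤ.i≤j⇒0≤j-i (ℤ.≤-reflexive q))
    E≤-1 : E v ≤ -1ℤ
    E≤-1 = subst₂ _≤_ (trans (cong (_- lap f v) (eq v)) (cancel (E v) (lap f v))) refl
      (ℤ.≤-trans (ℤ.≤-reflexive (regroup (sum lower) (lap f v)))
        (ℤ.+-monoʳ-≤ -1ℤ (ℤ.i≤j⇒i-j≤0 (sum-mono {f = lower} lower≤))))
      where
      lower : Vertex → ℤ
      lower w = if does (rk w ℤ.<? rk v) then m v w else 0ℤ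
      regroup : ∀ a b → a - 1ℤ - b ≡ -1ℤ + (a - b)
      regroup = solve-∀
      cancel : ∀ a b → a + b - b ≡ a
      cancel = solve-∀

  -- An edge points one way in the orientation and the other way in its reverse. Equal ranks can
  -- only belong to equal vertices, where there is no edge.
  compare-ranks : ∀ rk → Injective rk → ∀ v w →
    (if does (rk w ℤ.<? rk v) then m v w else 0ℤ) + (if does (- rk w ℤ.<? - rk v) then m v w else 0ℤ) ≡ m v w
  compare-ranks rk inj v w with rk w ℤ.<? rk v | - rk w ℤ.<? - rk v
  ... | yes p | yes q = ⊥-elim (ℤ.<-asym p (ℤ.neg-cancel-< q))
  ... | yes _ | no _  = ℤ.+-identityʳ _
  ... | no _  | yes _ = ℤ.+-identityˡ _
  ... | no p  | no q with ℤ.<-cmp (rk w) (rk v)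
  ...   | tri< a _ _ = ⊥-elim (p a)
  ...   | tri> _ _ c = ⊥-elim (q (ℤ.neg-mono-< c))
  ...   | tri≈ _ b _ with inj b
  ...     | refl = sym (m-loop v)

  canonical : Divisor G
  canonical v = + val G v - + 2

  ν-reverse : ∀ rk → Injective rk → ∀ v → ν rk v + ν (λ u → - rk u) v ≡ canonical v
  ν-reverse rk inj v = begin
    (sum lower - 1ℤ) + (sum upper - 1ℤ)  ≡⟨ regroup (sum lower) (sum upper) ⟩
    (sum lower + sum upper) - + 2        ≡⟨ cong (_- + 2) (∑-distrib-+ lower upper) ⟨
    sum (λ w → lower w + upper w) - + 2  ≡⟨ cong (_- + 2) (sum-cong-≗ (compare-ranks rk inj v)) ⟩
    sum (m v) - + 2                      ≡⟨ cong (_- + 2) (sum-ℕ (mult v)) ⟨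
    canonical v                          ∎
    where
    open ≡-Reasoning
    lower upper : Vertex → ℤ
    lower w = if does (rk w ℤ.<? rk v) then m v w else 0ℤ
    upper w = if does (- rk w ℤ.<? - rk v) then m v w else 0ℤ
    regroup : ∀ a b → a - 1ℤ + (b - 1ℤ) ≡ a + b - + 2
    regroup = solve-∀

  -- Legal sets and Dhar's burning algorithm

  out : (Vertex → Bool) → Vertex → ℤ
  out A v = sum λ w → if A w then 0ℤ else m v w

  record Legal (D : Divisor G) (q : Vertex) : Set where
    constructor legal
    field
      set      : Vertex → Bool
      avoids   : set q ≡ false
      {member} : Vertex
      nonempty : set member ≡ true
      bound    : ∀ v → set v ≡ true → out set v ≤ D v

  -- By `ν-not-effective` this certifies that the class of `D` contains no effective divisor.
  Dominated : Divisor G → Set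
  Dominated D = ∃[ rk ] Injective rk × (∀ v → D v ≤ ν rk v)

  private
    if≥0 : ∀ b {x : ℤ} → 0ℤ ≤ x → 0ℤ ≤ (if b then x else 0ℤ)
    if≥0 true  p = p
    if≥0 false p = ℤ.≤-refl

    upd : ∀ {A : Set} → Vertex → A → (Vertex → A) → Vertex → A
    upd v x f u = if does (v Fin.≟ u) then x else f u

    upd-eq : ∀ {A : Set} v (x : A) f → upd v x f v ≡ x
    upd-eq v x f with v Fin.≟ v
    ... | yes _ = refl
    ... | no ¬p = ⊥-elim (¬p refl)

    upd-neq : ∀ {A : Set} v (x : A) f {u} → v ≢ u → upd v x f u ≡ f u
    upd-neq v x f {u} ¬p with v Fin.≟ u
    ... | yes p = ⊥-elim (¬p p)
    ... | no _  = refl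

  module Burning (D : Divisor G) (q : Vertex) where

    fire : (Vertex → Bool) → (Vertex → ℤ) → Vertex → Vertex → ℤ
    fire B rk v w = if B w then (if does (rk w ℤ.<? rk v) then m v w else 0ℤ) else 0ℤ

    fire-in : ∀ B rk v w → B w ≡ true → fire B rk v w ≡ (if does (rk w ℤ.<? rk v) then m v w else 0ℤ)
    fire-in B rk v w eq = cong (λ b → if b then (if does (rk w ℤ.<? rk v) then m v w else 0ℤ) else 0ℤ) eq

    fire-out : ∀ B rk v w → B w ≡ false → fire B rk v w ≡ 0ℤ
    fire-out B rk v w eq = cong (λ b → if b then (if does (rk w ℤ.<? rk v) then m v w else 0ℤ) else 0ℤ) eq

    fire≥0 : ∀ B rk v w → 0ℤ ≤ fire B rk v w
    fire≥0 B rk v w = if≥0 (B w) (if≥0 (does (rk w ℤ.<? rk v)) (m≥0 v w))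

    unburnt : (Vertex → Bool) → ℤ
    unburnt B = sum λ v → if B v then 0ℤ else 1ℤ

    -- `B` is the burnt part and `rk` the time of burning, with clock `k`. If edges point from
    -- earlier to later, a burnt vertex has fewer chips than incoming edges; at `q` this is the debt
    -- that starts the fire.
    record State (k : ℕ) (B : Vertex → Bool) (rk : Vertex → ℤ) : Set where
      field
        start     : B q ≡ true
        below     : ∀ v → B v ≡ true → rk v < + k
        distinct  : ∀ {v w} → B v ≡ true → B w ≡ true → rk v ≡ rk w → v ≡ w
        dominated : ∀ v → B v ≡ true → D v ≤ sum (fire B rk v) - 1ℤ

    heat : (Vertex → Bool) → Vertex → ℤ
    heat B v = sum λ w → if B w then m v w else 0ℤ

    -- A vertex with fewer chips than burning edges catches fire. Its time `k` is later than all
    -- others, so its burning edges all point towards it and those of the older vertices are kept.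
    extend : ∀ {k B rk} → State k B rk → ∀ v → B v ≡ false → D v < heat B v →
             State (suc k) (upd v true B) (upd v (+ k) rk)
    extend {k} {B} {rk} st v v∉B hot = record
      { start = start′ ; below = below′ ; distinct = distinct′ ; dominated = dominated′ }
      where
      open State st
      B′ = upd v true B
      rk′ = upd v (+ k) rk
      old : ∀ {u} → B u ≡ true → v ≢ u
      old u∈B refl = true≢false u∈B v∉B
      B′-old : ∀ {u} → B u ≡ true → B′ u ≡ true
      B′-old u∈B = trans (upd-neq v true B (old u∈B)) u∈B
      rk′-old : ∀ {u} → B u ≡ true → rk′ u ≡ rk u
      rk′-old u∈B = upd-neq v (+ k) rk (old u∈B)
      split : ∀ u → B′ u ≡ true → (v ≡ u) ⊎ (B u ≡ true)
      split u u∈B′ with v Fin.≟ u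
      ... | yes p = inj₁ p
      ... | no _  = inj₂ u∈B′
      start′ : B′ q ≡ true
      start′ = B′-old start
      below′ : ∀ u → B′ u ≡ true → rk′ u < + suc k
      below′ u u∈B′ with split u u∈B′
      ... | inj₁ refl = subst (_< + suc k) (sym (upd-eq v (+ k) rk)) (+<+ ℕ.≤-refl)
      ... | inj₂ u∈B = subst (_< + suc k) (sym (rk′-old u∈B))
              (ℤ.<-trans (below u u∈B) (+<+ ℕ.≤-refl))
      fresh : ∀ {u} → B u ≡ true → rk u ≢ + k
      fresh {u} u∈B eq = ℤ.<-irrefl eq (below u u∈B)
      distinct′ : ∀ {u w} → B′ u ≡ true → B′ w ≡ true → rk′ u ≡ rk′ w → u ≡ w
      distinct′ {u} {w} u∈ w∈ eq with split u u∈ | split w w∈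
      ... | inj₁ refl | inj₁ refl = refl
      ... | inj₁ refl | inj₂ w∈B = ⊥-elim (fresh w∈B
              (trans (sym (rk′-old w∈B)) (trans (sym eq) (upd-eq v (+ k) rk))))
      ... | inj₂ u∈B | inj₁ refl = ⊥-elim (fresh u∈B
              (trans (sym (rk′-old u∈B)) (trans eq (upd-eq v (+ k) rk))))
      ... | inj₂ u∈B | inj₂ w∈B = distinct u∈B w∈B
              (trans (sym (rk′-old u∈B)) (trans eq (rk′-old w∈B)))
      grow : ∀ u → B u ≡ true → ∀ w → fire B rk u w ≤ fire B′ rk′ u w
      grow u u∈B w with status (B w)
      ... | inj₂ eq = subst (_≤ fire B′ rk′ u w) (sym (fire-out B rk u w eq)) (fire≥0 B′ rk′ u w)
      ... | inj₁ eq = ℤ.≤-reflexive (trans (fire-in B rk u w eq) (trans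
              (cong₂ (λ a b → if does (a ℤ.<? b) then m u w else 0ℤ) (sym (rk′-old eq)) (sym (rk′-old u∈B)))
              (sym (fire-in B′ rk′ u w (B′-old eq)))))
      ignite : ∀ w → (if B w then m v w else 0ℤ) ≤ fire B′ rk′ v w
      ignite w with status (B w)
      ... | inj₂ eq = subst (λ b → (if b then m v w else 0ℤ) ≤ fire B′ rk′ v w) (sym eq) (fire≥0 B′ rk′ v w)
      ... | inj₁ eq = ℤ.≤-reflexive (trans (cong (λ b → if b then m v w else 0ℤ) eq) (sym (trans
              (fire-in B′ rk′ v w (B′-old eq))
              (trans (cong₂ (λ a b → if does (a ℤ.<? b) then m v w else 0ℤ) (rk′-old eq) (upd-eq v (+ k) rk))
                     (cong (λ b → if b then m v w else 0ℤ) (dec-true (rk w ℤ.<? + k) (below w eq)))))))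
      dominated′ : ∀ u → B′ u ≡ true → D u ≤ sum (fire B′ rk′ u) - 1ℤ
      dominated′ u u∈B′ with split u u∈B′
      ... | inj₂ u∈B = ℤ.≤-trans (dominated u u∈B)
              (ℤ.+-monoˡ-≤ -1ℤ (sum-mono {f = fire B rk u} (grow u u∈B)))
      ... | inj₁ refl = ℤ.≤-trans (ℤ.i<j⇒i≤pred[j] hot)
              (subst (_≤ sum (fire B′ rk′ v) - 1ℤ) (ℤ.+-comm (heat B v) -1ℤ)
                (ℤ.+-monoˡ-≤ -1ℤ (sum-mono {f = λ w → if B w then m v w else 0ℤ} ignite)))

    unburnt-upd : ∀ B v → B v ≡ false → unburnt (upd v true B) ≡ unburnt B - 1ℤ
    unburnt-upd B v v∉B = trans (sum-cong-≗ pointwise)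
      (trans (sum-sub (λ u → if B u then 0ℤ else 1ℤ) (single v 1ℤ))
             (cong (_-_ (unburnt B)) (sum-single v 1ℤ)))
      where
      pointwise : ∀ u → (if upd v true B u then 0ℤ else 1ℤ) ≡ (if B u then 0ℤ else 1ℤ) - single v 1ℤ u
      pointwise u with v Fin.≟ u
      ... | yes refl rewrite v∉B = refl
      ... | no _ = sym (ℤ.+-identityʳ _)

    -- The fuel bounds the number of unburnt vertices. When nothing more catches fire, the unburnt
    -- vertices form a legal set; if there are none, the times of burning are the ranks of the
    -- orientation.
    loop : ∀ fuel {k B rk} → unburnt B ≤ + fuel → State k B rk → Legal D q ⊎ Dominated D
    loop fuel {k} {B} {rk} enough st
      with Fin.any? (λ v → (B v Bool.≟ false) ×-dec (D v ℤ.<? heat B v))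
    ... | yes (v , v∉B , hot) with fuel
    ...   | suc fuel′ = loop fuel′ (subst (_≤ + fuel′) (sym (unburnt-upd B v v∉B))
              (ℤ.+-monoˡ-≤ -1ℤ enough)) (extend st v v∉B hot)
    ...   | zero = ⊥-elim (ℤ.<⇒≱ {0ℤ} {1ℤ} (+<+ (s≤s z≤n))
              (ℤ.≤-trans (subst (λ b → 1ℤ ≤ (if b then 0ℤ else 1ℤ)) (sym v∉B) ℤ.≤-refl)
                (ℤ.≤-trans (term≤sum {f = λ u → if B u then 0ℤ else 1ℤ} nonneg v) enough)))
      where
      nonneg : ∀ u → 0ℤ ≤ (if B u then 0ℤ else 1ℤ)
      nonneg u with B u
      ... | true  = ℤ.≤-refl
      ... | false = +≤+ z≤n
    loop fuel {k} {B} {rk} enough st | no cold with Fin.any? (λ v → B v Bool.≟ false)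
    ... | yes (v , v∉B) = inj₁ (legal (not ∘ B) (cong not start) (cong not v∉B) bound)
      where
      open State st
      bound : ∀ u → not (B u) ≡ true → out (not ∘ B) u ≤ D u
      bound u u∈A = subst (_≤ D u) (sum-cong-≗ flip)
        (ℤ.≮⇒≥ λ hot → cold (u , trans (sym (Bool.not-involutive (B u))) (cong not u∈A) , hot))
        where
        flip : ∀ w → (if B w then m u w else 0ℤ) ≡ (if not (B w) then 0ℤ else m u w)
        flip w with B w
        ... | true  = refl
        ... | false = refl
    ... | no none = inj₂ (rk , (λ {v} {w} → distinct (all v) (all w)) , λ v →
            ℤ.≤-trans (dominated v (all v)) (ℤ.≤-reflexive (cong (_- 1ℤ) (sum-cong-≗ λ w →
              cong (λ b → if b then (if does (rk w ℤ.<? rk v) then m v w else 0ℤ) else 0ℤ) (all w)))))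
      where
      open State st
      all : ∀ v → B v ≡ true
      all v with B v in eq
      ... | true  = refl
      ... | false = ⊥-elim (none (v , eq))

    burn : D q < 0ℤ → Legal D q ⊎ Dominated D
    burn Dq<0 = loop ∣ unburnt B₀ ∣ {1} (ℤ.≤-reflexive (sym (ℤ.0≤i⇒+∣i∣≡i (sum-nonneg nonneg)))) record
      { start = B₀q
      ; below = λ v _ → +<+ (s≤s z≤n)
      ; distinct = λ {v} {w} v∈ w∈ _ → trans (sym (only v v∈)) (only w w∈)
      ; dominated = λ v v∈ → subst (λ u → D u ≤ sum (fire B₀ (λ _ → 0ℤ) u) - 1ℤ) (only v v∈)
          (ℤ.≤-trans (ℤ.i<j⇒i≤pred[j] Dq<0)
            (subst (-1ℤ ≤_) (ℤ.+-comm -1ℤ (sum (fire B₀ (λ _ → 0ℤ) q)))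
              (ℤ.+-monoʳ-≤ -1ℤ (sum-nonneg (fire≥0 B₀ (λ _ → 0ℤ) q)))))
      }
      where
      B₀ : Vertex → Bool
      B₀ = upd q true (λ _ → false)
      B₀q : B₀ q ≡ true
      B₀q = upd-eq q true (λ _ → false)
      only : ∀ v → B₀ v ≡ true → q ≡ v
      only v v∈ with q Fin.≟ v
      ... | yes p = p
      nonneg : ∀ v → 0ℤ ≤ (if B₀ v then 0ℤ else 1ℤ)
      nonneg v with B₀ v
      ... | true  = ℤ.≤-refl
      ... | false = +≤+ z≤n

  𝟙 : (Vertex → Bool) → Vertex → ℤ
  𝟙 A v = indicator (A v)

  lap-set-in : ∀ A v → A v ≡ true → lap (𝟙 A) v ≡ out A v
  lap-set-in A v v∈A = sum-cong-≗ pointwise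
    where
    pointwise : ∀ w → m v w * (𝟙 A v - 𝟙 A w) ≡ (if A w then 0ℤ else m v w)
    pointwise w rewrite v∈A with A w
    ... | true  = ℤ.*-zeroʳ (m v w)
    ... | false = ℤ.*-identityʳ (m v w)

  lap-set-out : ∀ A v → A v ≡ false → lap (𝟙 A) v ≤ 0ℤ
  lap-set-out A v v∉A = subst (lap (𝟙 A) v ≤_) (sum-replicate-zero (suc n)) (sum-mono pointwise)
    where
    pointwise : ∀ w → m v w * (𝟙 A v - 𝟙 A w) ≤ 0ℤ
    pointwise w rewrite v∉A with A w
    ... | true  = subst (_≤ 0ℤ) (ℤ.*-comm -1ℤ (m v w))
                    (subst (_≤ 0ℤ) (sym (ℤ.-1*i≡-i (m v w))) (ℤ.neg-mono-≤ (m≥0 v w)))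
    ... | false = ℤ.≤-reflexive (ℤ.*-zeroʳ (m v w))

  -- Firing never pushes a vertex below the smaller of 0 and its old value.
  infix 4 _⊑_
  _⊑_ : Divisor G → Divisor G → Set
  D ⊑ D′ = ∀ v → (0ℤ ≤ D′ v) ⊎ (D v ≤ D′ v)

  ⊑-trans : ∀ {A B C} → A ⊑ B → B ⊑ C → A ⊑ C
  ⊑-trans p q v with q v
  ... | inj₁ nn = inj₁ nn
  ... | inj₂ le with p v
  ...   | inj₁ nn = inj₁ (ℤ.≤-trans nn le)
  ...   | inj₂ le′ = inj₂ (ℤ.≤-trans le′ le)

  fired : Divisor G → (Vertex → Bool) → Divisor G
  fired D A v = D v - lap (𝟙 A) v

  fired-⊑ : ∀ {D q} (L : Legal D q) → D ⊑ fired D (Legal.set L)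
  fired-⊑ {D} (legal A _ _ bound) v with status (A v)
  ... | inj₁ v∈A = inj₁ (ℤ.i≤j⇒0≤j-i (subst (_≤ D v) (sym (lap-set-in A v v∈A)) (bound v v∈A)))
  ... | inj₂ v∉A = inj₂ (subst (_≤ D v - lap (𝟙 A) v) (ℤ.+-identityʳ (D v))
                     (ℤ.+-monoʳ-≤ (D v) (ℤ.neg-mono-≤ (lap-set-out A v v∉A))))

  -- Termination of legal firing

  module Saturation (D₀ : Divisor G) (q : Vertex) where

    private
      M : ℤ
      M = sum λ v → + ∣ D₀ v ∣

      -M≤ : ∀ {D} → D₀ ⊑ D → ∀ v → 0ℤ ≤ D v + M
      -M≤ {D} low v with low v
      ... | inj₁ nn = ℤ.+-mono-≤ nn (sum-nonneg {f = λ v → + ∣ D₀ v ∣} λ _ → +≤+ z≤n)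
      ... | inj₂ le = ℤ.≤-trans (0≤x+∣x∣ (D₀ v))
              (ℤ.+-mono-≤ le (term≤sum {f = λ v → + ∣ D₀ v ∣} (λ _ → +≤+ z≤n) v))
        where
        0≤x+∣x∣ : ∀ x → 0ℤ ≤ x + + ∣ x ∣
        0≤x+∣x∣ (+ k) = +≤+ z≤n
        0≤x+∣x∣ -[1+ k ] = ℤ.≤-reflexive (sym (ℤ.+-inverseˡ (+ suc k)))

      C : ℤ
      C = sum λ v → D₀ v + M

      -- After adding `M` all entries are nonnegative, and the degree does not change under firing,
      -- so a single entry is at most the total.
      ceiling : ∀ {D} → D₀ ⊑ D → D ≋ D₀ → ∀ v → D v ≤ C
      ceiling {D} low eqv v = ℤ.≤-trans
        (subst (_≤ D v + M) (ℤ.+-identityʳ (D v))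
          (ℤ.+-monoʳ-≤ (D v) (sum-nonneg {f = λ v → + ∣ D₀ v ∣} λ _ → +≤+ z≤n)))
        (ℤ.≤-trans (term≤sum {f = λ v → D v + M} (-M≤ low) v) (ℤ.≤-reflexive (begin
          sum (λ v → D v + M)        ≡⟨ ∑-distrib-+ D (λ _ → M) ⟩
          sum D + sum {suc n} (λ _ → M)  ≡⟨ cong (_+ sum {suc n} (λ _ → M)) (≋-deg {D} {D₀} eqv) ⟩
          sum D₀ + sum {suc n} (λ _ → M) ≡⟨ ∑-distrib-+ D₀ (λ _ → M) ⟨
          C                          ∎)))
        where open ≡-Reasoning

      -- A bound on how often the first vertex of a path to `q` can have been fired. The vertex `q`
      -- never fires; if `v′` has fired boundedly often, its neighbours cannot have fired much more,
      -- since their chips would raise `v′` above `C`.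
      cap : ∀ {v} → Star Adjacent v q → ℤ
      cap ε = 0ℤ
      cap (_◅_ {_} {v′} _ p) = sum (m v′) * cap p + C - D₀ v′

      capped : ∀ F → (∀ v → 0ℤ ≤ F v) → F q ≡ 0ℤ → D₀ ⊑ (λ v → D₀ v - lap F v) →
               ∀ {v} (p : Star Adjacent v q) → F v ≤ cap p
      capped F F≥0 Fq low ε = ℤ.≤-reflexive Fq
      capped F F≥0 Fq low {v} (_◅_ {_} {v′} adj p) = begin
        F v                                ≡⟨ ℤ.*-identityˡ (F v) ⟨
        1ℤ * F v                           ≤⟨ ℤ.*-monoʳ-≤-nonNeg (F v) {{nonNegative (F≥0 v)}} (+≤+ adj′) ⟩
        m v′ v * F v                       ≤⟨ term≤sum {f = λ w → m v′ w * F w} (λ w → m*≥0 v′ w (F≥0 w)) v ⟩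
        sum (λ w → m v′ w * F w)           ≡⟨ shape ⟩
        sum (m v′) * F v′ + D′ v′ - D₀ v′  ≤⟨ ℤ.+-monoˡ-≤ (- D₀ v′) (ℤ.+-mono-≤
                                                (ℤ.*-monoˡ-≤-nonNeg (sum (m v′)) {{nonNegative (sum-nonneg (m≥0 v′))}}
                                                  (capped F F≥0 Fq low p))
                                                (ceiling low D′≋D₀ v′)) ⟩
        sum (m v′) * cap p + C - D₀ v′     ∎
        where
        open ℤ.≤-Reasoning
        adj′ : 1 ℕ.≤ mult v′ v
        adj′ = subst (1 ℕ.≤_) (symmetric v v′) adj
        D′ : Divisor G
        D′ u = D₀ u - lap F u
        D′≋D₀ : D′ ≋ D₀
        D′≋D₀ = (λ u → - F u) , λ u → cong (_+_ (D₀ u)) (sym (lap-neg F u))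
        shape : sum (λ w → m v′ w * F w) ≡ sum (m v′) * F v′ + D′ v′ - D₀ v′
        shape = sym (begin-equality
          sum (m v′) * F v′ + D′ v′ - D₀ v′
            ≡⟨ regroup (sum (m v′)) (F v′) (D₀ v′) (lap F v′) ⟩
          F v′ * sum (m v′) - lap F v′
            ≡⟨ cong (_- lap F v′) (sum-*ˡ (F v′) (m v′)) ⟨
          sum (λ w → F v′ * m v′ w) - lap F v′
            ≡⟨ sum-sub (λ w → F v′ * m v′ w) (λ w → m v′ w * (F v′ - F w)) ⟨
          sum (λ w → F v′ * m v′ w - m v′ w * (F v′ - F w))
            ≡⟨ sum-cong-≗ (λ w → cancel (m v′ w) (F v′) (F w)) ⟩
          sum (λ w → m v′ w * F w) ∎)
          where
          regroup : ∀ a f d l → a * f + (d - l) - d ≡ f * a - l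
          regroup = solve-∀
          cancel : ∀ a b c → b * a - a * (b - c) ≡ a * c
          cancel = solve-∀

    -- The engine behind every argument that drives chips towards a vertex. Legal sets avoiding `q`
    -- are fired while they preserve `P`. The accumulated script stays below `cap` and each firing
    -- increases it, so `step` must at some point yield `Q`.
    saturation : ∀ {P : Divisor G → Set} {Q : Set} →
      (∀ D → D ≋ D₀ → D₀ ⊑ D → P D → Q ⊎ (Σ[ L ∈ Legal D q ] P (fired D (Legal.set L)))) →
      P D₀ → Q
    saturation {P} {Q} step P₀ = run ∣ total ∣ D₀ (λ _ → 0ℤ) (λ _ → ℤ.≤-refl) refl start
        (λ v → inj₂ ℤ.≤-refl) P₀
        (ℤ.≤-reflexive (trans (sum-cong-≗ λ v → ℤ.+-identityʳ (cap (path v)))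
          (sym (ℤ.0≤i⇒+∣i∣≡i (sum-nonneg {f = λ v → cap (path v)} λ v →
            capped (λ _ → 0ℤ) (λ _ → ℤ.≤-refl) refl
              (λ u → inj₂ (ℤ.≤-reflexive (start u))) (path v))))))
      where
      path : ∀ v → Star Adjacent v q
      path v = connected v q
      total : ℤ
      total = sum λ v → cap (path v)
      start : ∀ v → D₀ v ≡ D₀ v - lap (λ _ → 0ℤ) v
      start v = sym (trans (cong (_-_ (D₀ v)) (lap-0 v)) (ℤ.+-identityʳ (D₀ v)))
      run : ∀ fuel D F → (∀ v → 0ℤ ≤ F v) → F q ≡ 0ℤ → (∀ v → D v ≡ D₀ v - lap F v) →
            D₀ ⊑ D → P D → sum (λ v → cap (path v) - F v) ≤ + fuel → Q
      run fuel D F F≥0 Fq D≡ low PD enough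
        with step D ((λ u → - F u) , λ u → trans (D≡ u) (cong (_+_ (D₀ u)) (sym (lap-neg F u)))) low PD
      ... | inj₁ done = done
      ... | inj₂ (L@(legal A q∉A {u} u∈A bound) , PD′) = continue fuel (ℤ.≤-trans drop (ℤ.+-monoˡ-≤ -1ℤ enough))
        where
        F′ : Vertex → ℤ
        F′ v = F v + 𝟙 A v
        𝟙≥0 : ∀ v → 0ℤ ≤ 𝟙 A v
        𝟙≥0 v with A v
        ... | true  = +≤+ z≤n
        ... | false = ℤ.≤-refl
        F′≥0 : ∀ v → 0ℤ ≤ F′ v
        F′≥0 v = ℤ.+-mono-≤ (F≥0 v) (𝟙≥0 v)
        F′q : F′ q ≡ 0ℤ
        F′q = cong₂ _+_ Fq (cong indicator q∉A)
        D′≡ : ∀ v → fired D A v ≡ D₀ v - lap F′ v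
        D′≡ v = trans (cong (_- lap (𝟙 A) v) (D≡ v))
          (trans (regroup (D₀ v) (lap F v) (lap (𝟙 A) v)) (cong (_-_ (D₀ v)) (sym (lap-+ F (𝟙 A) v))))
          where
          regroup : ∀ a b c → a - b - c ≡ a - (b + c)
          regroup = solve-∀
        low′ : D₀ ⊑ fired D A
        low′ = ⊑-trans low (fired-⊑ L)
        low″ : D₀ ⊑ (λ v → D₀ v - lap F′ v)
        low″ v with low′ v
        ... | inj₁ p = inj₁ (subst (0ℤ ≤_) (D′≡ v) p)
        ... | inj₂ p = inj₂ (subst (D₀ v ≤_) (D′≡ v) p)
        drop : sum (λ v → cap (path v) - F′ v) ≤ sum (λ v → cap (path v) - F v) - 1ℤ
        drop = begin
          sum (λ v → cap (path v) - F′ v)                       ≡⟨ sum-cong-≗ (λ v → regroup (cap (path v)) (F v) (𝟙 A v)) ⟩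
          sum (λ v → (cap (path v) - F v) - 𝟙 A v)              ≡⟨ sum-sub (λ v → cap (path v) - F v) (𝟙 A) ⟩
          sum (λ v → cap (path v) - F v) - sum (𝟙 A)            ≤⟨ ℤ.+-monoʳ-≤ (sum (λ v → cap (path v) - F v)) (ℤ.neg-mono-≤
                                                                     (subst (_≤ sum (𝟙 A)) (cong indicator u∈A) (term≤sum {f = 𝟙 A} 𝟙≥0 u))) ⟩
          sum (λ v → cap (path v) - F v) - 1ℤ                   ∎
          where
          open ℤ.≤-Reasoning
          regroup : ∀ a b c → a - (b + c) ≡ a - b - c
          regroup = solve-∀
        continue : ∀ fuel → sum (λ v → cap (path v) - F′ v) ≤ + fuel - 1ℤ → Q
        continue (suc fuel) enough′ = run fuel (fired D A) F′ F′≥0 F′q D′≡ low′ PD′ enough′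
        continue zero enough′ = ⊥-elim (ℤ.<⇒≱ (ℤ.≤-<-trans enough′ (-<+ {0}))
          (sum-nonneg λ v → ℤ.i≤j⇒0≤j-i (capped F′ F′≥0 F′q low″ (path v))))

    saturate :
      (∃[ D ] D ≋ D₀ × D₀ ⊑ D × 0ℤ ≤ D q) ⊎ (∃[ D ] D ≋ D₀ × D₀ ⊑ D × Dominated D)
    saturate = saturation {P = λ _ → ⊤} step tt
      where
      step : ∀ D → D ≋ D₀ → D₀ ⊑ D → ⊤ → _
      step D D≋D₀ low _ with 0ℤ ℤ.≤? D q
      ... | yes nn = inj₁ (inj₁ (D , D≋D₀ , low , nn))
      ... | no neg with Burning.burn D q (ℤ.≰⇒> neg)
      ...   | inj₂ dom = inj₁ (inj₂ (D , D≋D₀ , low , dom))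
      ...   | inj₁ L = inj₂ (L , tt)

  -- The vertices are made nonnegative one after the other; by ⊑ they stay so.
  effective-or-dominated : ∀ D → (∃[ E ] Effective G E × D ≋ E) ⊎ (∃[ E ] Dominated E × D ≋ E)
  effective-or-dominated D = sweep (suc n) D ≋-refl (λ v p → ⊥-elim (ℕ.<⇒≱ (Fin.toℕ<n v) p))
    where
    Result = (∃[ E ] Effective G E × D ≋ E) ⊎ (∃[ E ] Dominated E × D ≋ E)
    sweep : ∀ k (E : Divisor G) → D ≋ E → (∀ v → k ℕ.≤ toℕ v → 0ℤ ≤ E v) → Result
    sweep zero E D≋E nn = inj₁ (E , (λ v → nn v z≤n) , D≋E)
    sweep (suc k) E D≋E nn with Fin.any? (λ v → toℕ v ℕ.≟ k)
    ... | no none = sweep k E D≋E λ v k≤v → nn v (ℕ.≤∧≢⇒< k≤v λ eq → none (v , sym eq))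
    ... | yes (q , q≡k) with Saturation.saturate E q
    ...   | inj₂ (E′ , E′≋E , _ , dom) = inj₂ (E′ , dom , ≋-trans {D} {E} {E′} D≋E (≋-sym {E′} {E} E′≋E))
    ...   | inj₁ (E′ , E′≋E , low , E′q≥0) = sweep k E′ (≋-trans {D} {E} {E′} D≋E (≋-sym {E′} {E} E′≋E)) keep
      where
      keep : ∀ v → k ℕ.≤ toℕ v → 0ℤ ≤ E′ v
      keep v q≤v with k ℕ.≟ toℕ v
      ... | yes eq = subst (λ u → 0ℤ ≤ E′ u) (Fin.toℕ-injective (trans q≡k eq)) E′q≥0
      ... | no neq with low v
      ...   | inj₁ p = p
      ...   | inj₂ p = ℤ.≤-trans (nn v (ℕ.≤∧≢⇒< q≤v neq)) p

  EffClass : Divisor G → Set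
  EffClass D = ∃[ E ] Effective G E × D ≋ E

  -- Adding the nonnegative gap `ν rk - E` to both sides gives an effective divisor equivalent to
  -- `ν rk`.
  dominated⇒¬effective : ∀ {D} → (∃[ E ] Dominated E × D ≋ E) → ¬ EffClass D
  dominated⇒¬effective {D} (E , (rk , _ , E≤ν) , D≋E) (F , F≥0 , D≋F) =
    ν-not-effective rk {λ v → F v + (ν rk v - E v)}
      (λ v → ℤ.+-mono-≤ (F≥0 v) (ℤ.i≤j⇒0≤j-i (E≤ν v)))
      (proj₁ E≋F , λ v → trans (regroup (ν rk v) (E v))
        (trans (cong (_+ (ν rk v - E v)) (proj₂ E≋F v)) (swap (F v) (lap (proj₁ E≋F) v) (ν rk v - E v))))
    where
    E≋F : E ≋ F
    E≋F = ≋-trans {E} {D} {F} (≋-sym {D} {E} D≋E) D≋F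
    regroup : ∀ a b → a ≡ b + (a - b)
    regroup = solve-∀
    swap : ∀ a b c → a + b + c ≡ a + c + b
    swap = solve-∀

  effClass? : ∀ D → Dec (EffClass D)
  effClass? D with effective-or-dominated D
  ... | inj₁ e = yes e
  ... | inj₂ d = no (dominated⇒¬effective {D} d)

  -- Degrees of the special divisors and Riemann-Roch

  genus-vertices : ∀ rk → Injective rk → + 2 * sum (λ v → sum λ w → if does (rk w ℤ.<? rk v) then m v w else 0ℤ)
                   ≡ sum (λ v → sum (m v))
  genus-vertices rk inj = begin
    + 2 * S                     ≡⟨ double S ⟩
    S + S                       ≡⟨ cong (_+_ S) swap ⟩
    S + sum (λ v → sum (upper v)) ≡⟨ ∑-distrib-+ (λ v → sum (lower v)) (λ v → sum (upper v)) ⟨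
    sum (λ v → sum (lower v) + sum (upper v)) ≡⟨ sum-cong-≗ (λ v → ∑-distrib-+ (lower v) (upper v)) ⟨
    sum (λ v → sum λ w → lower v w + upper v w) ≡⟨ sum-cong-≗ (λ v → sum-cong-≗ (compare-ranks rk inj v)) ⟩
    sum (λ v → sum (m v)) ∎
    where
    open ≡-Reasoning
    lower upper : Vertex → Vertex → ℤ
    lower v w = if does (rk w ℤ.<? rk v) then m v w else 0ℤ
    upper v w = if does (- rk w ℤ.<? - rk v) then m v w else 0ℤ
    S = sum λ v → sum (lower v)
    double : ∀ a → + 2 * a ≡ a + a
    double = solve-∀
    flip : ∀ v w → lower w v ≡ upper v w
    flip v w with rk v ℤ.<? rk w | - rk w ℤ.<? - rk v
    ... | yes _ | yes _ = m-sym w v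
    ... | no _  | no _  = refl
    ... | yes p | no q  = ⊥-elim (q (ℤ.neg-mono-< p))
    ... | no p  | yes q = ⊥-elim (p (ℤ.neg-cancel-< q))
    swap : S ≡ sum (λ v → sum (upper v))
    swap = trans (∑-comm lower) (sum-cong-≗ λ v → sum-cong-≗ λ w → flip v w)

  2*-cancel : ∀ {a b} → + 2 * a ≡ + 2 * b → a ≡ b
  2*-cancel {a} {b} = ℤ.*-cancelˡ-≡ (+ 2) a b

  -- Counting pairs `v < w` is counting along the acyclic orientation with ranks `- toℕ v`, so
  -- `genus-vertices` applies.
  ∣E∣-sum : + 2 * + ∣E∣ G ≡ sum (λ v → sum (m v))
  ∣E∣-sum = trans (cong (_*_ (+ 2)) (trans (sum-ℕ (λ v → sumℕ (edge v)))
      (sum-cong-≗ λ v → trans (sum-ℕ (edge v)) (sum-cong-≗ (term v)))))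
    (genus-vertices rk (λ eq → Fin.toℕ-injective (ℤ.+-injective (ℤ.neg-injective eq))))
    where
    edge : Vertex → Vertex → ℕ
    edge v w = if does (v Fin.<? w) then mult v w else 0
    rk : Vertex → ℤ
    rk v = - + toℕ v
    term : ∀ v w → + (if does (v Fin.<? w) then mult v w else 0) ≡ (if does (rk w ℤ.<? rk v) then m v w else 0ℤ)
    term v w = trans (float (does (v Fin.<? w))) (cong (λ b → if b then m v w else 0ℤ)
        (does-⇔ (mk⇔ (λ p → ℤ.neg-mono-< (+<+ p)) (λ q → ℤ.drop‿+<+ (ℤ.neg-cancel-< q))) (v Fin.<? w) (rk w ℤ.<? rk v)))
      where
      float : ∀ b → + (if b then mult v w else 0) ≡ (if b then m v w else 0ℤ)
      float true  = refl
      float false = refl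

  sum-const : ∀ k c → sum {k} (λ _ → c) ≡ + k * c
  sum-const zero c = refl
  sum-const (suc k) c = trans (cong (_+_ c) (sum-const k c)) (sym (ℤ.suc-* (+ k) c))

  deg-ν : ∀ rk → Injective rk → deg G (ν rk) ≡ genus G - 1ℤ
  deg-ν rk inj = begin
    sum (λ v → sum (lower v) - 1ℤ)               ≡⟨ sum-sub (λ v → sum (lower v)) (λ _ → 1ℤ) ⟩
    sum (λ v → sum (lower v)) - sum {suc n} (λ _ → 1ℤ) ≡⟨ cong₂ _-_ (2*-cancel {sum (λ v → sum (lower v))} {+ ∣E∣ G} (trans (genus-vertices rk inj) (sym ∣E∣-sum)))
                                                    (trans (sum-const (suc n) 1ℤ) (ℤ.*-identityʳ (+ suc n))) ⟩
    + ∣E∣ G - + suc n                            ≡⟨ regroup (+ ∣E∣ G) (+ suc n) ⟩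
    genus G - 1ℤ                                 ∎
    where
    open ≡-Reasoning
    lower : Vertex → Vertex → ℤ
    lower v w = if does (rk w ℤ.<? rk v) then m v w else 0ℤ
    regroup : ∀ a b → a - b ≡ a - b + 1ℤ - 1ℤ
    regroup = solve-∀

  deg-canonical : deg G canonical ≡ (genus G - 1ℤ) + (genus G - 1ℤ)
  deg-canonical = begin
    sum (λ v → + val G v - + 2)              ≡⟨ sum-sub (λ v → + val G v) (λ _ → + 2) ⟩
    sum (λ v → + val G v) - sum {suc n} (λ _ → + 2) ≡⟨ cong₂ _-_ (trans (sum-cong-≗ λ v → sum-ℕ (mult v)) (sym ∣E∣-sum))
                                                 (sum-const (suc n) (+ 2)) ⟩
    + 2 * + ∣E∣ G - + suc n * + 2            ≡⟨ regroup (+ ∣E∣ G) (+ suc n) ⟩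
    (genus G - 1ℤ) + (genus G - 1ℤ)          ∎
    where
    open ≡-Reasoning
    regroup : ∀ a b → + 2 * a - b * + 2 ≡ (a - b + 1ℤ - 1ℤ) + (a - b + 1ℤ - 1ℤ)
    regroup = solve-∀

  -- The working form of the rank, without maximality. `Rank≥ D 0` already contains that `D` is
  -- equivalent to an effective divisor.
  Rank≥ : Divisor G → ℕ → Set
  Rank≥ D r = ∀ E → Effective G E → deg G E ≡ + r → EffClass (λ v → D v - E v)

  -- If K - D - E is not effective it lies below an acyclic orientation ν, so
  -- that D - (ν - (K - D - E)) is the reverse orientation minus E.
  riemann-roch : ∀ D r s → Rank≥ D r → + s ≡ + r - deg G D + (genus G - 1ℤ) →
                 Rank≥ (λ v → canonical v - D v) s
  riemann-roch D r s rank s≡ E E≥0 degE with effective-or-dominated (λ v → canonical v - D v - E v)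
  ... | inj₁ e = e
  ... | inj₂ (N , (rk , inj , N≤ν) , f , L≡N+lapf) = ⊥-elim
      (ν-not-effective (λ u → - rk u) {λ v → X v + E v} (λ v → ℤ.+-mono-≤ (X≥0 v) (E≥0 v))
        ((λ u → h u + f u) , λ v → begin
          ν (λ u → - rk u) v                      ≡⟨ other v ⟩
          canonical v - ν rk v                    ≡⟨ solveν (canonical v) (D v) (E v) (N v) (lap f v) (L≡N+lapf v) (ν rk v) ⟩
          (D v - F v) + E v + lap f v             ≡⟨ cong (λ z → z + E v + lap f v) (D-F≡ v) ⟩
          (X v + lap h v) + E v + lap f v         ≡⟨ regroup (X v) (lap h v) (E v) (lap f v) ⟩
          X v + E v + (lap h v + lap f v)         ≡⟨ cong (_+_ (X v + E v)) (lap-+ h f v) ⟨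
          X v + E v + lap (λ u → h u + f u) v     ∎))
    where
    open ≡-Reasoning
    -- The gap below `ν` is effective, and the value of `s` is exactly what makes its degree `r`, so
    -- that it can be removed from `D`.
    F : Divisor G
    F v = ν rk v - N v
    L : Divisor G
    L v = canonical v - D v - E v
    degF : deg G F ≡ + r
    degF = begin
      sum F                                    ≡⟨ sum-sub (ν rk) N ⟩
      sum (ν rk) - sum N                       ≡⟨ cong₂ _-_ (deg-ν rk inj) (sym (≋-deg {L} {N} (f , L≡N+lapf))) ⟩
      (genus G - 1ℤ) - sum L                   ≡⟨ cong (_-_ (genus G - 1ℤ)) (trans (sum-sub (λ v → canonical v - D v) E)
                                                    (cong₂ _-_ (trans (sum-sub canonical D) (cong (_- sum D) deg-canonical)) (trans degE s≡))) ⟩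
      (genus G - 1ℤ) - ((genus G - 1ℤ) + (genus G - 1ℤ) - sum D - (+ r - sum D + (genus G - 1ℤ))) ≡⟨ simpl (genus G - 1ℤ) (sum D) (+ r) ⟩
      + r ∎
      where
      simpl : ∀ g d r → g - (g + g - d - (r - d + g)) ≡ r
      simpl = solve-∀
    witness : EffClass (λ v → D v - F v)
    witness = rank F (λ v → ℤ.i≤j⇒0≤j-i (N≤ν v)) degF
    X : Divisor G
    X = proj₁ witness
    X≥0 : Effective G X
    X≥0 = proj₁ (proj₂ witness)
    h : Vertex → ℤ
    h = proj₁ (proj₂ (proj₂ witness))
    D-F≡ : ∀ v → D v - F v ≡ X v + lap h v
    D-F≡ = proj₂ (proj₂ (proj₂ witness))
    other : ∀ v → ν (λ u → - rk u) v ≡ canonical v - ν rk v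
    other v = trans (cancel (ν rk v) (ν (λ u → - rk u) v)) (cong (_- ν rk v) (ν-reverse rk inj v))
      where
      cancel : ∀ a b → b ≡ a + b - a
      cancel = solve-∀
    solveν : ∀ k d e x l → k - d - e ≡ x + l → ∀ y → k - y ≡ (d - (y - x)) + e + l
    solveν k d e x l eq y = trans (expand k d e y) (trans (cong (λ z → z + d + e - y) eq) (collect x l d e y))
      where
      expand : ∀ k d e y → k - y ≡ (k - d - e) + d + e - y
      expand = solve-∀
      collect : ∀ x l d e y → x + l + d + e - y ≡ (d - (y - x)) + e + l
      collect = solve-∀
    regroup : ∀ x h e f → x + h + e + f ≡ x + e + (h + f)
    regroup = solve-∀

does⇒ : ∀ {P : Set} (P? : Dec P) → does P? ≡ true → P
does⇒ (yes p) _ = p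

does⇒¬ : ∀ {P : Set} (P? : Dec P) → does P? ≡ false → ¬ P
does⇒¬ (no ¬p) _ = ¬p

-- This turns bounds on the size of a cut into an exact description of where its edges start.
squeeze : ∀ {n} {f g : Fin n → ℤ} → (∀ i → f i ≤ g i) → sum g ≤ sum f → ∀ i → f i ≡ g i
squeeze {f = f} {g} f≤g le i = ℤ.≤-antisym (f≤g i) (ℤ.i-j≤0⇒i≤j (ℤ.≤-trans
  (term≤sum {f = λ j → g j - f j} (λ j → ℤ.i≤j⇒0≤j-i (f≤g j)) i)
  (subst (_≤ 0ℤ) (sym (sum-sub g f)) (ℤ.i≤j⇒i-j≤0 le))))

-- Opaque, so that unification can read off the vertex.
opaque
  pt : ∀ {n} → Fin n → Fin n → ℤ
  pt a = single a 1ℤ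

  pt-self : ∀ {n} (a : Fin n) → pt a a ≡ 1ℤ
  pt-self a = single-eq a 1ℤ

  pt-other : ∀ {n} {a b : Fin n} → a ≢ b → pt a b ≡ 0ℤ
  pt-other {a = a} = single-neq a 1ℤ

  pt≥0 : ∀ {n} (a : Fin n) b → 0ℤ ≤ pt a b
  pt≥0 a b with a Fin.≟ b
  ... | yes _ = +≤+ z≤n
  ... | no _  = ℤ.≤-refl

  pt-inj : ∀ {n} (a : Fin n) {b} → 1ℤ ≤ pt a b → a ≡ b
  pt-inj a {b} p with a Fin.≟ b
  ... | yes eq = eq
  ... | no _ = ⊥-elim (ℤ.<⇒≱ {0ℤ} {1ℤ} (+<+ (s≤s z≤n)) p)

  sum-pt : ∀ {n} (a : Fin n) → sum (pt a) ≡ 1ℤ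
  sum-pt a = sum-single a 1ℤ

∁ : ∀ {V : Set} → (V → Bool) → V → Bool
∁ A v = not (A v)

∑⟨_⟩ : ∀ {n} → (Fin n → Bool) → (Fin n → ℤ) → ℤ
∑⟨ A ⟩ f = sum λ v → if A v then f v else 0ℤ

-- Boundaries and cuts of vertex sets

module Firing (G : Graph) where
  open Graph G
  open Theory G

  VSet : Set
  VSet = Vertex → Bool

  -- The chips that firing `A` takes from its vertices, one for each outgoing edge; `A` is legal for
  -- an effective divisor exactly if `∂ A` lies below it.
  ∂ : VSet → Divisor G
  ∂ A v = if A v then out A v else 0ℤ

  cut : VSet → ℤ
  cut A = sum (∂ A)

  ∂-in : ∀ A {v} → A v ≡ true → ∂ A v ≡ out A v
  ∂-in A {v} v∈A = cong (λ b → if b then out A v else 0ℤ) v∈A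

  ∂-out : ∀ A {v} → A v ≡ false → ∂ A v ≡ 0ℤ
  ∂-out A {v} v∉A = cong (λ b → if b then out A v else 0ℤ) v∉A

  out≥0 : ∀ A v → 0ℤ ≤ out A v
  out≥0 A v = sum-nonneg {f = λ w → if A w then 0ℤ else m v w} λ w → nn (A w) (m≥0 v w)
    where
    nn : ∀ b {x} → 0ℤ ≤ x → 0ℤ ≤ (if b then 0ℤ else x)
    nn true  p = ℤ.≤-refl
    nn false p = p

  ∂≥0 : ∀ A → Effective G (∂ A)
  ∂≥0 A v with A v
  ... | true  = out≥0 A v
  ... | false = ℤ.≤-refl

  lap-set-out′ : ∀ A v → A v ≡ false → lap (𝟙 A) v ≡ - out (∁ A) v
  lap-set-out′ A v v∉A = trans (sum-cong-≗ pointwise) (sum-neg (λ w → if ∁ A w then 0ℤ else m v w))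
    where
    pointwise : ∀ w → m v w * (𝟙 A v - 𝟙 A w) ≡ - (if ∁ A w then 0ℤ else m v w)
    pointwise w rewrite v∉A with A w
    ... | true  = trans (ℤ.*-comm (m v w) -1ℤ) (ℤ.-1*i≡-i (m v w))
    ... | false = ℤ.*-zeroʳ (m v w)

  lap-𝟙 : ∀ A v → lap (𝟙 A) v ≡ ∂ A v - ∂ (∁ A) v
  lap-𝟙 A v with status (A v)
  ... | inj₁ v∈A = trans (lap-set-in A v v∈A) (sym (trans (cong₂ _-_ (∂-in A v∈A) (∂-out (∁ A) (cong not v∈A)))
                     (ℤ.+-identityʳ (out A v))))
  ... | inj₂ v∉A = trans (lap-set-out′ A v v∉A) (sym (trans (cong₂ _-_ (∂-out A v∉A) (∂-in (∁ A) (cong not v∉A)))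
                     (ℤ.+-identityˡ _)))

  -- Firing `A` carries each chip of `∂ A` to the other end of its edge.
  ∂-≋ : ∀ A → ∂ A ≋ ∂ (∁ A)
  ∂-≋ A = 𝟙 A , λ v → trans (regroup (∂ A v) (∂ (∁ A) v)) (cong (_+_ (∂ (∁ A) v)) (sym (lap-𝟙 A v)))
    where
    regroup : ∀ a b → a ≡ b + (a - b)
    regroup = solve-∀

  cut-∁ : ∀ A → cut (∁ A) ≡ cut A
  cut-∁ A = sym (≋-deg {∂ A} {∂ (∁ A)} (∂-≋ A))

  ≋-cong : ∀ {D D′} → (∀ v → D v ≡ D′ v) → D ≋ D′
  ≋-cong {D} {D′} eq = (λ _ → 0ℤ) , λ v → trans (eq v)
    (trans (sym (ℤ.+-identityʳ _)) (cong (_+_ (D′ v)) (sym (lap-0 v))))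

  out-anti : ∀ {A B} → (∀ w → A w ≡ true → B w ≡ true) → ∀ v → out B v ≤ out A v
  out-anti {A} {B} A⊆B v = sum-mono pointwise
    where
    pointwise : ∀ w → (if B w then 0ℤ else m v w) ≤ (if A w then 0ℤ else m v w)
    pointwise w with A w | B w | A⊆B w
    ... | true  | true  | _ = ℤ.≤-refl
    ... | true  | false | p = ⊥-elim (true≢false (p refl) refl)
    ... | false | true  | _ = m≥0 v w
    ... | false | false | _ = ℤ.≤-refl

  infixr 6 _∪_
  infixr 7 _∩_
  _∪_ _∩_ : VSet → VSet → VSet
  (A ∪ B) v = A v ∨ B v
  (A ∩ B) v = A v ∧ B v

  ∪-left : ∀ A B w → A w ≡ true → (A ∪ B) w ≡ true
  ∪-left A B w p = cong (_∨ B w) p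

  ∪-right : ∀ A B w → B w ≡ true → (A ∪ B) w ≡ true
  ∪-right A B w p = trans (cong (A w ∨_) p) (Bool.∨-zeroʳ (A w))

  ∪-avoid : ∀ A B w → A w ≡ false → B w ≡ false → (A ∪ B) w ≡ false
  ∪-avoid A B w p q = cong₂ _∨_ p q

  ∪-cases : ∀ A B w → (A ∪ B) w ≡ true → (A w ≡ true) ⊎ (B w ≡ true)
  ∪-cases A B w p with A w
  ... | true  = inj₁ refl
  ... | false = inj₂ p

  ∩-left : ∀ A B w → (A ∩ B) w ≡ true → A w ≡ true
  ∩-left A B w p with A w
  ... | true = refl

  ∩-right : ∀ A B w → (A ∩ B) w ≡ true → B w ≡ true
  ∩-right A B w p with A w
  ... | true = p

  ∩-intro : ∀ A B w → A w ≡ true → B w ≡ true → (A ∩ B) w ≡ true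
  ∩-intro A B w p q = cong₂ _∧_ p q

  ∩-avoidˡ : ∀ A B w → A w ≡ false → (A ∩ B) w ≡ false
  ∩-avoidˡ A B w p = cong (_∧ B w) p

  out-∪ˡ : ∀ A B v → out (A ∪ B) v ≤ out A v
  out-∪ˡ A B = out-anti {A} {A ∪ B} (∪-left A B)

  out-∪ʳ : ∀ A B v → out (A ∪ B) v ≤ out B v
  out-∪ʳ A B = out-anti {B} {A ∪ B} (∪-right A B)

  private
    edge : VSet → Vertex → Vertex → ℤ
    edge A v w = if A v then (if A w then 0ℤ else m v w) else 0ℤ

    cut-edges : ∀ A → cut A ≡ sum λ v → sum (edge A v)
    cut-edges A = sum-cong-≗ pointwise
      where
      pointwise : ∀ v → ∂ A v ≡ sum (edge A v)
      pointwise v with A v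
      ... | true  = refl
      ... | false = sym (sum-replicate-zero (suc n))

    +-sums : ∀ (h k : Vertex → Vertex → ℤ) → sum (λ v → sum (h v)) + sum (λ v → sum (k v)) ≡ sum (λ v → sum λ w → h v w + k v w)
    +-sums h k = sym (trans (sum-cong-≗ λ v → ∑-distrib-+ (h v) (k v)) (∑-distrib-+ (λ v → sum (h v)) (λ v → sum (k v))))

  -- Edge by edge. The only loss is at edges between `A` minus `B` and `B` minus `A`, which are
  -- counted on the right alone.
  submodular : ∀ A B → cut (A ∩ B) + cut (A ∪ B) ≤ cut A + cut B
  submodular A B = begin
    cut (A ∩ B) + cut (A ∪ B)                             ≡⟨ cong₂ _+_ (cut-edges (A ∩ B)) (cut-edges (A ∪ B)) ⟩
    sum (λ v → sum (edge (A ∩ B) v)) + sum (λ v → sum (edge (A ∪ B) v)) ≡⟨ +-sums (edge (A ∩ B)) (edge (A ∪ B)) ⟩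
    sum (λ v → sum λ w → edge (A ∩ B) v w + edge (A ∪ B) v w) ≤⟨ sum-mono (λ v → sum-mono (pointwise v)) ⟩
    sum (λ v → sum λ w → edge A v w + edge B v w)         ≡⟨ +-sums (edge A) (edge B) ⟨
    sum (λ v → sum (edge A v)) + sum (λ v → sum (edge B v)) ≡⟨ cong₂ _+_ (cut-edges A) (cut-edges B) ⟨
    cut A + cut B ∎
    where
    open ℤ.≤-Reasoning
    pointwise : ∀ v w → edge (A ∩ B) v w + edge (A ∪ B) v w ≤ edge A v w + edge B v w
    pointwise v w with A v | B v | A w | B w
    ... | true  | true  | true  | true  = ℤ.≤-refl
    ... | true  | true  | true  | false = ℤ.≤-reflexive (ℤ.+-comm (m v w) 0ℤ)
    ... | true  | true  | false | true  = ℤ.≤-refl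
    ... | true  | true  | false | false = ℤ.≤-refl
    ... | true  | false | true  | true  = ℤ.≤-refl
    ... | true  | false | true  | false = ℤ.≤-refl
    ... | true  | false | false | true  = subst (0ℤ ≤_) (sym (ℤ.+-identityʳ (m v w))) (m≥0 v w)
    ... | true  | false | false | false = ℤ.≤-reflexive (ℤ.+-comm 0ℤ (m v w))
    ... | false | true  | true  | true  = ℤ.≤-refl
    ... | false | true  | true  | false = subst (0ℤ ≤_) (sym (ℤ.+-identityˡ (m v w))) (m≥0 v w)
    ... | false | true  | false | true  = ℤ.≤-refl
    ... | false | true  | false | false = ℤ.≤-refl
    ... | false | false | true  | true  = ℤ.≤-refl
    ... | false | false | true  | false = ℤ.≤-refl
    ... | false | false | false | true  = ℤ.≤-refl
    ... | false | false | false | false = ℤ.≤-refl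

  -- Taking `A` out of `U` trades the edges from `A` out of `U` for the edges from `A` into the rest
  -- of `U`, and `cut A` consists of both kinds.
  cut-difference : ∀ U A → (∀ v → A v ≡ true → U v ≡ true) →
    cut (U ∩ ∁ A) + (∑⟨ A ⟩ (out U) + ∑⟨ A ⟩ (out U)) ≡ cut U + cut A
  cut-difference U A A⊆U = begin
    cut (U ∩ ∁ A) + (∑⟨ A ⟩ (out U) + ∑⟨ A ⟩ (out U)) ≡⟨ cong₂ (λ x y → x + (y + y)) (cut-edges (U ∩ ∁ A)) outs ⟩
    Σ₂ x + (Σ₂ h + Σ₂ h)   ≡⟨ ℤ.+-assoc (Σ₂ x) (Σ₂ h) (Σ₂ h) ⟨
    (Σ₂ x + Σ₂ h) + Σ₂ h   ≡⟨ cong (_+ Σ₂ h) (trans (+-sums x h) (trans (sum-cong-≗ λ v → sum-cong-≗ (split₁ v)) (sym (+-sums (edge U) l)))) ⟩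
    (Σ₂ (edge U) + Σ₂ l) + Σ₂ h ≡⟨ cong (λ z → (Σ₂ (edge U) + z) + Σ₂ h) l≡r ⟩
    (Σ₂ (edge U) + Σ₂ r) + Σ₂ h ≡⟨ ℤ.+-assoc (Σ₂ (edge U)) (Σ₂ r) (Σ₂ h) ⟩
    Σ₂ (edge U) + (Σ₂ r + Σ₂ h) ≡⟨ cong (_+_ (Σ₂ (edge U))) (trans (+-sums r h) (sum-cong-≗ λ v → sum-cong-≗ (split₂ v))) ⟩
    Σ₂ (edge U) + Σ₂ (edge A)   ≡⟨ cong₂ _+_ (cut-edges U) (cut-edges A) ⟨
    cut U + cut A ∎
    where
    open ≡-Reasoning
    Σ₂ : (Vertex → Vertex → ℤ) → ℤ
    Σ₂ f = sum λ v → sum (f v)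
    x h r l : Vertex → Vertex → ℤ
    x = edge (U ∩ ∁ A)
    h v w = if A v then (if U w then 0ℤ else m v w) else 0ℤ
    r v w = if A v ∧ (U w ∧ not (A w)) then m v w else 0ℤ
    l v w = if A w ∧ (U v ∧ not (A v)) then m v w else 0ℤ
    l≡r : Σ₂ l ≡ Σ₂ r
    l≡r = trans (sum-cong-≗ λ v → sum-cong-≗ λ w → cong (λ z → if A w ∧ (U v ∧ not (A v)) then z else 0ℤ) (m-sym v w))
                (∑-comm (λ v w → r w v))
    outs : ∑⟨ A ⟩ (out U) ≡ Σ₂ h
    outs = sum-cong-≗ pointwise
      where
      pointwise : ∀ v → (if A v then out U v else 0ℤ) ≡ sum (h v)
      pointwise v with A v
      ... | true  = refl
      ... | false = sym (sum-replicate-zero (suc n))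
    split₁ : ∀ v w → x v w + h v w ≡ edge U v w + l v w
    split₁ v w with A v | U v | A⊆U v | A w | U w | A⊆U w
    ... | true  | false | p | _     | _     | _ = ⊥-elim (true≢false (p refl) refl)
    ... | true  | true  | _ | true  | false | q = ⊥-elim (true≢false (q refl) refl)
    ... | false | true  | _ | true  | false | q = ⊥-elim (true≢false (q refl) refl)
    ... | false | false | _ | true  | false | q = ⊥-elim (true≢false (q refl) refl)
    ... | true  | true  | _ | true  | true  | _ = refl
    ... | true  | true  | _ | false | true  | _ = refl
    ... | true  | true  | _ | false | false | _ = ℤ.+-comm 0ℤ (m v w)
    ... | false | true  | _ | true  | true  | _ = ℤ.+-comm (m v w) 0ℤ
    ... | false | true  | _ | false | true  | _ = refl
    ... | false | true  | _ | false | false | _ = refl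
    ... | false | false | _ | true  | true  | _ = refl
    ... | false | false | _ | false | true  | _ = refl
    ... | false | false | _ | false | false | _ = refl
    split₂ : ∀ v w → r v w + h v w ≡ edge A v w
    split₂ v w with A v | A w | U w | A⊆U w
    ... | _     | true  | false | q = ⊥-elim (true≢false (q refl) refl)
    ... | false | true  | true  | _ = refl
    ... | false | false | true  | _ = refl
    ... | false | false | false | _ = refl
    ... | true  | true  | true  | _ = refl
    ... | true  | false | true  | _ = ℤ.+-identityʳ (m v w)
    ... | true  | false | false | _ = ℤ.+-identityˡ (m v w)

  nonempty-sum : ∀ E → Effective G E → 1ℤ ≤ deg G E → ∃[ a ] 1ℤ ≤ E a
  nonempty-sum E E≥0 deg≥1 with Fin.any? (λ v → 1ℤ ℤ.≤? E v)
  ... | yes found = found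
  ... | no none = ⊥-elim (ℤ.<⇒≱ {0ℤ} {1ℤ} (+<+ (s≤s z≤n)) (ℤ.≤-trans deg≥1
          (subst (sum E ≤_) (sum-replicate-zero (suc n)) (sum-mono {g = λ _ → 0ℤ} λ v → ℤ.≮⇒≥ λ p → none (v , ℤ.i<j⇒suc[i]≤j p)))))

  remove≥0 : ∀ E a → Effective G E → 1ℤ ≤ E a → Effective G (λ v → E v - pt a v)
  remove≥0 E a E≥0 Ea v with a Fin.≟ v
  ... | yes refl = ℤ.i≤j⇒0≤j-i (subst (_≤ E a) (sym (pt-self a)) Ea)
  ... | no a≢v = subst (0ℤ ≤_) (sym (trans (cong (_-_ (E v)) (pt-other a≢v)) (ℤ.+-identityʳ (E v)))) (E≥0 v)

  deg-remove : ∀ E a → deg G (λ v → E v - pt a v) ≡ deg G E - 1ℤ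
  deg-remove E a = trans (sum-sub E (pt a)) (cong (_-_ (sum E)) (sum-pt a))

  zero-sum : ∀ E → Effective G E → deg G E ≡ 0ℤ → ∀ v → E v ≡ 0ℤ
  zero-sum E E≥0 deg0 v = ℤ.≤-antisym (subst (E v ≤_) deg0 (term≤sum E≥0 v)) (E≥0 v)

  opaque
    two-points : ∀ E → Effective G E → deg G E ≡ + 2 → ∃[ p ] ∃[ q ] ∀ v → E v ≡ pt p v + pt q v
    two-points E E≥0 deg2
      with nonempty-sum E E≥0 (ℤ.≤-trans (+≤+ (s≤s z≤n)) (ℤ.≤-reflexive (sym deg2)))
    ... | p , Ep with nonempty-sum (λ v → E v - pt p v) (remove≥0 E p E≥0 Ep)
                        (ℤ.≤-reflexive (sym (trans (deg-remove E p) (cong (_- 1ℤ) deg2))))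
    ...   | q , Eq = p , q , λ v → trans (regroup (E v) (pt p v) (pt q v))
        (trans (cong (_+ (pt p v + pt q v)) (zero-sum (λ u → E u - pt p u - pt q u)
          (remove≥0 (λ u → E u - pt p u) q (remove≥0 E p E≥0 Ep) Eq)
          (trans (deg-remove (λ u → E u - pt p u) q) (cong (_- 1ℤ) (trans (deg-remove E p) (cong (_- 1ℤ) deg2)))) v))
        (ℤ.+-identityˡ _))
      where
      regroup : ∀ a b c → a ≡ (a - b - c) + (b + c)
      regroup = solve-∀

  fired-∂ : ∀ X L v → fired X L v ≡ X v - ∂ L v + ∂ (∁ L) v
  fired-∂ X L v = trans (cong (_-_ (X v)) (lap-𝟙 L v)) (regroup (X v) (∂ L v) (∂ (∁ L) v))
    where
    regroup : ∀ a b c → a - (b - c) ≡ a - b + c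
    regroup = solve-∀

  opaque
    -- The set on which the firing function is largest.
    towards : ∀ X w → EffClass (λ v → X v - pt w v) → X w ≤ 0ℤ → Legal X w
    towards X w (F , F≥0 , f , eq) Xw≤0 = legal A (dec-false (top w) w∉) {u} (dec-true (top u) (λ j → u-max j)) bound
      where
      best : ∃[ i ] (∀ j → f j ≤ f i)
      best = maximum _≤_ (λ _ → ℤ.≤-refl) ℤ.≤-trans ℤ.≤-total f
      u : Vertex
      u = proj₁ best
      u-max : ∀ j → f j ≤ f u
      u-max = proj₂ best
      top : ∀ v → Dec (∀ j → f j ≤ f v)
      top v = Fin.all? λ j → f j ℤ.≤? f v
      A : VSet
      A v = does (top v)
      ∈A : ∀ v → A v ≡ true → ∀ j → f j ≤ f v
      ∈A v = does⇒ (top v)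
      ∉A : ∀ v → A v ≡ false → ¬ (∀ j → f j ≤ f v)
      ∉A v = does⇒¬ (top v)
      out≤lap : ∀ v → (∀ j → f j ≤ f v) → out A v ≤ lap f v
      out≤lap v max = sum-mono pointwise
        where
        pointwise : ∀ x → (if A x then 0ℤ else m v x) ≤ m v x * (f v - f x)
        pointwise x with status (A x)
        ... | inj₁ x∈A = subst (λ b → (if b then 0ℤ else m v x) ≤ m v x * (f v - f x)) (sym x∈A)
                (m*≥0 v x (ℤ.i≤j⇒0≤j-i (max x)))
        ... | inj₂ x∉A = subst (λ b → (if b then 0ℤ else m v x) ≤ m v x * (f v - f x)) (sym x∉A)
                (subst (_≤ m v x * (f v - f x)) (ℤ.*-identityʳ (m v x)) (ℤ.*-monoˡ-≤-nonNeg (m v x)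
                  (1≤diff (ℤ.≰⇒> λ fv≤fx → ∉A x x∉A λ j → ℤ.≤-trans (max j) fv≤fx))))
      lap≤ : ∀ v → lap f v ≤ X v - pt w v
      lap≤ v = subst (lap f v ≤_) (sym (eq v)) (subst (_≤ F v + lap f v) (ℤ.+-identityˡ _) (ℤ.+-monoˡ-≤ (lap f v) (F≥0 v)))
      bound : ∀ v → A v ≡ true → out A v ≤ X v
      bound v v∈A = ℤ.≤-trans (out≤lap v (∈A v v∈A)) (ℤ.≤-trans (lap≤ v)
        (subst (X v - pt w v ≤_) (ℤ.+-identityʳ (X v)) (ℤ.+-monoʳ-≤ (X v) (ℤ.neg-mono-≤ (pt≥0 w v)))))
      -- At a maximum of `f` the Laplacian is nonnegative, but at `w` it is at most `X w - 1`, hence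
      -- negative.
      w∉ : ¬ (∀ j → f j ≤ f w)
      w∉ max = ℤ.<⇒≱ (-<+ {0}) (ℤ.≤-trans (out≥0 A w) (ℤ.≤-trans (out≤lap w max)
        (ℤ.≤-trans (lap≤ w) (subst (λ z → X w - z ≤ -1ℤ) (sym (pt-self w)) (ℤ.+-monoˡ-≤ -1ℤ Xw≤0)))))

-- Two-edge-connected sets with two outgoing edges, and moves of two chips

module Blobs (G : Graph) where
  open Graph G
  open Theory G
  open Firing G

  effClass-≋ : ∀ {A B} → A ≋ B → EffClass B → EffClass A
  effClass-≋ {A} {B} A≋B (E , E≥0 , B≋E) = E , E≥0 , ≋-trans {A} {B} {E} A≋B B≋E

  -- `iout` and `inner` are `out` and `∂` for the subgraph induced on `Z`.
  iout : VSet → VSet → Vertex → ℤ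
  iout Z B v = sum λ w → if Z w ∧ not (B w) then m v w else 0ℤ

  inner : VSet → VSet → Divisor G
  inner Z B v = if Z v ∧ B v then iout Z B v else 0ℤ

  iout≤out : ∀ Z B v → iout Z B v ≤ out B v
  iout≤out Z B v = sum-mono pointwise
    where
    pointwise : ∀ w → (if Z w ∧ not (B w) then m v w else 0ℤ) ≤ (if B w then 0ℤ else m v w)
    pointwise w with Z w | B w
    ... | true  | true  = ℤ.≤-refl
    ... | true  | false = ℤ.≤-refl
    ... | false | true  = ℤ.≤-refl
    ... | false | false = m≥0 v w

  inner≤∂ : ∀ Z B v → inner Z B v ≤ ∂ B v
  inner≤∂ Z B v with Z v | B v
  ... | true  | true  = iout≤out Z B v
  ... | true  | false = ℤ.≤-refl
  ... | false | true  = out≥0 B v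
  ... | false | false = ℤ.≤-refl

  -- split says that Z is two-edge-connected.
  record Blob (Z : VSet) : Set where
    field
      cut≡2   : cut Z ≡ + 2
      {out₀ one two} : Vertex
      out₀∉   : Z out₀ ≡ false
      one∈    : Z one ≡ true
      two∈    : Z two ≡ true
      one≢two : one ≢ two
      split   : ∀ B {v w} → Z v ≡ true → B v ≡ true → Z w ≡ true → B w ≡ false → + 2 ≤ sum (inner Z B)

    another : ∀ a → ∃[ z ] Z z ≡ true × a ≢ z
    another a with a Fin.≟ one
    ... | yes refl = two , two∈ , one≢two
    ... | no a≢one = one , one∈ , a≢one

    -- If `L` split `Z`, at least two edges inside `Z` would leave `L`, and a single chip at `a`
    -- would have to pay for them.
    unsplit : ∀ L a → (∀ v → Z v ≡ true → L v ≡ true → out L v ≤ pt a v) →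
              (∀ v → Z v ≡ true → L v ≡ false) ⊎ (∀ v → Z v ≡ true → L v ≡ true)
    unsplit L a bound with Fin.any? (λ v → (Z v Bool.≟ true) ×-dec (L v Bool.≟ true))
    ... | no none = inj₁ λ v v∈ → Bool.¬-not λ v∈L → none (v , v∈ , v∈L)
    ... | yes (v , v∈ , v∈L) with Fin.any? (λ w → (Z w Bool.≟ true) ×-dec (L w Bool.≟ false))
    ...   | no none = inj₂ λ w w∈ → Bool.¬-not λ w∉L → none (w , w∈ , w∉L)
    ...   | yes (w , w∈ , w∉L) = ⊥-elim (ℤ.<⇒≱ {1ℤ} {+ 2} (+<+ (s≤s (s≤s z≤n)))
            (ℤ.≤-trans (split L v∈ v∈L w∈ w∉L) (subst (sum (inner Z L) ≤_) (sum-pt a) (sum-mono pointwise))))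
      where
      pointwise : ∀ u → inner Z L u ≤ pt a u
      pointwise u with status (Z u) | status (L u)
      ... | inj₁ p | inj₁ q = ℤ.≤-trans (inner≤∂ Z L u) (subst (_≤ pt a u) (sym (∂-in L q)) (bound u p q))
      ... | inj₁ p | inj₂ q = ℤ.≤-trans (inner≤∂ Z L u) (subst (_≤ pt a u) (sym (∂-out L q)) (pt≥0 a u))
      ... | inj₂ p | _ = subst (_≤ pt a u) (sym (cong (λ b → if b then iout Z L u else 0ℤ) (∩-avoidˡ Z L u p))) (pt≥0 a u)

  pair : Vertex → Vertex → Divisor G
  pair p q v = pt p v + pt q v

  pair≥0 : ∀ p q → Effective G (pair p q)
  pair≥0 p q v = ℤ.+-mono-≤ (pt≥0 p v) (pt≥0 q v)

  deg-pair : ∀ p q → deg G (pair p q) ≡ + 2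
  deg-pair p q = trans (∑-distrib-+ (pt p) (pt q)) (cong₂ _+_ (sum-pt p) (sum-pt q))

  1≤pairˡ : ∀ p q → 1ℤ ≤ pair p q p
  1≤pairˡ p q = ℤ.+-mono-≤ (ℤ.≤-reflexive (sym (pt-self p))) (pt≥0 q p)

  1≤pairʳ : ∀ p q → 1ℤ ≤ pair p q q
  1≤pairʳ p q = ℤ.+-mono-≤ (pt≥0 p q) (ℤ.≤-reflexive (sym (pt-self q)))

  pair-avoids : ∀ {p q v} → p ≢ v → q ≢ v → pair p q v ≡ 0ℤ
  pair-avoids p≢v q≢v = cong₂ _+_ (pt-other p≢v) (pt-other q≢v)

  separated : ∀ {A : VSet} {v w} → A v ≡ true → A w ≡ false → v ≢ w
  separated p q refl = true≢false p q

  ∂-support : ∀ A {v} → 1ℤ ≤ ∂ A v → A v ≡ true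
  ∂-support A {v} p with A v
  ... | true  = refl
  ... | false = ⊥-elim (ℤ.<⇒≱ {0ℤ} {1ℤ} (+<+ (s≤s z≤n)) p)

  saturated : ∀ {X w} (L : Legal X w) → Effective G X → deg G X ≤ cut (Legal.set L) → ∀ v → ∂ (Legal.set L) v ≡ X v
  saturated {X} (legal A _ _ bound) X≥0 le = squeeze pointwise le
    where
    pointwise : ∀ v → ∂ A v ≤ X v
    pointwise v with status (A v)
    ... | inj₁ v∈ = subst (_≤ X v) (sym (∂-in A v∈)) (bound v v∈)
    ... | inj₂ v∉ = subst (_≤ X v) (sym (∂-out A v∉)) (X≥0 v)

  -- In the second hypothesis all edges leaving `A` start at `a` and something lies outside; unless
  -- `A` consists of `a` alone, `a` would be a cut vertex.
  module TwoConnected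
    (cut≥2 : ∀ A {v w} → A v ≡ true → A w ≡ false → + 2 ≤ cut A)
    (no-cut-vertex : ∀ A a → A a ≡ true → (∀ v → A v ≡ true → a ≢ v → out A v ≡ 0ℤ) →
                     ∀ {y} → A y ≡ false → ∀ {v} → A v ≡ true → a ≡ v)
    where

    -- Getting a single chip from `a` to `b` would take a legal set with at most one outgoing edge.
    pt-injective : ∀ {a b} → pt a ≋ pt b → a ≡ b
    pt-injective {a} {b} (f , eq) with a Fin.≟ b
    ... | yes p = p
    ... | no a≢b with towards (pt a) b ((λ _ → 0ℤ) , (λ _ → ℤ.≤-refl) , f , λ v →
                        trans (cong (_- pt b v) (eq v)) (regroup (pt b v) (lap f v))) (ℤ.≤-reflexive (pt-other a≢b))
      where
      regroup : ∀ x y → x + y - x ≡ 0ℤ + y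
      regroup = solve-∀
    ...   | legal A b∉A u∈A bound = ⊥-elim (ℤ.<⇒≱ {1ℤ} {+ 2} (+<+ (s≤s (s≤s z≤n)))
              (ℤ.≤-trans (cut≥2 A u∈A b∉A) (subst (cut A ≤_) (sum-pt a) (sum-mono pointwise))))
      where
      pointwise : ∀ v → ∂ A v ≤ pt a v
      pointwise v with status (A v)
      ... | inj₁ v∈ = subst (_≤ pt a v) (sym (∂-in A v∈)) (bound v v∈)
      ... | inj₂ v∉ = subst (_≤ pt a v) (sym (∂-out A v∉)) (pt≥0 a v)

    -- A legal firing of two chips. As every cut has at least two edges, both chips are used, and
    -- they arrive at `p′` and `q′`.
    record Move (p q w : Vertex) : Set where
      field
        set    : VSet
        avoids : set w ≡ false
        tails  : ∀ v → ∂ set v ≡ pair p q v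
        {p′ q′} : Vertex
        heads  : ∀ v → ∂ (∁ set) v ≡ pair p′ q′ v

      p∈ : set p ≡ true
      p∈ = ∂-support set (subst (1ℤ ≤_) (sym (tails p)) (1≤pairˡ p q))
      q∈ : set q ≡ true
      q∈ = ∂-support set (subst (1ℤ ≤_) (sym (tails q)) (1≤pairʳ p q))
      p′∉ : ∁ set p′ ≡ true
      p′∉ = ∂-support (∁ set) (subst (1ℤ ≤_) (sym (heads p′)) (1≤pairˡ p′ q′))
      q′∉ : ∁ set q′ ≡ true
      q′∉ = ∂-support (∁ set) (subst (1ℤ ≤_) (sym (heads q′)) (1≤pairʳ p′ q′))

      equivalent : pair p q ≋ pair p′ q′
      equivalent = ≋-trans {pair p q} {∂ set} {pair p′ q′} (≋-cong (λ v → sym (tails v)))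
        (≋-trans {∂ set} {∂ (∁ set)} {pair p′ q′} (∂-≋ set) (≋-cong heads))

      cut-set : cut set ≡ + 2
      cut-set = trans (sum-cong-≗ tails) (deg-pair p q)

      cut-∁set : cut (∁ set) ≡ + 2
      cut-∁set = trans (cut-∁ set) cut-set

    move : ∀ {p q w} → Legal (pair p q) w → Move p q w
    move {p} {q} {w} L@(legal A w∉A u∈A bound) = record
        { set = A ; avoids = w∉A ; tails = tails ; p′ = proj₁ heads ; q′ = proj₁ (proj₂ heads) ; heads = proj₂ (proj₂ heads) }
      where
      tails : ∀ v → ∂ A v ≡ pair p q v
      tails = saturated L (pair≥0 p q) (subst (_≤ cut A) (sym (deg-pair p q)) (cut≥2 A u∈A w∉A))
      heads : ∃[ p′ ] ∃[ q′ ] ∀ v → ∂ (∁ A) v ≡ pair p′ q′ v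
      heads = two-points (∂ (∁ A)) (∂≥0 (∁ A)) (trans (cut-∁ A) (trans (sum-cong-≗ tails) (deg-pair p q)))

    opaque
      -- `saturation` for divisors `p + q`: `P` is an invariant of the positions of the two chips,
      -- and `step` either answers or makes a further move avoiding `w`.
      pair-drive : ∀ {p₀ q₀} w {Q : Set} (P : Vertex → Vertex → Set) →
        (∀ p q → pair p q ≋ pair p₀ q₀ → P p q → Q ⊎ (Σ[ M ∈ Move p q w ] P (Move.p′ M) (Move.q′ M))) →
        P p₀ q₀ → Q
      pair-drive {p₀} {q₀} w {Q} P step start = Saturation.saturation (pair p₀ q₀) w
        {P = λ X → ∃[ p ] ∃[ q ] P p q × (∀ v → X v ≡ pair p q v)} step′ (p₀ , q₀ , start , λ _ → refl)
        where
        step′ : ∀ X → X ≋ pair p₀ q₀ → pair p₀ q₀ ⊑ X → (∃[ p ] ∃[ q ] P p q × (∀ v → X v ≡ pair p q v)) →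
                Q ⊎ (Σ[ L ∈ Legal X w ] ∃[ p ] ∃[ q ] P p q × (∀ v → fired X (Legal.set L) v ≡ pair p q v))
        step′ X X≋ _ (p , q , Ppq , X≗) with step p q (≋-trans {pair p q} {X} {pair p₀ q₀} (≋-cong (λ v → sym (X≗ v))) X≋) Ppq
        ... | inj₁ done = inj₁ done
        ... | inj₂ (M , Ppq′) = inj₂ (legal set avoids p∈ (λ v v∈ → ℤ.≤-reflexive (trans (sym (∂-in set v∈)) (trans (tails v) (sym (X≗ v)))))
                , (p′ , q′ , Ppq′ , λ v → trans (fired-∂ X set v)
                    (trans (cong₂ (λ x y → x - ∂ set v + y) (trans (X≗ v) (sym (tails v))) (heads v)) (cancel (∂ set v) (pair p′ q′ v)))))
          where
          open Move M
          cancel : ∀ a b → a - a + b ≡ b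
          cancel = solve-∀

    open Move

    -- A set that splits `Y` has at least two edges inside `Y`, and a move has only two edges in
    -- all.
    heads-inside : ∀ {Y p q w} → Blob Y → (M : Move p q w) → ∀ {u x} → Y u ≡ true → set M u ≡ true →
      Y x ≡ true → set M x ≡ false → Y (p′ M) ≡ true × Y (q′ M) ≡ true
    heads-inside {Y} blob M {u} {x} u∈Y u∈ x∈Y x∉ = inside (p′ M) (1≤pairˡ (p′ M) (q′ M)) , inside (q′ M) (1≤pairʳ (p′ M) (q′ M))
      where
      eq : ∀ v → inner Y (∁ (set M)) v ≡ ∂ (∁ (set M)) v
      eq = squeeze (inner≤∂ Y (∁ (set M))) (subst (_≤ sum (inner Y (∁ (set M)))) (sym (cut-∁set M))
             (Blob.split blob (∁ (set M)) x∈Y (cong not x∉) u∈Y (cong not u∈)))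
      inside : ∀ v → 1ℤ ≤ pair (p′ M) (q′ M) v → Y v ≡ true
      inside v p with status (Y v)
      ... | inj₁ v∈Y = v∈Y
      ... | inj₂ v∉Y = ⊥-elim (ℤ.<⇒≱ {0ℤ} {1ℤ} (+<+ (s≤s z≤n)) (subst (1ℤ ≤_) (trans (sym (trans (eq v) (heads M v)))
              (cong (λ b → if b then iout Y (∁ (set M)) v else 0ℤ) (∩-avoidˡ Y (∁ (set M)) v v∉Y))) p))

    -- If the two heads lie in Y and the tails do not, they are the ends in Y of the
    -- two edges leaving Y; dually for the tails.
    heads-∂ : ∀ {Y p q w} → Blob Y → (M : Move p q w) → (∀ v → Y v ≡ true → set M v ≡ false) →
      Y (p′ M) ≡ true → Y (q′ M) ≡ true → ∀ v → pair (p′ M) (q′ M) v ≡ ∂ Y v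
    heads-∂ {Y} blob M Y∩M=∅ p′∈ q′∈ = squeeze pointwise (ℤ.≤-reflexive (trans (Blob.cut≡2 blob) (sym (deg-pair (p′ M) (q′ M)))))
      where
      pointwise : ∀ v → pair (p′ M) (q′ M) v ≤ ∂ Y v
      pointwise v with status (Y v)
      ... | inj₂ v∉ = ℤ.≤-reflexive (trans (pair-avoids (separated {Y} p′∈ v∉) (separated {Y} q′∈ v∉)) (sym (∂-out Y v∉)))
      ... | inj₁ v∈ = subst₂ _≤_ (trans (sym (∂-in (∁ (set M)) (cong not (Y∩M=∅ v v∈)))) (heads M v)) (sym (∂-in Y v∈))
              (out-anti {Y} {∁ (set M)} (λ w w∈ → cong not (Y∩M=∅ w w∈)) v)

    tails-∂ : ∀ {Y p q w} → Blob Y → (M : Move p q w) → (∀ v → Y v ≡ true → set M v ≡ true) →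
      Y p ≡ true → Y q ≡ true → ∀ v → pair p q v ≡ ∂ Y v
    tails-∂ {Y} {p} {q} blob M Y⊆M p∈ q∈ = squeeze pointwise (ℤ.≤-reflexive (trans (Blob.cut≡2 blob) (sym (deg-pair p q))))
      where
      pointwise : ∀ v → pair p q v ≤ ∂ Y v
      pointwise v with status (Y v)
      ... | inj₂ v∉ = ℤ.≤-reflexive (trans (pair-avoids (separated {Y} p∈ v∉) (separated {Y} q∈ v∉)) (sym (∂-out Y v∉)))
      ... | inj₁ v∈ = subst₂ _≤_ (trans (sym (∂-in (set M) (Y⊆M v v∈))) (tails M v)) (sym (∂-in Y v∈))
              (out-anti {Y} {set M} Y⊆M v)

    opaque
      -- z₁ = z₂ would be a cut vertex
      terminals : ∀ {Z} → Blob Z → ∃[ z₁ ] ∃[ z₂ ] z₁ ≢ z₂ × Z z₁ ≡ true × Z z₂ ≡ true × (∀ v → ∂ Z v ≡ pair z₁ z₂ v)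
      terminals {Z} blob = ends (two-points (∂ Z) (∂≥0 Z) (Blob.cut≡2 blob))
        where
        ends : (∃[ z₁ ] ∃[ z₂ ] ∀ v → ∂ Z v ≡ pair z₁ z₂ v) →
               ∃[ z₁ ] ∃[ z₂ ] z₁ ≢ z₂ × Z z₁ ≡ true × Z z₂ ≡ true × (∀ v → ∂ Z v ≡ pair z₁ z₂ v)
        ends (z₁ , z₂ , eq) = z₁ , z₂ , distinct , z₁∈ , ∂-support Z (subst (1ℤ ≤_) (sym (eq z₂)) (1≤pairʳ z₁ z₂)) , eq
          where
          z₁∈ : Z z₁ ≡ true
          z₁∈ = ∂-support Z (subst (1ℤ ≤_) (sym (eq z₁)) (1≤pairˡ z₁ z₂))
          another : ∃[ z ] Z z ≡ true × z₁ ≢ z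
          another = Blob.another blob z₁
          distinct : z₁ ≢ z₂
          distinct refl = proj₂ (proj₂ another) (no-cut-vertex Z z₁ z₁∈
            (λ v v∈ z₁≢v → trans (sym (∂-in Z v∈)) (trans (eq v) (pair-avoids z₁≢v z₁≢v)))
            (Blob.out₀∉ blob) (proj₁ (proj₂ another)))

-- Rank 2 on a 2-connected graph, and two disjoint blobs

module Special (G : Graph)
  (cut≥2 : ∀ A {v w} → A v ≡ true → A w ≡ false → + 2 ≤ Firing.cut G A)
  (no-cut-vertex : ∀ A a → A a ≡ true → (∀ v → A v ≡ true → a ≢ v → Theory.out G A v ≡ 0ℤ) →
                   ∀ {y} → A y ≡ false → ∀ {v} → A v ≡ true → a ≡ v)
  (D : Divisor G) (rank2 : Theory.Rank≥ G D 2)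
  where
  open Graph G
  open Theory G
  open Firing G
  open Blobs G
  open TwoConnected cut≥2 no-cut-vertex

  1≰0 : ¬ (1ℤ ≤ 0ℤ)
  1≰0 = ℤ.<⇒≱ (+<+ (s≤s z≤n))

  2≰1 : ¬ (+ 2 ≤ 1ℤ)
  2≰1 = ℤ.<⇒≱ (+<+ (s≤s (s≤s z≤n)))

  opaque
    -- One unit of rank pays for the chip `k` held back and the other for `w`; `towards` extracts
    -- the legal set.
    reach : ∀ k X w → (λ v → pt k v + X v) ≋ D → X w ≡ 0ℤ → Legal X w
    reach k X w state Xw = towards X w (effClass-≋ {λ v → X v - pt w v} {λ v → D v - pair k w v} X-w≋ (rank2 (pair k w) (pair≥0 k w) (deg-pair k w))) (ℤ.≤-reflexive Xw)
      where
      X-w≋ : (λ v → X v - pt w v) ≋ (λ v → D v - pair k w v)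
      X-w≋ = proj₁ state , λ v → trans (regroup₁ (pt k v) (X v) (pt w v))
        (trans (cong (_- pair k w v) (proj₂ state v)) (regroup₂ (D v) (lap (proj₁ state) v) (pair k w v)))
        where
        regroup₁ : ∀ k x w → x - w ≡ (k + x) - (k + w)
        regroup₁ = solve-∀
        regroup₂ : ∀ d l p → d + l - p ≡ d - p + l
        regroup₂ = solve-∀

  relax : ∀ {X X′ w} (L : Legal X w) → (∀ v → Legal.set L v ≡ true → X v ≤ X′ v) → Legal X′ w
  relax (legal A w∉ u∈ bound) le = legal A w∉ u∈ λ v v∈ → ℤ.≤-trans (bound v v∈) (le v v∈)

  -- A chip a in the blob Z cannot leave it on its own, so sets avoiding a
  -- further vertex of Z avoid Z.
  opaque
    push : ∀ {Z k a p q z} → Blob Z → Z a ≡ true → Z z ≡ true → a ≢ z → Z p ≡ false → Z q ≡ false →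
           (λ v → pt k v + (pt a v + pair p q v)) ≋ D →
           Σ[ M ∈ Move p q z ] (∀ v → Z v ≡ true → Move.set M v ≡ false)
    push {Z} {k} {a} {p} {q} {z} blob a∈ z∈ a≢z p∉ q∉ state = move L′ , Z∩L=∅
      where
      off : ∀ v → Z v ≡ true → pair p q v ≡ 0ℤ
      off v v∈ = pair-avoids (λ p≡v → true≢false v∈ (subst (λ u → Z u ≡ false) p≡v p∉))
                             (λ q≡v → true≢false v∈ (subst (λ u → Z u ≡ false) q≡v q∉))
      X : Divisor G
      X v = pt a v + pair p q v
      L : Legal X z
      L = reach k X z state (cong₂ _+_ (pt-other a≢z) (off z z∈))
      open Legal L
      bound′ : ∀ v → Z v ≡ true → set v ≡ true → out set v ≤ pt a v
      bound′ v v∈ v∈L = subst (out set v ≤_) (trans (cong (_+_ (pt a v)) (off v v∈)) (ℤ.+-identityʳ (pt a v))) (bound v v∈L)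
      decide : ((∀ v → Z v ≡ true → set v ≡ false) ⊎ (∀ v → Z v ≡ true → set v ≡ true)) → ∀ v → Z v ≡ true → set v ≡ false
      decide (inj₁ none) = none
      decide (inj₂ all)  = ⊥-elim (true≢false (all z z∈) avoids)
      Z∩L=∅ : ∀ v → Z v ≡ true → set v ≡ false
      Z∩L=∅ = decide (Blob.unsplit blob set a bound′)
      L′ : Legal (pair p q) z
      L′ = relax {X} {pair p q} L λ v v∈ → ℤ.≤-reflexive (drop v (λ a≡v → true≢false v∈ (subst (λ u → set u ≡ false) a≡v (Z∩L=∅ a a∈))))
        where
        drop : ∀ v → a ≢ v → X v ≡ pair p q v
        drop v a≢v = trans (cong (_+ pair p q v) (pt-other a≢v)) (ℤ.+-identityˡ (pair p q v))

  ≋-congˡ : ∀ {A B : Divisor G} → (∀ v → A v ≡ B v) → A ≋ D → B ≋ D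
  ≋-congˡ {A} {B} eq A≋ = ≋-trans {B} {A} {D} (≋-cong (λ v → sym (eq v))) A≋

  replace : ∀ {X A B : Divisor G} → (λ v → X v + A v) ≋ D → B ≋ A → (λ v → X v + B v) ≋ D
  replace {X} {A} {B} state B≋A = ≋-trans {λ v → X v + B v} {λ v → X v + A v} {D} (≋-+ {X} {X} {B} {A} ≋-refl B≋A) state

  replace₂ : ∀ {X Y A B : Divisor G} → (λ v → X v + (Y v + A v)) ≋ D → B ≋ A → (λ v → X v + (Y v + B v)) ≋ D
  replace₂ {X} {Y} {A} {B} state B≋A =
    replace {X} {λ v → Y v + A v} {λ v → Y v + B v} state (≋-+ {Y} {Y} {B} {A} ≋-refl B≋A)

  cancelˡ : ∀ {X A B : Divisor G} → (λ v → X v + A v) ≋ (λ v → X v + B v) → A ≋ B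
  cancelˡ {X} {A} {B} (f , eq) = f , λ v → trans (regroup₁ (X v) (A v))
      (trans (cong (_- X v) (eq v)) (regroup₂ (X v) (B v) (lap f v)))
    where
    regroup₁ : ∀ x a → a ≡ x + a - x
    regroup₁ = solve-∀
    regroup₂ : ∀ x b l → x + b + l - x ≡ b + l
    regroup₂ = solve-∀

  pair-comm : ∀ p q v → pair p q v ≡ pair q p v
  pair-comm p q v = ℤ.+-comm (pt p v) (pt q v)

  module Ordered {Z Y : VSet} (bZ : Blob Z) (bY : Blob Y) (disjoint : ∀ v → Z v ≡ true → Y v ≡ false) where

    Y∌ : ∀ {v} → Y v ≡ true → Z v ≡ false
    Y∌ {v} v∈Y = Bool.¬-not λ v∈Z → true≢false v∈Y (disjoint v v∈Z)

    opaque
      -- The two chips in `Y` are driven towards a vertex `z` of `Z`. Moves avoid `Z`, as the lone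
      -- chip `a` cannot leave it, and while they split `Y` the chips stay in `Y`. Since `z` is
      -- never reached, the driving must end with a set containing all of `Y`; then the chips are at
      -- the ends of `Y`.
      pairs-meet : ∀ {k a p q} → Z a ≡ true → Y p ≡ true → Y q ≡ true →
                   (λ v → pt k v + (pt a v + pair p q v)) ≋ D → pair p q ≋ ∂ Y
      pairs-meet {k} {a} {p₀} {q₀} a∈ p₀∈ q₀∈ state =
          pair-drive z (λ p q → Y p ≡ true × Y q ≡ true) step (p₀∈ , q₀∈)
        where
        z : Vertex
        z = proj₁ (Blob.another bZ a)
        step : ∀ p q → pair p q ≋ pair p₀ q₀ → Y p ≡ true × Y q ≡ true →
               (pair p₀ q₀ ≋ ∂ Y) ⊎ (Σ[ M ∈ Move p q z ] Y (Move.p′ M) ≡ true × Y (Move.q′ M) ≡ true)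
        step p q pq≋ (p∈ , q∈) = leave (Fin.any? λ w → (Y w Bool.≟ true) ×-dec (Move.set M w Bool.≟ false))
          where
          pushed : Σ[ M ∈ Move p q z ] (∀ v → Z v ≡ true → Move.set M v ≡ false)
          pushed = push bZ a∈ (proj₁ (proj₂ (Blob.another bZ a))) (proj₂ (proj₂ (Blob.another bZ a))) (Y∌ p∈) (Y∌ q∈)
                     (replace₂ {pt k} {pt a} {pair p₀ q₀} {pair p q} state pq≋)
          M : Move p q z
          M = proj₁ pushed
          leave : Dec (∃[ w ] (Y w ≡ true × Move.set M w ≡ false)) →
                  (pair p₀ q₀ ≋ ∂ Y) ⊎ (Σ[ M ∈ Move p q z ] Y (Move.p′ M) ≡ true × Y (Move.q′ M) ≡ true)
          leave (yes (w , w∈ , w∉M)) = inj₂ (M , heads-inside bY M p∈ (Move.p∈ M) w∈ w∉M)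
          leave (no none) = inj₁ (≋-trans {pair p₀ q₀} {pair p q} {∂ Y} (≋-sym {pair p q} {pair p₀ q₀} pq≋)
            (≋-cong (tails-∂ bY M (λ v v∈ → Bool.¬-not λ v∉ → none (v , v∈ , v∉)) p∈ q∈)))

    opaque
      -- Either end of `Y` can serve as the chip held back. By `pairs-meet` the other end together
      -- with `b` is then equivalent to `∂ Y`, so `b` would be equal to both ends.
      no-triple : ∀ {a b} → Z a ≡ true → Y b ≡ true → ¬ ((λ v → pt a v + (pt b v + ∂ Y v)) ≋ D)
      no-triple {a} {b} a∈ b∈ state = distinct (trans (sym b≡y₁) b≡y₂)
        where
        ends : ∃[ z₁ ] ∃[ z₂ ] z₁ ≢ z₂ × Y z₁ ≡ true × Y z₂ ≡ true × (∀ v → ∂ Y v ≡ pair z₁ z₂ v)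
        ends = terminals bY
        y₁ y₂ : Vertex
        y₁ = proj₁ ends
        y₂ = proj₁ (proj₂ ends)
        distinct : y₁ ≢ y₂
        distinct = proj₁ (proj₂ (proj₂ ends))
        y₁∈ : Y y₁ ≡ true
        y₁∈ = proj₁ (proj₂ (proj₂ (proj₂ ends)))
        y₂∈ : Y y₂ ≡ true
        y₂∈ = proj₁ (proj₂ (proj₂ (proj₂ (proj₂ ends))))
        ∂Y : ∀ v → ∂ Y v ≡ pair y₁ y₂ v
        ∂Y = proj₂ (proj₂ (proj₂ (proj₂ (proj₂ ends))))
        b≡y₂ : b ≡ y₂
        b≡y₂ = pt-injective (cancelˡ {pt y₁} {pt b} {pt y₂} (≋-trans {pair y₁ b} {∂ Y} {pair y₁ y₂}
          (pairs-meet a∈ y₁∈ b∈ (≋-congˡ (λ v → trans (cong (λ z → pt a v + (pt b v + z)) (∂Y v)) (regroup (pt a v) (pt b v) (pt y₁ v) (pt y₂ v))) state))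
          (≋-cong ∂Y)))
          where
          regroup : ∀ a b c d → a + (b + (c + d)) ≡ d + (a + (c + b))
          regroup = solve-∀
        b≡y₁ : b ≡ y₁
        b≡y₁ = pt-injective (cancelˡ {pt y₂} {pt b} {pt y₁} (≋-trans {pair y₂ b} {∂ Y} {pair y₂ y₁}
          (pairs-meet a∈ y₂∈ b∈ (≋-congˡ (λ v → trans (cong (λ z → pt a v + (pt b v + z)) (∂Y v)) (regroup (pt a v) (pt b v) (pt y₁ v) (pt y₂ v))) state))
          (≋-cong (λ v → trans (∂Y v) (pair-comm y₁ y₂ v)))))
          where
          regroup : ∀ a b c d → a + (b + (c + d)) ≡ c + (a + (d + b))
          regroup = solve-∀

    private
      -- One term of the count in `crowded`, with `z`, `a`, `b` the membership in `Z`, `A₁`, `A₃`.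
      -- Edges out of `A₁` and edges to `Z` minus `A₃` are disjoint because `A₁` contains `Z`, and
      -- both kinds leave `A₃`.
      either-exit : ∀ z a b {x : ℤ} → 0ℤ ≤ x → (z ≡ true → a ≡ true) → (b ≡ true → x ≡ 0ℤ) →
                    (if a then 0ℤ else x) + (if z ∧ not b then x else 0ℤ) ≤ (if b then 0ℤ else x)
      either-exit true  false b     x≥0 za bx = ⊥-elim (true≢false (za refl) refl)
      either-exit true  true  true  x≥0 za bx = ℤ.≤-refl
      either-exit true  true  false x≥0 za bx = ℤ.≤-reflexive (ℤ.+-identityˡ _)
      either-exit false true  true  x≥0 za bx = ℤ.≤-refl
      either-exit false true  false x≥0 za bx = x≥0
      either-exit false false true  x≥0 za bx = ℤ.≤-reflexive (trans (ℤ.+-identityʳ _) (bx refl))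
      either-exit false false false x≥0 za bx = ℤ.≤-reflexive (ℤ.+-identityʳ _)

    -- Only one of the two chips lies in `Z`, so the set cannot split `Z`; it contains `x`, hence
    -- all of `Z`.
    fills : ∀ {x c y} → Z x ≡ true → Z c ≡ false → (M : Move x c y) → ∀ v → Z v ≡ true → Move.set M v ≡ true
    fills {x} {c} x∈ c∉ M = choose (Blob.unsplit bZ (Move.set M) x bound)
      where
      bound : ∀ v → Z v ≡ true → Move.set M v ≡ true → out (Move.set M) v ≤ pt x v
      bound v v∈ v∈M = ℤ.≤-reflexive (trans (sym (∂-in (Move.set M) v∈M)) (trans (Move.tails M v)
        (trans (cong (_+_ (pt x v)) (pt-other λ c≡v → true≢false v∈ (subst (λ u → Z u ≡ false) c≡v c∉))) (ℤ.+-identityʳ (pt x v)))))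
      choose : ((∀ v → Z v ≡ true → Move.set M v ≡ false) ⊎ (∀ v → Z v ≡ true → Move.set M v ≡ true)) →
               ∀ v → Z v ≡ true → Move.set M v ≡ true
      choose (inj₂ all)  = all
      choose (inj₁ none) = ⊥-elim (true≢false (Move.p∈ M) (none x x∈))

    private
      -- M₃ fires a alone, and M₁ fires Z along an edge from a out of Z, although
      -- both edges at a stay in Z.
      crowded : ∀ {a c y y′} → Z a ≡ true → Z c ≡ false → Move a c y → Move a a y′ → ⊥
      crowded {a} {c} {y} {y′} a∈ c∉Z M₁ M₃ = ℤ.<⇒≱ {+ 2} {+ 3} (+<+ (s≤s (s≤s (s≤s z≤n)))) (begin
            + 3                          ≤⟨ ℤ.+-mono-≤ (ℤ.≤-reflexive (sym out₁≡1)) two≤ ⟩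
            out A₁ a + iout Z A₃ a       ≤⟨ subst (_≤ out A₃ a) (∑-distrib-+ (λ w → if A₁ w then 0ℤ else m a w) (λ w → if Z w ∧ not (A₃ w) then m a w else 0ℤ)) (sum-mono pointwise) ⟩
            out A₃ a                     ≡⟨ trans (sym (∂-in A₃ (Move.p∈ M₃))) (trans (Move.tails M₃ a) (cong₂ _+_ (pt-self a) (pt-self a))) ⟩
            + 2                          ∎)
        where
        open ℤ.≤-Reasoning
        A₁ A₃ : VSet
        A₁ = Move.set M₁
        A₃ = Move.set M₃
        only : ∀ {v} → A₃ v ≡ true → a ≡ v
        only = no-cut-vertex A₃ a (Move.p∈ M₃) (λ v v∈ a≢v → trans (sym (∂-in A₃ v∈)) (trans (Move.tails M₃ v) (pair-avoids a≢v a≢v))) (Move.avoids M₃)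
        out₁≡1 : out A₁ a ≡ 1ℤ
        out₁≡1 = trans (sym (∂-in A₁ (Move.p∈ M₁))) (trans (Move.tails M₁ a)
          (cong₂ _+_ (pt-self a) (pt-other λ c≡a → true≢false a∈ (subst (λ u → Z u ≡ false) c≡a c∉Z))))
        other : ∃[ z ] Z z ≡ true × a ≢ z
        other = Blob.another bZ a
        at-a : ∀ v → inner Z A₃ v ≤ single a (iout Z A₃ a) v
        at-a v = here (status (A₃ v))
          where
          here : (A₃ v ≡ true) ⊎ (A₃ v ≡ false) → inner Z A₃ v ≤ single a (iout Z A₃ a) v
          here (inj₁ v∈) = subst (λ u → inner Z A₃ u ≤ single a (iout Z A₃ a) u) (only v∈)
            (ℤ.≤-reflexive (trans (cong (λ b → if b then iout Z A₃ a else 0ℤ) (∩-intro Z A₃ a a∈ (Move.p∈ M₃))) (sym (single-eq a (iout Z A₃ a)))))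
          here (inj₂ v∉) = ℤ.≤-reflexive (trans (cong (λ b → if b then iout Z A₃ v else 0ℤ) (trans (cong (Z v ∧_) v∉) (Bool.∧-zeroʳ (Z v))))
            (sym (single-neq a (iout Z A₃ a) (separated {A₃} (Move.p∈ M₃) v∉))))
        two≤ : + 2 ≤ iout Z A₃ a
        two≤ = ℤ.≤-trans (Blob.split bZ A₃ a∈ (Move.p∈ M₃) (proj₁ (proj₂ other)) (Bool.¬-not λ z∈ → proj₂ (proj₂ other) (only z∈)))
               (subst (sum (inner Z A₃) ≤_) (sum-single a (iout Z A₃ a)) (sum-mono at-a))
        pointwise : ∀ w → (if A₁ w then 0ℤ else m a w) + (if Z w ∧ not (A₃ w) then m a w else 0ℤ) ≤ (if A₃ w then 0ℤ else m a w)
        pointwise w = either-exit (Z w) (A₁ w) (A₃ w) (m≥0 a w) (fills a∈ c∉Z M₁ w)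
          λ w∈ → trans (cong (m a) (sym (only w∈))) (m-loop a)

      -- Holding back `a` gives a move of `a` and `c`; holding back `c` gives a move of the two
      -- chips on `a`.
      no-double : ∀ {a b c} → Z a ≡ true → Y b ≡ true → Z c ≡ false → Y c ≡ false →
                  ¬ ((λ v → pt a v + (pt b v + pair a c v)) ≋ D)
      no-double {a} {b} {c} a∈ b∈ c∉Z c∉Y state = crowded a∈ c∉Z
        (proj₁ (push bY b∈ (proj₁ (proj₂ other)) (proj₂ (proj₂ other)) (disjoint a a∈) c∉Y state))
        (proj₁ (push bY b∈ (proj₁ (proj₂ other)) (proj₂ (proj₂ other)) (disjoint a a∈) (disjoint a a∈)
          (≋-congˡ (λ v → regroup (pt a v) (pt b v) (pt c v)) state)))
        where
        other : ∃[ y ] Y y ≡ true × b ≢ y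
        other = Blob.another bY b
        regroup : ∀ a b c → a + (b + (a + c)) ≡ c + (b + (a + a))
        regroup = solve-∀

    -- For `a ≢ a′`, holding back each in turn gives two sets containing `Z`, and each of `a`, `a′`
    -- has no outgoing edge in the set for which it was held back. So the union is left by a single
    -- edge, at `c`.
    no-stray : ∀ {a a′ b c} → Z a ≡ true → Z a′ ≡ true → Y b ≡ true → Z c ≡ false → Y c ≡ false →
               ¬ ((λ v → pt a v + (pt b v + pair a′ c v)) ≋ D)
    no-stray {a} {a′} {b} {c} a∈ a′∈ b∈ c∉Z c∉Y state = cases (a Fin.≟ a′)
      where
      y = proj₁ (Blob.another bY b)
      y∈ = proj₁ (proj₂ (Blob.another bY b))
      b≢y = proj₂ (proj₂ (Blob.another bY b))
      swapped : (λ v → pt a′ v + (pt b v + pair a c v)) ≋ D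
      swapped = ≋-congˡ (λ v → regroup (pt a v) (pt b v) (pt a′ v) (pt c v)) state
        where
        regroup : ∀ a b c d → a + (b + (c + d)) ≡ c + (b + (a + d))
        regroup = solve-∀
      M₁ : Move a′ c y
      M₁ = proj₁ (push bY b∈ y∈ b≢y (disjoint a′ a′∈) c∉Y state)
      M₂ : Move a c y
      M₂ = proj₁ (push bY b∈ y∈ b≢y (disjoint a a∈) c∉Y swapped)
      A₁ A₂ : VSet
      A₁ = Move.set M₁
      A₂ = Move.set M₂
      out₁ : ∀ v → A₁ v ≡ true → out A₁ v ≡ pair a′ c v
      out₁ v v∈ = trans (sym (∂-in A₁ v∈)) (Move.tails M₁ v)
      out₂ : ∀ v → A₂ v ≡ true → out A₂ v ≡ pair a c v
      out₂ v v∈ = trans (sym (∂-in A₂ v∈)) (Move.tails M₂ v)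
      cases : Dec (a ≡ a′) → ⊥
      cases (no a≢a′) = 2≰1 (ℤ.≤-trans (cut≥2 (A₁ ∪ A₂) (∪-left A₁ A₂ c (Move.q∈ M₁)) (∪-avoid A₁ A₂ y (Move.avoids M₁) (Move.avoids M₂)))
          (subst (cut (A₁ ∪ A₂) ≤_) (sum-pt c) (sum-mono bound)))
        where
        keep : ∀ {x v} → x ≢ v → pair x c v ≤ pt c v
        keep {x} {v} x≢v = ℤ.≤-reflexive (trans (cong (_+ pt c v) (pt-other x≢v)) (ℤ.+-identityˡ (pt c v)))
        either : ∀ v → Dec (a ≡ v) → Dec (a′ ≡ v) → (A₁ v ≡ true) ⊎ (A₂ v ≡ true) → out (A₁ ∪ A₂) v ≤ pt c v
        either v _ (yes refl) _ = ℤ.≤-trans (out-∪ʳ A₁ A₂ v) (ℤ.≤-trans (ℤ.≤-reflexive (out₂ v (fills a∈ c∉Z M₂ v a′∈))) (keep a≢a′))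
        either v _ (no a′≢v) (inj₁ v∈A₁) = ℤ.≤-trans (out-∪ˡ A₁ A₂ v) (ℤ.≤-trans (ℤ.≤-reflexive (out₁ v v∈A₁)) (keep a′≢v))
        either v (no a≢v) (no a′≢v) (inj₂ v∈A₂) = ℤ.≤-trans (out-∪ʳ A₁ A₂ v) (ℤ.≤-trans (ℤ.≤-reflexive (out₂ v v∈A₂)) (keep a≢v))
        either v (yes refl) (no a′≢v) (inj₂ v∈A₂) = ℤ.≤-trans (out-∪ˡ A₁ A₂ v) (ℤ.≤-trans (ℤ.≤-reflexive (out₁ v (fills a′∈ c∉Z M₁ v a∈))) (keep a′≢v))
        bound : ∀ v → ∂ (A₁ ∪ A₂) v ≤ pt c v
        bound v = inside (status ((A₁ ∪ A₂) v))
          where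
          inside : ((A₁ ∪ A₂) v ≡ true) ⊎ ((A₁ ∪ A₂) v ≡ false) → ∂ (A₁ ∪ A₂) v ≤ pt c v
          inside (inj₂ v∉) = subst (_≤ pt c v) (sym (∂-out (A₁ ∪ A₂) v∉)) (pt≥0 c v)
          inside (inj₁ v∈) = subst (_≤ pt c v) (sym (∂-in (A₁ ∪ A₂) v∈)) (either v (a Fin.≟ v) (a′ Fin.≟ v) (∪-cases A₁ A₂ v v∈))
      cases (yes refl) = no-double a∈ b∈ c∉Z c∉Y state

-- Degree 4 and rank 2: two chips for each of two disjoint blobs

module Meeting
  (G : Graph)
  (cut≥2 : ∀ A {v w} → A v ≡ true → A w ≡ false → + 2 ≤ Firing.cut G A)
  (no-cut-vertex : ∀ A a → A a ≡ true → (∀ v → A v ≡ true → a ≢ v → Theory.out G A v ≡ 0ℤ) →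
                   ∀ {y} → A y ≡ false → ∀ {v} → A v ≡ true → a ≡ v)
  (D : Divisor G) (rank2 : Theory.Rank≥ G D 2) (degD : deg G D ≡ + 4)
  where
  open Graph G
  open Theory G
  open Firing G
  open Blobs G
  open TwoConnected cut≥2 no-cut-vertex
  open Special G cut≥2 no-cut-vertex D rank2

  module _ {Z Y : VSet} (bZ : Blob Z) (bY : Blob Y) (disjoint : ∀ v → Z v ≡ true → Y v ≡ false) where

    private
      disjoint′ : ∀ v → Y v ≡ true → Z v ≡ false
      disjoint′ v v∈Y = Bool.¬-not λ v∈Z → true≢false v∈Y (disjoint v v∈Z)

      module ZY = Ordered bZ bY disjoint
      module YZ = Ordered bY bZ disjoint′

    -- `pairs-meet` in both directions, each time holding back one chip of the other blob.
    merge : ∀ {a a′ b b′} → Z a ≡ true → Z a′ ≡ true → Y b ≡ true → Y b′ ≡ true →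
            (λ v → pt a v + (pt a′ v + pair b b′ v)) ≋ D → (λ v → ∂ Z v + ∂ Y v) ≋ D
    merge {a} {a′} {b} {b′} a∈ a′∈ b∈ b′∈ state =
      ≋-trans {λ v → ∂ Z v + ∂ Y v} {λ v → pair a a′ v + pair b b′ v} {D}
        (≋-+ {∂ Z} {pair a a′} {∂ Y} {pair b b′}
          (≋-sym {pair a a′} {∂ Z} (YZ.pairs-meet b′∈ a∈ a′∈ (≋-congˡ (λ v → regroup₁ (pt a v) (pt a′ v) (pt b v) (pt b′ v)) state)))
          (≋-sym {pair b b′} {∂ Y} (ZY.pairs-meet a′∈ b∈ b′∈ state)))
        (≋-congˡ (λ v → regroup₂ (pt a v) (pt a′ v) (pair b b′ v)) state)
      where
      regroup₁ : ∀ a a′ b b′ → a + (a′ + (b + b′)) ≡ b + (b′ + (a + a′))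
      regroup₁ = solve-∀
      regroup₂ : ∀ a a′ x → a + (a′ + x) ≡ (a + a′) + x
      regroup₂ = solve-∀

    -- The two free chips are driven towards `Y`. When they arrive, `no-triple` forbids that both
    -- enter, and if one enters, `no-stray` forces the other into `Z`.
    drive-in : ∀ {a b t c} → Z a ≡ true → Y b ≡ true → Y t ≡ false → Y c ≡ false →
               (λ v → pt a v + (pt b v + pair t c v)) ≋ D → (λ v → ∂ Z v + ∂ Y v) ≋ D
    drive-in {a} {b} {t} {c} a∈ b∈ t∉ c∉ state = pair-drive y (λ p q → Y p ≡ false × Y q ≡ false) step (t∉ , c∉)
      where
      other : ∃[ y ] Y y ≡ true × b ≢ y
      other = Blob.another bY b
      y : Vertex
      y = proj₁ other
      step : ∀ p q → pair p q ≋ pair t c → Y p ≡ false × Y q ≡ false →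
             ((λ v → ∂ Z v + ∂ Y v) ≋ D) ⊎ (Σ[ M ∈ Move p q y ] Y (Move.p′ M) ≡ false × Y (Move.q′ M) ≡ false)
      step p q pq≋ (p∉ , q∉) = arrive (status (Y p′)) (status (Y q′))
        where
        pushed : Σ[ M ∈ Move p q y ] (∀ v → Y v ≡ true → Move.set M v ≡ false)
        pushed = push bY b∈ (proj₁ (proj₂ other)) (proj₂ (proj₂ other)) p∉ q∉
                   (replace₂ {pt a} {pt b} {pair t c} {pair p q} state pq≋)
        M : Move p q y
        M = proj₁ pushed
        p′ q′ : Vertex
        p′ = Move.p′ M
        q′ = Move.q′ M
        state′ : (λ v → pt a v + (pt b v + pair p′ q′ v)) ≋ D
        state′ = replace₂ {pt a} {pt b} {pair t c} {pair p′ q′} state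
          (≋-trans {pair p′ q′} {pair p q} {pair t c} (≋-sym {pair p q} {pair p′ q′} (Move.equivalent M)) pq≋)
        Result : Set
        Result = ((λ v → ∂ Z v + ∂ Y v) ≋ D) ⊎ (Σ[ M ∈ Move p q y ] Y (Move.p′ M) ≡ false × Y (Move.q′ M) ≡ false)
        one-in : ∀ {p q} → Y p ≡ true → Y q ≡ false → (λ v → pt a v + (pt b v + pair p q v)) ≋ D → Result
        one-in {p} {q} p∈ q∉ st = inj₁ (located (status (Z q)))
          where
          regroup₁ : ∀ a b p q → a + (b + (p + q)) ≡ a + (q + (b + p))
          regroup₁ = solve-∀
          regroup₂ : ∀ a b x → a + (b + x) ≡ b + (a + x)
          regroup₂ = solve-∀
          located : (Z q ≡ true) ⊎ (Z q ≡ false) → (λ v → ∂ Z v + ∂ Y v) ≋ D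
          located (inj₁ q∈Z) = merge a∈ q∈Z b∈ p∈ (≋-congˡ (λ v → regroup₁ (pt a v) (pt b v) (pt p v) (pt q v)) st)
          located (inj₂ q∉Z) = ⊥-elim (YZ.no-stray b∈ p∈ a∈ q∉ q∉Z (≋-congˡ (λ v → regroup₂ (pt a v) (pt b v) (pair p q v)) st))
        arrive : (Y p′ ≡ true) ⊎ (Y p′ ≡ false) → (Y q′ ≡ true) ⊎ (Y q′ ≡ false) → Result
        arrive (inj₂ p′∉) (inj₂ q′∉) = inj₂ (M , p′∉ , q′∉)
        arrive (inj₁ p′∈) (inj₂ q′∉) = one-in p′∈ q′∉ state′
        arrive (inj₂ p′∉) (inj₁ q′∈) = one-in q′∈ p′∉ (≋-congˡ (λ v → cong (λ z → pt a v + (pt b v + z)) (pair-comm p′ q′ v)) state′)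
        arrive (inj₁ p′∈) (inj₁ q′∈) = ⊥-elim (ZY.no-triple a∈ b∈
          (≋-congˡ (λ v → cong (λ z → pt a v + (pt b v + z)) (heads-∂ bY M (proj₂ pushed) p′∈ q′∈ v)) state′))

  -- By rank 2 there are chips on both blobs; the other two chips can be
  -- driven so that each blob has two.
  meet : ∀ {Z Y} → Blob Z → Blob Y → (∀ v → Z v ≡ true → Y v ≡ false) → (λ v → ∂ Z v + ∂ Y v) ≋ D
  meet {Z} {Y} bZ bY disjoint = located (status (Y t)) (status (Y c))
    where
    disjoint′ : ∀ v → Y v ≡ true → Z v ≡ false
    disjoint′ v v∈Y = Bool.¬-not λ v∈Z → true≢false v∈Y (disjoint v v∈Z)
    a b : Vertex
    a = Blob.one bZ
    b = Blob.one bY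
    a∈ : Z a ≡ true
    a∈ = Blob.one∈ bZ
    b∈ : Y b ≡ true
    b∈ = Blob.one∈ bY
    rest : EffClass (λ v → D v - pair a b v)
    rest = rank2 (pair a b) (pair≥0 a b) (deg-pair a b)
    F : Divisor G
    F = proj₁ rest
    degF : deg G F ≡ + 2
    degF = trans (sym (≋-deg {λ v → D v - pair a b v} {F} (proj₂ (proj₂ rest))))
      (trans (sum-sub D (pair a b)) (cong₂ _-_ degD (deg-pair a b)))
    points : ∃[ p ] ∃[ q ] ∀ v → F v ≡ pair p q v
    points = two-points F (proj₁ (proj₂ rest)) degF
    t c : Vertex
    t = proj₁ points
    c = proj₁ (proj₂ points)
    state : (λ v → pt a v + (pt b v + pair t c v)) ≋ D
    state = ≋-trans {λ v → pt a v + (pt b v + pair t c v)} {λ v → pair a b v + (D v - pair a b v)} {D}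
      (≋-trans {λ v → pt a v + (pt b v + pair t c v)} {λ v → pair a b v + F v} {λ v → pair a b v + (D v - pair a b v)}
        (≋-cong λ v → trans (regroup (pt a v) (pt b v) (pair t c v)) (cong (_+_ (pair a b v)) (sym (proj₂ (proj₂ points) v))))
        (≋-+ {pair a b} {pair a b} {F} {λ v → D v - pair a b v} ≋-refl
          (≋-sym {λ v → D v - pair a b v} {F} (proj₂ (proj₂ rest)))))
      (≋-cong λ v → cancel (pair a b v) (D v))
      where
      regroup : ∀ a b x → a + (b + x) ≡ (a + b) + x
      regroup = solve-∀
      cancel : ∀ x d → x + (d - x) ≡ d
      cancel = solve-∀
    swapped : (λ v → pt b v + (pt a v + pair t c v)) ≋ D
    swapped = ≋-congˡ (λ v → regroup (pt a v) (pt b v) (pair t c v)) state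
      where
      regroup : ∀ a b x → a + (b + x) ≡ b + (a + x)
      regroup = solve-∀
    Result : Set
    Result = (λ v → ∂ Z v + ∂ Y v) ≋ D
    one-in : ∀ {p q} → Y p ≡ true → Y q ≡ false → (λ v → pt b v + (pt a v + pair p q v)) ≋ D → Result
    one-in {p} {q} p∈ q∉ st = in-Z (status (Z q))
      where
      regroup₁ : ∀ a b p q → b + (a + (p + q)) ≡ a + (q + (b + p))
      regroup₁ = solve-∀
      in-Z : (Z q ≡ true) ⊎ (Z q ≡ false) → Result
      in-Z (inj₁ q∈Z) = merge bZ bY disjoint a∈ q∈Z b∈ p∈ (≋-congˡ (λ v → regroup₁ (pt a v) (pt b v) (pt p v) (pt q v)) st)
      in-Z (inj₂ q∉Z) = ⊥-elim (Ordered.no-stray bY bZ disjoint′ b∈ p∈ a∈ q∉ q∉Z st)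
    located : (Y t ≡ true) ⊎ (Y t ≡ false) → (Y c ≡ true) ⊎ (Y c ≡ false) → Result
    located (inj₂ t∉) (inj₂ c∉) = drive-in bZ bY disjoint a∈ b∈ t∉ c∉ state
    located (inj₁ t∈) (inj₁ c∈) = ≋-congˡ (λ v → ℤ.+-comm (∂ Y v) (∂ Z v))
      (drive-in bY bZ disjoint′ b∈ a∈ (disjoint′ t t∈) (disjoint′ c c∈) swapped)
    located (inj₁ t∈) (inj₂ c∉) = one-in t∈ c∉ swapped
    located (inj₂ t∉) (inj₁ c∈) = one-in c∈ t∉
      (≋-congˡ (λ v → cong (λ z → pt b v + (pt a v + z)) (pair-comm t c v)) swapped)

  module _ {Z Y : VSet} (bZ : Blob Z) (bY : Blob Y) (disjoint : ∀ v → Z v ≡ true → Y v ≡ false) where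

    -- Remove the two ends of Z in turn and take the union of the two sets.
    free-pair : ∀ {p q w} → Z p ≡ false → Z q ≡ false → Z w ≡ false → p ≢ w → q ≢ w →
                pair p q ≋ ∂ Y → Legal (pair p q) w
    free-pair {p} {q} {w} p∉ q∉ w∉ p≢w q≢w pq≋ = combine (around L₁ z₂ (λ v → refl)) (around L₂ z₁ (λ v → refl))
      where
      ends : ∃[ z₁ ] ∃[ z₂ ] z₁ ≢ z₂ × Z z₁ ≡ true × Z z₂ ≡ true × (∀ v → ∂ Z v ≡ pair z₁ z₂ v)
      ends = terminals bZ
      z₁ z₂ : Vertex
      z₁ = proj₁ ends
      z₂ = proj₁ (proj₂ ends)
      z₁≢z₂ : z₁ ≢ z₂
      z₁≢z₂ = proj₁ (proj₂ (proj₂ ends))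
      z₁∈ : Z z₁ ≡ true
      z₁∈ = proj₁ (proj₂ (proj₂ (proj₂ ends)))
      z₂∈ : Z z₂ ≡ true
      z₂∈ = proj₁ (proj₂ (proj₂ (proj₂ (proj₂ ends))))
      ∂Z : ∀ v → ∂ Z v ≡ pair z₁ z₂ v
      ∂Z = proj₂ (proj₂ (proj₂ (proj₂ (proj₂ ends))))
      state : (λ v → pair z₁ z₂ v + pair p q v) ≋ D
      state = ≋-trans {λ v → pair z₁ z₂ v + pair p q v} {λ v → ∂ Z v + ∂ Y v} {D}
        (≋-+ {pair z₁ z₂} {∂ Z} {pair p q} {∂ Y} (≋-cong (λ v → sym (∂Z v))) pq≋) (meet bZ bY disjoint)
      away : pair p q w ≡ 0ℤ
      away = pair-avoids p≢w q≢w
      off : ∀ v → Z v ≡ true → pair p q v ≡ 0ℤ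
      off v v∈ = pair-avoids (λ p≡v → true≢false v∈ (subst (λ u → Z u ≡ false) p≡v p∉))
                             (λ q≡v → true≢false v∈ (subst (λ u → Z u ≡ false) q≡v q∉))
      L₁ : Legal (λ v → pt z₂ v + pair p q v) w
      L₁ = reach z₁ (λ v → pt z₂ v + pair p q v) w
        (≋-congˡ (λ v → ℤ.+-assoc (pt z₁ v) (pt z₂ v) (pair p q v)) state)
        (cong₂ _+_ (pt-other (separated {Z} z₂∈ w∉)) away)
      L₂ : Legal (λ v → pt z₁ v + pair p q v) w
      L₂ = reach z₂ (λ v → pt z₁ v + pair p q v) w
        (≋-congˡ (λ v → regroup (pt z₁ v) (pt z₂ v) (pair p q v)) state)
        (cong₂ _+_ (pt-other (separated {Z} z₁∈ w∉)) away)
        where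
        regroup : ∀ a b x → (a + b) + x ≡ b + (a + x)
        regroup = solve-∀
      without : ∀ {z} (L : Legal (λ v → pt z v + pair p q v) w) → Legal.set L z ≡ false → Legal (pair p q) w
      without {z} L z∉ = relax {λ v → pt z v + pair p q v} {pair p q} L λ v v∈ → ℤ.≤-reflexive
        (trans (cong (_+ pair p q v) (pt-other λ z≡v → true≢false v∈ (subst (λ u → Legal.set L u ≡ false) z≡v z∉))) (ℤ.+-identityˡ (pair p q v)))
      around : ∀ {X} (L : Legal X w) z → (∀ v → X v ≡ pt z v + pair p q v) →
               (∀ v → Z v ≡ true → Legal.set L v ≡ false) ⊎ (∀ v → Z v ≡ true → Legal.set L v ≡ true)
      around L z X≗ = Blob.unsplit bZ (Legal.set L) z λ v v∈ v∈L → ℤ.≤-trans (Legal.bound L v v∈L)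
        (ℤ.≤-reflexive (trans (X≗ v) (trans (cong (_+_ (pt z v)) (off v v∈)) (ℤ.+-identityʳ (pt z v)))))
      combine : (∀ v → Z v ≡ true → Legal.set L₁ v ≡ false) ⊎ (∀ v → Z v ≡ true → Legal.set L₁ v ≡ true) →
                (∀ v → Z v ≡ true → Legal.set L₂ v ≡ false) ⊎ (∀ v → Z v ≡ true → Legal.set L₂ v ≡ true) →
                Legal (pair p q) w
      combine (inj₁ none) _ = without L₁ (none z₂ z₂∈)
      combine (inj₂ _) (inj₁ none) = without L₂ (none z₁ z₁∈)
      combine (inj₂ all₁) (inj₂ all₂) = legal (A₁ ∪ A₂) (∪-avoid A₁ A₂ w (Legal.avoids L₁) (Legal.avoids L₂))
          (∪-left A₁ A₂ z₁ (all₁ z₁ z₁∈)) λ v v∈ → bound v (z₁ Fin.≟ v) (z₂ Fin.≟ v) (∪-cases A₁ A₂ v v∈)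
        where
        A₁ A₂ : VSet
        A₁ = Legal.set L₁
        A₂ = Legal.set L₂
        drop : ∀ {z} v → z ≢ v → pt z v + pair p q v ≡ pair p q v
        drop v z≢v = trans (cong (_+ pair p q v) (pt-other z≢v)) (ℤ.+-identityˡ (pair p q v))
        left : ∀ v → A₁ v ≡ true → z₂ ≢ v → out (A₁ ∪ A₂) v ≤ pair p q v
        left v v∈ z₂≢v = ℤ.≤-trans (out-∪ˡ A₁ A₂ v) (ℤ.≤-trans (Legal.bound L₁ v v∈) (ℤ.≤-reflexive (drop v z₂≢v)))
        right : ∀ v → A₂ v ≡ true → z₁ ≢ v → out (A₁ ∪ A₂) v ≤ pair p q v
        right v v∈ z₁≢v = ℤ.≤-trans (out-∪ʳ A₁ A₂ v) (ℤ.≤-trans (Legal.bound L₂ v v∈) (ℤ.≤-reflexive (drop v z₁≢v)))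
        bound : ∀ v → Dec (z₁ ≡ v) → Dec (z₂ ≡ v) → (A₁ v ≡ true) ⊎ (A₂ v ≡ true) → out (A₁ ∪ A₂) v ≤ pair p q v
        bound v _ (yes refl) _ = right v (all₂ v z₂∈) z₁≢z₂
        bound v (yes refl) (no z₂≢v) _ = left v (all₁ v z₁∈) z₂≢v
        bound v (no z₁≢v) (no z₂≢v) (inj₁ v∈) = left v v∈ z₂≢v
        bound v (no z₁≢v) (no z₂≢v) (inj₂ v∈) = right v v∈ z₁≢v

    -- As long as `w` is empty, `free-pair` gives a set avoiding it. This set splits `Y`, so the two
    -- chips remain in `Y` on their way to `w`.
    reach-inside : ∀ {w} → Y w ≡ true → ∃[ p ] Y p ≡ true × ∂ Y ≋ pair w p
    reach-inside {w} w∈ = pair-drive w (λ p q → Y p ≡ true × Y q ≡ true) step (y₁∈ , y₂∈)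
      where
      disjoint′ : ∀ v → Y v ≡ true → Z v ≡ false
      disjoint′ v v∈Y = Bool.¬-not λ v∈Z → true≢false v∈Y (disjoint v v∈Z)
      ends : ∃[ z₁ ] ∃[ z₂ ] z₁ ≢ z₂ × Y z₁ ≡ true × Y z₂ ≡ true × (∀ v → ∂ Y v ≡ pair z₁ z₂ v)
      ends = terminals bY
      y₁ y₂ : Vertex
      y₁ = proj₁ ends
      y₂ = proj₁ (proj₂ ends)
      y₁∈ : Y y₁ ≡ true
      y₁∈ = proj₁ (proj₂ (proj₂ (proj₂ ends)))
      y₂∈ : Y y₂ ≡ true
      y₂∈ = proj₁ (proj₂ (proj₂ (proj₂ (proj₂ ends))))
      ∂Y≋ : ∂ Y ≋ pair y₁ y₂
      ∂Y≋ = ≋-cong (proj₂ (proj₂ (proj₂ (proj₂ (proj₂ ends)))))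
      Found : Set
      Found = ∃[ p ] Y p ≡ true × ∂ Y ≋ pair w p
      step : ∀ p q → pair p q ≋ pair y₁ y₂ → Y p ≡ true × Y q ≡ true →
             Found ⊎ (Σ[ M ∈ Move p q w ] Y (Move.p′ M) ≡ true × Y (Move.q′ M) ≡ true)
      step p q pq≋ (p∈ , q∈) = found (p Fin.≟ w) (q Fin.≟ w)
        where
        ∂Y≋pq : ∂ Y ≋ pair p q
        ∂Y≋pq = ≋-trans {∂ Y} {pair y₁ y₂} {pair p q} ∂Y≋ (≋-sym {pair p q} {pair y₁ y₂} pq≋)
        found : Dec (p ≡ w) → Dec (q ≡ w) → Found ⊎ (Σ[ M ∈ Move p q w ] Y (Move.p′ M) ≡ true × Y (Move.q′ M) ≡ true)
        found (yes refl) _ = inj₁ (q , q∈ , ∂Y≋pq)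
        found (no _) (yes refl) = inj₁ (p , p∈ , ≋-trans {∂ Y} {pair p q} {pair q p} ∂Y≋pq (≋-cong (pair-comm p q)))
        found (no p≢w) (no q≢w) = inj₂ (M , heads-inside bY M p∈ (Move.p∈ M) w∈ (Move.avoids M))
          where
          M : Move p q w
          M = move (free-pair (disjoint′ p p∈) (disjoint′ q q∈) (disjoint′ w w∈) p≢w q≢w (≋-sym {∂ Y} {pair p q} ∂Y≋pq))

  module _ {Z Y : VSet} (bZ : Blob Z) (bY : Blob Y) (disjoint : ∀ v → Z v ≡ true → Y v ≡ false) where

    private
      disjoint′ : ∀ v → Y v ≡ true → Z v ≡ false
      disjoint′ v v∈Y = Bool.¬-not λ v∈Z → true≢false v∈Y (disjoint v v∈Z)

    -- While `∂ Y` stays in place, the chips of `∂ Z` are driven towards an end of `Y`. They enter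
    -- `Y` only through its two edges: both at once, which gives the equivalence, or just one.
    connect : (∂ Z ≋ ∂ Y) ⊎ (∃[ y ] ∃[ q ] 1ℤ ≤ ∂ Y y × Y q ≡ false × (λ v → pt y v + (∂ Y v + pt q v)) ≋ D)
    connect = pair-drive y₁ (λ p q → Y p ≡ false × Y q ≡ false) step (disjoint z₁ z₁∈ , disjoint z₂ z₂∈)
      where
      ends : ∃[ z₁ ] ∃[ z₂ ] z₁ ≢ z₂ × Z z₁ ≡ true × Z z₂ ≡ true × (∀ v → ∂ Z v ≡ pair z₁ z₂ v)
      ends = terminals bZ
      z₁ z₂ : Vertex
      z₁ = proj₁ ends
      z₂ = proj₁ (proj₂ ends)
      z₁∈ : Z z₁ ≡ true
      z₁∈ = proj₁ (proj₂ (proj₂ (proj₂ ends)))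
      z₂∈ : Z z₂ ≡ true
      z₂∈ = proj₁ (proj₂ (proj₂ (proj₂ (proj₂ ends))))
      ∂Z≋ : pair z₁ z₂ ≋ ∂ Z
      ∂Z≋ = ≋-cong λ v → sym (proj₂ (proj₂ (proj₂ (proj₂ (proj₂ ends)))) v)
      ends′ : ∃[ z₁ ] ∃[ z₂ ] z₁ ≢ z₂ × Y z₁ ≡ true × Y z₂ ≡ true × (∀ v → ∂ Y v ≡ pair z₁ z₂ v)
      ends′ = terminals bY
      y₁ y₂ : Vertex
      y₁ = proj₁ ends′
      y₂ = proj₁ (proj₂ ends′)
      y₁≢y₂ : y₁ ≢ y₂
      y₁≢y₂ = proj₁ (proj₂ (proj₂ ends′))
      y₁∈ : Y y₁ ≡ true
      y₁∈ = proj₁ (proj₂ (proj₂ (proj₂ ends′)))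
      y₂∈ : Y y₂ ≡ true
      y₂∈ = proj₁ (proj₂ (proj₂ (proj₂ (proj₂ ends′))))
      ∂Y : ∀ v → ∂ Y v ≡ pair y₁ y₂ v
      ∂Y = proj₂ (proj₂ (proj₂ (proj₂ (proj₂ ends′))))
      Result : Set
      Result = (∂ Z ≋ ∂ Y) ⊎ (∃[ y ] ∃[ q ] 1ℤ ≤ ∂ Y y × Y q ≡ false × (λ v → pt y v + (∂ Y v + pt q v)) ≋ D)
      step : ∀ p q → pair p q ≋ pair z₁ z₂ → Y p ≡ false × Y q ≡ false →
             Result ⊎ (Σ[ M ∈ Move p q y₁ ] Y (Move.p′ M) ≡ false × Y (Move.q′ M) ≡ false)
      step p q pq≋ (p∉ , q∉) = arrive (status (Y p′)) (status (Y q′))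
        where
        state : ∀ {A} → A ≋ ∂ Z → (λ v → ∂ Y v + A v) ≋ D
        state {A} A≋ = replace {∂ Y} {∂ Z} {A} (≋-congˡ (λ v → ℤ.+-comm (∂ Z v) (∂ Y v)) (meet bZ bY disjoint)) A≋
        pq≋∂Z : pair p q ≋ ∂ Z
        pq≋∂Z = ≋-trans {pair p q} {pair z₁ z₂} {∂ Z} pq≋ ∂Z≋
        pushed : Σ[ M ∈ Move p q y₁ ] (∀ v → Y v ≡ true → Move.set M v ≡ false)
        pushed = push bY y₂∈ y₁∈ (λ eq → y₁≢y₂ (sym eq)) p∉ q∉
          (≋-congˡ (λ v → trans (cong (_+ pair p q v) (∂Y v)) (ℤ.+-assoc (pt y₁ v) (pt y₂ v) (pair p q v))) (state {pair p q} pq≋∂Z))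
        M : Move p q y₁
        M = proj₁ pushed
        p′ q′ : Vertex
        p′ = Move.p′ M
        q′ = Move.q′ M
        pq′≋ : pair p′ q′ ≋ ∂ Z
        pq′≋ = ≋-trans {pair p′ q′} {pair p q} {∂ Z} (≋-sym {pair p q} {pair p′ q′} (Move.equivalent M)) pq≋∂Z
        end : ∀ {v} → Y v ≡ true → 1ℤ ≤ pair p′ q′ v → 1ℤ ≤ ∂ Y v
        end {v} v∈ 1≤ = subst (1ℤ ≤_) (sym (∂-in Y v∈)) (ℤ.≤-trans 1≤ (subst (_≤ out Y v)
          (trans (sym (∂-in (∁ (Move.set M)) (cong not (proj₂ pushed v v∈)))) (Move.heads M v))
          (out-anti {Y} {∁ (Move.set M)} (λ w w∈ → cong not (proj₂ pushed w w∈)) v)))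
        arrive : (Y p′ ≡ true) ⊎ (Y p′ ≡ false) → (Y q′ ≡ true) ⊎ (Y q′ ≡ false) →
                 Result ⊎ (Σ[ M ∈ Move p q y₁ ] Y (Move.p′ M) ≡ false × Y (Move.q′ M) ≡ false)
        arrive (inj₂ p′∉) (inj₂ q′∉) = inj₂ (M , p′∉ , q′∉)
        arrive (inj₁ p′∈) (inj₁ q′∈) = inj₁ (inj₁ (≋-trans {∂ Z} {pair p′ q′} {∂ Y} (≋-sym {pair p′ q′} {∂ Z} pq′≋)
          (≋-cong (heads-∂ bY M (proj₂ pushed) p′∈ q′∈))))
        arrive (inj₁ p′∈) (inj₂ q′∉) = inj₁ (inj₂ (p′ , q′ , end p′∈ (1≤pairˡ p′ q′) , q′∉ ,
          ≋-congˡ (λ v → regroup (∂ Y v) (pt p′ v) (pt q′ v)) (state {pair p′ q′} pq′≋)))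
          where
          regroup : ∀ x p q → x + (p + q) ≡ p + (x + q)
          regroup = solve-∀
        arrive (inj₂ p′∉) (inj₁ q′∈) = inj₁ (inj₂ (q′ , p′ , end q′∈ (1≤pairʳ p′ q′) , p′∉ ,
          ≋-congˡ (λ v → regroup (∂ Y v) (pt p′ v) (pt q′ v)) (state {pair p′ q′} pq′≋)))
          where
          regroup : ∀ x p q → x + (p + q) ≡ q + (x + p)
          regroup = solve-∀

    -- For `w` outside both blobs, the chips `p + q` are equivalent to both boundaries, so
    -- `free-pair` may use whichever blob contains neither of them. `no-triple` excludes one chip in
    -- each blob.
    gonal : ∂ Z ≋ ∂ Y → ∀ w → EffClass (λ v → ∂ Z v - pt w v)
    gonal ∂Z≋∂Y w = search (status (Z w)) (status (Y w))
      where
      ends : ∃[ z₁ ] ∃[ z₂ ] z₁ ≢ z₂ × Z z₁ ≡ true × Z z₂ ≡ true × (∀ v → ∂ Z v ≡ pair z₁ z₂ v)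
      ends = terminals bZ
      z₁ z₂ : Vertex
      z₁ = proj₁ ends
      z₂ = proj₁ (proj₂ ends)
      ∂Z≋ : pair z₁ z₂ ≋ ∂ Z
      ∂Z≋ = ≋-cong λ v → sym (proj₂ (proj₂ (proj₂ (proj₂ (proj₂ ends)))) v)
      reached : ∀ p → ∂ Z ≋ pair w p → EffClass (λ v → ∂ Z v - pt w v)
      reached p (f , eq) = pt p , pt≥0 p , f , λ v → trans (cong (_- pt w v) (eq v)) (cancel (pt w v) (pt p v) (lap f v))
        where
        cancel : ∀ a b c → a + b + c - a ≡ b + c
        cancel = solve-∀
      step : Z w ≡ false → Y w ≡ false → ∀ p q → pair p q ≋ pair z₁ z₂ → ⊤ →
             EffClass (λ v → ∂ Z v - pt w v) ⊎ (Σ[ M ∈ Move p q w ] ⊤)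
      step w∉Z w∉Y p q pq≋ _ = found (p Fin.≟ w) (q Fin.≟ w)
        where
        pq≋∂Z : pair p q ≋ ∂ Z
        pq≋∂Z = ≋-trans {pair p q} {pair z₁ z₂} {∂ Z} pq≋ ∂Z≋
        pq≋∂Y : pair p q ≋ ∂ Y
        pq≋∂Y = ≋-trans {pair p q} {∂ Z} {∂ Y} pq≋∂Z ∂Z≋∂Y
        state : (λ v → ∂ Y v + pair p q v) ≋ D
        state = replace {∂ Y} {∂ Z} {pair p q} (≋-congˡ (λ v → ℤ.+-comm (∂ Z v) (∂ Y v)) (meet bZ bY disjoint)) pq≋∂Z
        split : ∀ {p q} → Z p ≡ true → Y q ≡ true → (λ v → ∂ Y v + pair p q v) ≋ D → ⊥
        split {p} {q} p∈ q∈ st = Ordered.no-triple bZ bY disjoint p∈ q∈ (≋-congˡ (λ v → regroup (∂ Y v) (pt p v) (pt q v)) st)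
          where
          regroup : ∀ x p q → x + (p + q) ≡ p + (q + x)
          regroup = solve-∀
        legal-move : p ≢ w → q ≢ w → (Z p ≡ true) ⊎ (Z p ≡ false) → (Z q ≡ true) ⊎ (Z q ≡ false) →
                     (Y p ≡ true) ⊎ (Y p ≡ false) → (Y q ≡ true) ⊎ (Y q ≡ false) → Legal (pair p q) w
        legal-move p≢w q≢w (inj₂ p∉) (inj₂ q∉) _ _ = free-pair bZ bY disjoint p∉ q∉ w∉Z p≢w q≢w pq≋∂Y
        legal-move p≢w q≢w (inj₁ p∈) _ _ (inj₁ q∈) = ⊥-elim (split p∈ q∈ state)
        legal-move p≢w q≢w (inj₁ p∈) _ _ (inj₂ q∉) = free-pair bY bZ disjoint′ (disjoint p p∈) q∉ w∉Y p≢w q≢w pq≋∂Z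
        legal-move p≢w q≢w (inj₂ _) (inj₁ q∈) (inj₁ p∈) _ = ⊥-elim (split q∈ p∈ (≋-congˡ (λ v → cong (_+_ (∂ Y v)) (pair-comm p q v)) state))
        legal-move p≢w q≢w (inj₂ _) (inj₁ q∈) (inj₂ p∉) _ = free-pair bY bZ disjoint′ p∉ (disjoint q q∈) w∉Y p≢w q≢w pq≋∂Z
        found : Dec (p ≡ w) → Dec (q ≡ w) → EffClass (λ v → ∂ Z v - pt w v) ⊎ (Σ[ M ∈ Move p q w ] ⊤)
        found (yes refl) _ = inj₁ (reached q (≋-sym {pair p q} {∂ Z} pq≋∂Z))
        found (no _) (yes refl) = inj₁ (reached p (≋-trans {∂ Z} {pair p q} {pair q p} (≋-sym {pair p q} {∂ Z} pq≋∂Z) (≋-cong (pair-comm p q))))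
        found (no p≢w) (no q≢w) = inj₂ (move (legal-move p≢w q≢w (status (Z p)) (status (Z q)) (status (Y p)) (status (Y q))) , tt)
      search : (Z w ≡ true) ⊎ (Z w ≡ false) → (Y w ≡ true) ⊎ (Y w ≡ false) → EffClass (λ v → ∂ Z v - pt w v)
      search (inj₁ w∈) _ = in-Z (reach-inside bY bZ disjoint′ w∈)
        where
        in-Z : (∃[ p ] Z p ≡ true × ∂ Z ≋ pair w p) → EffClass (λ v → ∂ Z v - pt w v)
        in-Z (p , _ , eqv) = reached p eqv
      search (inj₂ _) (inj₁ w∈) = in-Y (reach-inside bZ bY disjoint w∈)
        where
        in-Y : (∃[ p ] Y p ≡ true × ∂ Y ≋ pair w p) → EffClass (λ v → ∂ Z v - pt w v)
        in-Y (p , _ , eqv) = reached p (≋-trans {∂ Z} {∂ Y} {pair w p} ∂Z≋∂Y eqv)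
      search (inj₂ w∉Z) (inj₂ w∉Y) = pair-drive w (λ _ _ → ⊤) (step w∉Z w∉Y) tt

  private
    nonneg : ∀ b {x : ℤ} → 0ℤ ≤ x → 0ℤ ≤ (if b then x else 0ℤ)
    nonneg true  p = p
    nonneg false p = ℤ.≤-refl

    sum-unique : ∀ {n} {f : Fin n → ℤ} {c} → 0ℤ ≤ c → (∀ i → f i ≤ c) → (∀ i j → 1ℤ ≤ f i → 1ℤ ≤ f j → i ≡ j) → sum f ≤ c
    sum-unique {n} {f} {c} c≥0 f≤c unique = cases (Fin.any? λ i → 1ℤ ℤ.≤? f i)
      where
      ≤0 : ∀ {x} → ¬ (1ℤ ≤ x) → x ≤ 0ℤ
      ≤0 p = ℤ.≮⇒≥ λ q → p (ℤ.i<j⇒suc[i]≤j q)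
      cases : Dec (∃[ i ] 1ℤ ≤ f i) → sum f ≤ c
      cases (no none) = ℤ.≤-trans (subst (sum f ≤_) (sum-replicate-zero n) (sum-mono {g = λ _ → 0ℤ} λ i → ≤0 λ p → none (i , p))) c≥0
      cases (yes (i , fi)) = subst (sum f ≤_) (sum-single i c) (sum-mono at)
        where
        at : ∀ j → f j ≤ single i c j
        at j = here (i Fin.≟ j)
          where
          here : Dec (i ≡ j) → f j ≤ single i c j
          here (yes refl) = subst (f i ≤_) (sym (single-eq i c)) (f≤c i)
          here (no i≢j) = subst (f j ≤_) (sym (single-neq i c i≢j)) (≤0 λ p → i≢j (unique i j fi p))

  degree-in : VSet → Vertex → ℤ
  degree-in Y v = sum λ w → if Y w then m v w else 0ℤ

  -- A blob with an extra chip at one of its ends is a cycle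

  module _ {Z Y : VSet} (bZ : Blob Z) (bY : Blob Y) (disjoint : ∀ v → Z v ≡ true → Y v ≡ false)
           {y q : Vertex} (y-end : 1ℤ ≤ ∂ Y y) (q∉ : Y q ≡ false) (state : (λ v → pt y v + (∂ Y v + pt q v)) ≋ D) where

    private
      y∈ : Y y ≡ true
      y∈ = ∂-support Y y-end

      -- Inside `Y` the set is left by exactly one edge at `y` and one at `z`, or by two edges at
      -- `y` if the two coincide.
      record Separator (z w : Vertex) : Set where
        field
          set    : VSet
          w∉     : set w ≡ false
          edges  : ∀ v → inner Y set v ≡ pair y z v

        y∈set : set y ≡ true
        y∈set = ∩-right Y set y (supported (subst (1ℤ ≤_) (sym (edges y)) (1≤pairˡ y z)))
          where
          supported : ∀ {v} → 1ℤ ≤ inner Y set v → (Y ∩ set) v ≡ true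
          supported {v} p with (Y ∩ set) v
          ... | true  = refl
          ... | false = ⊥-elim (1≰0 p)
        z∈set : set z ≡ true
        z∈set = ∩-right Y set z (supported (subst (1ℤ ≤_) (sym (edges z)) (1≤pairʳ y z)))
          where
          supported : ∀ {v} → 1ℤ ≤ inner Y set v → (Y ∩ set) v ≡ true
          supported {v} p with (Y ∩ set) v
          ... | true  = refl
          ... | false = ⊥-elim (1≰0 p)
        leaving : ∀ v → Y v ≡ true → set v ≡ true → iout Y set v ≡ pair y z v
        leaving v v∈Y v∈ = trans (sym (cong (λ b → if b then iout Y set v else 0ℤ) (∩-intro Y set v v∈Y v∈))) (edges v)

      -- `∂ Y` is replaced by `z + p`. Holding back `p` and asking for `w` leaves `y`, `z` and `q`;
      -- inside `Y` only `y` and `z` can pay, and separating `w` costs two edges.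
      separate : ∀ {z w} → Y z ≡ true → Y w ≡ true → y ≢ w → z ≢ w → Separator z w
      separate {z} {w} z∈ w∈ y≢w z≢w = record { set = set ; w∉ = avoids ; edges = edges }
        where
        inside : ∃[ p ] Y p ≡ true × ∂ Y ≋ pair z p
        inside = reach-inside bZ bY disjoint z∈
        p : Vertex
        p = proj₁ inside
        with-p : (λ v → pt p v + (pt y v + pair z q v)) ≋ D
        with-p = ≋-congˡ (λ v → regroup (pt y v) (pt q v) (pt z v) (pt p v))
          (replace {λ v → pt y v + pt q v} {∂ Y} {pair z p} (≋-congˡ (λ v → regroup′ (pt y v) (∂ Y v) (pt q v)) state)
            (≋-sym {∂ Y} {pair z p} (proj₂ (proj₂ inside))))
          where
          regroup : ∀ y q z p → (y + q) + (z + p) ≡ p + (y + (z + q))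
          regroup = solve-∀
          regroup′ : ∀ y x q → y + (x + q) ≡ (y + q) + x
          regroup′ = solve-∀
        q-off : ∀ v → Y v ≡ true → pt q v ≡ 0ℤ
        q-off v v∈ = pt-other λ q≡v → true≢false v∈ (subst (λ u → Y u ≡ false) q≡v q∉)
        L : Legal (λ v → pt y v + pair z q v) w
        L = reach p (λ v → pt y v + pair z q v) w with-p (cong₂ _+_ (pt-other y≢w) (cong₂ _+_ (pt-other z≢w) (q-off w w∈)))
        open Legal L
        bound′ : ∀ v → Y v ≡ true → set v ≡ true → out set v ≤ pair y z v
        bound′ v v∈Y v∈ = ℤ.≤-trans (bound v v∈) (ℤ.≤-reflexive (cong (_+_ (pt y v))
          (trans (cong (_+_ (pt z v)) (q-off v v∈Y)) (ℤ.+-identityʳ (pt z v)))))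
        inner≤ : ∀ v → inner Y set v ≤ pair y z v
        inner≤ v = here (status (Y v)) (status (set v))
          where
          here : (Y v ≡ true) ⊎ (Y v ≡ false) → (set v ≡ true) ⊎ (set v ≡ false) → inner Y set v ≤ pair y z v
          here (inj₁ v∈Y) (inj₁ v∈) = ℤ.≤-trans (inner≤∂ Y set v) (subst (_≤ pair y z v) (sym (∂-in set v∈)) (bound′ v v∈Y v∈))
          here (inj₁ v∈Y) (inj₂ v∉) = ℤ.≤-trans (inner≤∂ Y set v) (subst (_≤ pair y z v) (sym (∂-out set v∉)) (pair≥0 y z v))
          here (inj₂ v∉Y) _ = subst (_≤ pair y z v) (sym (cong (λ b → if b then iout Y set v else 0ℤ) (∩-avoidˡ Y set v v∉Y))) (pair≥0 y z v)
        -- A set that missed `Y` would be left by a single edge, at `q`.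
        meets : ∃[ v ] Y v ≡ true × set v ≡ true
        meets = decide (Fin.any? λ v → (Y v Bool.≟ true) ×-dec (set v Bool.≟ true))
          where
          decide : Dec (∃[ v ] Y v ≡ true × set v ≡ true) → ∃[ v ] Y v ≡ true × set v ≡ true
          decide (yes found) = found
          decide (no none) = ⊥-elim (2≰1 (ℤ.≤-trans (cut≥2 set nonempty avoids) (subst (cut set ≤_) (sum-pt q) (sum-mono only-q))))
            where
            only-q : ∀ v → ∂ set v ≤ pt q v
            only-q v = here (status (set v))
              where
              here : (set v ≡ true) ⊎ (set v ≡ false) → ∂ set v ≤ pt q v
              here (inj₂ v∉) = subst (_≤ pt q v) (sym (∂-out set v∉)) (pt≥0 q v)
              here (inj₁ v∈) = subst (_≤ pt q v) (sym (∂-in set v∈)) (ℤ.≤-trans (bound v v∈) (ℤ.≤-reflexive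
                (trans (cong₂ (λ a b → a + (b + pt q v)) (pt-other λ y≡v → none (v , subst (λ u → Y u ≡ true) y≡v y∈ , v∈))
                                                         (pt-other λ z≡v → none (v , subst (λ u → Y u ≡ true) z≡v z∈ , v∈)))
                  (trans (ℤ.+-identityˡ (0ℤ + pt q v)) (ℤ.+-identityˡ (pt q v))))))
        edges : ∀ v → inner Y set v ≡ pair y z v
        edges = squeeze inner≤ (subst (_≤ sum (inner Y set)) (sym (deg-pair y z))
          (Blob.split bY set (proj₁ (proj₂ meets)) (proj₂ (proj₂ meets)) w∈ avoids))

      private
        enter : ∀ yw sw {x : ℤ} → 0ℤ ≤ x → (yw ≡ true → sw ≡ true → x ≡ 0ℤ) → (if yw then x else 0ℤ) ≤ (if yw ∧ not sw then x else 0ℤ)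
        enter true  true  x≥0 z = ℤ.≤-reflexive (z refl refl)
        enter true  false x≥0 z = ℤ.≤-refl
        enter false _     x≥0 z = ℤ.≤-refl

      -- `y` is separated from the other end of `Y`, with both edges at `y`. The separated part of
      -- `Y` is left only at `y`, so it is `y` alone, and these two edges are all its edges in `Y`.
      degree-end : degree-in Y y ≤ + 2
      degree-end = ℤ.≤-trans (sum-mono pointwise) (ℤ.≤-reflexive (trans (leaving y y∈ y∈set) (cong₂ _+_ (pt-self y) (pt-self y))))
        where
        ends : ∃[ z₁ ] ∃[ z₂ ] z₁ ≢ z₂ × Y z₁ ≡ true × Y z₂ ≡ true × (∀ v → ∂ Y v ≡ pair z₁ z₂ v)
        ends = terminals bY
        opposite : ∃[ w ] Y w ≡ true × y ≢ w × (∀ v → ∂ Y v ≡ pair y w v)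
        opposite = choose (proj₁ ends Fin.≟ y) (proj₁ (proj₂ ends) Fin.≟ y)
          where
          choose : Dec (proj₁ ends ≡ y) → Dec (proj₁ (proj₂ ends) ≡ y) → ∃[ w ] Y w ≡ true × y ≢ w × (∀ v → ∂ Y v ≡ pair y w v)
          choose (yes e) _ = proj₁ (proj₂ ends) , proj₁ (proj₂ (proj₂ (proj₂ (proj₂ ends)))) ,
            (λ y≡ → proj₁ (proj₂ (proj₂ ends)) (trans e y≡)) ,
            subst (λ u → ∀ v → ∂ Y v ≡ pair u (proj₁ (proj₂ ends)) v) e (proj₂ (proj₂ (proj₂ (proj₂ (proj₂ ends)))))
          choose (no _) (yes e) = proj₁ ends , proj₁ (proj₂ (proj₂ (proj₂ ends))) ,
            (λ y≡ → proj₁ (proj₂ (proj₂ ends)) (trans (sym y≡) (sym e))) ,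
            λ v → trans (subst (λ u → ∀ v → ∂ Y v ≡ pair (proj₁ ends) u v) e (proj₂ (proj₂ (proj₂ (proj₂ (proj₂ ends))))) v) (pair-comm (proj₁ ends) y v)
          choose (no ¬e₁) (no ¬e₂) = ⊥-elim (1≰0 (subst (1ℤ ≤_) (trans (proj₂ (proj₂ (proj₂ (proj₂ (proj₂ ends)))) y) (pair-avoids ¬e₁ ¬e₂)) y-end))
        w : Vertex
        w = proj₁ opposite
        w∈ : Y w ≡ true
        w∈ = proj₁ (proj₂ opposite)
        y≢w : y ≢ w
        y≢w = proj₁ (proj₂ (proj₂ opposite))
        S : Separator y w
        S = separate y∈ w∈ y≢w y≢w
        open Separator S
        only : ∀ {v} → (Y ∩ set) v ≡ true → y ≡ v
        only = no-cut-vertex (Y ∩ set) y (∩-intro Y set y y∈ y∈set) closed {w} (trans (cong (Y w ∧_) w∉) (Bool.∧-zeroʳ (Y w)))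
          where
          or-leaves : ∀ a b {x : ℤ} → 0ℤ ≤ x → (if a ∧ b then 0ℤ else x) ≤ (if a ∧ not b then x else 0ℤ) + (if a then 0ℤ else x)
          or-leaves true  true  p = ℤ.≤-refl
          or-leaves true  false p = ℤ.≤-reflexive (sym (ℤ.+-identityʳ _))
          or-leaves false _     p = ℤ.≤-reflexive (sym (ℤ.+-identityˡ _))
          closed : ∀ v → (Y ∩ set) v ≡ true → y ≢ v → out (Y ∩ set) v ≡ 0ℤ
          closed v v∈ y≢v = ℤ.≤-antisym (ℤ.≤-trans
            (subst (out (Y ∩ set) v ≤_) (∑-distrib-+ (λ u → if Y u ∧ not (set u) then m v u else 0ℤ) (λ u → if Y u then 0ℤ else m v u))
              (sum-mono λ u → or-leaves (Y u) (set u) (m≥0 v u)))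
            (ℤ.≤-reflexive (cong₂ _+_ (trans (leaving v v∈Y (∩-right Y set v v∈)) (pair-avoids y≢v y≢v))
              (trans (sym (∂-in Y v∈Y)) (trans (proj₂ (proj₂ (proj₂ opposite)) v) (pair-avoids y≢v (λ w≡v → true≢false (∩-right Y set v v∈) (subst (λ u → set u ≡ false) w≡v w∉))))))))
            (out≥0 (Y ∩ set) v)
            where
            v∈Y : Y v ≡ true
            v∈Y = ∩-left Y set v v∈
        pointwise : ∀ u → (if Y u then m y u else 0ℤ) ≤ (if Y u ∧ not (set u) then m y u else 0ℤ)
        pointwise u = enter (Y u) (set u) (m≥0 y u) λ u∈Y u∈ → trans (cong (m y) (sym (only (∩-intro Y set u u∈Y u∈)))) (m-loop y)

      -- The edges of `z` in `Y` are charged to edges of `y`. A neighbour `w` of `z` other than `y`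
      -- has a separator with the edge to `w` as its only exit at `z`; it also has one exit at `y`,
      -- and different neighbours have different exits.
      module Other {z : Vertex} (z∈ : Y z ≡ true) (y≢z : y ≢ z) where

        Active : Vertex → Set
        Active w = Y w ≡ true × y ≢ w × 1ℤ ≤ m z w

        active? : ∀ w → Dec (Active w)
        active? w = (Y w Bool.≟ true) ×-dec (¬? (y Fin.≟ w) ×-dec (1ℤ ℤ.≤? m z w))

        z≢ : ∀ {w} → Active w → z ≢ w
        z≢ (_ , _ , adj) refl = 1≰0 (subst (1ℤ ≤_) (m-loop z) adj)

        T : ∀ {w} → Active w → Separator z w
        T a@(w∈ , y≢w , _) = separate z∈ w∈ y≢w (z≢ a)

        -- A matrix for double counting: row `w` marks the exit at `y` of the separator of `w`. Row
        -- sums bound the degree of `z`, column sums that of `y`.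
        crossing : ∀ w → Dec (Active w) → Vertex → ℤ
        crossing w (yes a) u = if Y u ∧ not (Separator.set (T a) u) then m y u else 0ℤ
        crossing w (no _) u = 0ℤ

        leave-y : ∀ {w} (a : Active w) → iout Y (Separator.set (T a)) y ≡ 1ℤ
        leave-y a = trans (Separator.leaving (T a) y y∈ (Separator.y∈set (T a))) (cong₂ _+_ (pt-self y) (pt-other λ z≡y → y≢z (sym z≡y)))

        leave-z : ∀ {w} (a : Active w) → iout Y (Separator.set (T a)) z ≡ 1ℤ
        leave-z a = trans (Separator.leaving (T a) z z∈ (Separator.z∈set (T a))) (cong₂ _+_ (pt-other y≢z) (pt-self z))

        out-term : ∀ {A : VSet} {u} → Y u ≡ true → A u ≡ false → m z u ≤ iout Y A z
        out-term {A} {u} u∈ u∉ = subst (_≤ iout Y A z) (cong (λ b → if b then m z u else 0ℤ) (∩-intro Y (∁ A) u u∈ (cong not u∉)))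
          (term≤sum {f = λ w → if Y w ∧ not (A w) then m z w else 0ℤ} (λ w → nonneg (Y w ∧ not (A w)) (m≥0 z w)) u)

        -- The single exit at `z` of the separator for `w₂` is used up by the edge to `w₂`.
        others-in : ∀ {w w₂} (a : Active w) (a₂ : Active w₂) → w ≢ w₂ → Separator.set (T a₂) w ≡ true
        others-in {w} {w₂} a@(w∈ , _ , adj) a₂@(w₂∈ , _ , adj₂) w≢w₂ = Bool.¬-not λ w∉ → 2≰1 (ℤ.≤-trans (ℤ.+-mono-≤ adj adj₂)
          (ℤ.≤-trans (subst (_≤ iout Y A z) (trans (∑-distrib-+ (single w (m z w)) (single w₂ (m z w₂))) (cong₂ _+_ (sum-single w (m z w)) (sum-single w₂ (m z w₂))))
            (sum-mono (both w∉))) (ℤ.≤-reflexive (leave-z a₂))))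
          where
          A : VSet
          A = Separator.set (T a₂)
          both : A w ≡ false → ∀ u → single w (m z w) u + single w₂ (m z w₂) u ≤ (if Y u ∧ not (A u) then m z u else 0ℤ)
          both w∉ u = here (w Fin.≟ u) (w₂ Fin.≟ u)
            where
            at : ∀ {u} → Y u ≡ true → A u ≡ false → m z u ≡ (if Y u ∧ not (A u) then m z u else 0ℤ)
            at {u} u∈ u∉ = sym (cong (λ b → if b then m z u else 0ℤ) (∩-intro Y (∁ A) u u∈ (cong not u∉)))
            here : Dec (w ≡ u) → Dec (w₂ ≡ u) → single w (m z w) u + single w₂ (m z w₂) u ≤ (if Y u ∧ not (A u) then m z u else 0ℤ)
            here (yes refl) (yes e) = ⊥-elim (w≢w₂ (sym e))
            here (yes refl) (no n₂) = ℤ.≤-reflexive (trans (cong₂ _+_ (single-eq w (m z w)) (single-neq w₂ (m z w₂) n₂)) (trans (ℤ.+-identityʳ (m z w)) (at w∈ w∉)))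
            here (no n₁) (yes refl) = ℤ.≤-reflexive (trans (cong₂ _+_ (single-neq w (m z w) n₁) (single-eq w₂ (m z w₂))) (trans (ℤ.+-identityˡ (m z w₂)) (at w₂∈ (Separator.w∉ (T a₂)))))
            here (no n₁) (no n₂) = subst (_≤ (if Y u ∧ not (A u) then m z u else 0ℤ)) (sym (cong₂ _+_ (single-neq w (m z w) n₁) (single-neq w₂ (m z w₂) n₂)))
              (nonneg (Y u ∧ not (A u)) (m≥0 z u))

        -- Otherwise the union of the two sets would leave Y only through one edge at y.
        distinct-exits : ∀ {w w₂ u} (a : Active w) (a₂ : Active w₂) → Y u ≡ true →
          Separator.set (T a) u ≡ false → Separator.set (T a₂) u ≡ false → w ≡ w₂
        distinct-exits {w} {w₂} {u} a a₂ u∈ u∉ u∉₂ = decide (w Fin.≟ w₂)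
          where
          A A₂ U : VSet
          A = Separator.set (T a)
          A₂ = Separator.set (T a₂)
          U = A ∪ A₂
          iout-anti : ∀ {B C : VSet} → (∀ v → B v ≡ true → C v ≡ true) → ∀ v → iout Y C v ≤ iout Y B v
          iout-anti {B} {C} B⊆C v = sum-mono λ x → pointwise (Y x) (B x) (C x) (B⊆C x) (m≥0 v x)
            where
            pointwise : ∀ a b c {x : ℤ} → (b ≡ true → c ≡ true) → 0ℤ ≤ x → (if a ∧ not c then x else 0ℤ) ≤ (if a ∧ not b then x else 0ℤ)
            pointwise true  true  true  _ _ = ℤ.≤-refl
            pointwise true  true  false f _ = ⊥-elim (true≢false (f refl) refl)
            pointwise true  false true  _ p = p
            pointwise true  false false _ _ = ℤ.≤-refl
            pointwise false _     _     _ _ = ℤ.≤-refl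
          decide : Dec (w ≡ w₂) → w ≡ w₂
          decide (yes eq) = eq
          decide (no w≢w₂) = ⊥-elim (2≰1 (ℤ.≤-trans
              (Blob.split bY U y∈ (∪-left A A₂ y (Separator.y∈set (T a))) u∈ (∪-avoid A A₂ u u∉ u∉₂))
              (subst (sum (inner Y U) ≤_) (sum-pt y) (sum-mono few))))
            where
            w∈U : U w ≡ true
            w∈U = ∪-right A A₂ w (others-in a a₂ w≢w₂)
            none-at-z : iout Y U z ≤ 0ℤ
            none-at-z = ℤ.i-j≤0⇒i≤j {iout Y U z} {0ℤ} (subst (_≤ 0ℤ) (sym (ℤ.+-identityʳ (iout Y U z))) (ℤ.≤-trans (ℤ.≤-reflexive (cancel (iout Y U z)))
                (ℤ.i≤j⇒i-j≤0 (ℤ.≤-trans (ℤ.+-monoʳ-≤ (iout Y U z) (proj₂ (proj₂ a)))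
                  (ℤ.≤-trans (subst (_≤ iout Y A z) (trans (∑-distrib-+ (λ x → if Y x ∧ not (U x) then m z x else 0ℤ) (single w (m z w))) (cong (_+_ (iout Y U z)) (sum-single w (m z w))))
                    (sum-mono extra)) (ℤ.≤-reflexive (leave-z a)))))))
              where
              cancel : ∀ x → x ≡ (x + 1ℤ) - 1ℤ
              cancel = solve-∀
              extra : ∀ x → (if Y x ∧ not (U x) then m z x else 0ℤ) + single w (m z w) x ≤ (if Y x ∧ not (A x) then m z x else 0ℤ)
              extra x = here (w Fin.≟ x)
                where
                mono : ∀ a b c {t : ℤ} → 0ℤ ≤ t → (if a ∧ not (b ∨ c) then t else 0ℤ) ≤ (if a ∧ not b then t else 0ℤ)
                mono true  true  _     p = ℤ.≤-refl
                mono true  false true  p = p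
                mono true  false false p = ℤ.≤-refl
                mono false _     _     p = ℤ.≤-refl
                here : Dec (w ≡ x) → (if Y x ∧ not (U x) then m z x else 0ℤ) + single w (m z w) x ≤ (if Y x ∧ not (A x) then m z x else 0ℤ)
                here (yes refl) = ℤ.≤-reflexive (trans (cong₂ _+_
                    (cong (λ b → if b then m z w else 0ℤ) (trans (cong (λ b → Y w ∧ not b) w∈U) (Bool.∧-zeroʳ (Y w)))) (single-eq w (m z w)))
                  (trans (ℤ.+-identityˡ (m z w)) (sym (cong (λ b → if b then m z w else 0ℤ) (∩-intro Y (∁ A) w (proj₁ a) (cong not (Separator.w∉ (T a))))))))
                here (no w≢x) = subst (_≤ (if Y x ∧ not (A x) then m z x else 0ℤ)) (sym (trans (cong (_+_ (if Y x ∧ not (U x) then m z x else 0ℤ)) (single-neq w (m z w) w≢x)) (ℤ.+-identityʳ _)))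
                  (mono (Y x) (A x) (A₂ x) (m≥0 z x))
            few : ∀ v → inner Y U v ≤ pt y v
            few v = here (status (Y v)) (status (U v)) (z Fin.≟ v)
              where
              drop-z : z ≢ v → pair y z v ≡ pt y v
              drop-z z≢v = trans (cong (_+_ (pt y v)) (pt-other z≢v)) (ℤ.+-identityʳ (pt y v))
              here : (Y v ≡ true) ⊎ (Y v ≡ false) → (U v ≡ true) ⊎ (U v ≡ false) → Dec (z ≡ v) → inner Y U v ≤ pt y v
              here (inj₂ v∉) _ _ = subst (_≤ pt y v) (sym (cong (λ b → if b then iout Y U v else 0ℤ) (∩-avoidˡ Y U v v∉))) (pt≥0 y v)
              here (inj₁ _) (inj₂ v∉) _ = subst (_≤ pt y v) (sym (cong (λ b → if b then iout Y U v else 0ℤ) (trans (cong (Y v ∧_) v∉) (Bool.∧-zeroʳ (Y v))))) (pt≥0 y v)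
              here (inj₁ v∈Y) (inj₁ v∈) (yes refl) = subst (_≤ pt y v) (sym (cong (λ b → if b then iout Y U v else 0ℤ) (∩-intro Y U v v∈Y v∈))) (ℤ.≤-trans none-at-z (pt≥0 y v))
              here (inj₁ v∈Y) (inj₁ v∈) (no z≢v) = subst (_≤ pt y v) (sym (cong (λ b → if b then iout Y U v else 0ℤ) (∩-intro Y U v v∈Y v∈))) (either (∪-cases A A₂ v v∈))
                where
                either : (A v ≡ true) ⊎ (A₂ v ≡ true) → iout Y U v ≤ pt y v
                either (inj₁ p) = ℤ.≤-trans (iout-anti {A} {U} (∪-left A A₂) v) (ℤ.≤-reflexive (trans (Separator.leaving (T a) v v∈Y p) (drop-z z≢v)))
                either (inj₂ p) = ℤ.≤-trans (iout-anti {A₂} {U} (∪-right A A₂) v) (ℤ.≤-reflexive (trans (Separator.leaving (T a₂) v v∈Y p) (drop-z z≢v)))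

        row column-sum : Vertex → ℤ
        row w = sum (crossing w (active? w))
        column-sum u = sum λ w → crossing w (active? w) u

        cross≥0 : ∀ w d u → 0ℤ ≤ crossing w d u
        cross≥0 w (no _) u = ℤ.≤-refl
        cross≥0 w (yes a) u = nonneg (Y u ∧ not (Separator.set (T a) u)) (m≥0 y u)

        first : degree-in Y z ≤ sum row + m z y
        first = subst (degree-in Y z ≤_) (trans (∑-distrib-+ row (single y (m z y))) (cong (_+_ (sum row)) (sum-single y (m z y))))
          (sum-mono {f = λ w → if Y w then m z w else 0ℤ} {g = λ w → row w + single y (m z y) w} λ w → term w (status (Y w)) (y Fin.≟ w) (active? w))
          where
          term : ∀ w → (Y w ≡ true) ⊎ (Y w ≡ false) → Dec (y ≡ w) → (d : Dec (Active w)) → (if Y w then m z w else 0ℤ) ≤ sum (crossing w d) + single y (m z y) w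
          term w (inj₂ w∉) _ d = subst (λ b → (if b then m z w else 0ℤ) ≤ sum (crossing w d) + single y (m z y) w) (sym w∉)
            (ℤ.+-mono-≤ {0ℤ} {sum (crossing w d)} {0ℤ} (sum-nonneg (cross≥0 w d)) (nn (y Fin.≟ w)))
            where
            nn : Dec (y ≡ w) → 0ℤ ≤ single y (m z y) w
            nn (yes refl) = subst (0ℤ ≤_) (sym (single-eq y (m z y))) (m≥0 z y)
            nn (no y≢w) = ℤ.≤-reflexive (sym (single-neq y (m z y) y≢w))
          term w (inj₁ w∈) (yes refl) d = subst (λ b → (if b then m z y else 0ℤ) ≤ sum (crossing w d) + single y (m z y) y) (sym w∈)
            (subst₂ _≤_ (ℤ.+-identityˡ (m z y)) (cong (_+_ (sum (crossing w d))) (sym (single-eq y (m z y))))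
              (ℤ.+-monoˡ-≤ (m z y) (sum-nonneg (cross≥0 w d))))
          term w (inj₁ w∈) (no y≢w) (yes a) = subst (λ b → (if b then m z w else 0ℤ) ≤ sum (crossing w (yes a)) + single y (m z y) w) (sym w∈)
            (ℤ.≤-trans (ℤ.≤-trans (out-term {Separator.set (T a)} w∈ (Separator.w∉ (T a))) (ℤ.≤-reflexive (trans (leave-z a) (sym (leave-y a)))))
              (ℤ.≤-reflexive (trans (sym (ℤ.+-identityʳ (sum (crossing w (yes a))))) (cong (_+_ (sum (crossing w (yes a)))) (sym (single-neq y (m z y) y≢w))))))
          term w (inj₁ w∈) (no y≢w) (no ¬a) = subst (λ b → (if b then m z w else 0ℤ) ≤ sum (crossing w (no ¬a)) + single y (m z y) w) (sym w∈)
            (ℤ.≤-trans (ℤ.≮⇒≥ {0ℤ} {m z w} λ p → ¬a (w∈ , y≢w , ℤ.i<j⇒suc[i]≤j p))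
              (ℤ.≤-reflexive (sym (cong₂ _+_ (sum-replicate-zero (suc n)) (single-neq y (m z y) y≢w)))))

        middle : sum row + m z y ≤ sum (λ u → column-sum u + single z (m z y) u)
        middle = ℤ.≤-reflexive (trans (cong₂ _+_ (∑-comm (λ w u → crossing w (active? w) u)) (sym (sum-single z (m z y))))
          (sym (∑-distrib-+ column-sum (single z (m z y)))))

        last : sum (λ u → column-sum u + single z (m z y) u) ≤ degree-in Y y
        last = sum-mono {f = λ u → column-sum u + single z (m z y) u} {g = λ u → if Y u then m y u else 0ℤ} λ u → column u (z Fin.≟ u)
          where
          zero-col : ∀ w d → crossing w d z ≡ 0ℤ
          zero-col w (no _) = refl
          zero-col w (yes a) = cong (λ b → if b then m y z else 0ℤ) (trans (cong (λ b → Y z ∧ not b) (Separator.z∈set (T a))) (Bool.∧-zeroʳ (Y z)))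
          cell≤ : ∀ u w d → crossing w d u ≤ (if Y u then m y u else 0ℤ)
          cell≤ u w (no _) = nonneg (Y u) (m≥0 y u)
          cell≤ u w (yes a) = smaller (Y u) (Separator.set (T a) u) (m≥0 y u)
            where
            smaller : ∀ b c {x : ℤ} → 0ℤ ≤ x → (if b ∧ not c then x else 0ℤ) ≤ (if b then x else 0ℤ)
            smaller true  true  p = p
            smaller true  false p = ℤ.≤-refl
            smaller false _     p = ℤ.≤-refl
          exits : ∀ u w d → 1ℤ ≤ crossing w d u → Σ[ a ∈ Active w ] Y u ≡ true × Separator.set (T a) u ≡ false
          exits u w (no _) p = ⊥-elim (1≰0 p)
          exits u w (yes a) p = a , positive (Y u) (Separator.set (T a) u) p
            where
            positive : ∀ b c → 1ℤ ≤ (if b ∧ not c then m y u else 0ℤ) → b ≡ true × c ≡ false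
            positive true  false _ = refl , refl
            positive true  true  q = ⊥-elim (1≰0 q)
            positive false _     q = ⊥-elim (1≰0 q)
          column : ∀ u → Dec (z ≡ u) → column-sum u + single z (m z y) u ≤ (if Y u then m y u else 0ℤ)
          column u (yes refl) = ℤ.≤-reflexive (trans (cong₂ _+_ (trans (sum-cong-≗ λ w → zero-col w (active? w)) (sum-replicate-zero (suc n))) (single-eq z (m z y)))
            (trans (ℤ.+-identityˡ (m z y)) (trans (m-sym z y) (sym (cong (λ b → if b then m y z else 0ℤ) z∈)))))
          column u (no z≢u) = subst (_≤ (if Y u then m y u else 0ℤ)) (sym (trans (cong (_+_ (column-sum u)) (single-neq z (m z y) z≢u)) (ℤ.+-identityʳ (column-sum u))))
            (sum-unique {f = λ w → crossing w (active? w) u} (nonneg (Y u) (m≥0 y u)) (λ w → cell≤ u w (active? w)) λ w w₂ p p₂ → same (exits u w (active? w) p) (exits u w₂ (active? w₂) p₂))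
            where
            same : ∀ {w w₂} → Σ[ a ∈ Active w ] Y u ≡ true × Separator.set (T a) u ≡ false →
                   Σ[ a ∈ Active w₂ ] Y u ≡ true × Separator.set (T a) u ≡ false → w ≡ w₂
            same (a , u∈ , u∉) (a₂ , _ , u∉₂) = distinct-exits a a₂ u∈ u∉ u∉₂

        degree-other : degree-in Y z ≤ + 2
        degree-other = ℤ.≤-trans (ℤ.≤-trans first (ℤ.≤-trans middle last)) degree-end

    cycle : ∀ {z} → Y z ≡ true → degree-in Y z ≤ + 2
    cycle {z} z∈ = decide (y Fin.≟ z)
      where
      decide : Dec (y ≡ z) → degree-in Y z ≤ + 2
      decide (yes refl) = degree-end
      decide (no y≢z) = Other.degree-other z∈ y≢z

  -- Branching vertices separated by two edges

  valency : Vertex → ℤ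
  valency v = sum (m v)

  Branching : Vertex → Set
  Branching v = + 3 ≤ valency v

  branching? : ∀ v → Dec (Branching v)
  branching? v = + 3 ℤ.≤? valency v

  3≰2 : ¬ (+ 3 ≤ + 2)
  3≰2 = ℤ.<⇒≱ (+<+ (s≤s (s≤s (s≤s z≤n))))

  size : VSet → ℤ
  size A = sum (𝟙 A)

  𝟙≥0 : ∀ A v → 0ℤ ≤ 𝟙 A v
  𝟙≥0 A v with A v
  ... | true  = +≤+ z≤n
  ... | false = ℤ.≤-refl

  size-strict : ∀ {A B w} → (∀ v → A v ≡ true → B v ≡ true) → A w ≡ false → B w ≡ true → size A + 1ℤ ≤ size B
  size-strict {A} {B} {w} A⊆B w∉ w∈ = subst (_≤ size B) (trans (∑-distrib-+ (𝟙 A) (pt w)) (cong (_+_ (size A)) (sum-pt w))) (sum-mono pointwise)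
    where
    pointwise : ∀ v → 𝟙 A v + pt w v ≤ 𝟙 B v
    pointwise v = here (w Fin.≟ v) (status (A v))
      where
      here : Dec (w ≡ v) → (A v ≡ true) ⊎ (A v ≡ false) → 𝟙 A v + pt w v ≤ 𝟙 B v
      here (yes refl) _ = ℤ.≤-reflexive (trans (cong₂ _+_ (cong indicator w∉) (pt-self w)) (sym (cong indicator w∈)))
      here (no w≢v) (inj₁ v∈) = ℤ.≤-reflexive (trans (cong₂ _+_ (cong indicator v∈) (pt-other w≢v)) (sym (cong indicator (A⊆B v v∈))))
      here (no w≢v) (inj₂ v∉) = subst (_≤ 𝟙 B v) (sym (cong₂ _+_ (cong indicator v∉) (pt-other w≢v))) (𝟙≥0 B v)

  size≥1 : ∀ {A v} → A v ≡ true → 1ℤ ≤ size A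
  size≥1 {A} {v} v∈ = subst (_≤ size A) (cong indicator v∈) (term≤sum (𝟙≥0 A) v)

  inner-cong : ∀ Z {A B} → (∀ v → A v ≡ B v) → ∀ v → inner Z A v ≡ inner Z B v
  inner-cong Z {A} {B} eq v = cong₂ (λ b x → if Z v ∧ b then x else 0ℤ) (eq v)
    (sum-cong-≗ λ w → cong (λ b → if Z w ∧ not b then m v w else 0ℤ) (eq w))

  Halves : VSet → Set
  Halves Z = ∃[ A ] ∃[ B ] ∃[ a ] ∃[ b ] A a ≡ true × B b ≡ true × cut A ≡ + 2 × cut B ≡ + 2 ×
             (∀ v → A v ≡ true → Z v ≡ true × B v ≡ false) × (∀ v → B v ≡ true → Z v ≡ true × A v ≡ false) ×
             (∀ v → Z v ≡ true → (A v ≡ true) ⊎ (B v ≡ true))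

  -- If `Z` splits along at most one inner edge, the parts together have at most `2 + 2` outgoing
  -- edges. Every cut has at least two, so each part has exactly two.
  blob-or-halves : ∀ {Z : VSet} {x y w} → cut Z ≡ + 2 → Z w ≡ false → Z x ≡ true → Z y ≡ true → x ≢ y → Blob Z ⊎ Halves Z
  blob-or-halves {Z} {x} {y} {w} cut2 w∉ x∈ y∈ x≢y = decide (any-subset? Weak (λ {A} {B} → weak-resp {A} {B}) weak?)
    where
    Weak : VSet → Set
    Weak B = sum (inner Z B) ≤ 1ℤ × (∃[ v ] Z v ≡ true × B v ≡ true) × (∃[ v ] Z v ≡ true × B v ≡ false)
    weak-resp : ∀ {A B} → (∀ v → A v ≡ B v) → Weak A → Weak B
    weak-resp eq (le , (v , v∈Z , v∈) , (u , u∈Z , u∉)) = subst (_≤ 1ℤ) (sum-cong-≗ (inner-cong Z eq)) le ,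
      (v , v∈Z , trans (sym (eq v)) v∈) , (u , u∈Z , trans (sym (eq u)) u∉)
    weak? : ∀ B → Dec (Weak B)
    weak? B = (sum (inner Z B) ℤ.≤? 1ℤ) ×-dec
      (Fin.any? (λ v → (Z v Bool.≟ true) ×-dec (B v Bool.≟ true)) ×-dec Fin.any? (λ v → (Z v Bool.≟ true) ×-dec (B v Bool.≟ false)))
    decide : Dec (∃[ B ] Weak B) → Blob Z ⊎ Halves Z
    decide (no none) = inj₁ record
      { cut≡2 = cut2 ; out₀∉ = w∉ ; one∈ = x∈ ; two∈ = y∈ ; one≢two = x≢y
      ; split = λ B {v} {u} v∈Z v∈ u∈Z u∉ → ℤ.i<j⇒suc[i]≤j (ℤ.≰⇒> λ le → none (B , le , (v , v∈Z , v∈) , (u , u∈Z , u∉))) }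
    decide (yes (B , le , (v , v∈Z , v∈B) , (u , u∈Z , u∉B))) =
      inj₂ (A , R , v , u , v∈A , u∈R , ℤ.≤-antisym A≤2 A≥2 , ℤ.≤-antisym R≤2 R≥2 ,
            (λ s s∈ → ∩-left Z B s s∈ , trans (cong (λ b → Z s ∧ not b) s∈) (Bool.∧-zeroʳ (Z s))) ,
            (λ s s∈ → ∩-left Z (∁ A) s s∈ , trans (sym (Bool.not-involutive (A s))) (cong not (∩-right Z (∁ A) s s∈))) ,
            λ s s∈ → either s s∈ (status (A s)))
      where
      A R : VSet
      A = Z ∩ B
      R = Z ∩ ∁ A
      v∈A : A v ≡ true
      v∈A = ∩-intro Z B v v∈Z v∈B
      u∉A : A u ≡ false
      u∉A = trans (cong (Z u ∧_) u∉B) (Bool.∧-zeroʳ (Z u))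
      u∈R : R u ≡ true
      u∈R = ∩-intro Z (∁ A) u u∈Z (cong not u∉A)
      A≥2 : + 2 ≤ cut A
      A≥2 = cut≥2 A v∈A u∉A
      R≥2 : + 2 ≤ cut R
      R≥2 = cut≥2 R {u} {v} u∈R (trans (cong (λ b → Z v ∧ not b) v∈A) (Bool.∧-zeroʳ (Z v)))
      either : ∀ s → Z s ≡ true → (A s ≡ true) ⊎ (A s ≡ false) → (A s ≡ true) ⊎ (R s ≡ true)
      either s s∈ (inj₁ p) = inj₁ p
      either s s∈ (inj₂ p) = inj₂ (∩-intro Z (∁ A) s s∈ (cong not p))
      cut-A : cut A ≤ sum (inner Z B) + ∑⟨ A ⟩ (out Z)
      cut-A = subst (cut A ≤_) (∑-distrib-+ (inner Z B) (λ s → if A s then out Z s else 0ℤ)) (sum-mono λ s → gate (A s) {out A s} {iout Z B s} {out Z s} (leaves s))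
        where
        gate : ∀ b {x y z : ℤ} → x ≤ y + z → (if b then x else 0ℤ) ≤ (if b then y else 0ℤ) + (if b then z else 0ℤ)
        gate true  p = p
        gate false p = ℤ.≤-refl
        or-leaves : ∀ a b {x : ℤ} → (if a ∧ b then 0ℤ else x) ≤ (if a ∧ not b then x else 0ℤ) + (if a then 0ℤ else x)
        or-leaves true  true  = ℤ.≤-refl
        or-leaves true  false = ℤ.≤-reflexive (sym (ℤ.+-identityʳ _))
        or-leaves false _     = ℤ.≤-reflexive (sym (ℤ.+-identityˡ _))
        leaves : ∀ s → out A s ≤ iout Z B s + out Z s
        leaves s = subst (out A s ≤_) (∑-distrib-+ (λ t → if Z t ∧ not (B t) then m s t else 0ℤ) (λ t → if Z t then 0ℤ else m s t))
          (sum-mono λ t → or-leaves (Z t) (B t) {m s t})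
      total : cut A + cut R ≤ + 4
      total = begin
        cut A + cut R                                   ≡⟨ regroup₁ (cut A) (cut R) (∑⟨ A ⟩ (out Z)) ⟩
        cut A + (cut R + (∑⟨ A ⟩ (out Z) + ∑⟨ A ⟩ (out Z))) - (∑⟨ A ⟩ (out Z) + ∑⟨ A ⟩ (out Z))
          ≡⟨ cong (λ t → cut A + t - (∑⟨ A ⟩ (out Z) + ∑⟨ A ⟩ (out Z))) (trans (cut-difference Z A (λ s s∈ → ∩-left Z B s s∈)) (cong (_+ cut A) cut2)) ⟩
        cut A + (+ 2 + cut A) - (∑⟨ A ⟩ (out Z) + ∑⟨ A ⟩ (out Z)) ≡⟨ regroup₂ (cut A) (∑⟨ A ⟩ (out Z)) ⟩
        (cut A - ∑⟨ A ⟩ (out Z)) + (cut A - ∑⟨ A ⟩ (out Z)) + + 2 ≤⟨ ℤ.+-monoˡ-≤ (+ 2) (ℤ.+-mono-≤ few few) ⟩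
        + 4                                             ∎
        where
        open ℤ.≤-Reasoning
        regroup₁ : ∀ a r x → a + r ≡ a + (r + (x + x)) - (x + x)
        regroup₁ = solve-∀
        regroup₂ : ∀ a x → a + (+ 2 + a) - (x + x) ≡ (a - x) + (a - x) + + 2
        regroup₂ = solve-∀
        few : cut A - ∑⟨ A ⟩ (out Z) ≤ 1ℤ
        few = ℤ.≤-trans (ℤ.+-monoˡ-≤ (- ∑⟨ A ⟩ (out Z)) cut-A)
          (ℤ.≤-trans (ℤ.≤-reflexive (cancel (sum (inner Z B)) (∑⟨ A ⟩ (out Z)))) le)
          where
          cancel : ∀ a b → a + b - b ≡ a
          cancel = solve-∀
      A≤2 : cut A ≤ + 2
      A≤2 = subst (_≤ + 2) (cancel (cut A) (cut R)) (ℤ.+-mono-≤ {cut A + cut R} { + 4} { - cut R} { - (+ 2)} total (ℤ.neg-mono-≤ R≥2))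
        where
        cancel : ∀ a b → a + b - b ≡ a
        cancel = solve-∀
      R≤2 : cut R ≤ + 2
      R≤2 = subst (_≤ + 2) (cancel (cut A) (cut R)) (ℤ.+-mono-≤ {cut A + cut R} { + 4} { - cut A} { - (+ 2)} total (ℤ.neg-mono-≤ A≥2))
        where
        cancel : ∀ a b → a + b - a ≡ b
        cancel = solve-∀

  -- A branching vertex alone would have at least three outgoing edges.
  second-vertex : ∀ {Z x} → cut Z ≡ + 2 → Z x ≡ true → Branching x → ∃[ y ] Z y ≡ true × x ≢ y
  second-vertex {Z} {x} cut2 x∈ br = decide (Fin.any? λ y → (Z y Bool.≟ true) ×-dec ¬? (x Fin.≟ y))
    where
    decide : Dec (∃[ y ] Z y ≡ true × x ≢ y) → ∃[ y ] Z y ≡ true × x ≢ y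
    decide (yes found) = found
    decide (no none) = ⊥-elim (3≰2 (ℤ.≤-trans br (ℤ.≤-trans (sum-mono leaves)
      (subst (out Z x ≤_) cut2 (subst (_≤ cut Z) (∂-in Z x∈) (term≤sum (∂≥0 Z) x))))))
      where
      leaves : ∀ w → m x w ≤ (if Z w then 0ℤ else m x w)
      leaves w = here (status (Z w)) (x Fin.≟ w)
        where
        here : (Z w ≡ true) ⊎ (Z w ≡ false) → Dec (x ≡ w) → m x w ≤ (if Z w then 0ℤ else m x w)
        here (inj₂ w∉) _ = ℤ.≤-reflexive (sym (cong (λ b → if b then 0ℤ else m x w) w∉))
        here (inj₁ w∈) (yes refl) = ℤ.≤-reflexive (trans (m-loop x) (sym (cong (λ b → if b then 0ℤ else m x x) w∈)))
        here (inj₁ w∈) (no x≢w) = ⊥-elim (none (w , w∈ , x≢w))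

  BlobIn : VSet → Set
  BlobIn A = ∃[ Z ] Blob Z × (∀ v → Z v ≡ true → A v ≡ true) × (∃[ x ] Z x ≡ true × Branching x)

  shrink : ∀ {A B C : VSet} {k} → size C ≤ + suc k → (∀ v → A v ≡ true → C v ≡ true × B v ≡ false) →
           ∀ {b} → B b ≡ true → C b ≡ true → A b ≡ false → size A ≤ + k
  shrink {A} {B} {C} {k} C≤ A⊆ {b} b∈ b∈C b∉A = subst₂ _≤_ (cancel (size A)) refl (ℤ.+-monoˡ-≤ -1ℤ
      (ℤ.≤-trans (size-strict {A} {C} {b} (λ v v∈ → proj₁ (A⊆ v v∈)) b∉A b∈C) C≤))
    where
    cancel : ∀ a → a + 1ℤ + -1ℤ ≡ a
    cancel = solve-∀

  -- Descent on the size: if `A` is not a blob, the half that contains `x` again has two outgoing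
  -- edges.
  find-blob : ∀ k {A x w} → size A ≤ + k → cut A ≡ + 2 → A w ≡ false → A x ≡ true → Branching x → BlobIn A
  find-blob zero {A} {x} size≤ _ _ x∈ _ = ⊥-elim (1≰0 (ℤ.≤-trans (size≥1 {A} {x} x∈) size≤))
  find-blob (suc k) {A} {x} {w} size≤ cut2 w∉ x∈ br = decide (blob-or-halves cut2 w∉ x∈ (proj₁ (proj₂ other)) (proj₂ (proj₂ other)))
    where
    other : ∃[ y ] A y ≡ true × x ≢ y
    other = second-vertex cut2 x∈ br
    decide : Blob A ⊎ Halves A → BlobIn A
    decide (inj₁ blob) = A , blob , (λ _ p → p) , (x , x∈ , br)
    decide (inj₂ (B , C , b , c , b∈ , c∈ , cutB , cutC , B⊆ , C⊆ , cover)) = choose (cover x x∈)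
      where
      widen : ∀ {S : VSet} → (∀ v → S v ≡ true → A v ≡ true) → BlobIn S → BlobIn A
      widen S⊆ (Z , blob , Z⊆ , found) = Z , blob , (λ v v∈ → S⊆ v (Z⊆ v v∈)) , found
      choose : (B x ≡ true) ⊎ (C x ≡ true) → BlobIn A
      choose (inj₁ x∈B) = widen {B} (λ v v∈ → proj₁ (B⊆ v v∈)) (find-blob k (shrink {B} {C} {A} size≤ B⊆ c∈ (proj₁ (C⊆ c c∈)) (proj₂ (C⊆ c c∈)))
        cutB (proj₂ (C⊆ c c∈)) x∈B br)
      choose (inj₂ x∈C) = widen {C} (λ v v∈ → proj₁ (C⊆ v v∈)) (find-blob k (shrink {C} {B} {A} size≤ C⊆ b∈ (proj₁ (B⊆ b b∈)) (proj₂ (B⊆ b b∈)))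
        cutC (proj₂ (B⊆ b b∈)) x∈C br)

  -- Either one blob catches all branching vertices of `A`, so that they can be counted, or `A`
  -- offers two disjoint blobs.
  Covering : VSet → Set
  Covering A = (∃[ Y ] Blob Y × (∀ v → Y v ≡ true → A v ≡ true) × (∀ v → A v ≡ true → Branching v → Y v ≡ true)) ⊎
               (∃[ B ] ∃[ C ] BlobIn B × BlobIn C × (∀ v → B v ≡ true → A v ≡ true × C v ≡ false) × (∀ v → C v ≡ true → A v ≡ true × B v ≡ false))

  find-cover : ∀ k {A x w} → size A ≤ + k → cut A ≡ + 2 → A w ≡ false → A x ≡ true → Branching x → Covering A
  find-cover zero {A} {x} size≤ _ _ x∈ _ = ⊥-elim (1≰0 (ℤ.≤-trans (size≥1 {A} {x} x∈) size≤))
  find-cover (suc k) {A} {x} {w} size≤ cut2 w∉ x∈ br = decide (blob-or-halves cut2 w∉ x∈ (proj₁ (proj₂ other)) (proj₂ (proj₂ other)))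
    where
    other : ∃[ y ] A y ≡ true × x ≢ y
    other = second-vertex cut2 x∈ br
    decide : Blob A ⊎ Halves A → Covering A
    decide (inj₁ blob) = inj₁ (A , blob , (λ _ p → p) , λ v v∈ _ → v∈)
    decide (inj₂ (B , C , b , c , b∈ , c∈ , cutB , cutC , B⊆ , C⊆ , cover)) =
        choose (Fin.any? λ v → (B v Bool.≟ true) ×-dec branching? v) (Fin.any? λ v → (C v Bool.≟ true) ×-dec branching? v)
      where
      sizeB : size B ≤ + k
      sizeB = shrink {B} {C} {A} size≤ B⊆ c∈ (proj₁ (C⊆ c c∈)) (proj₂ (C⊆ c c∈))
      sizeC : size C ≤ + k
      sizeC = shrink {C} {B} {A} size≤ C⊆ b∈ (proj₁ (B⊆ b b∈)) (proj₂ (B⊆ b b∈))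
      widen : ∀ {S T : VSet} → (∀ v → S v ≡ true → A v ≡ true) → (∀ v → A v ≡ true → (S v ≡ true) ⊎ (T v ≡ true)) →
              ¬ (∃[ v ] T v ≡ true × Branching v) → Covering S → Covering A
      widen {S} {T} S⊆ split none (inj₁ (Y , blob , Y⊆ , all)) = inj₁ (Y , blob , (λ v v∈ → S⊆ v (Y⊆ v v∈)) , λ v v∈ brv → pick v brv (split v v∈))
        where
        pick : ∀ v → Branching v → (S v ≡ true) ⊎ (T v ≡ true) → Y v ≡ true
        pick v brv (inj₁ v∈S) = all v v∈S brv
        pick v brv (inj₂ v∈T) = ⊥-elim (none (v , v∈T , brv))
      widen S⊆ split none (inj₂ (B′ , C′ , inB , inC , B′⊆ , C′⊆)) = inj₂ (B′ , C′ , inB , inC ,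
        (λ v v∈ → S⊆ v (proj₁ (B′⊆ v v∈)) , proj₂ (B′⊆ v v∈)) , λ v v∈ → S⊆ v (proj₁ (C′⊆ v v∈)) , proj₂ (C′⊆ v v∈))
      flip : ∀ v → A v ≡ true → (C v ≡ true) ⊎ (B v ≡ true)
      flip v v∈ = swap (cover v v∈)
        where
        swap : ∀ {P Q : Set} → P ⊎ Q → Q ⊎ P
        swap (inj₁ p) = inj₂ p
        swap (inj₂ q) = inj₁ q
      choose : Dec (∃[ v ] B v ≡ true × Branching v) → Dec (∃[ v ] C v ≡ true × Branching v) → Covering A
      choose (yes (p , p∈ , brp)) (yes (q , q∈ , brq)) = inj₂ (B , C , find-blob k sizeB cutB (proj₂ (C⊆ c c∈)) p∈ brp ,
        find-blob k sizeC cutC (proj₂ (B⊆ b b∈)) q∈ brq , B⊆ , C⊆)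
      choose (yes (p , p∈ , brp)) (no none) = widen {B} {C} (λ v v∈ → proj₁ (B⊆ v v∈)) cover none (find-cover k sizeB cutB (proj₂ (C⊆ c c∈)) p∈ brp)
      choose (no none) (yes (q , q∈ , brq)) = widen {C} {B} (λ v v∈ → proj₁ (C⊆ v v∈)) flip none (find-cover k sizeC cutC (proj₂ (B⊆ b b∈)) q∈ brq)
      choose (no noneB) (no noneC) = ⊥-elim (neither (cover x x∈))
        where
        neither : (B x ≡ true) ⊎ (C x ≡ true) → ⊥
        neither (inj₁ p) = noneB (x , p , br)
        neither (inj₂ p) = noneC (x , p , br)

  Pencil : Set
  Pencil = ∃[ h ] deg G h ≡ + 2 × (∀ w → EffClass (λ v → h v - pt w v))

  -- If the complement of `Z` holds two blobs `Y` and `W`, both `∂ Z` and `∂ Y` complete `∂ W` to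
  -- `D`, hence are equivalent. Otherwise `Z` and one blob `Y` contain all branching vertices. If
  -- `connect` fails in both directions, `Z` and `Y` are cycles, and `valency - 2` is at most
  -- `∂ Z + ∂ Y`, of total 4.
  essential-cut : (sum (λ v → valency v - + 2) ≡ + 8) → ∀ {A x y} → cut A ≡ + 2 → A x ≡ true → Branching x → A y ≡ false → Branching y → Pencil
  essential-cut total {A} {x} {y} cut2 x∈ brx y∉ bry = covered (find-cover ∣ size (∁ Z) ∣ (ℤ.≤-reflexive (sym (ℤ.0≤i⇒+∣i∣≡i (sum-nonneg (𝟙≥0 (∁ Z))))))
      (trans (cut-∁ Z) (Blob.cut≡2 bZ)) (cong not (Blob.one∈ bZ)) (cong not (Bool.¬-not λ y∈Z → true≢false (Z⊆ y y∈Z) y∉)) bry)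
    where
    first : BlobIn A
    first = find-blob ∣ size A ∣ (ℤ.≤-reflexive (sym (ℤ.0≤i⇒+∣i∣≡i (sum-nonneg (𝟙≥0 A))))) cut2 y∉ x∈ brx
    Z : VSet
    Z = proj₁ first
    bZ : Blob Z
    bZ = proj₁ (proj₂ first)
    Z⊆ : ∀ v → Z v ≡ true → A v ≡ true
    Z⊆ = proj₁ (proj₂ (proj₂ first))
    off-Z : ∀ {Y : VSet} → (∀ v → Y v ≡ true → ∁ Z v ≡ true) → ∀ v → Z v ≡ true → Y v ≡ false
    off-Z Y⊆ v v∈Z = Bool.¬-not λ v∈Y → true≢false (Y⊆ v v∈Y) (cong not v∈Z)
    pencil : ∀ {Y : VSet} (bY : Blob Y) → (∀ v → Z v ≡ true → Y v ≡ false) → ∂ Z ≋ ∂ Y → Pencil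
    pencil bY disj eqv = ∂ Z , Blob.cut≡2 bZ , gonal bZ bY disj eqv
    covered : Covering (∁ Z) → Pencil
    covered (inj₂ (B , C , (Y , bY , Y⊆ , _) , (W , bW , W⊆ , _) , B⊆ , C⊆)) = pencil bY (off-Z {Y} (λ v v∈ → proj₁ (B⊆ v (Y⊆ v v∈))))
      (cancelˡ {∂ W} {∂ Z} {∂ Y} (≋-trans {λ v → ∂ W v + ∂ Z v} {D} {λ v → ∂ W v + ∂ Y v} Z+W (≋-sym {λ v → ∂ W v + ∂ Y v} {D} Y+W)))
      where
      Z+W : (λ v → ∂ W v + ∂ Z v) ≋ D
      Z+W = ≋-congˡ (λ v → ℤ.+-comm (∂ Z v) (∂ W v)) (meet bZ bW (off-Z {W} (λ v v∈ → proj₁ (C⊆ v (W⊆ v v∈)))))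
      Y+W : (λ v → ∂ W v + ∂ Y v) ≋ D
      Y+W = ≋-congˡ (λ v → ℤ.+-comm (∂ Y v) (∂ W v)) (meet bY bW λ v v∈ → Bool.¬-not λ v∈W → true≢false (W⊆ v v∈W) (proj₂ (B⊆ v (Y⊆ v v∈))))
    covered (inj₁ (Y , bY , Y⊆ , all)) = ends (connect bZ bY disj) (connect bY bZ disj′)
      where
      disj : ∀ v → Z v ≡ true → Y v ≡ false
      disj = off-Z {Y} Y⊆
      disj′ : ∀ v → Y v ≡ true → Z v ≡ false
      disj′ v v∈Y = Bool.¬-not λ v∈Z → true≢false v∈Y (disj v v∈Z)
      ends : (∂ Z ≋ ∂ Y) ⊎ (∃[ y ] ∃[ q ] 1ℤ ≤ ∂ Y y × Y q ≡ false × (λ v → pt y v + (∂ Y v + pt q v)) ≋ D) →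
             (∂ Y ≋ ∂ Z) ⊎ (∃[ y ] ∃[ q ] 1ℤ ≤ ∂ Z y × Z q ≡ false × (λ v → pt y v + (∂ Z v + pt q v)) ≋ D) → Pencil
      ends (inj₁ eqv) _ = pencil bY disj eqv
      ends (inj₂ _) (inj₁ eqv) = pencil bY disj (≋-sym {∂ Y} {∂ Z} eqv)
      ends (inj₂ (y₀ , q₀ , y-end , q∉ , st)) (inj₂ (z₀ , q₁ , z-end , q₁∉ , st′)) = ⊥-elim
          (ℤ.<⇒≱ {+ 4} {+ 8} (+<+ (s≤s (s≤s (s≤s (s≤s (s≤s z≤n)))))) (subst₂ _≤_ total
            (trans (∑-distrib-+ (∂ Z) (∂ Y)) (cong₂ _+_ (Blob.cut≡2 bZ) (Blob.cut≡2 bY))) (sum-mono small)))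
        where
        in-blob : ∀ {W : VSet} v → W v ≡ true → degree-in W v ≤ + 2 → valency v - + 2 ≤ ∂ W v
        in-blob {W} v v∈ deg≤2 = ℤ.≤-trans (ℤ.+-monoˡ-≤ (- + 2) (ℤ.≤-trans (ℤ.≤-reflexive split)
            (ℤ.+-monoˡ-≤ (out W v) deg≤2))) (ℤ.≤-reflexive (trans (cancel (out W v)) (sym (∂-in W v∈))))
          where
          cancel : ∀ a → + 2 + a - + 2 ≡ a
          cancel = solve-∀
          split : valency v ≡ degree-in W v + out W v
          split = trans (sum-cong-≗ λ w → side (W w) {m v w}) (∑-distrib-+ (λ w → if W w then m v w else 0ℤ) (λ w → if W w then 0ℤ else m v w))
            where
            side : ∀ b {x : ℤ} → x ≡ (if b then x else 0ℤ) + (if b then 0ℤ else x)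
            side true  = sym (ℤ.+-identityʳ _)
            side false = sym (ℤ.+-identityˡ _)
        small : ∀ v → valency v - + 2 ≤ ∂ Z v + ∂ Y v
        small v = here (status (Z v)) (status (Y v))
          where
          here : (Z v ≡ true) ⊎ (Z v ≡ false) → (Y v ≡ true) ⊎ (Y v ≡ false) → valency v - + 2 ≤ ∂ Z v + ∂ Y v
          here (inj₁ v∈) _ = ℤ.≤-trans (in-blob {Z} v v∈ (cycle bY bZ disj′ z-end q₁∉ st′ v∈))
            (subst (_≤ ∂ Z v + ∂ Y v) (ℤ.+-identityʳ (∂ Z v)) (ℤ.+-monoʳ-≤ (∂ Z v) (∂≥0 Y v)))
          here (inj₂ _) (inj₁ v∈) = ℤ.≤-trans (in-blob {Y} v v∈ (cycle bZ bY disj y-end q∉ st v∈))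
            (subst (_≤ ∂ Z v + ∂ Y v) (ℤ.+-identityˡ (∂ Y v)) (ℤ.+-monoˡ-≤ (∂ Y v) (∂≥0 Z v)))
          here (inj₂ v∉Z) (inj₂ v∉Y) = ℤ.≤-trans (ℤ.i≤j⇒i-j≤0 (ℤ.≮⇒≥ λ p → true≢false (all v (cong not v∉Z) (ℤ.i<j⇒suc[i]≤j p)) v∉Y))
            (ℤ.+-mono-≤ (∂≥0 Z v) (∂≥0 Y v))

  -- No two edges separate branching vertices

  module NoEssentialCut
    (no-essential : ∀ {A x y} → cut A ≤ + 2 → A x ≡ true → Branching x → A y ≡ false → Branching y → ⊥)
    (total : sum (λ v → valency v - + 2) ≡ + 8)
    where

    -- For branching `r` such a set contains no branching vertex, so firing it leaves the chips on
    -- branching vertices alone.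
    record Reducible (E : Divisor G) (r : Vertex) : Set where
      field
        set    : VSet
        avoids : set r ≡ false
        {member} : Vertex
        nonempty : set member ≡ true
        bound  : ∀ v → set v ≡ true → out set v ≤ E v
        small  : cut set ≤ + 2

      unbranched : Branching r → ∀ {v} → set v ≡ true → ¬ Branching v
      unbranched br v∈ brv = no-essential small v∈ brv avoids br

    -- The legal set obtained by holding back `x`, in the case that all three other chips are used.
    -- In the lemmas that follow, `x` is a centre if it lies in its own set.
    record Triple (E : Divisor G) (r x : Vertex) : Set where
      field
        set    : VSet
        avoids : set r ≡ false
        tails  : ∀ v → ∂ set v ≡ E v - pt x v

      holds : ∀ {v} → 1ℤ ≤ E v → x ≢ v → set v ≡ true
      holds {v} Ev x≢v = ∂-support set (subst (1ℤ ≤_) (sym (trans (tails v) (trans (cong (_-_ (E v)) (pt-other x≢v)) (ℤ.+-identityʳ (E v))))) Ev)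

      outs : ∀ {v} → set v ≡ true → out set v ≡ E v - pt x v
      outs {v} v∈ = trans (sym (∂-in set v∈)) (tails v)

    ∂-bounded : ∀ A {X : Divisor G} → (∀ v → A v ≡ true → out A v ≤ X v) → (∀ v → A v ≡ false → 0ℤ ≤ X v) → ∀ v → ∂ A v ≤ X v
    ∂-bounded A {X} inside outside v = here (status (A v))
      where
      here : (A v ≡ true) ⊎ (A v ≡ false) → ∂ A v ≤ X v
      here (inj₁ v∈) = subst (_≤ X v) (sym (∂-in A v∈)) (inside v v∈)
      here (inj₂ v∉) = subst (_≤ X v) (sym (∂-out A v∉)) (outside v v∉)

    minus0 : ∀ {x v : Vertex} (z : ℤ) → x ≢ v → z - pt x v ≡ z
    minus0 z x≢v = trans (cong (_-_ z) (pt-other x≢v)) (ℤ.+-identityʳ z)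

    minus≤ : ∀ (x v : Vertex) (z : ℤ) → z - pt x v ≤ z
    minus≤ x v z = subst (z - pt x v ≤_) (ℤ.+-identityʳ z) (ℤ.+-monoʳ-≤ z (ℤ.neg-mono-≤ (pt≥0 x v)))

    occupied≢empty : ∀ {E : Divisor G} {x r} → 1ℤ ≤ E x → E r ≡ 0ℤ → x ≢ r
    occupied≢empty Ex Er refl = 1≰0 (subst (1ℤ ≤_) Er Ex)

    valency-lonely : ∀ {A : VSet} {x} → A x ≡ true → (∀ {v} → A v ≡ true → x ≡ v) → out A x ≡ valency x
    valency-lonely {A} {x} x∈ only = sum-cong-≗ λ w → here w (status (A w))
      where
      here : ∀ w → (A w ≡ true) ⊎ (A w ≡ false) → (if A w then 0ℤ else m x w) ≡ m x w
      here w (inj₂ w∉) = cong (λ b → if b then 0ℤ else m x w) w∉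
      here w (inj₁ w∈) = trans (cong (λ b → if b then 0ℤ else m x w) w∈) (trans (sym (m-loop x)) (cong (m x) (only w∈)))

    module Configuration (E : Divisor G) (E≥0 : Effective G E) (degE : deg G E ≡ + 4) (state : E ≋ D)
                         {r : Vertex} (r-branching : Branching r) (Er : E r ≡ 0ℤ) where

      -- Three chips are left without `x`: a cut of more than two edges uses all of them.
      reduce-or-triple : ∀ {A : VSet} {x} → A r ≡ false → ∀ {u} → A u ≡ true → 1ℤ ≤ E x → (∀ v → ∂ A v ≤ E v - pt x v) →
                         Reducible E r ⊎ (∀ v → ∂ A v ≡ E v - pt x v)
      reduce-or-triple {A} {x} r∉ u∈ Ex le = decide (cut A ℤ.≤? + 2)
        where
        decide : Dec (cut A ≤ + 2) → Reducible E r ⊎ (∀ v → ∂ A v ≡ E v - pt x v)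
        decide (yes p) = inj₁ record { set = A ; avoids = r∉ ; nonempty = u∈ ; small = p
          ; bound = λ v v∈ → ℤ.≤-trans (subst (_≤ E v - pt x v) (∂-in A v∈) (le v)) (minus≤ x v (E v)) }
        decide (no p) = inj₂ (squeeze le (subst (_≤ cut A) (sym (trans (deg-remove E x) (cong (_- 1ℤ) degE))) (ℤ.i<j⇒suc[i]≤j (ℤ.≰⇒> p))))

      triple : ∀ {x} → 1ℤ ≤ E x → Reducible E r ⊎ Triple E r x
      triple {x} Ex = wrap (reduce-or-triple {set} {x} avoids nonempty Ex (∂-bounded set bound λ v _ → remove≥0 E x E≥0 Ex v))
        where
        L : Legal (λ v → E v - pt x v) r
        L = reach x (λ v → E v - pt x v) r (≋-congˡ (λ v → regroup (E v) (pt x v)) state)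
              (trans (minus0 (E r) (occupied≢empty {E} Ex Er)) Er)
          where
          regroup : ∀ e x → e ≡ x + (e - x)
          regroup = solve-∀
        open Legal L
        wrap : Reducible E r ⊎ (∀ v → ∂ set v ≡ E v - pt x v) → Reducible E r ⊎ Triple E r x
        wrap (inj₁ red) = inj₁ red
        wrap (inj₂ eq) = inj₂ record { set = set ; avoids = avoids ; tails = eq }

      -- Two centres: the union of the sets uses two chips less.
      two-centres : ∀ {x y} → x ≢ y → 1ℤ ≤ E x → 1ℤ ≤ E y → (X : Triple E r x) (Y : Triple E r y) →
                    Triple.set X x ≡ true → Triple.set Y y ≡ true → Reducible E r
      two-centres {x} {y} x≢y Ex Ey X Y x∈ y∈ = record
          { set = U ; avoids = ∪-avoid A B r (Triple.avoids X) (Triple.avoids Y) ; nonempty = ∪-left A B x x∈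
          ; bound = λ v v∈ → either v (∪-cases A B v v∈)
          ; small = subst (cut U ≤_) deg2 (sum-mono (∂-bounded U inside outside)) }
        where
        A B U : VSet
        A = Triple.set X
        B = Triple.set Y
        U = A ∪ B
        left : ∀ v → A v ≡ true → out U v ≤ E v - pt x v
        left v v∈ = ℤ.≤-trans (out-∪ˡ A B v) (ℤ.≤-reflexive (Triple.outs X v∈))
        right : ∀ v → B v ≡ true → out U v ≤ E v - pt y v
        right v v∈ = ℤ.≤-trans (out-∪ʳ A B v) (ℤ.≤-reflexive (Triple.outs Y v∈))
        either : ∀ v → (A v ≡ true) ⊎ (B v ≡ true) → out U v ≤ E v
        either v (inj₁ p) = ℤ.≤-trans (left v p) (minus≤ x v (E v))
        either v (inj₂ p) = ℤ.≤-trans (right v p) (minus≤ y v (E v))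
        deg2 : sum (λ v → E v - pt x v - pt y v) ≡ + 2
        deg2 = trans (deg-remove (λ v → E v - pt x v) y) (cong (_- 1ℤ) (trans (deg-remove E x) (cong (_- 1ℤ) degE)))
        inside : ∀ v → U v ≡ true → out U v ≤ E v - pt x v - pt y v
        inside v v∈ = here (x Fin.≟ v) (y Fin.≟ v)
          where
          here : Dec (x ≡ v) → Dec (y ≡ v) → out U v ≤ E v - pt x v - pt y v
          here _ (no y≢v) = subst (out U v ≤_) (sym (minus0 (E v - pt x v) y≢v)) (sub (x Fin.≟ v) (∪-cases A B v v∈))
            where
            sub : Dec (x ≡ v) → (A v ≡ true) ⊎ (B v ≡ true) → out U v ≤ E v - pt x v
            sub (yes refl) _ = left v x∈
            sub (no x≢v) p = subst (out U v ≤_) (sym (minus0 (E v) x≢v)) (either v p)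
          here _ (yes refl) = subst (out U v ≤_) (cong (_- pt y v) (sym (minus0 (E v) x≢y))) (right v y∈)
        outside : ∀ v → U v ≡ false → 0ℤ ≤ E v - pt x v - pt y v
        outside v v∉ = subst (0ℤ ≤_) (sym (trans (minus0 (E v - pt x v) (separated {U} (∪-right A B y y∈) v∉)) (minus0 (E v) (separated {U} (∪-left A B x x∈) v∉)))) (E≥0 v)

      -- The part of the star at s cut off by the set for c is a 2-cut around c.
      star : ∀ {s c} → c ≢ s → 1ℤ ≤ E s → 1ℤ ≤ E c → Branching c → (S : Triple E r s) (C : Triple E r c) →
             Triple.set S s ≡ true → Triple.set C c ≡ false → Reducible E r
      star {s} {c} c≢s Es Ec brc S C s∈ c∉ = conclude (reduce-or-triple {U} {s} r∉ {s} (∪-left A B s s∈) Es (∂-bounded U inside outside))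
        where
        A B U : VSet
        A = Triple.set S
        B = Triple.set C
        U = A ∪ B
        r∉ : U r ≡ false
        r∉ = ∪-avoid A B r (Triple.avoids S) (Triple.avoids C)
        inside : ∀ v → U v ≡ true → out U v ≤ E v - pt s v
        inside v v∈ = here (s Fin.≟ v) (∪-cases A B v v∈)
          where
          here : Dec (s ≡ v) → (A v ≡ true) ⊎ (B v ≡ true) → out U v ≤ E v - pt s v
          here (yes refl) _ = ℤ.≤-trans (out-∪ˡ A B v) (ℤ.≤-reflexive (Triple.outs S s∈))
          here (no _) (inj₁ p) = ℤ.≤-trans (out-∪ˡ A B v) (ℤ.≤-reflexive (Triple.outs S p))
          here (no s≢v) (inj₂ p) = subst (out U v ≤_) (sym (minus0 (E v) s≢v))
            (ℤ.≤-trans (out-∪ʳ A B v) (ℤ.≤-trans (ℤ.≤-reflexive (Triple.outs C p)) (minus≤ c v (E v))))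
        outside : ∀ v → U v ≡ false → 0ℤ ≤ E v - pt s v
        outside v v∉ = subst (0ℤ ≤_) (sym (minus0 (E v) (separated {U} (∪-left A B s s∈) v∉))) (E≥0 v)
        s∈B : B s ≡ true
        s∈B = Triple.holds C Es c≢s
        c∈A : A c ≡ true
        c∈A = Triple.holds S Ec (λ s≡c → c≢s (sym s≡c))
        conclude : Reducible E r ⊎ (∀ v → ∂ U v ≡ E v - pt s v) → Reducible E r
        conclude (inj₁ red) = red
        conclude (inj₂ eq) = ⊥-elim (no-essential {U ∩ ∁ B} {c} {r} (ℤ.≤-reflexive cut2)
            (∩-intro U (∁ B) c (∪-left A B c c∈A) (cong not c∉)) brc (∩-avoidˡ U (∁ B) r r∉) r-branching)
          where
          cut3 : ∀ x → sum (λ v → E v - pt x v) ≡ + 3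
          cut3 x = trans (deg-remove E x) (cong (_- 1ℤ) degE)
          exits : ∑⟨ B ⟩ (out U) ≡ + 2
          exits = trans (sum-cong-≗ pointwise) (trans (deg-remove (λ v → E v - pt c v) s) (cong (_- 1ℤ) (cut3 c)))
            where
            pointwise : ∀ v → (if B v then out U v else 0ℤ) ≡ E v - pt c v - pt s v
            pointwise v = here (status (B v))
              where
              here : (B v ≡ true) ⊎ (B v ≡ false) → (if B v then out U v else 0ℤ) ≡ E v - pt c v - pt s v
              here (inj₁ v∈) = trans (cong (λ b → if b then out U v else 0ℤ) v∈) (trans (sym (∂-in U (∪-right A B v v∈))) (trans (eq v)
                (cong (_- pt s v) (sym (minus0 (E v) λ c≡v → true≢false v∈ (subst (λ u → B u ≡ false) c≡v c∉))))))
              here (inj₂ v∉) = trans (cong (λ b → if b then out U v else 0ℤ) v∉) (sym (trans (minus0 (E v - pt c v) (separated {B} s∈B v∉))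
                (trans (sym (Triple.tails C v)) (∂-out B v∉))))
          cut2 : cut (U ∩ ∁ B) ≡ + 2
          cut2 = trans (regroup (cut (U ∩ ∁ B)) (∑⟨ B ⟩ (out U)))
            (cong₂ (λ a b → a - (b + b)) (trans (cut-difference U B (∪-right A B)) (cong₂ _+_ (trans (sum-cong-≗ eq) (cut3 s))
              (trans (sum-cong-≗ (Triple.tails C)) (cut3 c)))) exits)
            where
            regroup : ∀ a b → a ≡ a + (b + b) - (b + b)
            regroup = solve-∀

      rest-points : ∀ {x y} → 1ℤ ≤ E x → 1ℤ ≤ E y - pt x y → ∃[ a ] ∃[ b ] ∀ v → E v ≡ pair x y v + pair a b v
      rest-points {x} {y} Ex Ey = found (two-points (λ v → E v - pt x v - pt y v) (remove≥0 (λ v → E v - pt x v) y (remove≥0 E x E≥0 Ex) Ey)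
          (trans (deg-remove (λ v → E v - pt x v) y) (cong (_- 1ℤ) (trans (deg-remove E x) (cong (_- 1ℤ) degE)))))
        where
        found : (∃[ a ] ∃[ b ] ∀ v → E v - pt x v - pt y v ≡ pair a b v) → ∃[ a ] ∃[ b ] ∀ v → E v ≡ pair x y v + pair a b v
        found (a , b , eq) = a , b , λ v → trans (regroup (E v) (pt x v) (pt y v)) (cong (_+_ (pair x y v)) (eq v))
          where
          regroup : ∀ e x y → e ≡ (x + y) + (e - x - y)
          regroup = solve-∀

      single-chip : ∀ {x} → (X : Triple E r x) → Triple.set X x ≡ false → E x ≡ 1ℤ
      single-chip {x} X x∉ = trans (regroup (E x) (pt x x)) (trans (cong (_+ pt x x) (trans (sym (Triple.tails X x)) (∂-out (Triple.set X) x∉)))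
        (trans (ℤ.+-identityˡ (pt x x)) (pt-self x)))
        where
        regroup : ∀ e x → e ≡ e - x + x
        regroup = solve-∀

      -- A centre at any chip leads to `two-centres` or `star`. If neither `p`, `q` nor the other
      -- chips `a`, `b` are centres, let `U` be the union of the sets for `a` and `b`. A chip that
      -- `U` does not use is a centre for `U`. If all four are used, the intersection has at most
      -- `3 + 3 - 4` outgoing edges and separates `p` from `r`.
      two-branching : ∀ {p q} → p ≢ q → Branching p → Branching q → 1ℤ ≤ E p → 1ℤ ≤ E q → Reducible E r
      two-branching {p} {q} p≢q brp brq Ep Eq = with-triples (triple Ep) (triple Eq)
        where
        with-triples : Reducible E r ⊎ Triple E r p → Reducible E r ⊎ Triple E r q → Reducible E r
        with-triples (inj₁ red) _ = red
        with-triples (inj₂ _) (inj₁ red) = red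
        with-triples (inj₂ P) (inj₂ Q) = centres (status (Triple.set P p)) (status (Triple.set Q q))
          where
          centres : (Triple.set P p ≡ true) ⊎ (Triple.set P p ≡ false) → (Triple.set Q q ≡ true) ⊎ (Triple.set Q q ≡ false) → Reducible E r
          centres (inj₁ p∈) (inj₁ q∈) = two-centres p≢q Ep Eq P Q p∈ q∈
          centres (inj₁ p∈) (inj₂ q∉) = star (λ q≡p → p≢q (sym q≡p)) Ep Eq brq P Q p∈ q∉
          centres (inj₂ p∉) (inj₁ q∈) = star p≢q Eq Ep brp Q P q∈ p∉
          centres (inj₂ p∉) (inj₂ q∉) = with-rest (rest-points Ep (subst (1ℤ ≤_) (sym (minus0 (E q) p≢q)) Eq))
            where
            centred : ∀ {s} → 1ℤ ≤ E s → (S : Triple E r s) → Triple.set S s ≡ true → Reducible E r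
            centred {s} Es S s∈ = choose (p Fin.≟ s)
              where
              choose : Dec (p ≡ s) → Reducible E r
              choose (no p≢s) = star p≢s Es Ep brp S P s∈ p∉
              choose (yes refl) = star (λ q≡p → p≢q (sym q≡p)) Es Eq brq S Q s∈ q∉
            with-rest : (∃[ a ] ∃[ b ] ∀ v → E v ≡ pair p q v + pair a b v) → Reducible E r
            with-rest (a , b , E≡) = others (triple Ea) (triple Eb)
              where
              Ea : 1ℤ ≤ E a
              Ea = subst (1ℤ ≤_) (sym (E≡ a)) (ℤ.+-mono-≤ (pair≥0 p q a) (1≤pairˡ a b))
              Eb : 1ℤ ≤ E b
              Eb = subst (1ℤ ≤_) (sym (E≡ b)) (ℤ.+-mono-≤ (pair≥0 p q b) (1≤pairʳ a b))
              others : Reducible E r ⊎ Triple E r a → Reducible E r ⊎ Triple E r b → Reducible E r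
              others (inj₁ red) _ = red
              others (inj₂ _) (inj₁ red) = red
              others (inj₂ A₀) (inj₂ B₀) = outer (status (Triple.set A₀ a)) (status (Triple.set B₀ b))
                where
                outer : (Triple.set A₀ a ≡ true) ⊎ (Triple.set A₀ a ≡ false) → (Triple.set B₀ b ≡ true) ⊎ (Triple.set B₀ b ≡ false) → Reducible E r
                outer (inj₁ a∈) _ = centred Ea A₀ a∈
                outer (inj₂ _) (inj₁ b∈) = centred Eb B₀ b∈
                outer (inj₂ a∉) (inj₂ b∉) = split (Fin.any? λ v → ∂ U v ℤ.<? E v)
                  where
                  A B U : VSet
                  A = Triple.set A₀
                  B = Triple.set B₀
                  U = A ∪ B
                  r∉ : U r ≡ false
                  r∉ = ∪-avoid A B r (Triple.avoids A₀) (Triple.avoids B₀)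
                  a≢b : a ≢ b
                  a≢b refl = 2≰1 (subst (+ 2 ≤_) (single-chip A₀ a∉) (subst (+ 2 ≤_) (sym (E≡ a))
                    (ℤ.+-mono-≤ (pair≥0 p q a) (ℤ.≤-reflexive (sym (cong₂ _+_ (pt-self a) (pt-self a)))))))
                  covers : ∀ {v} → 1ℤ ≤ E v → U v ≡ true
                  covers {v} Ev = here (a Fin.≟ v)
                    where
                    here : Dec (a ≡ v) → U v ≡ true
                    here (no a≢v) = ∪-left A B v (Triple.holds A₀ Ev a≢v)
                    here (yes refl) = ∪-right A B v (Triple.holds B₀ Ev (λ b≡a → a≢b (sym b≡a)))
                  U≤E : ∀ v → ∂ U v ≤ E v
                  U≤E = ∂-bounded U (λ v v∈ → either v (∪-cases A B v v∈)) (λ v _ → E≥0 v)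
                    where
                    either : ∀ v → (A v ≡ true) ⊎ (B v ≡ true) → out U v ≤ E v
                    either v (inj₁ k) = ℤ.≤-trans (out-∪ˡ A B v) (ℤ.≤-trans (ℤ.≤-reflexive (Triple.outs A₀ k)) (minus≤ a v (E v)))
                    either v (inj₂ k) = ℤ.≤-trans (out-∪ʳ A B v) (ℤ.≤-trans (ℤ.≤-reflexive (Triple.outs B₀ k)) (minus≤ b v (E v)))
                  p≢ : ∀ {x} → (∀ v → pt x v ≤ pair a b v) → p ≢ x
                  p≢ {x} le refl = 2≰1 (subst (+ 2 ≤_) (single-chip P p∉) (subst (+ 2 ≤_) (sym (E≡ p))
                    (ℤ.+-mono-≤ (1≤pairˡ p q) (subst (_≤ pair a b p) (pt-self p) (le p)))))
                  split : Dec (∃[ v ] ∂ U v < E v) → Reducible E r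
                  split (yes (c , c<)) = fewer (reduce-or-triple {U} {c} r∉ {c} (covers Ec) Ec U≤)
                    where
                    Ec : 1ℤ ≤ E c
                    Ec = ℤ.i<j⇒suc[i]≤j (ℤ.≤-<-trans (∂≥0 U c) c<)
                    U≤ : ∀ v → ∂ U v ≤ E v - pt c v
                    U≤ v = here (c Fin.≟ v)
                      where
                      here : Dec (c ≡ v) → ∂ U v ≤ E v - pt c v
                      here (no c≢v) = subst (∂ U v ≤_) (sym (minus0 (E v) c≢v)) (U≤E v)
                      here (yes refl) = subst (∂ U c ≤_) (trans (ℤ.+-comm -1ℤ (E c)) (cong (_-_ (E c)) (sym (pt-self c)))) (ℤ.i<j⇒i≤pred[j] c<)
                    fewer : Reducible E r ⊎ (∀ v → ∂ U v ≡ E v - pt c v) → Reducible E r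
                    fewer (inj₁ red) = red
                    fewer (inj₂ eq) = centred Ec (record { set = U ; avoids = r∉ ; tails = eq }) (covers Ec)
                  split (no none) = ⊥-elim (no-essential {A ∩ B} {p} {r} small
                      (∩-intro A B p (Triple.holds A₀ Ep (λ a≡p → p≢ (λ v → a≤ v) (sym a≡p))) (Triple.holds B₀ Ep (λ b≡p → p≢ (λ v → b≤ v) (sym b≡p)))) brp
                      (∩-avoidˡ A B r (Triple.avoids A₀)) r-branching)
                    where
                    a≤ : ∀ v → pt a v ≤ pair a b v
                    a≤ v = subst (_≤ pair a b v) (ℤ.+-identityʳ (pt a v)) (ℤ.+-monoʳ-≤ (pt a v) (pt≥0 b v))
                    b≤ : ∀ v → pt b v ≤ pair a b v
                    b≤ v = subst (_≤ pair a b v) (ℤ.+-identityˡ (pt b v)) (ℤ.+-monoˡ-≤ (pt b v) (pt≥0 a v))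
                    cutU : + 4 ≤ cut U
                    cutU = subst (_≤ cut U) degE (sum-mono λ v → ℤ.≮⇒≥ λ lt → none (v , lt))
                    cut3 : ∀ {x} (X : Triple E r x) → cut (Triple.set X) ≡ + 3
                    cut3 {x} X = trans (sum-cong-≗ (Triple.tails X)) (trans (deg-remove E x) (cong (_- 1ℤ) degE))
                    small : cut (A ∩ B) ≤ + 2
                    small = subst (_≤ + 2) (cancel (cut (A ∩ B)) (cut U)) (ℤ.+-mono-≤ {cut (A ∩ B) + cut U} { + 6} { - cut U} { - (+ 4)}
                      (subst (cut (A ∩ B) + cut U ≤_) (cong₂ _+_ (cut3 A₀) (cut3 B₀)) (submodular A B)) (ℤ.neg-mono-≤ cutU))
                      where
                      cancel : ∀ a b → a + b - b ≡ a
                      cancel = solve-∀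

      out-∩ : ∀ A B v → out (A ∩ B) v ≤ out A v + out B v
      out-∩ A B v = subst (out (A ∩ B) v ≤_) (∑-distrib-+ (λ w → if A w then 0ℤ else m v w) (λ w → if B w then 0ℤ else m v w))
        (sum-mono λ w → pointwise (A w) (B w) (m≥0 v w))
        where
        pointwise : ∀ a b {x : ℤ} → 0ℤ ≤ x → (if a ∧ b then 0ℤ else x) ≤ (if a then 0ℤ else x) + (if b then 0ℤ else x)
        pointwise true  true  p = ℤ.≤-refl
        pointwise true  false p = ℤ.≤-reflexive (sym (ℤ.+-identityˡ _))
        pointwise false true  p = ℤ.≤-reflexive (sym (ℤ.+-identityʳ _))
        pointwise false false {x} p = subst (_≤ x + x) (ℤ.+-identityʳ x) (ℤ.+-monoʳ-≤ x p)

      -- Two chips on `p` make it a member of every triple, in particular a centre. If neither `a`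
      -- nor `b` is a centre, the intersection of their sets is left only at `p`, so it is `p`
      -- alone; but its cut is at most `3 + 3 - 3`, as the union has at least three outgoing edges.
      thick : ∀ {p a b} → (∀ v → E v ≡ pair p p v + pair a b v) → + 4 ≤ valency p → Branching p → Reducible E r
      thick {p} {a} {b} E≡ val4 brp = by-chips (p Fin.≟ a) (p Fin.≟ b)
        where
        3≱4 : ¬ (+ 4 ≤ + 3)
        3≱4 = ℤ.<⇒≱ (+<+ (s≤s (s≤s (s≤s (s≤s z≤n)))))
        Ep : 1ℤ ≤ E p
        Ep = subst (1ℤ ≤_) (sym (E≡ p)) (ℤ.+-mono-≤ (1≤pairˡ p p) (pair≥0 a b p))
        Ea : 1ℤ ≤ E a
        Ea = subst (1ℤ ≤_) (sym (E≡ a)) (ℤ.+-mono-≤ (pair≥0 p p a) (1≤pairˡ a b))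
        Eb : 1ℤ ≤ E b
        Eb = subst (1ℤ ≤_) (sym (E≡ b)) (ℤ.+-mono-≤ (pair≥0 p p b) (1≤pairʳ a b))
        p-stays : ∀ {x} (X : Triple E r x) → Triple.set X p ≡ true
        p-stays {x} X = ∂-support (Triple.set X) (subst (1ℤ ≤_) (sym (trans (Triple.tails X p) (cong (_- pt x p) (E≡ p))))
          (ℤ.≤-trans (ℤ.≤-reflexive refl) (ℤ.≤-trans (ℤ.+-mono-≤ (ℤ.+-mono-≤ {+ 2} {pair p p p} {0ℤ} {pair a b p}
            (ℤ.≤-reflexive (sym (cong₂ _+_ (pt-self p) (pt-self p)))) (pair≥0 a b p)) (ℤ.neg-mono-≤ (pt≤1 x p))) ℤ.≤-refl)))
          where
          pt≤1 : ∀ x v → pt x v ≤ 1ℤ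
          pt≤1 x v = subst (pt x v ≤_) (sum-pt x) (term≤sum (pt≥0 x) v)
        lonely : ∀ {A : VSet} → A p ≡ true → A r ≡ false → (∀ v → A v ≡ true → p ≢ v → out A v ≡ 0ℤ) → cut A ≤ + 3 → ⊥
        lonely {A} p∈ r∉ closed small = 3≱4 (ℤ.≤-trans val4 (ℤ.≤-trans (ℤ.≤-reflexive (sym (valency-lonely {A} p∈ (no-cut-vertex A p p∈ closed r∉))))
          (ℤ.≤-trans (subst (_≤ cut A) (∂-in A p∈) (term≤sum (∂≥0 A) p)) small)))
        cut3 : ∀ {x} (X : Triple E r x) → cut (Triple.set X) ≡ + 3
        cut3 {x} X = trans (sum-cong-≗ (Triple.tails X)) (trans (deg-remove E x) (cong (_- 1ℤ) degE))
        concentrated : ∀ {x} → (∀ v → p ≢ v → E v ≡ pt x v) → Reducible E r ⊎ Triple E r x → Reducible E r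
        concentrated _ (inj₁ red) = red
        concentrated {x} away (inj₂ X) = ⊥-elim (lonely {Triple.set X} (p-stays X) (Triple.avoids X)
          (λ v v∈ p≢v → trans (Triple.outs X v∈) (trans (cong (_- pt x v) (away v p≢v)) (ℤ.+-inverseʳ (pt x v)))) (ℤ.≤-reflexive (cut3 X)))
        E-off : ∀ v → p ≢ v → E v ≡ pair a b v
        E-off v p≢v = trans (E≡ v) (trans (cong (_+ pair a b v) (pair-avoids p≢v p≢v)) (ℤ.+-identityˡ (pair a b v)))
        by-chips : Dec (p ≡ a) → Dec (p ≡ b) → Reducible E r
        -- With three chips on `p`, holding back the fourth gives a set left only at `p`, by three
        -- edges.
        by-chips (yes refl) _ = concentrated (λ v p≢v → trans (E-off v p≢v) (trans (cong (_+ pt b v) (pt-other p≢v)) (ℤ.+-identityˡ (pt b v)))) (triple Eb)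
        by-chips (no _) (yes refl) = concentrated (λ v p≢v → trans (E-off v p≢v) (trans (cong (_+_ (pt a v)) (pt-other p≢v)) (ℤ.+-identityʳ (pt a v)))) (triple Ea)
        by-chips (no p≢a) (no p≢b) = with-triples (triple Ep) (triple Ea) (triple Eb)
          where
          with-triples : Reducible E r ⊎ Triple E r p → Reducible E r ⊎ Triple E r a → Reducible E r ⊎ Triple E r b → Reducible E r
          with-triples (inj₁ red) _ _ = red
          with-triples (inj₂ _) (inj₁ red) _ = red
          with-triples (inj₂ _) (inj₂ _) (inj₁ red) = red
          with-triples (inj₂ P) (inj₂ A₀) (inj₂ B₀) = outer (status (Triple.set A₀ a)) (status (Triple.set B₀ b))
            where
            A B : VSet
            A = Triple.set A₀
            B = Triple.set B₀
            outer : (A a ≡ true) ⊎ (A a ≡ false) → (B b ≡ true) ⊎ (B b ≡ false) → Reducible E r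
            outer (inj₁ a∈) _ = two-centres p≢a Ep Ea P A₀ (p-stays P) a∈
            outer (inj₂ _) (inj₁ b∈) = two-centres p≢b Ep Eb P B₀ (p-stays P) b∈
            outer (inj₂ a∉) (inj₂ b∉) = ⊥-elim (lonely {A ∩ B} (∩-intro A B p (p-stays A₀) (p-stays B₀)) (∩-avoidˡ A B r (Triple.avoids A₀)) closed small)
              where
              cutU : + 3 ≤ cut (A ∪ B)
              cutU = ℤ.i<j⇒suc[i]≤j (ℤ.≰⇒> λ le → no-essential {A ∪ B} {p} {r} le (∪-left A B p (p-stays A₀)) brp
                (∪-avoid A B r (Triple.avoids A₀) (Triple.avoids B₀)) r-branching)
              small : cut (A ∩ B) ≤ + 3
              small = subst (_≤ + 3) (cancel (cut (A ∩ B)) (cut (A ∪ B))) (ℤ.+-mono-≤ {cut (A ∩ B) + cut (A ∪ B)} { + 6} { - cut (A ∪ B)} { - (+ 3)}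
                (subst (cut (A ∩ B) + cut (A ∪ B) ≤_) (cong₂ _+_ (cut3 A₀) (cut3 B₀)) (submodular A B)) (ℤ.neg-mono-≤ cutU))
                where
                cancel : ∀ a b → a + b - b ≡ a
                cancel = solve-∀
              closed : ∀ v → (A ∩ B) v ≡ true → p ≢ v → out (A ∩ B) v ≡ 0ℤ
              closed v v∈ p≢v = ℤ.≤-antisym (ℤ.≤-trans (out-∩ A B v) (ℤ.≤-reflexive (cong₂ _+_
                  (trans (Triple.outs A₀ (∩-left A B v v∈)) (trans (cong (_- pt a v) zero-v) (minus0 0ℤ a≢v)))
                  (trans (Triple.outs B₀ (∩-right A B v v∈)) (trans (cong (_- pt b v) zero-v) (minus0 0ℤ b≢v)))))) (out≥0 (A ∩ B) v)
                where
                a≢v : a ≢ v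
                a≢v a≡v = true≢false (∩-left A B v v∈) (subst (λ u → A u ≡ false) a≡v a∉)
                b≢v : b ≢ v
                b≢v b≡v = true≢false (∩-right A B v v∈) (subst (λ u → B u ≡ false) b≡v b∉)
                zero-v : E v ≡ 0ℤ
                zero-v = trans (E-off v p≢v) (pair-avoids a≢v b≢v)

    ⟦_⟧ : Vertex → VSet
    ⟦ x ⟧ v = does (x Fin.≟ v)

    ⟦⟧-self : ∀ x → ⟦ x ⟧ x ≡ true
    ⟦⟧-self x = dec-true (x Fin.≟ x) refl

    ⟦⟧-other : ∀ {x v} → x ≢ v → ⟦ x ⟧ v ≡ false
    ⟦⟧-other {x} {v} x≢v = dec-false (x Fin.≟ v) x≢v

    only-⟦⟧ : ∀ x {v} → ⟦ x ⟧ v ≡ true → x ≡ v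
    only-⟦⟧ x {v} = does⇒ (x Fin.≟ v)

    cut-⟦⟧ : ∀ x → cut ⟦ x ⟧ ≡ valency x
    cut-⟦⟧ x = trans (sum-cong-≗ pointwise) (sum-single x (valency x))
      where
      pointwise : ∀ v → ∂ ⟦ x ⟧ v ≡ single x (valency x) v
      pointwise v = here (x Fin.≟ v)
        where
        here : Dec (x ≡ v) → ∂ ⟦ x ⟧ v ≡ single x (valency x) v
        here (yes refl) = trans (∂-in ⟦ x ⟧ (⟦⟧-self x)) (trans (valency-lonely {⟦ x ⟧} (⟦⟧-self x) (only-⟦⟧ x)) (sym (single-eq x (valency x))))
        here (no x≢v) = trans (∂-out ⟦ x ⟧ (⟦⟧-other x≢v)) (sym (single-neq x (valency x) x≢v))

    -- Vertices of valency 2 on the boundary can be taken out of A.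
    valency≤cut : ∀ k {A p y} → size A ≤ + k → A p ≡ true → A y ≡ false → (∀ v → A v ≡ true → p ≢ v → valency v ≤ + 2) → valency p ≤ cut A
    valency≤cut zero {A} {p} size≤ p∈ _ _ = ⊥-elim (1≰0 (ℤ.≤-trans (size≥1 {A} {p} p∈) size≤))
    valency≤cut (suc k) {A} {p} {y} size≤ p∈ y∉ thin = decide (Fin.any? λ v → (A v Bool.≟ true) ×-dec (¬? (p Fin.≟ v) ×-dec (1ℤ ℤ.≤? out A v)))
      where
      decide : Dec (∃[ v ] A v ≡ true × p ≢ v × 1ℤ ≤ out A v) → valency p ≤ cut A
      decide (no none) = ℤ.≤-trans (ℤ.≤-reflexive (sym (valency-lonely {A} p∈ (no-cut-vertex A p p∈ closed y∉))))
          (subst (_≤ cut A) (∂-in A p∈) (term≤sum (∂≥0 A) p))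
        where
        closed : ∀ v → A v ≡ true → p ≢ v → out A v ≡ 0ℤ
        closed v v∈ p≢v = ℤ.≤-antisym (ℤ.≮⇒≥ λ lt → none (v , v∈ , p≢v , ℤ.i<j⇒suc[i]≤j lt)) (out≥0 A v)
      decide (yes (v , v∈ , p≢v , out≥1)) = ℤ.≤-trans
          (valency≤cut k {A′} {p} {y} size′ (∩-intro A (∁ ⟦ v ⟧) p p∈ (cong not (⟦⟧-other (λ v≡p → p≢v (sym v≡p))))) (∩-avoidˡ A (∁ ⟦ v ⟧) y y∉)
            (λ u u∈ → thin u (∩-left A (∁ ⟦ v ⟧) u u∈))) smaller
        where
        A′ : VSet
        A′ = A ∩ ∁ ⟦ v ⟧
        v∉ : A′ v ≡ false
        v∉ = trans (cong (λ b → A v ∧ not b) (⟦⟧-self v)) (Bool.∧-zeroʳ (A v))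
        size′ : size A′ ≤ + k
        size′ = subst (_≤ + k) (cancel (size A′)) (ℤ.+-monoˡ-≤ -1ℤ (ℤ.≤-trans (size-strict {A′} {A} {v} (λ u → ∩-left A (∁ ⟦ v ⟧) u) v∉ v∈) size≤))
          where
          cancel : ∀ a → a + 1ℤ + -1ℤ ≡ a
          cancel = solve-∀
        outer : ∑⟨ ⟦ v ⟧ ⟩ (out A) ≡ out A v
        outer = trans (sum-cong-≗ pointwise) (sum-single v (out A v))
          where
          pointwise : ∀ u → (if ⟦ v ⟧ u then out A u else 0ℤ) ≡ single v (out A v) u
          pointwise u = here (v Fin.≟ u)
            where
            here : Dec (v ≡ u) → (if ⟦ v ⟧ u then out A u else 0ℤ) ≡ single v (out A v) u
            here (yes refl) = trans (cong (λ b → if b then out A v else 0ℤ) (⟦⟧-self v)) (sym (single-eq v (out A v)))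
            here (no v≢u) = trans (cong (λ b → if b then out A u else 0ℤ) (⟦⟧-other v≢u)) (sym (single-neq v (out A v) v≢u))
        smaller : cut A′ ≤ cut A
        smaller = begin
          cut A′                                       ≡⟨ regroup (cut A′) (out A v) ⟩
          cut A′ + (out A v + out A v) - (out A v + out A v) ≡⟨ cong (_- (out A v + out A v)) (trans (cong (λ x → cut A′ + (x + x)) (sym outer))
                                                            (trans (cut-difference A ⟦ v ⟧ (λ u u∈ → subst (λ w → A w ≡ true) (only-⟦⟧ v u∈) v∈)) (cong (_+_ (cut A)) (cut-⟦⟧ v)))) ⟩
          cut A + valency v - (out A v + out A v)      ≤⟨ ℤ.+-mono-≤ (ℤ.+-monoʳ-≤ (cut A) (thin v v∈ p≢v)) (ℤ.neg-mono-≤ (ℤ.+-mono-≤ out≥1 out≥1)) ⟩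
          cut A + + 2 - + 2                            ≡⟨ cancel (cut A) ⟩
          cut A                                        ∎
          where
          open ℤ.≤-Reasoning
          regroup : ∀ a b → a ≡ a + (b + b) - (b + b)
          regroup = solve-∀
          cancel : ∀ a → a + + 2 - + 2 ≡ a
          cancel = solve-∀

    valency≤ : ∀ {A p y} → A p ≡ true → A y ≡ false → (∀ v → A v ≡ true → p ≢ v → ¬ Branching v) → valency p ≤ cut A
    valency≤ {A} p∈ y∉ thin = valency≤cut ∣ size A ∣ (ℤ.≤-reflexive (sym (ℤ.0≤i⇒+∣i∣≡i (sum-nonneg (𝟙≥0 A))))) p∈ y∉
      λ v v∈ p≢v → ℤ.≮⇒≥ λ lt → thin v v∈ p≢v (ℤ.i<j⇒suc[i]≤j lt)

    realise : ∀ x y → ∃[ a ] ∃[ b ] (λ v → pair x y v + pair a b v) ≋ D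
    realise x y = points (two-points F (proj₁ (proj₂ rest)) degF)
      where
      rest : EffClass (λ v → D v - pair x y v)
      rest = rank2 (pair x y) (pair≥0 x y) (deg-pair x y)
      F : Divisor G
      F = proj₁ rest
      degF : deg G F ≡ + 2
      degF = trans (sym (≋-deg {λ v → D v - pair x y v} {F} (proj₂ (proj₂ rest))))
        (trans (sum-sub D (pair x y)) (cong₂ _-_ degD (deg-pair x y)))
      points : (∃[ a ] ∃[ b ] ∀ v → F v ≡ pair a b v) → ∃[ a ] ∃[ b ] (λ v → pair x y v + pair a b v) ≋ D
      points (a , b , eq) = a , b , replace {pair x y} {λ v → D v - pair x y v} {pair a b} (≋-cong λ v → cancel (pair x y v) (D v))
          (≋-trans {pair a b} {F} {λ v → D v - pair x y v} (≋-cong (λ v → sym (eq v))) (≋-sym {λ v → D v - pair x y v} {F} (proj₂ (proj₂ rest))))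
        where
        cancel : ∀ x d → x + (d - x) ≡ d
        cancel = solve-∀

    quad≥0 : ∀ x y a b → Effective G (λ v → pair x y v + pair a b v)
    quad≥0 x y a b v = ℤ.+-mono-≤ (pair≥0 x y v) (pair≥0 a b v)

    deg-quad : ∀ x y a b → deg G (λ v → pair x y v + pair a b v) ≡ + 4
    deg-quad x y a b = trans (∑-distrib-+ (pair x y) (pair a b)) (cong₂ _+_ (deg-pair x y) (deg-pair a b))

    pt-branching : ∀ {x v} → Branching x → ¬ Branching v → pt x v ≡ 0ℤ
    pt-branching brx ¬brv = pt-other λ { refl → ¬brv brx }

    -- Reducible sets contain neither `x` nor `y`, so they are legal for the other two chips alone,
    -- which can be driven until one of them reaches `r`.
    drive-to : ∀ {x y a b r} → Branching x → Branching y → Branching r → (λ v → pair x y v + pair a b v) ≋ D →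
      (∀ p q → (λ v → pair x y v + pair p q v) ≋ D → p ≢ r → q ≢ r → Reducible (λ v → pair x y v + pair p q v) r) →
      ∃[ c ] (λ v → pair x y v + pair r c v) ≋ D
    drive-to {x} {y} {a} {b} {r} brx bry brr state reducible = pair-drive r (λ _ _ → ⊤) step tt
      where
      step : ∀ p q → pair p q ≋ pair a b → ⊤ → (∃[ c ] (λ v → pair x y v + pair r c v) ≋ D) ⊎ (Σ[ M ∈ Move p q r ] ⊤)
      step p q pq≋ _ = found (p Fin.≟ r) (q Fin.≟ r)
        where
        st : (λ v → pair x y v + pair p q v) ≋ D
        st = replace {pair x y} {pair a b} {pair p q} state pq≋
        found : Dec (p ≡ r) → Dec (q ≡ r) → (∃[ c ] (λ v → pair x y v + pair r c v) ≋ D) ⊎ (Σ[ M ∈ Move p q r ] ⊤)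
        found (yes refl) _ = inj₁ (q , st)
        found (no _) (yes refl) = inj₁ (p , ≋-congˡ (λ v → cong (_+_ (pair x y v)) (pair-comm p q v)) st)
        found (no p≢r) (no q≢r) = inj₂ (move (legal set avoids nonempty bound′) , tt)
          where
          R : Reducible (λ v → pair x y v + pair p q v) r
          R = reducible p q st p≢r q≢r
          open Reducible R
          bound′ : ∀ v → set v ≡ true → out set v ≤ pair p q v
          bound′ v v∈ = ℤ.≤-trans (bound v v∈) (ℤ.≤-reflexive (trans (cong (_+ pair p q v)
            (cong₂ _+_ (pt-branching brx (unbranched brr v∈)) (pt-branching bry (unbranched brr v∈)))) (ℤ.+-identityˡ (pair p q v))))

    -- With three chips on branching vertices, only `b` could pay for a reducible set, and it pays
    -- for one edge.
    stuck : ∀ {x y z b r} → Branching x → Branching y → Branching z → Branching r → Reducible (λ v → pair x y v + pair z b v) r → ⊥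
    stuck {x} {y} {z} {b} {r} brx bry brz brr R = 2≰1 (ℤ.≤-trans (cut≥2 set nonempty avoids)
        (subst (cut set ≤_) (sum-pt b) (sum-mono (∂-bounded set bound′ (λ v _ → pt≥0 b v)))))
      where
      open Reducible R
      bound′ : ∀ v → set v ≡ true → out set v ≤ pt b v
      bound′ v v∈ = ℤ.≤-trans (bound v v∈) (ℤ.≤-reflexive (trans (cong₂ _+_
        (cong₂ _+_ (pt-branching brx ¬br) (pt-branching bry ¬br)) (cong (_+ pt b v) (pt-branching brz ¬br)))
        (trans (ℤ.+-identityˡ (0ℤ + pt b v)) (ℤ.+-identityˡ (pt b v)))))
        where
        ¬br : ¬ Branching v
        ¬br = unbranched brr v∈

    -- If `r` were empty, `two-branching` would give a reducible set, which `stuck` forbids.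
    covered : ∀ {x y z b r} → Branching x → Branching y → Branching z → Branching r → x ≢ z → x ≢ r → y ≢ r → z ≢ r →
              (λ v → pair x y v + pair z b v) ≋ D → b ≡ r
    covered {x} {y} {z} {b} {r} brx bry brz brr x≢z x≢r y≢r z≢r state = decide (b Fin.≟ r)
      where
      decide : Dec (b ≡ r) → b ≡ r
      decide (yes eq) = eq
      decide (no b≢r) = ⊥-elim (stuck brx bry brz brr (Configuration.two-branching (λ v → pair x y v + pair z b v) (quad≥0 x y z b) (deg-quad x y z b) state brr
        (cong₂ _+_ (pair-avoids x≢r y≢r) (pair-avoids z≢r b≢r)) x≢z brx brz
        (ℤ.+-mono-≤ (1≤pairˡ x y) (pair≥0 z b x)) (ℤ.+-mono-≤ (pair≥0 x y z) (1≤pairˡ z b))))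

    Thick : Vertex → Set
    Thick v = + 4 ≤ valency v

    thick⇒branching : ∀ {v} → Thick v → Branching v
    thick⇒branching = ℤ.≤-trans (+≤+ (s≤s (s≤s (s≤s z≤n))))

    -- Rank 2 places two chips on `p`; `thick` then supplies the reducible sets that drive a further
    -- chip to `r`.
    double : ∀ {p r} → Thick p → Branching r → p ≢ r → ∃[ b ] (λ v → pair p p v + pair r b v) ≋ D
    double {p} {r} thp brr p≢r = start (realise p p)
      where
      start : (∃[ a ] ∃[ b ] (λ v → pair p p v + pair a b v) ≋ D) → ∃[ b ] (λ v → pair p p v + pair r b v) ≋ D
      start (a , b , state) = drive-to (thick⇒branching thp) (thick⇒branching thp) brr state λ c d st c≢r d≢r →
        Configuration.thick (λ v → pair p p v + pair c d v) (quad≥0 p p c d) (deg-quad p p c d) st brr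
          (cong₂ _+_ (pair-avoids p≢r p≢r) (pair-avoids c≢r d≢r)) (λ _ → refl) thp (thick⇒branching thp)

    triangle : ∀ {p r s} → Thick p → Branching r → Branching s → p ≢ r → p ≢ s → r ≢ s → (λ v → pair p p v + pair r s v) ≋ D
    triangle {p} {r} {s} thp brr brs p≢r p≢s r≢s = finish (double thp brr p≢r)
      where
      finish : (∃[ b ] (λ v → pair p p v + pair r b v) ≋ D) → (λ v → pair p p v + pair r s v) ≋ D
      finish (b , state) = subst (λ u → (λ v → pair p p v + pair r u v) ≋ D)
        (covered (thick⇒branching thp) (thick⇒branching thp) brr brs p≢r p≢s p≢s r≢s state) state

    -- Exchanging the roles of two thick vertices in `triangle` would identify them, so `r` and `s`
    -- have valency 3, and `covered` shows that no other vertex branches. The total 8 forces valency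
    -- at least 8 at `p`, yet all of it must pass through the at most 6 edges around `r` and `s`.
    no-triangle : ∀ {p r s} → Thick p → Branching r → Branching s → p ≢ r → p ≢ s → r ≢ s → ⊥
    no-triangle {p} {r} {s} thp brr brs p≢r p≢s r≢s = ℤ.<⇒≱ {+ 6} {+ 8} (+<+ (s≤s (s≤s (s≤s (s≤s (s≤s (s≤s (s≤s z≤n)))))))) (ℤ.≤-trans val8 val6)
      where
      thin : ∀ {x y} → Branching x → Branching y → p ≢ x → p ≢ y → x ≢ y → ¬ Thick x
      thin {x} {y} brx bry p≢x p≢y x≢y thx = p≢x (pt-injective (cancelˡ {λ v → pt p v + pair x y v} {pt p} {pt x}
        (≋-trans {λ v → (pt p v + pair x y v) + pt p v} {D} {λ v → (pt p v + pair x y v) + pt x v}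
          (≋-congˡ (λ v → regroup₁ (pt p v) (pair x y v)) (triangle thp brx bry p≢x p≢y x≢y))
          (≋-sym {λ v → (pt p v + pair x y v) + pt x v} {D}
            (≋-congˡ (λ v → regroup₂ (pt p v) (pt x v) (pt y v)) (triangle thx (thick⇒branching thp) bry (λ x≡p → p≢x (sym x≡p)) x≢y p≢y))))))
        where
        regroup₁ : ∀ p x → (p + p) + x ≡ (p + x) + p
        regroup₁ = solve-∀
        regroup₂ : ∀ p x y → (x + x) + (p + y) ≡ (p + (x + y)) + x
        regroup₂ = solve-∀
      at-most3 : ∀ {x} → ¬ Thick x → valency x ≤ + 3
      at-most3 ¬th = ℤ.≮⇒≥ λ lt → ¬th (ℤ.i<j⇒suc[i]≤j lt)
      val-r : valency r ≤ + 3
      val-r = at-most3 (thin brr brs p≢r p≢s r≢s)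
      val-s : valency s ≤ + 3
      val-s = at-most3 (thin brs brr p≢s p≢r (λ s≡r → r≢s (sym s≡r)))
      only : ∀ {v} → p ≢ v → r ≢ v → s ≢ v → ¬ Branching v
      only {v} p≢v r≢v s≢v brv = s≢v (covered (thick⇒branching thp) (thick⇒branching thp) brr brv p≢r p≢v p≢v r≢v (triangle thp brr brs p≢r p≢s r≢s))
      A : VSet
      A = ⟦ r ⟧ ∪ ⟦ s ⟧
      cutA : cut A ≤ + 6
      cutA = begin
        cut A                           ≤⟨ subst (_≤ cut (⟦ r ⟧ ∩ ⟦ s ⟧) + cut A) (ℤ.+-identityˡ (cut A)) (ℤ.+-monoˡ-≤ (cut A) (sum-nonneg (∂≥0 (⟦ r ⟧ ∩ ⟦ s ⟧)))) ⟩
        cut (⟦ r ⟧ ∩ ⟦ s ⟧) + cut A     ≤⟨ submodular ⟦ r ⟧ ⟦ s ⟧ ⟩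
        cut ⟦ r ⟧ + cut ⟦ s ⟧           ≡⟨ cong₂ _+_ (cut-⟦⟧ r) (cut-⟦⟧ s) ⟩
        valency r + valency s           ≤⟨ ℤ.+-mono-≤ val-r val-s ⟩
        + 6                             ∎
        where open ℤ.≤-Reasoning
      val6 : valency p ≤ + 6
      val6 = ℤ.≤-trans (valency≤ {∁ A} {p} {r} (cong not (∪-avoid ⟦ r ⟧ ⟦ s ⟧ p (⟦⟧-other (λ r≡p → p≢r (sym r≡p))) (⟦⟧-other (λ s≡p → p≢s (sym s≡p)))))
          (cong not (∪-left ⟦ r ⟧ ⟦ s ⟧ r (⟦⟧-self r)))
          (λ v v∈ p≢v → only p≢v (λ r≡v → true≢false v∈ (cong not (∪-left ⟦ r ⟧ ⟦ s ⟧ v (subst (λ u → ⟦ r ⟧ u ≡ true) r≡v (⟦⟧-self r)))))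
            (λ s≡v → true≢false v∈ (cong not (∪-right ⟦ r ⟧ ⟦ s ⟧ v (subst (λ u → ⟦ s ⟧ u ≡ true) s≡v (⟦⟧-self s)))))))
        (ℤ.≤-trans (ℤ.≤-reflexive (cut-∁ A)) cutA)
      val8 : + 8 ≤ valency p
      val8 = subst₂ _≤_ total sums (sum-mono excess)
        where
        sums : sum (λ v → single p (valency p - + 2) v + pair r s v) ≡ valency p
        sums = trans (∑-distrib-+ (single p (valency p - + 2)) (pair r s)) (trans (cong₂ _+_ (sum-single p (valency p - + 2)) (deg-pair r s)) (cancel (valency p)))
          where
          cancel : ∀ a → a - + 2 + + 2 ≡ a
          cancel = solve-∀
        excess : ∀ v → valency v - + 2 ≤ single p (valency p - + 2) v + pair r s v
        excess v = here (p Fin.≟ v) (r Fin.≟ v) (s Fin.≟ v)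
          where
          here : Dec (p ≡ v) → Dec (r ≡ v) → Dec (s ≡ v) → valency v - + 2 ≤ single p (valency p - + 2) v + pair r s v
          here (yes refl) _ _ = subst₂ _≤_ (ℤ.+-identityʳ _) (cong (_+ pair r s p) (sym (single-eq p (valency p - + 2)))) (ℤ.+-monoʳ-≤ (valency p - + 2) (pair≥0 r s p))
          here (no p≢v) (yes refl) _ = ℤ.≤-trans (ℤ.+-monoˡ-≤ (- + 2) val-r) (subst (1ℤ ≤_) (trans (sym (ℤ.+-identityˡ _)) (cong (_+ pair r s r) (sym (single-neq p (valency p - + 2) p≢v)))) (1≤pairˡ r s))
          here (no p≢v) (no _) (yes refl) = ℤ.≤-trans (ℤ.+-monoˡ-≤ (- + 2) val-s) (subst (1ℤ ≤_) (trans (sym (ℤ.+-identityˡ _)) (cong (_+ pair r s s) (sym (single-neq p (valency p - + 2) p≢v)))) (1≤pairʳ r s))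
          here (no p≢v) (no r≢v) (no s≢v) = ℤ.≤-trans (ℤ.i≤j⇒i-j≤0 (ℤ.≮⇒≥ λ lt → only p≢v r≢v s≢v (ℤ.i<j⇒suc[i]≤j lt)))
            (ℤ.≤-reflexive (sym (cong₂ _+_ (single-neq p (valency p - + 2) p≢v) (pair-avoids r≢v s≢v))))

    -- Any other vertex has valency at most 2, and by `valency≤` for its complement so has `p`.
    no-loner : ∀ {p} → Thick p → ¬ (∀ v → p ≢ v → ¬ Branching v)
    no-loner {p} thp alone = other (Fin.any? λ x → ¬? (p Fin.≟ x))
      where
      4≰2 : ¬ (+ 4 ≤ + 2)
      4≰2 = ℤ.<⇒≱ (+<+ (s≤s (s≤s (s≤s z≤n))))
      other : Dec (∃[ x ] p ≢ x) → ⊥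
      other (yes (x , p≢x)) = 4≰2 (ℤ.≤-trans thp (ℤ.≤-trans
        (valency≤ {∁ ⟦ x ⟧} {p} {x} (cong not (⟦⟧-other (λ x≡p → p≢x (sym x≡p)))) (cong not (⟦⟧-self x)) (λ v _ → alone v))
        (ℤ.≤-trans (ℤ.≤-reflexive (trans (cut-∁ ⟦ x ⟧) (cut-⟦⟧ x))) (ℤ.≮⇒≥ λ lt → alone x p≢x (ℤ.i<j⇒suc[i]≤j lt)))))
      other (no none) = 4≰2 (ℤ.≤-trans thp (ℤ.≤-trans (ℤ.≤-reflexive (trans (sum-cong-≗ λ w → no-edge w (p Fin.≟ w)) (sum-replicate-zero (suc n)))) (+≤+ z≤n)))
        where
        no-edge : ∀ w → Dec (p ≡ w) → m p w ≡ 0ℤ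
        no-edge w (yes refl) = m-loop p
        no-edge w (no p≢w) = ⊥-elim (none (w , p≢w))

    -- Vertices of valency at most 3 contribute at most 1 each to the total of 8, so four of them
    -- cannot account for it.
    fresh : (∀ v → ¬ Thick v) → ∀ a b c d → ∃[ v ] Branching v × a ≢ v × b ≢ v × c ≢ v × d ≢ v
    fresh thin a b c d = decide (Fin.any? λ v → branching? v ×-dec (¬? (a Fin.≟ v) ×-dec (¬? (b Fin.≟ v) ×-dec (¬? (c Fin.≟ v) ×-dec ¬? (d Fin.≟ v)))))
      where
      Goal : Set
      Goal = ∃[ v ] Branching v × a ≢ v × b ≢ v × c ≢ v × d ≢ v
      decide : Dec Goal → Goal
      decide (yes found) = found
      decide (no none) = ⊥-elim (ℤ.<⇒≱ {+ 4} {+ 8} (+<+ (s≤s (s≤s (s≤s (s≤s (s≤s z≤n)))))) (subst₂ _≤_ total (deg-quad a b c d) (sum-mono excess)))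
        where
        one : ∀ v → valency v - + 2 ≤ 1ℤ
        one v = ℤ.+-monoˡ-≤ (- + 2) (ℤ.≮⇒≥ {+ 3} {valency v} λ lt → thin v (ℤ.i<j⇒suc[i]≤j lt))
        excess : ∀ v → valency v - + 2 ≤ pair a b v + pair c d v
        excess v = here (a Fin.≟ v) (b Fin.≟ v) (c Fin.≟ v) (d Fin.≟ v)
          where
          here : Dec (a ≡ v) → Dec (b ≡ v) → Dec (c ≡ v) → Dec (d ≡ v) → valency v - + 2 ≤ pair a b v + pair c d v
          here (yes refl) _ _ _ = ℤ.≤-trans (one a) (ℤ.+-mono-≤ (1≤pairˡ a b) (pair≥0 c d a))
          here (no _) (yes refl) _ _ = ℤ.≤-trans (one b) (ℤ.+-mono-≤ (1≤pairʳ a b) (pair≥0 c d b))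
          here (no _) (no _) (yes refl) _ = ℤ.≤-trans (one c) (ℤ.+-mono-≤ (pair≥0 a b c) (1≤pairˡ c d))
          here (no _) (no _) (no _) (yes refl) = ℤ.≤-trans (one d) (ℤ.+-mono-≤ (pair≥0 a b d) (1≤pairʳ c d))
          here (no a≢v) (no b≢v) (no c≢v) (no d≢v) = ℤ.≤-trans (ℤ.i≤j⇒i-j≤0 (ℤ.≮⇒≥ λ lt → none (v , ℤ.i<j⇒suc[i]≤j lt , a≢v , b≢v , c≢v , d≢v)))
            (quad≥0 a b c d v)

    -- With three chips on distinct branching vertices, `covered` puts the fourth chip on every
    -- further one; `fresh` finds a branching vertex where it is not.
    no-trivalent : ¬ (∀ v → ¬ Thick v)
    no-trivalent thin = with-p (fresh thin zero zero zero zero)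
      where
      with-p : (∃[ p ] Branching p × zero ≢ p × zero ≢ p × zero ≢ p × zero ≢ p) → ⊥
      with-p (p , brp , _) = with-q (fresh thin p p p p)
        where
        with-q : (∃[ q ] Branching q × p ≢ q × p ≢ q × p ≢ q × p ≢ q) → ⊥
        with-q (q , brq , p≢q , _) = with-r (fresh thin p q p q)
          where
          with-r : (∃[ r ] Branching r × p ≢ r × q ≢ r × p ≢ r × q ≢ r) → ⊥
          with-r (r , brr , p≢r , q≢r , _) = start (realise p q)
            where
            start : (∃[ a ] ∃[ b ] (λ v → pair p q v + pair a b v) ≋ D) → ⊥
            start (a , b , state) = finish (drive-to brp brq brr state λ c d st c≢r d≢r →
                Configuration.two-branching (λ v → pair p q v + pair c d v) (quad≥0 p q c d) (deg-quad p q c d) st brr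
                  (cong₂ _+_ (pair-avoids p≢r q≢r) (pair-avoids c≢r d≢r)) p≢q brp brq
                  (ℤ.+-mono-≤ (1≤pairˡ p q) (pair≥0 c d p)) (ℤ.+-mono-≤ (1≤pairʳ p q) (pair≥0 c d q)))
              where
              finish : (∃[ c ] (λ v → pair p q v + pair r c v) ≋ D) → ⊥
              finish (c , st) = last (fresh thin p q r c)
                where
                last : (∃[ s ] Branching s × p ≢ s × q ≢ s × r ≢ s × c ≢ s) → ⊥
                last (s , brs , p≢s , q≢s , r≢s , c≢s) = c≢s (covered brp brq brr brs p≢r p≢s q≢s r≢s st)

    -- From the total 8 and `r≤p` the valency of `p` is at least 6, and separating `p` from `r`
    -- takes six edges. Legal sets for three chips therefore contain both or neither. This gives
    -- `D ~ 2p + 2r`, and then `p + r` can be driven to every vertex.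
    banana : ∀ {p r} → Thick p → Branching r → p ≢ r → (∀ v → p ≢ v → r ≢ v → ¬ Branching v) → Pencil
    banana {p} {r} thp brr p≢r only = at-r (double thp brr p≢r)
      where
      r≢p : r ≢ p
      r≢p r≡p = p≢r (sym r≡p)
      6≰3 : ¬ (+ 6 ≤ + 3)
      6≰3 = ℤ.<⇒≱ (+<+ (s≤s (s≤s (s≤s (s≤s z≤n)))))
      r≤p : valency r ≤ valency p
      r≤p = ℤ.≤-trans (valency≤ {∁ ⟦ p ⟧} {r} {p} (cong not (⟦⟧-other p≢r)) (cong not (⟦⟧-self p))
          (λ v v∈ r≢v → only v (λ p≡v → true≢false v∈ (cong not (subst (λ u → ⟦ p ⟧ u ≡ true) p≡v (⟦⟧-self p)))) r≢v))
        (ℤ.≤-reflexive (trans (cut-∁ ⟦ p ⟧) (cut-⟦⟧ p)))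
      twelve : + 12 ≤ valency p + valency p
      twelve = ℤ.≤-trans (ℤ.≤-trans (ℤ.+-monoˡ-≤ (+ 4) (subst₂ _≤_ total sums (sum-mono excess))) (ℤ.≤-reflexive (cancel (valency p) (valency r))))
          (ℤ.+-monoʳ-≤ (valency p) r≤p)
        where
        cancel : ∀ a b → (a - + 2) + (b - + 2) + + 4 ≡ a + b
        cancel = solve-∀
        sums : sum (λ v → single p (valency p - + 2) v + single r (valency r - + 2) v) ≡ (valency p - + 2) + (valency r - + 2)
        sums = trans (∑-distrib-+ (single p (valency p - + 2)) (single r (valency r - + 2))) (cong₂ _+_ (sum-single p (valency p - + 2)) (sum-single r (valency r - + 2)))
        excess : ∀ v → valency v - + 2 ≤ single p (valency p - + 2) v + single r (valency r - + 2) v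
        excess v = here (p Fin.≟ v) (r Fin.≟ v)
          where
          here : Dec (p ≡ v) → Dec (r ≡ v) → valency v - + 2 ≤ single p (valency p - + 2) v + single r (valency r - + 2) v
          here (yes refl) _ = ℤ.≤-reflexive (trans (sym (ℤ.+-identityʳ (valency p - + 2))) (sym (cong₂ _+_ (single-eq p (valency p - + 2)) (single-neq r (valency r - + 2) r≢p))))
          here (no p≢v) (yes refl) = ℤ.≤-reflexive (trans (sym (ℤ.+-identityˡ (valency r - + 2))) (sym (cong₂ _+_ (single-neq p (valency p - + 2) p≢v) (single-eq r (valency r - + 2)))))
          here (no p≢v) (no r≢v) = ℤ.≤-trans (ℤ.i≤j⇒i-j≤0 (ℤ.≮⇒≥ λ lt → only v p≢v r≢v (ℤ.i<j⇒suc[i]≤j lt)))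
            (ℤ.≤-reflexive (sym (cong₂ _+_ (single-neq p (valency p - + 2) p≢v) (single-neq r (valency r - + 2) r≢v))))
      six : + 6 ≤ valency p
      six = ℤ.≮⇒≥ λ lt → ℤ.<⇒≱ (ℤ.+-mono-< lt lt) twelve
      wide : ∀ {A} → A p ≡ true → A r ≡ false → + 6 ≤ cut A
      wide {A} p∈ r∉ = ℤ.≤-trans six (valency≤ {A} {p} {r} p∈ r∉ λ v v∈ p≢v → only v p≢v λ r≡v → true≢false v∈ (subst (λ u → A u ≡ false) r≡v r∉))
      wide′ : ∀ {A} → A r ≡ true → A p ≡ false → + 6 ≤ cut A
      wide′ {A} r∈ p∉ = subst (+ 6 ≤_) (cut-∁ A) (wide {∁ A} (cong not p∉) (cong not r∈))
      deg3 : ∀ a b c → deg G (λ v → pt a v + pair b c v) ≡ + 3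
      deg3 a b c = trans (∑-distrib-+ (pt a) (pair b c)) (cong₂ _+_ (sum-pt a) (deg-pair b c))
      three≥0 : ∀ a b c → Effective G (λ v → pt a v + pair b c v)
      three≥0 a b c v = ℤ.+-mono-≤ (pt≥0 a v) (pair≥0 b c v)
      small : ∀ {a b c w} (L : Legal (λ v → pt a v + pair b c v) w) → cut (Legal.set L) ≤ + 3
      small {a} {b} {c} (legal A _ _ bound) = subst (cut A ≤_) (deg3 a b c) (sum-mono (∂-bounded A bound λ v _ → three≥0 a b c v))
      at-r : (∃[ b ] (λ v → pair p p v + pair r b v) ≋ D) → Pencil
      at-r (b , state) = on-r (b Fin.≟ r)
        where
        on-r : Dec (b ≡ r) → Pencil
        on-r (no b≢r) = ⊥-elim (sided (status (set p)))
          where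
          L : Legal (λ v → pt b v + pair p p v) r
          L = reach r (λ v → pt b v + pair p p v) r (≋-congˡ (λ v → regroup (pair p p v) (pt r v) (pt b v)) state)
                (cong₂ _+_ (pt-other b≢r) (pair-avoids p≢r p≢r))
            where
            regroup : ∀ x r b → x + (r + b) ≡ r + (b + x)
            regroup = solve-∀
          open Legal L
          sided : (set p ≡ true) ⊎ (set p ≡ false) → ⊥
          sided (inj₁ p∈) = 6≰3 (ℤ.≤-trans (wide {set} p∈ avoids) (small L))
          sided (inj₂ p∉) = 2≰1 (ℤ.≤-trans (cut≥2 set nonempty avoids) (subst (cut set ≤_) (sum-pt b) (sum-mono (∂-bounded set
            (λ v v∈ → ℤ.≤-trans (bound v v∈) (ℤ.≤-reflexive (trans (cong (_+_ (pt b v)) (pair-avoids (λ p≡v → true≢false v∈ (subst (λ u → set u ≡ false) p≡v p∉))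
              (λ p≡v → true≢false v∈ (subst (λ u → set u ≡ false) p≡v p∉)))) (ℤ.+-identityʳ (pt b v))))) (λ v _ → pt≥0 b v)))))
        on-r (yes refl) = pair p r , deg-pair p r , λ w → pair-drive w (λ _ _ → ⊤) (step w) tt
          where
          step : ∀ w c d → pair c d ≋ pair p r → ⊤ → EffClass (λ v → pair p r v - pt w v) ⊎ (Σ[ M ∈ Move c d w ] ⊤)
          step w c d cd≋ _ = found (c Fin.≟ w) (d Fin.≟ w)
            where
            reached : ∀ u → pair w u ≋ pair p r → EffClass (λ v → pair p r v - pt w v)
            reached u eqv = pt u , pt≥0 u , proj₁ back , λ v → trans (cong (_- pt w v) (proj₂ back v)) (cancel (pt w v) (pt u v) (lap (proj₁ back) v))
              where
              back : pair p r ≋ pair w u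
              back = ≋-sym {pair w u} {pair p r} eqv
              cancel : ∀ a b c → a + b + c - a ≡ b + c
              cancel = solve-∀
            st : (λ v → pair p r v + pair c d v) ≋ D
            st = replace {pair p r} {pair p r} {pair c d} (≋-congˡ (λ v → regroup (pt p v) (pt r v)) state) cd≋
              where
              regroup : ∀ p r → (p + p) + (r + r) ≡ (p + r) + (p + r)
              regroup = solve-∀
            found : Dec (c ≡ w) → Dec (d ≡ w) → EffClass (λ v → pair p r v - pt w v) ⊎ (Σ[ M ∈ Move c d w ] ⊤)
            found (yes refl) _ = inj₁ (reached d cd≋)
            found (no _) (yes refl) = inj₁ (reached c (≋-trans {pair d c} {pair c d} {pair p r} (≋-cong (pair-comm d c)) cd≋))
            found (no c≢w) (no d≢w) = at-end (p Fin.≟ w) (r Fin.≟ w)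
              where
              at-end : Dec (p ≡ w) → Dec (r ≡ w) → EffClass (λ v → pair p r v - pt w v) ⊎ (Σ[ M ∈ Move c d w ] ⊤)
              at-end (yes refl) _ = inj₁ (reached r ≋-refl)
              at-end (no _) (yes refl) = inj₁ (reached p (≋-cong (pair-comm r p)))
              at-end (no p≢w) (no r≢w) = inj₂ (move (combine (sides L₁) (sides L₂)) , tt)
                where
                L₁ : Legal (λ v → pt r v + pair c d v) w
                L₁ = reach p (λ v → pt r v + pair c d v) w (≋-congˡ (λ v → ℤ.+-assoc (pt p v) (pt r v) (pair c d v)) st)
                       (cong₂ _+_ (pt-other r≢w) (pair-avoids c≢w d≢w))
                L₂ : Legal (λ v → pt p v + pair c d v) w
                L₂ = reach r (λ v → pt p v + pair c d v) w (≋-congˡ (λ v → regroup (pt p v) (pt r v) (pair c d v)) st)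
                       (cong₂ _+_ (pt-other p≢w) (pair-avoids c≢w d≢w))
                  where
                  regroup : ∀ a b x → (a + b) + x ≡ b + (a + x)
                  regroup = solve-∀
                Sides : VSet → Set
                Sides A = (A p ≡ true × A r ≡ true) ⊎ (A p ≡ false × A r ≡ false)
                sides : ∀ {a} (L : Legal (λ v → pt a v + pair c d v) w) → Sides (Legal.set L)
                sides {a} L = here (status (Legal.set L p)) (status (Legal.set L r))
                  where
                  here : (Legal.set L p ≡ true) ⊎ (Legal.set L p ≡ false) → (Legal.set L r ≡ true) ⊎ (Legal.set L r ≡ false) → Sides (Legal.set L)
                  here (inj₁ p∈) (inj₁ r∈) = inj₁ (p∈ , r∈)
                  here (inj₂ p∉) (inj₂ r∉) = inj₂ (p∉ , r∉)
                  here (inj₁ p∈) (inj₂ r∉) = ⊥-elim (6≰3 (ℤ.≤-trans (wide {Legal.set L} p∈ r∉) (small L)))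
                  here (inj₂ p∉) (inj₁ r∈) = ⊥-elim (6≰3 (ℤ.≤-trans (wide′ {Legal.set L} r∈ p∉) (small L)))
                drop : ∀ {a} v → a ≢ v → pt a v + pair c d v ≡ pair c d v
                drop v a≢v = trans (cong (_+ pair c d v) (pt-other a≢v)) (ℤ.+-identityˡ (pair c d v))
                without : ∀ {a} (L : Legal (λ v → pt a v + pair c d v) w) → Legal.set L a ≡ false → Legal (pair c d) w
                without {a} L a∉ = relax {λ v → pt a v + pair c d v} {pair c d} L λ v v∈ → ℤ.≤-reflexive
                  (drop v λ a≡v → true≢false v∈ (subst (λ u → Legal.set L u ≡ false) a≡v a∉))
                combine : Sides (Legal.set L₁) → Sides (Legal.set L₂) → Legal (pair c d) w
                combine (inj₂ (_ , r∉)) _ = without L₁ r∉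
                combine (inj₁ _) (inj₂ (p∉ , _)) = without L₂ p∉
                -- In `A₁` the chip at `p` is held back, in `A₂` the one at `r`. So in the union
                -- neither needs more than `c + d` provides.
                combine (inj₁ (p∈₁ , r∈₁)) (inj₁ (p∈₂ , r∈₂)) = legal (A₁ ∪ A₂) (∪-avoid A₁ A₂ w (Legal.avoids L₁) (Legal.avoids L₂))
                    (∪-left A₁ A₂ p p∈₁) λ v v∈ → bound v (p Fin.≟ v) (r Fin.≟ v) (∪-cases A₁ A₂ v v∈)
                  where
                  A₁ A₂ : VSet
                  A₁ = Legal.set L₁
                  A₂ = Legal.set L₂
                  left : ∀ v → A₁ v ≡ true → r ≢ v → out (A₁ ∪ A₂) v ≤ pair c d v
                  left v v∈ r≢v = ℤ.≤-trans (out-∪ˡ A₁ A₂ v) (ℤ.≤-trans (Legal.bound L₁ v v∈) (ℤ.≤-reflexive (drop v r≢v)))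
                  right : ∀ v → A₂ v ≡ true → p ≢ v → out (A₁ ∪ A₂) v ≤ pair c d v
                  right v v∈ p≢v = ℤ.≤-trans (out-∪ʳ A₁ A₂ v) (ℤ.≤-trans (Legal.bound L₂ v v∈) (ℤ.≤-reflexive (drop v p≢v)))
                  bound : ∀ v → Dec (p ≡ v) → Dec (r ≡ v) → (A₁ v ≡ true) ⊎ (A₂ v ≡ true) → out (A₁ ∪ A₂) v ≤ pair c d v
                  bound v _ (yes refl) _ = right v r∈₂ p≢r
                  bound v (yes refl) (no r≢v) _ = left v p∈₁ r≢v
                  bound v (no p≢v) (no r≢v) (inj₁ v∈) = left v v∈ r≢v
                  bound v (no p≢v) (no r≢v) (inj₂ v∈) = right v v∈ p≢v

    three-connected : Pencil
    three-connected = by-thick (Fin.any? λ v → + 4 ℤ.≤? valency v)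
      where
      by-thick : Dec (∃[ p ] Thick p) → Pencil
      by-thick (no none) = ⊥-elim (no-trivalent λ v th → none (v , th))
      by-thick (yes (p , thp)) = by-second (Fin.any? λ r → ¬? (p Fin.≟ r) ×-dec branching? r)
        where
        by-second : Dec (∃[ r ] p ≢ r × Branching r) → Pencil
        by-second (no none) = ⊥-elim (no-loner thp λ v p≢v brv → none (v , p≢v , brv))
        by-second (yes (r , p≢r , brr)) = by-third (Fin.any? λ s → ¬? (p Fin.≟ s) ×-dec (¬? (r Fin.≟ s) ×-dec branching? s))
          where
          by-third : Dec (∃[ s ] p ≢ s × r ≢ s × Branching s) → Pencil
          by-third (yes (s , p≢s , r≢s , brs)) = ⊥-elim (no-triangle thp brr brs p≢r p≢s r≢s)
          by-third (no none) = banana thp brr p≢r λ v p≢v r≢v brv → none (v , p≢v , r≢v , brv)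

-- Elementary inequalities for ranks, and Clifford's inequality

module Ranks (G : Graph) where
  open Graph G
  open Theory G
  open Firing G
  open Blobs G using (effClass-≋)

  effClass-deg : ∀ {X} → EffClass X → 0ℤ ≤ deg G X
  effClass-deg {X} (E , E≥0 , X≋E) = subst (0ℤ ≤_) (sym (≋-deg {X} {E} X≋E)) (sum-nonneg E≥0)

  effClass-+ : ∀ {X Y} → EffClass X → EffClass Y → EffClass (λ v → X v + Y v)
  effClass-+ {X} {Y} (E , E≥0 , X≋E) (F , F≥0 , Y≋F) = (λ v → E v + F v) , (λ v → ℤ.+-mono-≤ (E≥0 v) (F≥0 v)) , ≋-+ {X} {E} {Y} {F} X≋E Y≋F

  effClass-add : ∀ {X Y} → EffClass X → Effective G Y → EffClass (λ v → X v + Y v)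
  effClass-add {X} {Y} e Y≥0 = effClass-+ {X} {Y} e (Y , Y≥0 , ≋-refl)

  rank-≋ : ∀ {X Y r} → X ≋ Y → Rank≥ Y r → Rank≥ X r
  rank-≋ {X} {Y} (f , eq) rank E E≥0 degE = effClass-≋ {λ v → X v - E v} {λ v → Y v - E v}
    (f , λ v → trans (cong (_- E v) (eq v)) (regroup (Y v) (lap f v) (E v))) (rank E E≥0 degE)
    where
    regroup : ∀ a b c → a + b - c ≡ a - c + b
    regroup = solve-∀

  rank-zero : ∀ {X} → Rank≥ X 0 → EffClass X
  rank-zero {X} rank = effClass-≋ {X} {λ v → X v - 0ℤ} (≋-cong λ v → sym (ℤ.+-identityʳ (X v)))
    (rank (λ _ → 0ℤ) (λ _ → ℤ.≤-refl) (sum-replicate-zero (suc n)))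

  zero-rank : ∀ {X} → EffClass X → Rank≥ X 0
  zero-rank {X} e E E≥0 degE = effClass-≋ {λ v → X v - E v} {X}
    (≋-cong λ v → trans (cong (_-_ (X v)) (zero-sum E E≥0 degE v)) (ℤ.+-identityʳ (X v))) e

  rank-suc : ∀ {X r} → (∀ w → Rank≥ (λ v → X v - pt w v) r) → Rank≥ X (suc r)
  rank-suc {X} {r} rank E E≥0 degE = remove (nonempty-sum E E≥0 (subst (1ℤ ≤_) (sym degE) (+≤+ (s≤s z≤n))))
    where
    remove : (∃[ w ] 1ℤ ≤ E w) → EffClass (λ v → X v - E v)
    remove (w , Ew) = effClass-≋ {λ v → X v - E v} {λ v → X v - pt w v - (E v - pt w v)}
      (≋-cong λ v → regroup (X v) (E v) (pt w v))
      (rank w (λ v → E v - pt w v) (remove≥0 E w E≥0 Ew) (trans (deg-remove E w) (cong (_- 1ℤ) degE)))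
      where
      regroup : ∀ x e p → x - e ≡ x - p - (e - p)
      regroup = solve-∀

  rank-pred : ∀ {X r} → Rank≥ X (suc r) → ∀ w → Rank≥ (λ v → X v - pt w v) r
  rank-pred {X} {r} rank w E E≥0 degE = effClass-≋ {λ v → X v - pt w v - E v} {λ v → X v - (pt w v + E v)}
    (≋-cong λ v → regroup (X v) (pt w v) (E v))
    (rank (λ v → pt w v + E v) (λ v → ℤ.+-mono-≤ (pt≥0 w v) (E≥0 v)) (trans (∑-distrib-+ (pt w) E) (cong₂ _+_ (sum-pt w) degE)))
    where
    regroup : ∀ x p e → x - p - e ≡ x - (p + e)
    regroup = solve-∀

  rank-less : ∀ {X r} → Rank≥ X (suc r) → Rank≥ X r
  rank-less {X} {r} rank E E≥0 degE = effClass-≋ {λ v → X v - E v} {λ v → X v - pt zero v - E v + pt zero v}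
    (≋-cong λ v → regroup (X v) (E v) (pt zero v))
    (effClass-add {λ v → X v - pt zero v - E v} {pt zero} (rank-pred {X} {r} rank zero E E≥0 degE) (pt≥0 zero))
    where
    regroup : ∀ x e p → x - e ≡ x - p - e + p
    regroup = solve-∀

  rank-mono : ∀ k {X r} → Rank≥ X (k ℕ.+ r) → Rank≥ X r
  rank-mono zero rank = rank
  rank-mono (suc k) {X} {r} rank = rank-mono k {X} {r} (rank-less {X} {k ℕ.+ r} rank)

  rank-≤ : ∀ {X r s} → s ℕ.≤ r → Rank≥ X r → Rank≥ X s
  rank-≤ {X} {r} {s} s≤r rank = rank-mono (r ℕ.∸ s) {X} {s} (subst (Rank≥ X) (sym (ℕ.m∸n+n≡m s≤r)) rank)

  -- Points are removed one at a time from a summand that still has positive rank.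
  superadditive : ∀ r s {X Y} → Rank≥ X r → Rank≥ Y s → Rank≥ (λ v → X v + Y v) (r ℕ.+ s)
  superadditive zero zero {X} {Y} rX rY = zero-rank {λ v → X v + Y v} (effClass-+ {X} {Y} (rank-zero {X} rX) (rank-zero {Y} rY))
  superadditive zero (suc s) {X} {Y} rX rY = rank-suc {λ v → X v + Y v} λ w → rank-≋ {λ v → X v + Y v - pt w v} {λ v → X v + (Y v - pt w v)}
    (≋-cong λ v → ℤ.+-assoc (X v) (Y v) (- pt w v)) (superadditive zero s {X} {λ v → Y v - pt w v} rX (rank-pred {Y} {s} rY w))
  superadditive (suc r) s {X} {Y} rX rY = rank-suc {λ v → X v + Y v} λ w → rank-≋ {λ v → X v + Y v - pt w v} {λ v → X v - pt w v + Y v}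
    (≋-cong λ v → regroup (X v) (Y v) (pt w v)) (superadditive r s {λ v → X v - pt w v} {Y} (rank-pred {X} {r} rX w) rY)
    where
    regroup : ∀ x y p → x + y - p ≡ x - p + y
    regroup = solve-∀

  rank≤deg : ∀ {X r} → Rank≥ X r → + r ≤ deg G X
  rank≤deg {X} {r} rank = ℤ.0≤i-j⇒j≤i (subst (0ℤ ≤_) (trans (sum-sub X E) (cong (_-_ (sum X)) (sum-single o (+ r))))
      (effClass-deg {λ v → X v - E v} (rank E nonneg (sum-single o (+ r)))))
    where
    o : Vertex
    o = zero
    E : Divisor G
    E = single o (+ r)
    nonneg : Effective G E
    nonneg v = here (o Fin.≟ v)
      where
      here : Dec (o ≡ v) → 0ℤ ≤ E v
      here (yes refl) = subst (0ℤ ≤_) (sym (single-eq o (+ r))) (+≤+ z≤n)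
      here (no ne) = ℤ.≤-reflexive (sym (single-neq o (+ r) ne))

  deg-K- : ∀ X → deg G (λ v → canonical v - X v) ≡ (genus G - 1ℤ) + (genus G - 1ℤ) - deg G X
  deg-K- X = trans (sum-sub canonical X) (cong (_- sum X) deg-canonical)

  -- Clifford: r(X) + r(K - X) ≤ r(K) ≤ g - 1
  clifford : ∀ {X r} s → Rank≥ X r → + s ≡ + r - deg G X + (genus G - 1ℤ) → genus G ≤ + (r ℕ.+ s) → ⊥
  -- If the canonical class had rank at least `g`, Riemann-Roch would give the difference of two
  -- canonical divisors, of degree 0, a positive rank.
  clifford {X} {r} s rank s≡ g≤ = ℤ.<⇒≱ {0ℤ} {+ suc t} (+<+ (s≤s z≤n))
      (ℤ.≤-trans (rank≤deg {λ v → canonical v - K v} (riemann-roch K (r ℕ.+ s) (suc t) rankK t≡))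
        (ℤ.≤-reflexive (trans (deg-K- K) (trans (cong (_-_ ((genus G - 1ℤ) + (genus G - 1ℤ))) degK) (ℤ.+-inverseʳ ((genus G - 1ℤ) + (genus G - 1ℤ)))))))
    where
    K : Divisor G
    K v = X v + (canonical v - X v)
    rankK : Rank≥ K (r ℕ.+ s)
    rankK = superadditive r s {X} {λ v → canonical v - X v} rank (riemann-roch X r s rank s≡)
    degK : deg G K ≡ (genus G - 1ℤ) + (genus G - 1ℤ)
    degK = trans (sum-cong-≗ λ v → cancel (X v) (canonical v)) deg-canonical
      where
      cancel : ∀ x k → x + (k - x) ≡ k
      cancel = solve-∀
    t : ℕ
    t = ∣ + (r ℕ.+ s) - genus G ∣
    t≡ : + suc t ≡ + (r ℕ.+ s) - deg G K + (genus G - 1ℤ)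
    t≡ = trans (cong (_+_ 1ℤ) (ℤ.0≤i⇒+∣i∣≡i (ℤ.i≤j⇒0≤j-i g≤)))
      (trans (regroup (+ (r ℕ.+ s)) (genus G)) (cong (λ d → + (r ℕ.+ s) - d + (genus G - 1ℤ)) (sym degK)))
      where
      regroup : ∀ a g → 1ℤ + (a - g) ≡ a - ((g - 1ℤ) + (g - 1ℤ)) + (g - 1ℤ)
      regroup = solve-∀

  rank-from-points : ∀ {X} → (∀ w → EffClass (λ v → X v - pt w v)) → Rank≥ X 1
  rank-from-points {X} e = rank-suc {X} λ w → zero-rank {λ v → X v - pt w v} (e w)

  rank-to-points : ∀ {X} → Rank≥ X 1 → ∀ w → EffClass (λ v → X v - pt w v)
  rank-to-points {X} rank w = rank-zero {λ v → X v - pt w v} (rank-pred {X} {0} rank w)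

  -- The dual has rank at least `g - 1`, so the ranks add up to `g`, which `clifford` excludes.
  no-pencil-of-degree-1 : ∀ {X} → deg G X ≡ 1ℤ → 1ℤ ≤ genus G → ¬ Rank≥ X 1
  no-pencil-of-degree-1 {X} deg1 g≥1 rank = clifford {X} {1} s rank
      (trans s≡ (trans (regroup (genus G)) (cong (λ d → 1ℤ - d + (genus G - 1ℤ)) (sym deg1))))
      (ℤ.≤-reflexive (trans (regroup′ (genus G)) (cong (_+_ 1ℤ) (sym s≡))))
    where
    s : ℕ
    s = ∣ genus G - 1ℤ ∣
    s≡ : + s ≡ genus G - 1ℤ
    s≡ = ℤ.0≤i⇒+∣i∣≡i (ℤ.i≤j⇒0≤j-i g≥1)
    regroup : ∀ g → g - 1ℤ ≡ 1ℤ - 1ℤ + (g - 1ℤ)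
    regroup = solve-∀
    regroup′ : ∀ g → g ≡ 1ℤ + (g - 1ℤ)
    regroup′ = solve-∀

  -- The dual has rank at least `g - 2`, and again the ranks add up to `g`.
  no-net-of-degree-3 : ∀ {X} → deg G X ≡ + 3 → + 2 ≤ genus G → ¬ Rank≥ X 2
  no-net-of-degree-3 {X} deg3 g≥2 rank = clifford {X} {2} s rank
      (trans s≡ (trans (regroup (genus G)) (cong (λ d → + 2 - d + (genus G - 1ℤ)) (sym deg3))))
      (ℤ.≤-reflexive (trans (regroup′ (genus G)) (cong (_+_ (+ 2)) (sym s≡))))
    where
    s : ℕ
    s = ∣ genus G - + 2 ∣
    s≡ : + s ≡ genus G - + 2
    s≡ = ℤ.0≤i⇒+∣i∣≡i (ℤ.i≤j⇒0≤j-i g≥2)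
    regroup : ∀ g → g - + 2 ≡ + 2 - + 3 + (g - 1ℤ)
    regroup = solve-∀
    regroup′ : ∀ g → g ≡ + 2 + (g - + 2)
    regroup′ = solve-∀

  -- After the removal the degree is still at least `g`, too large to lie below an orientation
  -- divisor of degree `g - 1`.
  riemann : ∀ X r → + r + genus G ≤ deg G X → Rank≥ X r
  riemann X r le E E≥0 degE = dichotomy (effective-or-dominated (λ v → X v - E v))
    where
    dichotomy : (∃[ F ] Effective G F × (λ v → X v - E v) ≋ F) ⊎ (∃[ F ] Dominated F × (λ v → X v - E v) ≋ F) → EffClass (λ v → X v - E v)
    dichotomy (inj₁ e) = e
    dichotomy (inj₂ (F , (rk , inj , F≤ν) , eqv)) = ⊥-elim (below (genus G) (ℤ.≤-trans (ℤ.≤-trans (ℤ.≤-reflexive (regroup (genus G) (+ r)))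
        (ℤ.+-monoˡ-≤ (- + r) le)) (subst₂ _≤_ (trans (sym (≋-deg {λ v → X v - E v} {F} eqv)) (trans (sum-sub X E) (cong (_-_ (sum X)) degE))) (deg-ν rk inj) (sum-mono F≤ν))))
      where
      regroup : ∀ g r → g ≡ r + g - r
      regroup = solve-∀
      below : ∀ g → ¬ (g ≤ g - 1ℤ)
      below g p = ℤ.<⇒≱ (-<+ {0}) (subst (0ℤ ≤_) (cancel g) (ℤ.i≤j⇒0≤j-i p))
        where
        cancel : ∀ g → g - 1ℤ - g ≡ -1ℤ
        cancel = solve-∀

-- Graphs glued at a cut vertex

agree-at : ∀ {n} {f g : Fin n → ℤ} a → (∀ v → a ≢ v → f v ≡ g v) → sum f ≡ sum g → f a ≡ g a
agree-at {f = f} {g} a eq same = ℤ.i-j≡0⇒i≡j (f a) (g a) (trans (sym (sum-single a (f a - g a))) (trans (sum-cong-≗ pointwise)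
    (trans (sum-sub f g) (trans (cong (_- sum g) same) (ℤ.+-inverseʳ (sum g))))))
  where
  pointwise : ∀ v → single a (f a - g a) v ≡ f v - g v
  pointwise v = here (a Fin.≟ v)
    where
    here : Dec (a ≡ v) → single a (f a - g a) v ≡ f v - g v
    here (yes refl) = single-eq a (f a - g a)
    here (no a≢v) = trans (single-neq a (f a - g a) a≢v) (sym (trans (cong (_- g v) (eq v a≢v)) (ℤ.+-inverseʳ (g v))))

-- The part S of G, attached to the rest of G only at a, on the vertex set of G:
-- the vertices outside S are made leaves at a.
module Side (G : Graph) (S : Graph.Vertex G → Bool) (a : Graph.Vertex G) (a∈ : S a ≡ true)
            (closed : ∀ v w → S v ≡ true → S w ≡ false → a ≢ v → Graph.mult G v w ≡ 0) where
  open Graph G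
  open Theory G
  open Firing G

  is-a : Vertex → Bool
  is-a v = does (a Fin.≟ v)

  edge : Bool → Bool → Bool → Bool → ℕ → ℕ
  edge true  true  _     _     k = k
  edge true  false va    _     k = if va then 1 else 0
  edge false true  _     wa    k = if wa then 1 else 0
  edge false false _     _     k = 0

  edge-sym : ∀ sv sw va wa k → edge sv sw va wa k ≡ edge sw sv wa va k
  edge-sym true  true  va wa k = refl
  edge-sym true  false va wa k = refl
  edge-sym false true  va wa k = refl
  edge-sym false false va wa k = refl

  mult′ : Vertex → Vertex → ℕ
  mult′ v w = edge (S v) (S w) (is-a v) (is-a w) (mult v w)

  mult-in : ∀ {v w} → S v ≡ true → a ≢ v → mult′ v w ≡ mult v w
  mult-in {v} {w} v∈ a≢v = here (status (S w))
    where
    here : (S w ≡ true) ⊎ (S w ≡ false) → mult′ v w ≡ mult v w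
    here (inj₁ w∈) = cong₂ (λ x y → edge x y (is-a v) (is-a w) (mult v w)) v∈ w∈
    here (inj₂ w∉) = trans (cong₂ (λ x y → edge x y (is-a v) (is-a w) (mult v w)) v∈ w∉)
      (trans (cong (λ b → if b then 1 else 0) (dec-false (a Fin.≟ v) a≢v)) (sym (closed v w v∈ w∉ a≢v)))

  mult-out : ∀ {v w} → S v ≡ false → mult′ v w ≡ (if is-a w then 1 else 0)
  mult-out {v} {w} v∉ = here (status (S w))
    where
    here : (S w ≡ true) ⊎ (S w ≡ false) → mult′ v w ≡ (if is-a w then 1 else 0)
    here (inj₁ w∈) = cong₂ (λ x y → edge x y (is-a v) (is-a w) (mult v w)) v∉ w∈
    here (inj₂ w∉) = trans (cong₂ (λ x y → edge x y (is-a v) (is-a w) (mult v w)) v∉ w∉)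
      (sym (cong (λ b → if b then 1 else 0) (dec-false (a Fin.≟ w) λ { refl → true≢false a∈ w∉ })))

  symmetric′ : ∀ v w → mult′ v w ≡ mult′ w v
  symmetric′ v w = trans (cong (edge (S v) (S w) (is-a v) (is-a w)) (symmetric v w)) (edge-sym (S v) (S w) (is-a v) (is-a w) (mult w v))

  loopless′ : ∀ v → mult′ v v ≡ 0
  loopless′ v = here (status (S v))
    where
    here : (S v ≡ true) ⊎ (S v ≡ false) → mult′ v v ≡ 0
    here (inj₁ v∈) = trans (cong₂ (λ x y → edge x y (is-a v) (is-a v) (mult v v)) v∈ v∈) (loopless v)
    here (inj₂ v∉) = cong₂ (λ x y → edge x y (is-a v) (is-a v) (mult v v)) v∉ v∉

  Adjacent′ : Vertex → Vertex → Set
  Adjacent′ v w = 0 ℕ.< mult′ v w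

  to-a : ∀ v → Star Adjacent′ v a
  to-a v = here (status (S v))
    where
    walk : ∀ {v} → S v ≡ true → Star Adjacent v a → Star Adjacent′ v a
    walk v∈ ε = ε
    walk {v} v∈ (_◅_ {_} {w} adj path) = step (a Fin.≟ v) (status (S w))
      where
      step : Dec (a ≡ v) → (S w ≡ true) ⊎ (S w ≡ false) → Star Adjacent′ v a
      step (yes refl) _ = ε
      step (no a≢v) (inj₁ w∈) = subst (0 ℕ.<_) (sym (mult-in v∈ a≢v)) adj ◅ walk w∈ path
      step (no a≢v) (inj₂ w∉) = ⊥-elim (ℕ.n≮0 (subst (0 ℕ.<_) (closed v w v∈ w∉ a≢v) adj))
    here : (S v ≡ true) ⊎ (S v ≡ false) → Star Adjacent′ v a
    here (inj₁ v∈) = walk v∈ (connected v a)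
    here (inj₂ v∉) = subst (0 ℕ.<_) (sym (trans (mult-out v∉) (cong (λ b → if b then 1 else 0) (dec-true (a Fin.≟ a) refl)))) (s≤s z≤n) ◅ ε

  side : Graph
  side = record
    { n = n ; mult = mult′ ; symmetric = symmetric′ ; loopless = loopless′
    ; connected = λ v w → to-a v ◅◅ reverse (λ {x} {y} → subst (0 ℕ.<_) (symmetric′ x y)) (to-a w) }

  module S = Theory side

  lap-in : ∀ {f g : Vertex → ℤ} {v} → S v ≡ true → a ≢ v → (∀ w → S w ≡ true → f w ≡ g w) → S.lap f v ≡ lap g v
  lap-in {f} {g} {v} v∈ a≢v f≡g = sum-cong-≗ λ w → term w (status (S w))
    where
    term : ∀ w → (S w ≡ true) ⊎ (S w ≡ false) → S.m v w * (f v - f w) ≡ m v w * (g v - g w)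
    term w (inj₁ w∈) = cong₂ _*_ (cong +_ (mult-in v∈ a≢v)) (cong₂ _-_ (f≡g v v∈) (f≡g w w∈))
    term w (inj₂ w∉) = trans (cong (λ k → + k * (f v - f w)) (trans (mult-in v∈ a≢v) (closed v w v∈ w∉ a≢v)))
      (sym (cong (λ k → + k * (g v - g w)) (closed v w v∈ w∉ a≢v)))

  lap-out : ∀ {f : Vertex → ℤ} {v} → S v ≡ false → S.lap f v ≡ f v - f a
  lap-out {f} {v} v∉ = trans (sum-cong-≗ λ w → term w (a Fin.≟ w)) (sum-single a (f v - f a))
    where
    term : ∀ w → Dec (a ≡ w) → S.m v w * (f v - f w) ≡ single a (f v - f a) w
    term w (yes refl) = trans (cong (λ k → + k * (f v - f a)) (trans (mult-out v∉) (cong (λ b → if b then 1 else 0) (dec-true (a Fin.≟ a) refl))))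
      (trans (ℤ.*-identityˡ (f v - f a)) (sym (single-eq a (f v - f a))))
    term w (no a≢w) = trans (cong (λ k → + k * (f v - f w)) (trans (mult-out v∉) (cong (λ b → if b then 1 else 0) (dec-false (a Fin.≟ w) a≢w))))
      (sym (single-neq a (f v - f a) a≢w))

  inside : Divisor G → Divisor G
  inside E v = if S v then (if is-a v then 0ℤ else E v) else 0ℤ

  inside-a : ∀ E → inside E a ≡ 0ℤ
  inside-a E = trans (cong (λ b → if b then (if is-a a then 0ℤ else E a) else 0ℤ) a∈) (cong (λ b → if b then 0ℤ else E a) (dec-true (a Fin.≟ a) refl))

  inside-in : ∀ E {v} → S v ≡ true → a ≢ v → inside E v ≡ E v
  inside-in E {v} v∈ a≢v = trans (cong (λ b → if b then (if is-a v then 0ℤ else E v) else 0ℤ) v∈) (cong (λ b → if b then 0ℤ else E v) (dec-false (a Fin.≟ v) a≢v))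

  inside-out : ∀ E {v} → S v ≡ false → inside E v ≡ 0ℤ
  inside-out E {v} v∉ = cong (λ b → if b then (if is-a v then 0ℤ else E v) else 0ℤ) v∉

  inside≥0 : ∀ {E} → Effective G E → Effective G (inside E)
  inside≥0 {E} E≥0 v = nonneg (S v) (is-a v)
    where
    nonneg : ∀ b c → 0ℤ ≤ (if b then (if c then 0ℤ else E v) else 0ℤ)
    nonneg true  true  = ℤ.≤-refl
    nonneg true  false = E≥0 v
    nonneg false _     = ℤ.≤-refl

  inside≤ : ∀ {E} → Effective G E → ∀ v → inside E v ≤ E v
  inside≤ {E} E≥0 v = bounded (S v) (is-a v)
    where
    bounded : ∀ b c → (if b then (if c then 0ℤ else E v) else 0ℤ) ≤ E v
    bounded true  true  = E≥0 v
    bounded true  false = ℤ.≤-refl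
    bounded false _     = E≥0 v

  -- All chips of `E` that are not strictly inside `S` are gathered at `a`; there are `k` of them.
  -- Away from `a` the equation is local, and at `a` it follows by comparing degrees with
  -- `agree-at`.
  restrict : ∀ {X} ((E , _) : EffClass X) → S.EffClass (λ v → X v - single a (deg G X - sum (inside E)) v)
  restrict {X} (E , E≥0 , f , eq) = inside E , inside≥0 E≥0 , g , everywhere
    where
    k : ℤ
    k = deg G X - sum (inside E)
    g : Vertex → ℤ
    -- At a leaf the script is chosen to send all of its chips to `a`.
    g v = if S v then f v else f a + X v
    g-in : ∀ {v} → S v ≡ true → g v ≡ f v
    g-in {v} v∈ = cong (λ b → if b then f v else f a + X v) v∈
    g-out : ∀ {v} → S v ≡ false → g v ≡ f a + X v
    g-out {v} v∉ = cong (λ b → if b then f v else f a + X v) v∉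
    off : ∀ v → a ≢ v → X v - single a k v ≡ inside E v + S.lap g v
    off v a≢v = trans (trans (cong (_-_ (X v)) (single-neq a k a≢v)) (ℤ.+-identityʳ (X v))) (here (status (S v)))
      where
      here : (S v ≡ true) ⊎ (S v ≡ false) → X v ≡ inside E v + S.lap g v
      here (inj₁ v∈) = trans (eq v) (sym (cong₂ _+_ (inside-in E v∈ a≢v) (lap-in {g} {f} v∈ a≢v λ w w∈ → g-in w∈)))
      here (inj₂ v∉) = trans (regroup (X v) (f a)) (sym (cong₂ _+_ (inside-out E v∉) (trans (lap-out {g} v∉) (cong₂ _-_ (g-out v∉) (g-in a∈)))))
        where
        regroup : ∀ x c → x ≡ 0ℤ + (c + x - c)
        regroup = solve-∀
    degrees : sum (λ v → X v - single a k v) ≡ sum (λ v → inside E v + S.lap g v)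
    degrees = begin
      sum (λ v → X v - single a k v)       ≡⟨ trans (sum-sub X (single a k)) (cong (_-_ (sum X)) (sum-single a k)) ⟩
      sum X - (sum X - sum (inside E))     ≡⟨ cancel (sum X) (sum (inside E)) ⟩
      sum (inside E) + 0ℤ                  ≡⟨ cong (_+_ (sum (inside E))) (S.deg-lap g) ⟨
      sum (inside E) + sum (S.lap g)       ≡⟨ ∑-distrib-+ (inside E) (S.lap g) ⟨
      sum (λ v → inside E v + S.lap g v)   ∎
      where
      open ≡-Reasoning
      cancel : ∀ x y → x - (x - y) ≡ y + 0ℤ
      cancel = solve-∀
    everywhere : ∀ v → X v - single a k v ≡ inside E v + S.lap g v
    everywhere v = here (a Fin.≟ v)
      where
      here : Dec (a ≡ v) → X v - single a k v ≡ inside E v + S.lap g v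
      here (no a≢v) = off v a≢v
      here (yes refl) = agree-at a off degrees

  leaf-≋ : ∀ {x} → S x ≡ false → S._≋_ (pt x) (pt a)
  leaf-≋ {x} x∉ = pt x , everywhere
    where
    x≢a : x ≢ a
    x≢a refl = true≢false a∈ x∉
    off : ∀ v → a ≢ v → pt x v ≡ pt a v + S.lap (pt x) v
    off v a≢v = here (status (S v))
      where
      here : (S v ≡ true) ⊎ (S v ≡ false) → pt x v ≡ pt a v + S.lap (pt x) v
      here (inj₂ v∉) = trans (regroup (pt x v)) (sym (cong₂ _+_ (pt-other a≢v) (trans (lap-out {pt x} v∉) (cong (_-_ (pt x v)) (pt-other x≢a)))))
        where
        regroup : ∀ p → p ≡ 0ℤ + (p - 0ℤ)
        regroup = solve-∀
      here (inj₁ v∈) = trans (pt-other {b = v} λ { refl → true≢false v∈ x∉ }) (sym (cong₂ _+_ (pt-other a≢v)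
        (trans (lap-in {pt x} {λ _ → 0ℤ} v∈ a≢v (λ w w∈ → pt-other λ { refl → true≢false w∈ x∉ })) (lap-0 v))))
    everywhere : ∀ v → pt x v ≡ pt a v + S.lap (pt x) v
    everywhere v = here (a Fin.≟ v)
      where
      here : Dec (a ≡ v) → pt x v ≡ pt a v + S.lap (pt x) v
      here (no a≢v) = off v a≢v
      here (yes refl) = agree-at a off (trans (sum-pt x) (sym (trans (∑-distrib-+ (pt a) (S.lap (pt x))) (cong₂ _+_ (sum-pt a) (S.deg-lap (pt x))))))

-- Both sides keep the vertex set of `G`, so a divisor on `G` can be read on either side without
-- renaming; a vertex foreign to a side counts as `a` there.
module Wedge (G : Graph) (A B : Graph.Vertex G → Bool) (a : Graph.Vertex G) (a∈A : A a ≡ true) (a∈B : B a ≡ true)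
             (closedA : ∀ v w → A v ≡ true → A w ≡ false → a ≢ v → Graph.mult G v w ≡ 0)
             (closedB : ∀ v w → B v ≡ true → B w ≡ false → a ≢ v → Graph.mult G v w ≡ 0)
             (opposite : ∀ v → a ≢ v → (A v ≡ true × B v ≡ false) ⊎ (A v ≡ false × B v ≡ true)) where
  open Graph G
  open Theory G
  open Firing G
  module A′ = Side G A a a∈A closedA
  module B′ = Side G B a a∈B closedB
  GA GB : Graph
  GA = A′.side
  GB = B′.side
  module TA = Theory GA
  module TB = Theory GB

  -- `k` and `l` are the numbers of chips of `E` not strictly inside `A` and `B`. Chips at `a` count
  -- in both, all others in exactly one.
  cut-apart : ∀ {X} → EffClass X → ∃[ k ] ∃[ l ] TA.EffClass (λ v → X v - single a k v) × TB.EffClass (λ v → X v - single a l v) × deg G X ≤ k + l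
  cut-apart {X} e@(E , E≥0 , eqv) = deg G X - sum (A′.inside E) , deg G X - sum (B′.inside E) , A′.restrict e , B′.restrict e ,
      subst (_≤ (deg G X - sum (A′.inside E)) + (deg G X - sum (B′.inside E))) (cancel (deg G X) (sum E) (≋-deg {X} {E} eqv))
        (subst (deg G X + deg G X - sum E ≤_) (regroup (deg G X) (sum (A′.inside E)) (sum (B′.inside E)))
          (ℤ.+-monoʳ-≤ (deg G X + deg G X) (ℤ.neg-mono-≤ (subst (_≤ sum E) (∑-distrib-+ (A′.inside E) (B′.inside E)) (sum-mono both)))))
    where
    cancel : ∀ d e → d ≡ e → d + d - e ≡ d
    cancel d .d refl = simplify d
      where
      simplify : ∀ d → d + d - d ≡ d
      simplify = solve-∀
    regroup : ∀ d x y → d + d - (x + y) ≡ (d - x) + (d - y)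
    regroup = solve-∀
    both : ∀ v → A′.inside E v + B′.inside E v ≤ E v
    both v = here (a Fin.≟ v)
      where
      here : Dec (a ≡ v) → A′.inside E v + B′.inside E v ≤ E v
      here (yes refl) = subst (_≤ E a) (sym (cong₂ _+_ (A′.inside-a E) (B′.inside-a E))) (E≥0 a)
      here (no a≢v) = one (opposite v a≢v)
        where
        one : (A v ≡ true × B v ≡ false) ⊎ (A v ≡ false × B v ≡ true) → A′.inside E v + B′.inside E v ≤ E v
        one (inj₁ (v∈ , v∉)) = ℤ.≤-reflexive (trans (cong₂ _+_ (A′.inside-in E v∈ a≢v) (B′.inside-out E v∉)) (ℤ.+-identityʳ (E v)))
        one (inj₂ (v∉ , v∈)) = ℤ.≤-reflexive (trans (cong₂ _+_ (A′.inside-out E v∉) (B′.inside-in E v∈ a≢v)) (ℤ.+-identityˡ (E v)))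

  -- The two scripts are normalised to vanish at `a` and then joined. Debt could arise only at `a`,
  -- and the degree count with `k + l` excludes it.
  glue : ∀ {X} k l → TA.EffClass (λ v → X v - single a k v) → TB.EffClass (λ v → X v - single a l v) → deg G X ≤ k + l → EffClass X
  glue {X} k l (E₁ , E₁≥0 , f₁ , eq₁) (E₂ , E₂≥0 , f₂ , eq₂) le = E , E≥0 , f , λ v → regroup (X v) (lap f v)
    where
    f : Vertex → ℤ
    f v = if A v then f₁ v - f₁ a else f₂ v - f₂ a
    E : Divisor G
    E v = X v - lap f v
    regroup : ∀ x l → x ≡ x - l + l
    regroup = solve-∀
    shift : ∀ (T : Vertex → Vertex → ℤ) (h : Vertex → ℤ) (c : ℤ) v → sum (λ w → T v w * ((h v - c) - (h w - c))) ≡ sum (λ w → T v w * (h v - h w))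
    shift T h c v = sum-cong-≗ λ w → cong (_*_ (T v w)) (cancel (h v) (h w) c)
      where
      cancel : ∀ x y c → (x - c) - (y - c) ≡ x - y
      cancel = solve-∀
    f-A : ∀ w → A w ≡ true → f₁ w - f₁ a ≡ f w
    f-A w w∈ = sym (cong (λ b → if b then f₁ w - f₁ a else f₂ w - f₂ a) w∈)
    f-B : ∀ w → B w ≡ true → f₂ w - f₂ a ≡ f w
    f-B w w∈ = here (a Fin.≟ w)
      where
      here : Dec (a ≡ w) → f₂ w - f₂ a ≡ f w
      here (yes refl) = trans (ℤ.+-inverseʳ (f₂ a)) (trans (sym (ℤ.+-inverseʳ (f₁ a))) (f-A a a∈A))
      here (no a≢w) = one (opposite w a≢w)
        where
        one : (A w ≡ true × B w ≡ false) ⊎ (A w ≡ false × B w ≡ true) → f₂ w - f₂ a ≡ f w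
        one (inj₁ (_ , w∉)) = ⊥-elim (true≢false w∈ w∉)
        one (inj₂ (w∉ , _)) = sym (cong (λ b → if b then f₁ w - f₁ a else f₂ w - f₂ a) w∉)
    solve : ∀ x s e l → x - s ≡ e + l → s ≡ 0ℤ → x - l ≡ e
    solve x s e l p refl = trans (cong (_- l) (trans (sym (ℤ.+-identityʳ x)) p)) (cancel e l)
      where
      cancel : ∀ e l → e + l - l ≡ e
      cancel = solve-∀
    on-A : ∀ v → A v ≡ true → a ≢ v → E v ≡ E₁ v
    on-A v v∈ a≢v = solve (X v) (single a k v) (E₁ v) (lap f v) (trans (eq₁ v) (cong (_+_ (E₁ v))
      (trans (sym (shift TA.m f₁ (f₁ a) v)) (A′.lap-in {λ w → f₁ w - f₁ a} {f} v∈ a≢v f-A)))) (single-neq a k a≢v)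
    on-B : ∀ v → B v ≡ true → a ≢ v → E v ≡ E₂ v
    on-B v v∈ a≢v = solve (X v) (single a l v) (E₂ v) (lap f v) (trans (eq₂ v) (cong (_+_ (E₂ v))
      (trans (sym (shift TB.m f₂ (f₂ a) v)) (B′.lap-in {λ w → f₂ w - f₂ a} {f} v∈ a≢v f-B)))) (single-neq a l a≢v)
    parts : ∀ v → E v - single a (E a) v ≡ A′.inside E₁ v + B′.inside E₂ v
    parts v = here (a Fin.≟ v)
      where
      here : Dec (a ≡ v) → E v - single a (E a) v ≡ A′.inside E₁ v + B′.inside E₂ v
      here (yes refl) = trans (cong (_-_ (E a)) (single-eq a (E a))) (trans (ℤ.+-inverseʳ (E a)) (sym (cong₂ _+_ (A′.inside-a E₁) (B′.inside-a E₂))))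
      here (no a≢v) = trans (cong (_-_ (E v)) (single-neq a (E a) a≢v)) (trans (ℤ.+-identityʳ (E v)) (one (opposite v a≢v)))
        where
        one : (A v ≡ true × B v ≡ false) ⊎ (A v ≡ false × B v ≡ true) → E v ≡ A′.inside E₁ v + B′.inside E₂ v
        one (inj₁ (v∈ , v∉)) = trans (on-A v v∈ a≢v) (trans (sym (ℤ.+-identityʳ (E₁ v))) (sym (cong₂ _+_ (A′.inside-in E₁ v∈ a≢v) (B′.inside-out E₂ v∉))))
        one (inj₂ (v∉ , v∈)) = trans (on-B v v∈ a≢v) (trans (sym (ℤ.+-identityˡ (E₂ v))) (sym (cong₂ _+_ (A′.inside-out E₁ v∉) (B′.inside-in E₂ v∈ a≢v))))
    degE : sum E ≡ deg G X
    degE = trans (sum-sub X (lap f)) (trans (cong (_-_ (sum X)) (deg-lap f)) (ℤ.+-identityʳ (sum X)))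
    deg₁ : sum E₁ ≡ deg G X - k
    deg₁ = trans (sym (TA.≋-deg {λ v → X v - single a k v} {E₁} (f₁ , eq₁))) (trans (sum-sub X (single a k)) (cong (_-_ (sum X)) (sum-single a k)))
    deg₂ : sum E₂ ≡ deg G X - l
    deg₂ = trans (sym (TB.≋-deg {λ v → X v - single a l v} {E₂} (f₂ , eq₂))) (trans (sum-sub X (single a l)) (cong (_-_ (sum X)) (sum-single a l)))
    E-a : 0ℤ ≤ E a
    E-a = ℤ.≤-trans (ℤ.i≤j⇒0≤j-i le) (subst₂ _≤_ (regroup₁ (deg G X) k l) (regroup₂ (deg G X) (E a))
        (ℤ.+-monoʳ-≤ (deg G X) (ℤ.neg-mono-≤ total)))
      where
      regroup₁ : ∀ d k l → d - ((d - k) + (d - l)) ≡ k + l - d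
      regroup₁ = solve-∀
      regroup₂ : ∀ d e → d - (d - e) ≡ e
      regroup₂ = solve-∀
      total : deg G X - E a ≤ (deg G X - k) + (deg G X - l)
      total = begin
        deg G X - E a                                     ≡⟨ cong₂ _-_ degE (sum-single a (E a)) ⟨
        sum E - sum (single a (E a))                      ≡⟨ sum-sub E (single a (E a)) ⟨
        sum (λ v → E v - single a (E a) v)                ≡⟨ sum-cong-≗ parts ⟩
        sum (λ v → A′.inside E₁ v + B′.inside E₂ v)       ≡⟨ ∑-distrib-+ (A′.inside E₁) (B′.inside E₂) ⟩
        sum (A′.inside E₁) + sum (B′.inside E₂)           ≤⟨ ℤ.+-mono-≤ (sum-mono (A′.inside≤ E₁≥0)) (sum-mono (B′.inside≤ E₂≥0)) ⟩
        sum E₁ + sum E₂                                   ≡⟨ cong₂ _+_ deg₁ deg₂ ⟩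
        (deg G X - k) + (deg G X - l)                     ∎
        where open ℤ.≤-Reasoning
    E≥0 : Effective G E
    E≥0 v = here (a Fin.≟ v)
      where
      here : Dec (a ≡ v) → 0ℤ ≤ E v
      here (yes refl) = E-a
      here (no a≢v) = one (opposite v a≢v)
        where
        one : (A v ≡ true × B v ≡ false) ⊎ (A v ≡ false × B v ≡ true) → 0ℤ ≤ E v
        one (inj₁ (v∈ , _)) = subst (0ℤ ≤_) (sym (on-A v v∈ a≢v)) (E₁≥0 v)
        one (inj₂ (_ , v∈)) = subst (0ℤ ≤_) (sym (on-B v v∈ a≢v)) (E₂≥0 v)

  -- Every vertex other than `a` is a leaf at `a` on exactly one of the sides; the spokes are these
  -- additional edges, directed away from `a`.
  spoke : Vertex → Vertex → ℤ
  spoke v w = if does (a Fin.≟ v) then (if does (a Fin.≟ w) then 0ℤ else 1ℤ) else 0ℤ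

  edges : ∀ v w → TA.m v w + TB.m v w ≡ m v w + (spoke v w + spoke w v)
  edges v w = by (a Fin.≟ v) (a Fin.≟ w)
    where
    yesA : ∀ {x} → a ≡ x → does (a Fin.≟ x) ≡ true
    yesA {x} p = dec-true (a Fin.≟ x) p
    noA : ∀ {x} → a ≢ x → does (a Fin.≟ x) ≡ false
    noA {x} p = dec-false (a Fin.≟ x) p
    spoke-0 : ∀ {x y} → a ≢ x → spoke x y ≡ 0ℤ
    spoke-0 {x} {y} p = cong (λ b → if b then (if does (a Fin.≟ y) then 0ℤ else 1ℤ) else 0ℤ) (noA p)
    spoke-1 : ∀ {y} → a ≢ y → spoke a y ≡ 1ℤ
    spoke-1 {y} p = trans (cong (λ b → if b then (if does (a Fin.≟ y) then 0ℤ else 1ℤ) else 0ℤ) (yesA refl)) (cong (λ b → if b then 0ℤ else 1ℤ) (noA p))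
    spoke-a : spoke a a ≡ 0ℤ
    spoke-a = trans (cong (λ b → if b then (if does (a Fin.≟ a) then 0ℤ else 1ℤ) else 0ℤ) (yesA refl)) (cong (λ b → if b then 0ℤ else 1ℤ) (yesA refl))
    -- v ≠ a lies on one side, where it keeps its edges, and is a leaf on the other
    ordinary : ∀ {v w} → a ≢ v → TA.m v w + TB.m v w ≡ m v w + (if does (a Fin.≟ w) then 1ℤ else 0ℤ)
    ordinary {v} {w} a≢v = one (opposite v a≢v)
      where
      float : ∀ b → + (if b then 1 else 0) ≡ (if b then 1ℤ else 0ℤ)
      float true  = refl
      float false = refl
      one : (A v ≡ true × B v ≡ false) ⊎ (A v ≡ false × B v ≡ true) → TA.m v w + TB.m v w ≡ m v w + (if does (a Fin.≟ w) then 1ℤ else 0ℤ)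
      one (inj₁ (v∈ , v∉)) = cong₂ _+_ (cong +_ (A′.mult-in v∈ a≢v)) (trans (cong +_ (B′.mult-out v∉)) (float (does (a Fin.≟ w))))
      one (inj₂ (v∉ , v∈)) = trans (ℤ.+-comm (TA.m v w) (TB.m v w)) (cong₂ _+_ (cong +_ (B′.mult-in v∈ a≢v)) (trans (cong +_ (A′.mult-out v∉)) (float (does (a Fin.≟ w)))))
    by : Dec (a ≡ v) → Dec (a ≡ w) → TA.m v w + TB.m v w ≡ m v w + (spoke v w + spoke w v)
    by (yes refl) (yes refl) = trans (cong₂ _+_ (TA.m-loop a) (TB.m-loop a)) (sym (cong₂ _+_ (m-loop a) (cong₂ _+_ spoke-a spoke-a)))
    by (no a≢v) (yes refl) = trans (ordinary a≢v) (cong (_+_ (m v a)) (trans (cong (λ b → if b then 1ℤ else 0ℤ) (yesA refl))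
      (sym (cong₂ _+_ (spoke-0 {v} {a} a≢v) (spoke-1 a≢v)))))
    by (no a≢v) (no a≢w) = trans (ordinary a≢v) (cong (_+_ (m v w)) (trans (cong (λ b → if b then 1ℤ else 0ℤ) (noA a≢w))
      (sym (cong₂ _+_ (spoke-0 {v} {w} a≢v) (spoke-0 {w} {v} a≢w)))))
    by (yes refl) (no a≢w) = trans (cong₂ _+_ (TA.m-sym a w) (TB.m-sym a w)) (trans (ordinary a≢w)
      (cong₂ _+_ (m-sym w a) (trans (cong (λ b → if b then 1ℤ else 0ℤ) (yesA refl)) (sym (cong₂ _+_ (spoke-1 a≢w) (spoke-0 {w} {a} a≢w))))))

  -- The vertices are counted twice except for `a`, and each repeated vertex is balanced by its
  -- spoke.
  genus-+ : genus GA + genus GB ≡ genus G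
  genus-+ = 2*-cancel {genus GA + genus GB} {genus G} (begin
      + 2 * (genus GA + genus GB)
        ≡⟨ regroup₁ (+ ∣E∣ GA) (+ ∣E∣ GB) N ⟩
      (+ 2 * + ∣E∣ GA + + 2 * + ∣E∣ GB) - (+ 4 * N - + 4)
        ≡⟨ cong (_- (+ 4 * N - + 4)) (trans (cong₂ _+_ TA.∣E∣-sum TB.∣E∣-sum) sums) ⟩
      (+ 2 * + ∣E∣ G + ((N - 1ℤ) + (N - 1ℤ))) - (+ 4 * N - + 4)
        ≡⟨ regroup₂ (+ ∣E∣ G) N ⟩
      + 2 * genus G ∎)
    where
    open ≡-Reasoning
    N : ℤ
    N = + suc n
    regroup₁ : ∀ x y N → + 2 * ((x - N + 1ℤ) + (y - N + 1ℤ)) ≡ (+ 2 * x + + 2 * y) - (+ 4 * N - + 4)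
    regroup₁ = solve-∀
    regroup₂ : ∀ x N → (+ 2 * x + ((N - 1ℤ) + (N - 1ℤ))) - (+ 4 * N - + 4) ≡ + 2 * (x - N + 1ℤ)
    regroup₂ = solve-∀
    Σ₂ : (Vertex → Vertex → ℤ) → ℤ
    Σ₂ h = sum λ v → sum (h v)
    Σ₂-+ : ∀ h k → Σ₂ h + Σ₂ k ≡ Σ₂ (λ v w → h v w + k v w)
    Σ₂-+ h k = sym (trans (sum-cong-≗ λ v → ∑-distrib-+ (h v) (k v)) (∑-distrib-+ (λ v → sum (h v)) (λ v → sum (k v))))
    spokes : Σ₂ spoke ≡ N - 1ℤ
    spokes = begin
      Σ₂ spoke                                   ≡⟨ sum-cong-≗ row ⟩
      sum (single a (N - 1ℤ))                    ≡⟨ sum-single a (N - 1ℤ) ⟩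
      N - 1ℤ                                     ∎
      where
      rim : sum (λ w → if does (a Fin.≟ w) then 0ℤ else 1ℤ) ≡ N - 1ℤ
      rim = trans (sum-cong-≗ λ w → flip (does (a Fin.≟ w))) (trans (sum-sub (λ _ → 1ℤ) (single a 1ℤ))
        (cong₂ _-_ (trans (sum-const (suc n) 1ℤ) (ℤ.*-identityʳ N)) (sum-single a 1ℤ)))
        where
        flip : ∀ b → (if b then 0ℤ else 1ℤ) ≡ 1ℤ - (if b then 1ℤ else 0ℤ)
        flip true  = refl
        flip false = refl
      row : ∀ v → sum (spoke v) ≡ single a (N - 1ℤ) v
      row v = here (a Fin.≟ v)
        where
        here : (d : Dec (a ≡ v)) → sum (spoke v) ≡ single a (N - 1ℤ) v
        here (yes refl) = trans (sum-cong-≗ λ w → cong (λ b → if b then (if does (a Fin.≟ w) then 0ℤ else 1ℤ) else 0ℤ) (dec-true (a Fin.≟ a) refl))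
          (trans rim (sym (single-eq a (N - 1ℤ))))
        here (no a≢v) = trans (sum-cong-≗ λ w → cong (λ b → if b then (if does (a Fin.≟ w) then 0ℤ else 1ℤ) else 0ℤ) (dec-false (a Fin.≟ v) a≢v))
          (trans (sum-replicate-zero (suc n)) (sym (single-neq a (N - 1ℤ) a≢v)))
    sums : Σ₂ TA.m + Σ₂ TB.m ≡ + 2 * + ∣E∣ G + ((N - 1ℤ) + (N - 1ℤ))
    sums = begin
      Σ₂ TA.m + Σ₂ TB.m                          ≡⟨ Σ₂-+ TA.m TB.m ⟩
      Σ₂ (λ v w → TA.m v w + TB.m v w)           ≡⟨ sum-cong-≗ (λ v → sum-cong-≗ (edges v)) ⟩
      Σ₂ (λ v w → m v w + (spoke v w + spoke w v)) ≡⟨ Σ₂-+ m (λ v w → spoke v w + spoke w v) ⟨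
      Σ₂ m + Σ₂ (λ v w → spoke v w + spoke w v)  ≡⟨ cong₂ _+_ ∣E∣-sum (Σ₂-+ spoke (λ v w → spoke w v)) ⟨
      + 2 * + ∣E∣ G + (Σ₂ spoke + Σ₂ (λ v w → spoke w v)) ≡⟨ cong (λ x → + 2 * + ∣E∣ G + (Σ₂ spoke + x)) (∑-comm (λ v w → spoke w v)) ⟩
      + 2 * + ∣E∣ G + (Σ₂ spoke + Σ₂ spoke)      ≡⟨ cong (λ x → + 2 * + ∣E∣ G + (x + x)) spokes ⟩
      + 2 * + ∣E∣ G + ((N - 1ℤ) + (N - 1ℤ))      ∎

-- Ranks on the sides of a cut vertex

module SideRank (G : Graph) (S : Graph.Vertex G → Bool) (a : Graph.Vertex G) (a∈ : S a ≡ true)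
                (closed : ∀ v w → S v ≡ true → S w ≡ false → a ≢ v → Graph.mult G v w ≡ 0) where
  open Graph G
  open Side G S a a∈ closed
  module R = Ranks side
  module F = Firing side
  module C = Blobs side

  at : ℤ → Divisor G
  at = single a

  at-+ : ∀ k l v → at k v + at l v ≡ at (k + l) v
  at-+ k l v = here (a Fin.≟ v)
    where
    here : Dec (a ≡ v) → at k v + at l v ≡ at (k + l) v
    here (yes refl) = trans (cong₂ _+_ (single-eq a k) (single-eq a l)) (sym (single-eq a (k + l)))
    here (no a≢v) = trans (cong₂ _+_ (single-neq a k a≢v) (single-neq a l a≢v)) (sym (single-neq a (k + l) a≢v))

  at-1 : ∀ v → at 1ℤ v ≡ pt a v
  at-1 v = here (a Fin.≟ v)
    where
    here : Dec (a ≡ v) → at 1ℤ v ≡ pt a v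
    here (yes refl) = trans (single-eq a 1ℤ) (sym (pt-self a))
    here (no a≢v) = trans (single-neq a 1ℤ a≢v) (sym (pt-other a≢v))

  at≥0 : ∀ {k} → 0ℤ ≤ k → Effective G (at k)
  at≥0 {k} k≥0 v = here (a Fin.≟ v)
    where
    here : Dec (a ≡ v) → 0ℤ ≤ at k v
    here (yes refl) = subst (0ℤ ≤_) (sym (single-eq a k)) k≥0
    here (no a≢v) = ℤ.≤-reflexive (sym (single-neq a k a≢v))

  lower : ∀ {X : Divisor G} {k j} → j ≤ k → S.EffClass (λ v → X v - at k v) → S.EffClass (λ v → X v - at j v)
  lower {X} {k} {j} j≤k e = C.effClass-≋ {λ v → X v - at j v} {λ v → (X v - at k v) + at (k - j) v}
    (F.≋-cong λ v → trans (regroup (X v) (at k v) (at j v)) (cong (_+_ (X v - at k v)) (trans (sym (back (at k v) (at (k - j) v) (at j v) (trans (at-+ (k - j) j v) (cong (λ z → at z v) (cancel k j))))) refl)))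
    (R.effClass-add {λ v → X v - at k v} {at (k - j)} e (at≥0 (ℤ.i≤j⇒0≤j-i j≤k)))
    where
    regroup : ∀ x k j → x - j ≡ (x - k) + (k - j)
    regroup = solve-∀
    back : ∀ k d j → d + j ≡ k → d ≡ k - j
    back .(d + j) d j refl = simplify d j
      where
      simplify : ∀ d j → d ≡ d + j - j
      simplify = solve-∀
    cancel : ∀ k j → k - j + j ≡ k
    cancel = solve-∀

  -- A foreign vertex is equivalent to `a` on this side, so ranks need only be tested with vertices
  -- of `S`.
  home : Vertex → Vertex
  home x = if S x then x else a

  home∈ : ∀ x → S (home x) ≡ true
  home∈ x = here (status (S x))
    where
    here : (S x ≡ true) ⊎ (S x ≡ false) → S (home x) ≡ true
    here (inj₁ x∈) = trans (cong (λ b → S (if b then x else a)) x∈) x∈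
    here (inj₂ x∉) = trans (cong (λ b → S (if b then x else a)) x∉) a∈

  home-≋ : ∀ x → S._≋_ (pt x) (pt (home x))
  home-≋ x = here (status (S x))
    where
    here : (S x ≡ true) ⊎ (S x ≡ false) → S._≋_ (pt x) (pt (home x))
    here (inj₁ x∈) = F.≋-cong λ v → cong (λ b → pt (if b then x else a) v) (sym x∈)
    here (inj₂ x∉) = subst (λ b → S._≋_ (pt x) (pt (if b then x else a))) (sym x∉) (leaf-≋ x∉)

  away : ∀ y → (a ≢ y → S y ≡ false) → S._≋_ (pt y) (pt a)
  away y y∉ = here (a Fin.≟ y)
    where
    here : Dec (a ≡ y) → S._≋_ (pt y) (pt a)
    here (yes refl) = S.≋-refl
    here (no a≢y) = leaf-≋ (y∉ a≢y)

  -- A chip removed on the other side can be put back here at the price of one more chip required at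
  -- `a`.
  absorb : ∀ {X Y : Divisor G} {k} y → S._≋_ (pt y) (pt a) → (∀ v → X v ≡ Y v - pt y v) → S.EffClass (λ v → X v - at k v) → S.EffClass (λ v → Y v - at (k + 1ℤ) v)
  absorb {X} {Y} {k} y (f , eq) X≡ = C.effClass-≋ {λ v → Y v - at (k + 1ℤ) v} {λ v → X v - at k v} (f , λ v →
      trans (cong (_-_ (Y v)) (trans (sym (at-+ k 1ℤ v)) (cong (_+_ (at k v)) (at-1 v))))
      (trans (solve (Y v) (at k v) (pt a v) (pt y v) (S.lap f v) (eq v)) (cong (λ z → z - at k v + S.lap f v) (sym (X≡ v)))))
    where
    solve : ∀ y k a p l → p ≡ a + l → y - (k + a) ≡ y - p - k + l
    solve y k a .(a + l) l refl = simplify y k a l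
      where
      simplify : ∀ y k a l → y - (k + a) ≡ y - (a + l) - k + l
      simplify = solve-∀

  substitute : ∀ {X Y : Divisor G} x y → S._≋_ (pt x) (pt y) → (∀ v → X v ≡ Y v - pt y v) → S.EffClass X → S.EffClass (λ v → Y v - pt x v)
  substitute {X} {Y} x y (f , eq) X≡ e = C.effClass-≋ {λ v → Y v - pt x v} {X} (S.≋-sym {X} {λ v → Y v - pt x v} (f , λ v →
    trans (X≡ v) (solve (Y v) (pt x v) (pt y v) (S.lap f v) (eq v)))) e
    where
    solve : ∀ z x y l → x ≡ y + l → z - y ≡ z - x + l
    solve z .(y + l) y l refl = simplify z y l
      where
      simplify : ∀ z y l → z - y ≡ z - (y + l) + l
      simplify = solve-∀

  deg-minus : ∀ X k → deg G (λ v → X v - at k v) ≡ deg G X - k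
  deg-minus X k = trans (sum-sub X (at k)) (cong (_-_ (sum X)) (sum-single a k))

  by-home : ∀ {X : Divisor G} → (∀ x → S x ≡ true → S.EffClass (λ v → X v - pt x v)) → S.Rank≥ X 1
  by-home {X} e = R.rank-from-points {X} λ w → substitute {λ v → X v - pt (home w) v} {X} w (home w) (home-≋ w) (λ _ → refl) (e (home w) (home∈ w))

  by-home₂ : ∀ {X : Divisor G} → (∀ x y → S x ≡ true → S y ≡ true → S.EffClass (λ v → X v - pt x v - pt y v)) → S.Rank≥ X 2
  by-home₂ {X} e = R.rank-suc {X} {1} λ w → R.rank-≋ {λ v → X v - pt w v} {λ v → X v - pt (home w) v} {1} (moved w)
      (by-home {λ v → X v - pt (home w) v} λ y y∈ → e (home w) y (home∈ w) y∈)
    where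
    moved : ∀ w → S._≋_ (λ v → X v - pt w v) (λ v → X v - pt (home w) v)
    moved w = (λ u → - f u) , λ v → trans (solve (X v) (pt w v) (pt (home w) v) (S.lap f v) (proj₂ (home-≋ w) v))
        (cong (_+_ (X v - pt (home w) v)) (sym (S.lap-neg f v)))
      where
      f : Vertex → ℤ
      f = proj₁ (home-≋ w)
      solve : ∀ z x y l → x ≡ y + l → z - x ≡ z - y + - l
      solve z .(y + l) y l refl = simplify z y l
        where
        simplify : ∀ z y l → z - (y + l) ≡ z - y + - l
        simplify = solve-∀

module WedgeRank (G : Graph) (A B : Graph.Vertex G → Bool) (a : Graph.Vertex G) (a∈A : A a ≡ true) (a∈B : B a ≡ true)
                 (closedA : ∀ v w → A v ≡ true → A w ≡ false → a ≢ v → Graph.mult G v w ≡ 0)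
                 (closedB : ∀ v w → B v ≡ true → B w ≡ false → a ≢ v → Graph.mult G v w ≡ 0)
                 (opposite : ∀ v → a ≢ v → (A v ≡ true × B v ≡ false) ⊎ (A v ≡ false × B v ≡ true))
                 (D : Divisor G) (rank2 : Theory.Rank≥ G D 2) (degD : deg G D ≡ + 4) where
  open Graph G
  open Theory G
  open Firing G
  open Blobs G using (pair; pair≥0; deg-pair)
  open Wedge G A B a a∈A a∈B closedA closedB opposite
  module SA = SideRank G A a a∈A closedA
  module SB = SideRank G B a a∈B closedB
  open SA using (at; at-1; at-+)

  outside-A : ∀ y → B y ≡ true → a ≢ y → A y ≡ false
  outside-A y y∈ a≢y = one (opposite y a≢y)
    where
    one : (A y ≡ true × B y ≡ false) ⊎ (A y ≡ false × B y ≡ true) → A y ≡ false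
    one (inj₁ (_ , y∉)) = ⊥-elim (true≢false y∈ y∉)
    one (inj₂ (y∉ , _)) = y∉

  outside-B : ∀ y → A y ≡ true → a ≢ y → B y ≡ false
  outside-B y y∈ a≢y = one (opposite y a≢y)
    where
    one : (A y ≡ true × B y ≡ false) ⊎ (A y ≡ false × B y ≡ true) → B y ≡ false
    one (inj₁ (_ , y∉)) = y∉
    one (inj₂ (y∉ , _)) = ⊥-elim (true≢false y∈ y∉)

  two-removed : ∀ x y → ∃[ k ] ∃[ l ] TA.EffClass (λ v → D v - pair x y v - at k v) × TB.EffClass (λ v → D v - pair x y v - at l v) × + 2 ≤ k + l
  two-removed x y = repack (cut-apart {λ v → D v - pair x y v} (rank2 (pair x y) (pair≥0 x y) (deg-pair x y)))
    where
    repack : ∃[ k ] ∃[ l ] TA.EffClass (λ v → D v - pair x y v - at k v) × TB.EffClass (λ v → D v - pair x y v - at l v) × deg G (λ v → D v - pair x y v) ≤ k + l →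
             ∃[ k ] ∃[ l ] TA.EffClass (λ v → D v - pair x y v - at k v) × TB.EffClass (λ v → D v - pair x y v - at l v) × + 2 ≤ k + l
    repack (k , l , eA , eB , le) = k , l , eA , eB , subst (_≤ k + l) (trans (sum-sub D (pair x y)) (cong₂ _-_ degD (deg-pair x y))) le

  -- Otherwise `D - 3a`, of degree 1, would have rank 1 on a side of positive genus.
  spread : 1ℤ ≤ genus GA → ∃[ x ] A x ≡ true × ¬ TA.EffClass (λ v → (D v - pt x v) - at (+ 3) v)
  spread gA = decide (Fin.any? λ x → (A x Bool.≟ true) ×-dec ¬? (TA.effClass? (λ v → (D v - pt x v) - at (+ 3) v)))
    where
    decide : Dec (∃[ x ] A x ≡ true × ¬ TA.EffClass (λ v → (D v - pt x v) - at (+ 3) v)) → ∃[ x ] A x ≡ true × ¬ TA.EffClass (λ v → (D v - pt x v) - at (+ 3) v)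
    decide (yes found) = found
    decide (no none) = ⊥-elim (SA.R.no-pencil-of-degree-1 {λ v → D v - at (+ 3) v} (trans (SA.deg-minus D (+ 3)) (cong (_- + 3) degD)) gA
        (SA.by-home {λ v → D v - at (+ 3) v} λ x x∈ → everywhere x x∈ (TA.effClass? (λ v → (D v - pt x v) - at (+ 3) v))))
      where
      regroup : ∀ d p t → d - t - p ≡ d - p - t
      regroup = solve-∀
      everywhere : ∀ x → A x ≡ true → Dec (TA.EffClass (λ v → (D v - pt x v) - at (+ 3) v)) → TA.EffClass (λ v → D v - at (+ 3) v - pt x v)
      everywhere x x∈ (yes e) = SA.C.effClass-≋ {λ v → D v - at (+ 3) v - pt x v} {λ v → (D v - pt x v) - at (+ 3) v}
        (SA.F.≋-cong λ v → regroup (D v) (pt x v) (at (+ 3) v)) e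
      everywhere x x∈ (no ¬e) = ⊥-elim (none (x , x∈ , ¬e))

  rest≥ : ∀ {k l c} j → + 2 ≤ k + l → ¬ (+ j ≤ k) → c + + j ≡ + 3 → c ≤ l
  rest≥ {k} {l} {c} j le small eq = ℤ.≮⇒≥ λ l<c → ℤ.<⇒≱ {k + l} {+ 2} (bound (ℤ.≰⇒> small) l<c) le
    where
    bound : k < + j → l < c → k + l < + 2
    bound k<j l<c = ℤ.≤-<-trans (ℤ.+-mono-≤ (ℤ.i<j⇒i≤pred[j] k<j) (ℤ.i<j⇒i≤pred[j] l<c))
      (subst (_< + 2) (trans (cong (λ z → -1ℤ + (-1ℤ + z)) (trans (sym eq) (ℤ.+-comm c (+ j)))) (regroup (+ j) c)) (+<+ (s≤s (s≤s z≤n))))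
      where
      regroup : ∀ j c → -1ℤ + (-1ℤ + (j + c)) ≡ (-1ℤ + j) + (-1ℤ + c)
      regroup = solve-∀

  -- Besides `y` the vertex `x` of `spread` is removed. On the side `A` the chip `y` counts as `a`,
  -- so `k + 1 < 3` and hence `l ≥ 1`; on the side `B` the chip `x` counts as `a` and raises `l` to
  -- at least 2.
  half : 1ℤ ≤ genus GA → TB.Rank≥ (λ v → D v - at (+ 2) v) 1
  half gA = use (spread gA)
    where
    use : (∃[ x ] A x ≡ true × ¬ TA.EffClass (λ v → (D v - pt x v) - at (+ 3) v)) → TB.Rank≥ (λ v → D v - at (+ 2) v) 1
    use (x , x∈ , not-eff) = SB.by-home {λ v → D v - at (+ 2) v} λ y y∈ → finish y y∈ (two-removed x y)
      where
      finish : ∀ y → B y ≡ true → ∃[ k ] ∃[ l ] TA.EffClass (λ v → D v - pair x y v - at k v) × TB.EffClass (λ v → D v - pair x y v - at l v) × + 2 ≤ k + l →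
               TB.EffClass (λ v → D v - at (+ 2) v - pt y v)
      finish y y∈ (k , l , eA , eB , le) = SB.C.effClass-≋ {λ v → D v - at (+ 2) v - pt y v} {λ v → (D v - pt y v) - at (+ 2) v}
          (SB.F.≋-cong λ v → regroup (D v) (at (+ 2) v) (pt y v))
          (SB.lower {λ v → D v - pt y v} {l + 1ℤ} {+ 2} (ℤ.+-monoˡ-≤ 1ℤ (rest≥ {k} {l} {1ℤ} 2 le k-small refl)) onB)
        where
        regroup : ∀ d t p → d - t - p ≡ d - p - t
        regroup = solve-∀
        onA : TA.EffClass (λ v → (D v - pt x v) - at (k + 1ℤ) v)
        onA = SA.absorb {λ v → D v - pair x y v} {λ v → D v - pt x v} {k} y (SA.away y (outside-A y y∈)) (λ v → assoc (D v) (pt x v) (pt y v)) eA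
          where
          assoc : ∀ d x y → d - (x + y) ≡ d - x - y
          assoc = solve-∀
        onB : TB.EffClass (λ v → (D v - pt y v) - at (l + 1ℤ) v)
        onB = SB.absorb {λ v → D v - pair x y v} {λ v → D v - pt y v} {l} x (SB.away x (outside-B x x∈)) (λ v → assoc (D v) (pt x v) (pt y v)) eB
          where
          assoc : ∀ d x y → d - (x + y) ≡ d - y - x
          assoc = solve-∀
        k-small : ¬ (+ 2 ≤ k)
        k-small 2≤k = not-eff (SA.lower {λ v → D v - pt x v} {k + 1ℤ} {+ 3} (ℤ.+-monoˡ-≤ 1ℤ 2≤k) onA)

  -- Otherwise `l ≤ 1` whenever two vertices of `A` are removed, so `k ≥ 1`, and `D - a` has degree
  -- 3 and rank 2 on the side `A`, against Clifford.
  full : + 2 ≤ genus GA → TB.EffClass (λ v → D v - at (+ 4) v)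
  full gA = decide (TB.effClass? (λ v → D v - at (+ 4) v))
    where
    decide : Dec (TB.EffClass (λ v → D v - at (+ 4) v)) → TB.EffClass (λ v → D v - at (+ 4) v)
    decide (yes e) = e
    decide (no not-eff) = ⊥-elim (SA.R.no-net-of-degree-3 {λ v → D v - at 1ℤ v} (trans (SA.deg-minus D 1ℤ) (cong (_- 1ℤ) degD)) gA
        (SA.by-home₂ {λ v → D v - at 1ℤ v} λ x y x∈ y∈ → finish x y x∈ y∈ (two-removed x y)))
      where
      finish : ∀ x y → A x ≡ true → A y ≡ true → ∃[ k ] ∃[ l ] TA.EffClass (λ v → D v - pair x y v - at k v) × TB.EffClass (λ v → D v - pair x y v - at l v) × + 2 ≤ k + l →
               TA.EffClass (λ v → D v - at 1ℤ v - pt x v - pt y v)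
      finish x y x∈ y∈ (k , l , eA , eB , le) = SA.C.effClass-≋ {λ v → D v - at 1ℤ v - pt x v - pt y v} {λ v → D v - pair x y v - at 1ℤ v}
          (SA.F.≋-cong λ v → regroup (D v) (at 1ℤ v) (pt x v) (pt y v))
          (SA.lower {λ v → D v - pair x y v} {k} {1ℤ} (rest≥ {l} {k} {1ℤ} 2 (subst (+ 2 ≤_) (ℤ.+-comm k l) le) l-small refl) eA)
        where
        regroup : ∀ d t x y → d - t - x - y ≡ d - (x + y) - t
        regroup = solve-∀
        assoc : ∀ d x y → d - (x + y) ≡ d - y - x
        assoc = solve-∀
        onB : TB.EffClass (λ v → D v - at (l + 1ℤ + 1ℤ) v)
        onB = SB.absorb {λ v → D v - pt y v} {D} {l + 1ℤ} y (SB.away y (outside-B y y∈)) (λ _ → refl)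
          (SB.absorb {λ v → D v - pair x y v} {λ v → D v - pt y v} {l} x (SB.away x (outside-B x x∈)) (λ v → assoc (D v) (pt x v) (pt y v)) eB)
        l-small : ¬ (+ 2 ≤ l)
        l-small 2≤l = not-eff (SB.lower {D} {l + 1ℤ + 1ℤ} {+ 4} (ℤ.+-monoˡ-≤ 1ℤ (ℤ.+-monoˡ-≤ 1ℤ 2≤l)) onB)

  -- By `full`, `D ~ 4a` on the side `B`, so `2a ~ D - 2a` and `half` applies.
  big : + 2 ≤ genus GA → TB.Rank≥ (at (+ 2)) 1
  big gA = SB.R.rank-≋ {at (+ 2)} {λ v → D v - at (+ 2) v} {1} (TB.≋-sym {λ v → D v - at (+ 2) v} {at (+ 2)} moved) (half (ℤ.≤-trans (+≤+ (s≤s z≤n)) gA))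
    where
    four : TB.EffClass (λ v → D v - at (+ 4) v)
    four = full gA
    F : Divisor G
    F = proj₁ four
    F-zero : ∀ v → F v ≡ 0ℤ
    F-zero = SB.F.zero-sum F (proj₁ (proj₂ four)) (trans (sym (TB.≋-deg {λ v → D v - at (+ 4) v} {F} (proj₂ (proj₂ four))))
      (trans (SB.deg-minus D (+ 4)) (cong (_- + 4) degD)))
    moved : TB._≋_ (λ v → D v - at (+ 2) v) (at (+ 2))
    moved = proj₁ (proj₂ (proj₂ four)) , λ v → solve (D v) (at (+ 2) v) (at (+ 4) v) (F v) _ (at-+ (+ 2) (+ 2) v) (proj₂ (proj₂ (proj₂ four)) v) (F-zero v)
      where
      solve : ∀ d t q f l → t + t ≡ q → d - q ≡ f + l → f ≡ 0ℤ → d - t ≡ t + l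
      solve d t .(t + t) .0ℤ l refl eq refl = trans (expand d t) (cong (_+_ t) (trans eq (ℤ.+-identityˡ l)))
        where
        expand : ∀ d t → d - t ≡ t + (d - (t + t))
        expand = solve-∀

  genus-one : + 1 ≡ genus GA → TA.Rank≥ (at (+ 2)) 1
  genus-one g1 = SA.R.riemann (at (+ 2)) 1 (ℤ.≤-reflexive (trans (cong (_+_ 1ℤ) (sym g1)) (sym (sum-single a (+ 2)))))

  -- K - 2a = (K - D) + (D - 2a) has rank at least 2 on a side of genus 4.
  genus-four : 1ℤ ≤ genus GA → genus GB ≡ + 4 → TB.Rank≥ (at (+ 2)) 1
  genus-four gA g4 = SB.R.rank-≋ {at (+ 2)} {λ v → TB.canonical v - L v} {1} (SB.F.≋-cong λ v → twice (at (+ 2) v) (TB.canonical v) (D v))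
      (TB.riemann-roch L 2 1 rankL (trans (sym (cong₂ (λ x y → + 2 - x + (y - 1ℤ)) degL g4)) refl))
    where
    D-rank : TB.Rank≥ D 2
    D-rank = SB.by-home₂ {D} λ x y x∈ y∈ → finish x y x∈ y∈ (two-removed x y)
      where
      finish : ∀ x y → B x ≡ true → B y ≡ true → ∃[ k ] ∃[ l ] TA.EffClass (λ v → D v - pair x y v - at k v) × TB.EffClass (λ v → D v - pair x y v - at l v) × + 2 ≤ k + l →
               TB.EffClass (λ v → D v - pt x v - pt y v)
      finish x y x∈ y∈ (k , l , eA , eB , le) = SB.C.effClass-≋ {λ v → D v - pt x v - pt y v} {λ v → D v - pair x y v - at 0ℤ v}
          (SB.F.≋-cong λ v → trans (assoc (D v) (pt x v) (pt y v)) (trans (sym (ℤ.+-identityʳ (D v - pair x y v))) (cong (_-_ (D v - pair x y v)) (sym (at-0 v)))))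
          (SB.lower {λ v → D v - pair x y v} {l} {0ℤ} (rest≥ {k} {l} {0ℤ} 3 le k-small refl) eB)
        where
        assoc : ∀ d x y → d - x - y ≡ d - (x + y)
        assoc = solve-∀
        at-0 : ∀ v → at 0ℤ v ≡ 0ℤ
        at-0 v = here (a Fin.≟ v)
          where
          here : Dec (a ≡ v) → at 0ℤ v ≡ 0ℤ
          here (yes refl) = single-eq a 0ℤ
          here (no a≢v) = single-neq a 0ℤ a≢v
        k-small : ¬ (+ 3 ≤ k)
        k-small 3≤k = ℤ.<⇒≱ {+ 2} {+ 3} (+<+ (s≤s (s≤s (s≤s z≤n)))) (ℤ.≤-trans 3≤k (ℤ.0≤i-j⇒j≤i (subst (0ℤ ≤_)
          (trans (SA.deg-minus (λ v → D v - pair x y v) k) (cong (_- k) (trans (sum-sub D (pair x y)) (cong₂ _-_ degD (deg-pair x y)))))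
          (SA.R.effClass-deg {λ v → D v - pair x y v - at k v} eA))))
    L : Divisor G
    L v = (TB.canonical v - D v) + (D v - at (+ 2) v)
    rankL : TB.Rank≥ L 2
    rankL = SB.R.superadditive 1 1 {λ v → TB.canonical v - D v} {λ v → D v - at (+ 2) v}
      (TB.riemann-roch D 2 1 D-rank (sym (cong₂ (λ x y → + 2 - x + (y - 1ℤ)) degD g4))) (half gA)
    degL : deg G L ≡ + 4
    degL = trans (∑-distrib-+ (λ v → TB.canonical v - D v) (λ v → D v - at (+ 2) v))
      (cong₂ _+_ (trans (sum-sub TB.canonical D) (cong₂ _-_ (trans TB.deg-canonical (cong (λ g → (g - 1ℤ) + (g - 1ℤ)) g4)) degD))
        (trans (SB.deg-minus D (+ 2)) (cong (_- + 2) degD)))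
    twice : ∀ t k d → t ≡ k - ((k - d) + (d - t))
    twice = solve-∀

  -- On the side foreign to `w`, `2a - w - a` is equivalent to 0, so one chip at `a` is available
  -- there. The degree of `2a - w` is 1, so `glue` asks for none from the other side.
  join : TA.Rank≥ (at (+ 2)) 1 → TB.Rank≥ (at (+ 2)) 1 → ∀ w → EffClass (λ v → at (+ 2) v - pt w v)
  join rA rB w = located (a Fin.≟ w)
    where
    degree : deg G (λ v → at (+ 2) v - pt w v) ≡ 1ℤ
    degree = trans (sum-sub (at (+ 2)) (pt w)) (cong₂ _-_ (sum-single a (+ 2)) (sum-pt w))
    at-0 : ∀ v → at 0ℤ v ≡ 0ℤ
    at-0 v = here (a Fin.≟ v)
      where
      here : Dec (a ≡ v) → at 0ℤ v ≡ 0ℤ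
      here (yes refl) = single-eq a 0ℤ
      here (no a≢v) = single-neq a 0ℤ a≢v
    minus0 : ∀ v → at (+ 2) v - pt w v - at 0ℤ v ≡ at (+ 2) v - pt w v
    minus0 v = trans (cong (_-_ (at (+ 2) v - pt w v)) (at-0 v)) (ℤ.+-identityʳ (at (+ 2) v - pt w v))
    two≡ : ∀ v → at 1ℤ v + at 1ℤ v ≡ at (+ 2) v
    two≡ = at-+ 1ℤ 1ℤ
    effA : TA.EffClass (λ v → at (+ 2) v - pt w v - at 0ℤ v)
    effA = SA.C.effClass-≋ {λ v → at (+ 2) v - pt w v - at 0ℤ v} {λ v → at (+ 2) v - pt w v} (SA.F.≋-cong minus0) (SA.R.rank-to-points {at (+ 2)} rA w)
    effB : TB.EffClass (λ v → at (+ 2) v - pt w v - at 0ℤ v)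
    effB = SB.C.effClass-≋ {λ v → at (+ 2) v - pt w v - at 0ℤ v} {λ v → at (+ 2) v - pt w v} (SB.F.≋-cong minus0) (SB.R.rank-to-points {at (+ 2)} rB w)
    vanish : ∀ t o p l → o + o ≡ t → p ≡ o + l → t - p - o ≡ 0ℤ + - l
    vanish .(o + o) o .(o + l) l refl refl = simplify o l
      where
      simplify : ∀ o l → o + o - (o + l) - o ≡ 0ℤ + - l
      simplify = solve-∀
    trivialA : TA._≋_ (pt w) (pt a) → TA.EffClass (λ v → at (+ 2) v - pt w v - at 1ℤ v)
    trivialA (f , eq) = (λ _ → 0ℤ) , (λ _ → ℤ.≤-refl) , (λ u → - f u) , λ v → trans (vanish (at (+ 2) v) (at 1ℤ v) (pt w v) (TA.lap f v) (two≡ v)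
      (trans (eq v) (cong (_+ TA.lap f v) (sym (at-1 v))))) (cong (_+_ 0ℤ) (sym (TA.lap-neg f v)))
    trivialB : TB._≋_ (pt w) (pt a) → TB.EffClass (λ v → at (+ 2) v - pt w v - at 1ℤ v)
    trivialB (f , eq) = (λ _ → 0ℤ) , (λ _ → ℤ.≤-refl) , (λ u → - f u) , λ v → trans (vanish (at (+ 2) v) (at 1ℤ v) (pt w v) (TB.lap f v) (two≡ v)
      (trans (eq v) (cong (_+ TB.lap f v) (sym (at-1 v))))) (cong (_+_ 0ℤ) (sym (TB.lap-neg f v)))
    on-A : (a ≢ w → B w ≡ false) → EffClass (λ v → at (+ 2) v - pt w v)
    on-A w∉B = glue {λ v → at (+ 2) v - pt w v} 0ℤ 1ℤ effA (trivialB (SB.away w w∉B)) (ℤ.≤-reflexive degree)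
    on-B : (a ≢ w → A w ≡ false) → EffClass (λ v → at (+ 2) v - pt w v)
    on-B w∉A = glue {λ v → at (+ 2) v - pt w v} 1ℤ 0ℤ (trivialA (SA.away w w∉A)) effB (ℤ.≤-reflexive degree)
    located : Dec (a ≡ w) → EffClass (λ v → at (+ 2) v - pt w v)
    located (yes refl) = on-A λ a≢a → ⊥-elim (a≢a refl)
    located (no a≢w) = one (opposite w a≢w)
      where
      one : (A w ≡ true × B w ≡ false) ⊎ (A w ≡ false × B w ≡ true) → EffClass (λ v → at (+ 2) v - pt w v)
      one (inj₁ (_ , w∉B)) = on-A λ _ → w∉B
      one (inj₂ (w∉A , _)) = on-B λ _ → w∉A

module _ (G : Graph) (A B : Graph.Vertex G → Bool) (a : Graph.Vertex G) (a∈A : A a ≡ true) (a∈B : B a ≡ true)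
         (closedA : ∀ v w → A v ≡ true → A w ≡ false → a ≢ v → Graph.mult G v w ≡ 0)
         (closedB : ∀ v w → B v ≡ true → B w ≡ false → a ≢ v → Graph.mult G v w ≡ 0)
         (opposite : ∀ v → a ≢ v → (A v ≡ true × B v ≡ false) ⊎ (A v ≡ false × B v ≡ true))
         (D : Divisor G) (rank2 : Theory.Rank≥ G D 2) (degD : deg G D ≡ + 4) where
  private
    opposite′ : ∀ v → a ≢ v → (B v ≡ true × A v ≡ false) ⊎ (B v ≡ false × A v ≡ true)
    opposite′ v a≢v = flip (opposite v a≢v)
      where
      flip : (A v ≡ true × B v ≡ false) ⊎ (A v ≡ false × B v ≡ true) → (B v ≡ true × A v ≡ false) ⊎ (B v ≡ false × A v ≡ true)
      flip (inj₁ (p , q)) = inj₂ (q , p)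
      flip (inj₂ (p , q)) = inj₁ (q , p)
    module W = WedgeRank G A B a a∈A a∈B closedA closedB opposite D rank2 degD
    module W′ = WedgeRank G B A a a∈B a∈A closedB closedA opposite′ D rank2 degD
    GA GB : Graph
    GA = Side.side G A a a∈A closedA
    GB = Side.side G B a a∈B closedB

  -- The genera of the sides add up to 5: they are 1 and 4 in some order, or both at least 2. In all
  -- cases `2a` has rank 1 on both sides.
  wedge-pencil : genus G ≡ + 5 → 1ℤ ≤ genus GA → 1ℤ ≤ genus GB → ∃[ h ] deg G h ≡ + 2 × (∀ w → Theory.EffClass G (λ v → h v - pt w v))
  wedge-pencil g5 gA gB = single a (+ 2) , sum-single a (+ 2) , by-genus (1ℤ ℤ.≟ genus GA) (1ℤ ℤ.≟ genus GB)
    where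
    sum5 : genus GA + genus GB ≡ + 5
    sum5 = trans (Wedge.genus-+ G A B a a∈A a∈B closedA closedB opposite) g5
    other : ∀ {x y} → 1ℤ ≡ x → x + y ≡ + 5 → y ≡ + 4
    other {_} {y} refl eq = trans (sym (cancel y)) (cong (_+_ -1ℤ) eq)
      where
      cancel : ∀ y → -1ℤ + (1ℤ + y) ≡ y
      cancel = solve-∀
    Goal : Set
    Goal = ∀ w → Theory.EffClass G (λ v → single a (+ 2) v - pt w v)
    by-genus : Dec (1ℤ ≡ genus GA) → Dec (1ℤ ≡ genus GB) → Goal
    by-genus (yes g1) _ = W.join (W.genus-one g1) (W.genus-four gA (other g1 sum5))
    by-genus (no _) (yes g1) = W.join (W′.genus-four gB (other g1 (trans (ℤ.+-comm (genus GB) (genus GA)) sum5))) (W′.genus-one g1)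
    by-genus (no a≢1) (no b≢1) = W.join (W′.big (ℤ.i<j⇒suc[i]≤j (ℤ.≤∧≢⇒< gB b≢1))) (W.big (ℤ.i<j⇒suc[i]≤j (ℤ.≤∧≢⇒< gA a≢1)))

-- Deleting a leaf

module Delete {k : ℕ} (mult : Fin (suc (suc k)) → Fin (suc (suc k)) → ℕ)
              (symmetric : ∀ v w → mult v w ≡ mult w v) (loopless : ∀ v → mult v v ≡ 0)
              (connected : ∀ v w → Star (λ v w → 0 ℕ.< mult v w) v w)
              (ℓ : Fin (suc (suc k))) (leaf : sum (λ w → + mult ℓ w) ≡ 1ℤ) where

  G : Graph
  G = record { n = suc k ; mult = mult ; symmetric = symmetric ; loopless = loopless ; connected = connected }

  open Theory G
  open Firing G
  open Blobs G using (effClass-≋)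

  Vertex Vertex′ : Set
  Vertex = Fin (suc (suc k))
  Vertex′ = Fin (suc k)

  π : Vertex′ → Vertex
  π = Fin.punchIn ℓ

  ℓ≢π : ∀ i → ℓ ≢ π i
  ℓ≢π i eq = Fin.punchInᵢ≢i ℓ i (sym eq)

  private
    extend-by : ∀ {T : Set} {v} → (Vertex′ → T) → T → Dec (ℓ ≡ v) → T
    extend-by g x (yes _) = x
    extend-by g x (no p) = g (Fin.punchOut p)

  extend : ∀ {T : Set} → (Vertex′ → T) → T → Vertex → T
  extend g x v = extend-by g x (ℓ Fin.≟ v)

  extend-ℓ : ∀ {T : Set} (g : Vertex′ → T) x → extend g x ℓ ≡ x
  extend-ℓ g x = here (ℓ Fin.≟ ℓ)
    where
    here : (d : Dec (ℓ ≡ ℓ)) → extend-by g x d ≡ x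
    here (yes _) = refl
    here (no p) = ⊥-elim (p refl)

  extend-π : ∀ {T : Set} (g : Vertex′ → T) x i → extend g x (π i) ≡ g i
  extend-π g x i = here (ℓ Fin.≟ π i)
    where
    here : (d : Dec (ℓ ≡ π i)) → extend-by g x d ≡ g i
    here (yes p) = ⊥-elim (ℓ≢π i p)
    here (no p) = cong g (trans (Fin.punchOut-cong ℓ refl) (Fin.punchOut-punchIn ℓ))

  by-vertex : ∀ {P : Vertex → Set} → P ℓ → (∀ i → P (π i)) → ∀ v → P v
  by-vertex {P} pℓ pπ v = here (ℓ Fin.≟ v)
    where
    here : Dec (ℓ ≡ v) → P v
    here (yes refl) = pℓ
    here (no p) = subst P (Fin.punchIn-punchOut p) (pπ (Fin.punchOut p))

  sum-split : ∀ (f : Vertex → ℤ) → sum f ≡ f ℓ + sum (λ i → f (π i))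
  sum-split f = sum-remove {i = ℓ} f

  neighbour : ∃[ u ] 1ℤ ≤ m ℓ u
  neighbour = nonempty-sum (m ℓ) (m≥0 ℓ) (ℤ.≤-reflexive (sym leaf))

  u : Vertex
  u = proj₁ neighbour

  ℓ≢u : ℓ ≢ u
  ℓ≢u eq = ℤ.<⇒≱ {0ℤ} {1ℤ} (+<+ (s≤s z≤n)) (subst (1ℤ ≤_) (trans (cong (m ℓ) (sym eq)) (m-loop ℓ)) (proj₂ neighbour))

  m-ℓ : ∀ w → m ℓ w ≡ pt u w
  m-ℓ w = sym (squeeze pointwise (ℤ.≤-reflexive (trans leaf (sym (sum-pt u)))) w)
    where
    pointwise : ∀ w → pt u w ≤ m ℓ w
    pointwise w = here (u Fin.≟ w)
      where
      here : Dec (u ≡ w) → pt u w ≤ m ℓ w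
      here (yes refl) = subst (_≤ m ℓ u) (sym (pt-self u)) (proj₂ neighbour)
      here (no u≢w) = subst (_≤ m ℓ w) (sym (pt-other u≢w)) (m≥0 ℓ w)

  u′ : Vertex′
  u′ = Fin.punchOut ℓ≢u

  π-u′ : π u′ ≡ u
  π-u′ = Fin.punchIn-punchOut ℓ≢u

  collapse : Vertex → Vertex′
  collapse = extend (λ i → i) u′

  mult′ : Vertex′ → Vertex′ → ℕ
  mult′ i j = mult (π i) (π j)

  Adjacent′ : Vertex′ → Vertex′ → Set
  Adjacent′ i j = 0 ℕ.< mult′ i j

  only-u : ∀ {v} → 0 ℕ.< mult ℓ v → u ≡ v
  only-u {v} adj = pt-inj u (subst (1ℤ ≤_) (m-ℓ v) (+≤+ adj))

  collapse-edge : ∀ v w → 0 ℕ.< mult v w → Star Adjacent′ (collapse v) (collapse w)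
  collapse-edge = by-vertex (by-vertex (λ adj → ⊥-elim (ℕ.n≮0 (subst (0 ℕ.<_) (loopless ℓ) adj))) from-ℓ)
      (λ i → by-vertex (λ adj → reverse (λ {x} {y} → subst (0 ℕ.<_) (symmetric (π x) (π y))) (from-ℓ i (subst (0 ℕ.<_) (symmetric (π i) ℓ) adj)))
        (λ j adj → subst₂ (Star Adjacent′) (sym (extend-π (λ x → x) u′ i)) (sym (extend-π (λ x → x) u′ j)) (adj ◅ ε)))
    where
    from-ℓ : ∀ j → 0 ℕ.< mult ℓ (π j) → Star Adjacent′ (collapse ℓ) (collapse (π j))
    from-ℓ j adj = subst₂ (Star Adjacent′) (sym (extend-ℓ (λ x → x) u′)) (sym (extend-π (λ x → x) u′ j))
      (subst (Star Adjacent′ u′) (Fin.punchIn-injective ℓ u′ j (trans π-u′ (only-u adj))) ε)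

  collapse-path : ∀ {v w} → Star (λ v w → 0 ℕ.< mult v w) v w → Star Adjacent′ (collapse v) (collapse w)
  collapse-path ε = ε
  collapse-path (_◅_ {v} {w} adj path) = collapse-edge v w adj ◅◅ collapse-path path

  G′ : Graph
  G′ = record { n = k ; mult = mult′ ; symmetric = λ i j → symmetric (π i) (π j) ; loopless = λ i → loopless (π i)
              ; connected = λ i j → subst₂ (Star Adjacent′) (extend-π (λ x → x) u′ i) (extend-π (λ x → x) u′ j) (collapse-path (connected (π i) (π j))) }

  module T = Theory G′

  lap-ℓ : ∀ f → lap f ℓ ≡ f ℓ - f u
  lap-ℓ f = trans (sum-cong-≗ λ w → term w (u Fin.≟ w)) (sum-single u (f ℓ - f u))
    where
    term : ∀ w → Dec (u ≡ w) → m ℓ w * (f ℓ - f w) ≡ single u (f ℓ - f u) w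
    term w (yes refl) = trans (cong (_* (f ℓ - f u)) (trans (m-ℓ u) (pt-self u))) (trans (ℤ.*-identityˡ (f ℓ - f u)) (sym (single-eq u (f ℓ - f u))))
    term w (no u≢w) = trans (cong (_* (f ℓ - f w)) (trans (m-ℓ w) (pt-other u≢w))) (sym (single-neq u (f ℓ - f u) u≢w))

  lap-π : ∀ f i → lap f (π i) ≡ single u (f u - f ℓ) (π i) + T.lap (f ∘ π) i
  lap-π f i = trans (sum-split (λ w → m (π i) w * (f (π i) - f w))) (cong (_+ T.lap (f ∘ π) i)
      (trans (cong (_* (f (π i) - f ℓ)) (trans (m-sym (π i) ℓ) (m-ℓ (π i)))) (here (u Fin.≟ π i))))
    where
    here : Dec (u ≡ π i) → pt u (π i) * (f (π i) - f ℓ) ≡ single u (f u - f ℓ) (π i)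
    here (no p) = trans (cong (_* (f (π i) - f ℓ)) (pt-other p)) (sym (single-neq u (f u - f ℓ) p))
    here (yes p) = trans (cong₂ (λ x y → x * (f y - f ℓ)) (trans (cong (pt u) (sym p)) (pt-self u)) (sym p))
      (trans (ℤ.*-identityˡ (f u - f ℓ)) (trans (sym (single-eq u (f u - f ℓ))) (cong (single u (f u - f ℓ)) p)))

  down : Divisor G → Divisor G′
  down X i = X (π i) + single u (X ℓ) (π i)

  single-+ : ∀ x y v → single u x v + single u y v ≡ single u (x + y) v
  single-+ x y v = here (u Fin.≟ v)
    where
    here : Dec (u ≡ v) → single u x v + single u y v ≡ single u (x + y) v
    here (yes refl) = trans (cong₂ _+_ (single-eq u x) (single-eq u y)) (sym (single-eq u (x + y)))
    here (no p) = trans (cong₂ _+_ (single-neq u x p) (single-neq u y p)) (sym (single-neq u (x + y) p))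

  single≥0 : ∀ {x} → 0ℤ ≤ x → ∀ v → 0ℤ ≤ single u x v
  single≥0 {x} p v = here (u Fin.≟ v)
    where
    here : Dec (u ≡ v) → 0ℤ ≤ single u x v
    here (yes refl) = subst (0ℤ ≤_) (sym (single-eq u x)) p
    here (no q) = ℤ.≤-reflexive (sym (single-neq u x q))

  -- The leaf edge contributes `f u - f ℓ` at `u`, and moving the leaf's chips to `u` contributes
  -- the opposite amount.
  effClass-down : ∀ {X} → EffClass X → T.EffClass (down X)
  effClass-down {X} (E , E≥0 , f , eq) = down E , (λ i → ℤ.+-mono-≤ (E≥0 (π i)) (single≥0 (E≥0 ℓ) (π i))) , f ∘ π , λ i → begin
      X (π i) + single u (X ℓ) (π i)
        ≡⟨ cong₂ _+_ (trans (eq (π i)) (cong (_+_ (E (π i))) (lap-π f i))) (trans (cong (λ x → single u x (π i)) (trans (eq ℓ) (cong (_+_ (E ℓ)) (lap-ℓ f)))) (sym (single-+ (E ℓ) (f ℓ - f u) (π i)))) ⟩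
      E (π i) + (single u (f u - f ℓ) (π i) + T.lap (f ∘ π) i) + (single u (E ℓ) (π i) + single u (f ℓ - f u) (π i))
        ≡⟨ regroup (E (π i)) (single u (f u - f ℓ) (π i)) (T.lap (f ∘ π) i) (single u (E ℓ) (π i)) (single u (f ℓ - f u) (π i)) ⟩
      E (π i) + single u (E ℓ) (π i) + T.lap (f ∘ π) i + (single u (f u - f ℓ) (π i) + single u (f ℓ - f u) (π i))
        ≡⟨ cong (_+_ (E (π i) + single u (E ℓ) (π i) + T.lap (f ∘ π) i)) (trans (single-+ (f u - f ℓ) (f ℓ - f u) (π i)) (trans (cong (λ x → single u x (π i)) (opposite (f u) (f ℓ))) (single-0 (π i)))) ⟩
      E (π i) + single u (E ℓ) (π i) + T.lap (f ∘ π) i + 0ℤ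
        ≡⟨ ℤ.+-identityʳ _ ⟩
      E (π i) + single u (E ℓ) (π i) + T.lap (f ∘ π) i ∎
    where
    open ≡-Reasoning
    regroup : ∀ e a l s b → e + (a + l) + (s + b) ≡ e + s + l + (a + b)
    regroup = solve-∀
    opposite : ∀ x y → (x - y) + (y - x) ≡ 0ℤ
    opposite = solve-∀
    single-0 : ∀ v → single u 0ℤ v ≡ 0ℤ
    single-0 v = here (u Fin.≟ v)
      where
      here : Dec (u ≡ v) → single u 0ℤ v ≡ 0ℤ
      here (yes refl) = single-eq u 0ℤ
      here (no q) = single-neq u 0ℤ q

  up : Divisor G′ → Divisor G
  up Y = extend Y 0ℤ

  up≥0 : ∀ {Y} → Effective G′ Y → Effective G (up Y)
  up≥0 {Y} Y≥0 = by-vertex (ℤ.≤-reflexive (sym (extend-ℓ Y 0ℤ))) λ i → subst (0ℤ ≤_) (sym (extend-π Y 0ℤ i)) (Y≥0 i)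

  deg-up : ∀ Y → deg G (up Y) ≡ deg G′ Y
  deg-up Y = trans (sum-split (up Y)) (trans (cong₂ _+_ (extend-ℓ Y 0ℤ) (sum-cong-≗ (extend-π Y 0ℤ))) (ℤ.+-identityˡ (sum Y)))

  -- The script takes the same value at the leaf as at its neighbour, so no chip crosses the leaf
  -- edge.
  effClass-up : ∀ {Y} → T.EffClass Y → EffClass (up Y)
  effClass-up {Y} (F , F≥0 , g , eq) = up F , up≥0 F≥0 , f , by-vertex at-ℓ at-π
    where
    f : Vertex → ℤ
    f v = g (collapse v)
    f-π : ∀ i → f (π i) ≡ g i
    f-π i = cong g (extend-π (λ x → x) u′ i)
    f-ℓ : f ℓ ≡ f u
    f-ℓ = trans (cong g (extend-ℓ (λ x → x) u′)) (trans (sym (f-π u′)) (cong f π-u′))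
    at-ℓ : up Y ℓ ≡ up F ℓ + lap f ℓ
    at-ℓ = trans (extend-ℓ Y 0ℤ) (sym (cong₂ _+_ (extend-ℓ F 0ℤ) (trans (lap-ℓ f) (trans (cong (_- f u) f-ℓ) (ℤ.+-inverseʳ (f u))))))
    at-π : ∀ i → up Y (π i) ≡ up F (π i) + lap f (π i)
    at-π i = trans (extend-π Y 0ℤ i) (trans (eq i) (sym (cong₂ _+_ (extend-π F 0ℤ i)
      (trans (lap-π f i) (trans (cong₂ _+_ (none (u Fin.≟ π i)) (sum-cong-≗ λ j → cong (T.m i j *_) (cong₂ _-_ (f-π i) (f-π j)))) (ℤ.+-identityˡ (T.lap g i)))))))
      where
      none : Dec (u ≡ π i) → single u (f u - f ℓ) (π i) ≡ 0ℤ
      none (no p) = single-neq u (f u - f ℓ) p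
      none (yes p) = trans (cong (single u (f u - f ℓ)) (sym p)) (trans (single-eq u (f u - f ℓ)) (trans (cong (_-_ (f u)) f-ℓ) (ℤ.+-inverseʳ (f u))))

  rank-down : ∀ {D r} → Rank≥ D r → T.Rank≥ (down D) r
  rank-down {D} rank E E≥0 degE = Blobs.effClass-≋ G′ {λ i → down D i - E i} {down (λ v → D v - up E v)}
      (Firing.≋-cong G′ λ i → trans (sym (swap (D (π i)) (E i) (single u (D ℓ) (π i)))) (sym (cong₂ _+_ (cong (_-_ (D (π i))) (extend-π E 0ℤ i))
        (cong (λ x → single u x (π i)) (trans (cong (_-_ (D ℓ)) (extend-ℓ E 0ℤ)) (ℤ.+-identityʳ (D ℓ)))))))
      (effClass-down {λ v → D v - up E v} (rank (up E) (up≥0 E≥0) (trans (deg-up E) degE)))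
    where
    swap : ∀ d e s → d - e + s ≡ d + s - e
    swap = solve-∀

  deg-down : ∀ D → deg G′ (down D) ≡ deg G D
  deg-down D = trans (∑-distrib-+ (λ i → D (π i)) (λ i → single u (D ℓ) (π i))) (trans (cong (_+_ (sum (λ i → D (π i)))) at-u)
      (trans (ℤ.+-comm (sum (λ i → D (π i))) (D ℓ)) (sym (sum-split D))))
    where
    at-u : sum (λ i → single u (D ℓ) (π i)) ≡ D ℓ
    at-u = trans (trans (sym (ℤ.+-identityˡ _)) (cong (_+ sum (λ i → single u (D ℓ) (π i))) (sym (single-neq u (D ℓ) (λ p → ℓ≢u (sym p))))))
      (trans (sym (sum-split (single u (D ℓ)))) (sum-single u (D ℓ)))

  pencil-up : ∀ {h} → (∀ i → T.EffClass (λ j → h j - pt i j)) → ∀ w → EffClass (λ v → up h v - pt w v)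
  pencil-up {h} eff = by-vertex at-ℓ at-π
    where
    at-π : ∀ i → EffClass (λ v → up h v - pt (π i) v)
    at-π i = effClass-≋ {λ v → up h v - pt (π i) v} {up (λ j → h j - pt i j)} (≋-cong {λ v → up h v - pt (π i) v} {up (λ j → h j - pt i j)} (by-vertex
        (trans (cong₂ _-_ (extend-ℓ h 0ℤ) (pt-other λ p → ℓ≢π i (sym p))) (sym (extend-ℓ (λ j → h j - pt i j) 0ℤ)))
        λ j → trans (cong₂ _-_ (extend-π h 0ℤ j) (pt-π j (i Fin.≟ j))) (sym (extend-π (λ j → h j - pt i j) 0ℤ j))))
      (effClass-up (eff i))
      where
      pt-π : ∀ j → Dec (i ≡ j) → pt (π i) (π j) ≡ pt i j
      pt-π j (yes refl) = trans (pt-self (π i)) (sym (pt-self i))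
      pt-π j (no p) = trans (pt-other λ q → p (Fin.punchIn-injective ℓ i j q)) (sym (pt-other p))
    at-ℓ : EffClass (λ v → up h v - pt ℓ v)
    at-ℓ = effClass-≋ {λ v → up h v - pt ℓ v} {λ v → up h v - pt (π u′) v} ((λ v → - pt ℓ v) , by-vertex on-ℓ on-π) (at-π u′)
      where
      o : ∀ v → lap (λ v → - pt ℓ v) v ≡ - lap (pt ℓ) v
      o = lap-neg (pt ℓ)
      pt-πu : ∀ v → pt (π u′) v ≡ pt u v
      pt-πu v = cong (λ x → pt x v) π-u′
      on-ℓ : up h ℓ - pt ℓ ℓ ≡ up h ℓ - pt (π u′) ℓ + lap (λ v → - pt ℓ v) ℓ
      on-ℓ = trans (cong (_-_ (up h ℓ)) (pt-self ℓ)) (trans (regroup (up h ℓ)) (sym (cong₂ (λ x y → up h ℓ - x + y)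
        (trans (pt-πu ℓ) (pt-other λ p → ℓ≢u (sym p))) (trans (o ℓ) (cong -_ (trans (lap-ℓ (pt ℓ)) (cong₂ _-_ (pt-self ℓ) (pt-other ℓ≢u))))))))
        where
        regroup : ∀ x → x - 1ℤ ≡ x - 0ℤ + - (1ℤ - 0ℤ)
        regroup = solve-∀
      on-π : ∀ i → up h (π i) - pt ℓ (π i) ≡ up h (π i) - pt (π u′) (π i) + lap (λ v → - pt ℓ v) (π i)
      on-π i = trans (cong (_-_ (up h (π i))) (pt-other (ℓ≢π i))) (trans (regroup (up h (π i)) (pt u (π i))) (sym (cong₂ (λ x y → up h (π i) - x + y) (pt-πu (π i))
        (trans (o (π i)) (cong -_ (trans (lap-π (pt ℓ) i) (cong₂ _+_ (here (u Fin.≟ π i)) (trans (sum-cong-≗ λ j → cong (T.m i j *_) (cong₂ _-_ (pt-other (ℓ≢π i)) (pt-other (ℓ≢π j)))) (T.lap-0 i)))))))))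
        where
        regroup : ∀ x p → x - 0ℤ ≡ x - p + - (- p + 0ℤ)
        regroup = solve-∀
        here : Dec (u ≡ π i) → single u (pt ℓ u - pt ℓ ℓ) (π i) ≡ - pt u (π i)
        here (no p) = trans (single-neq u (pt ℓ u - pt ℓ ℓ) p) (sym (cong -_ (pt-other p)))
        here (yes p) = trans (cong (single u (pt ℓ u - pt ℓ ℓ)) (sym p)) (trans (single-eq u (pt ℓ u - pt ℓ ℓ))
          (trans (cong₂ _-_ (pt-other ℓ≢u) (pt-self ℓ)) (sym (cong -_ (trans (cong (pt u) (sym p)) (pt-self u))))))

  genus-down : genus G′ ≡ genus G
  genus-down = 2*-cancel {genus G′} {genus G} (trans (regroup₁ (+ ∣E∣ G′) (+ suc k)) (trans (cong (λ x → x + + 2 - + 2 * (1ℤ + + suc k) + + 2) edges) (sym (regroup₂ (+ ∣E∣ G) (+ suc k)))))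
    where
    open ≡-Reasoning
    regroup₁ : ∀ e n → + 2 * (e - n + 1ℤ) ≡ + 2 * e + + 2 - + 2 * (1ℤ + n) + + 2
    regroup₁ = solve-∀
    regroup₂ : ∀ e n → + 2 * (e - (1ℤ + n) + 1ℤ) ≡ (+ 2 * e - + 2) + + 2 - + 2 * (1ℤ + n) + + 2
    regroup₂ = solve-∀
    edges : + 2 * + ∣E∣ G′ ≡ + 2 * + ∣E∣ G - + 2
    edges = trans T.∣E∣-sum (sym (trans (cong (_- + 2) (trans ∣E∣-sum (begin
      sum (λ v → sum (m v))                                   ≡⟨ sum-split (λ v → sum (m v)) ⟩
      sum (m ℓ) + sum (λ i → sum (m (π i)))                   ≡⟨ cong₂ _+_ leaf (sum-cong-≗ λ i → sum-split (m (π i))) ⟩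
      1ℤ + sum (λ i → m (π i) ℓ + sum (T.m i))                ≡⟨ cong (_+_ 1ℤ) (∑-distrib-+ (λ i → m (π i) ℓ) (λ i → sum (T.m i))) ⟩
      1ℤ + (sum (λ i → m (π i) ℓ) + sum (λ i → sum (T.m i)))  ≡⟨ cong (λ x → 1ℤ + (x + sum (λ i → sum (T.m i)))) into-ℓ ⟩
      1ℤ + (1ℤ + sum (λ i → sum (T.m i)))                     ∎))) (cancel (sum (λ i → sum (T.m i))))))
      where
      cancel : ∀ x → 1ℤ + (1ℤ + x) - + 2 ≡ x
      cancel = solve-∀
      into-ℓ : sum (λ i → m (π i) ℓ) ≡ 1ℤ
      into-ℓ = trans (sum-cong-≗ λ i → m-sym (π i) ℓ) (trans (sym (trans (sum-split (m ℓ)) (trans (cong (_+ sum (λ i → m ℓ (π i))) (m-loop ℓ)) (ℤ.+-identityˡ _)))) leaf)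

-- Genus 5: a divisor of degree 4 and rank 2 yields one of degree 2 and rank 1

PencilOn : Graph → Set
PencilOn G = ∃[ h ] deg G h ≡ + 2 × (∀ w → Theory.EffClass G (λ v → h v - pt w v))

module Leafless (G : Graph) (no-leaf : ∀ v → ¬ (sum (Theory.m G v) ≡ 1ℤ)) where
  open Graph G
  open Theory G
  open Firing G
  open Blobs G

  boundary-edge : ∀ (C : VSet) {v w} → C v ≡ true → C w ≡ false → ∃[ x ] ∃[ y ] C x ≡ true × C y ≡ false × 1ℤ ≤ m x y
  boundary-edge C {v} {w} v∈ w∉ = walk v∈ (connected v w)
    where
    walk : ∀ {v} → C v ≡ true → Star Adjacent v w → ∃[ x ] ∃[ y ] C x ≡ true × C y ≡ false × 1ℤ ≤ m x y
    walk v∈ ε = ⊥-elim (true≢false v∈ w∉)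
    walk {v} v∈ (_◅_ {_} {x} adj path) = step (status (C x))
      where
      step : (C x ≡ true) ⊎ (C x ≡ false) → ∃[ x ] ∃[ y ] C x ≡ true × C y ≡ false × 1ℤ ≤ m x y
      step (inj₁ x∈) = walk x∈ path
      step (inj₂ x∉) = v , x , v∈ , x∉ , +≤+ adj

  valency≥2 : ∀ {v w} → v ≢ w → + 2 ≤ sum (m v)
  valency≥2 {v} {w} v≢w = ℤ.i<j⇒suc[i]≤j (ℤ.≤∧≢⇒< one≤ λ eq → no-leaf v (sym eq))
    where
    C : VSet
    C x = does (v Fin.≟ x)
    one≤ : 1ℤ ≤ sum (m v)
    one≤ = from-edge (boundary-edge C (dec-true (v Fin.≟ v) refl) (dec-false (v Fin.≟ w) v≢w))
      where
      from-edge : (∃[ x ] ∃[ y ] C x ≡ true × C y ≡ false × 1ℤ ≤ m x y) → 1ℤ ≤ sum (m v)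
      from-edge (x , y , x∈ , _ , adj) = ℤ.≤-trans (subst (λ z → 1ℤ ≤ m z y) (sym (does⇒ (v Fin.≟ x) x∈)) adj) (term≤sum (m≥0 v) y)

  CutVertex : VSet → Vertex → Set
  CutVertex A a = A a ≡ true × (∀ v → A v ≡ true → a ≢ v → out A v ≡ 0ℤ) × (∃[ x ] A x ≡ true × a ≢ x) × (∃[ y ] A y ≡ false)

  cutVertex? : ∀ A a → Dec (CutVertex A a)
  cutVertex? A a = (A a Bool.≟ true) ×-dec (Fin.all? (λ v → (A v Bool.≟ true) →-dec (¬? (a Fin.≟ v) →-dec (out A v ℤ.≟ 0ℤ)))
    ×-dec (Fin.any? (λ x → (A x Bool.≟ true) ×-dec ¬? (a Fin.≟ x)) ×-dec Fin.any? (λ y → A y Bool.≟ false)))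

  cutVertex-resp : ∀ {A B} a → (∀ v → A v ≡ B v) → CutVertex A a → CutVertex B a
  cutVertex-resp {A} {B} a eq (a∈ , closed , (x , x∈ , a≢x) , (y , y∉)) = trans (sym (eq a)) a∈ ,
    (λ v v∈ a≢v → trans (sum-cong-≗ λ w → cong (λ b → if b then 0ℤ else m v w) (sym (eq w))) (closed v (trans (eq v) v∈) a≢v)) ,
    (x , trans (sym (eq x)) x∈ , a≢x) , (y , trans (sym (eq y)) y∉)

  -- The leaves at a are outweighed by a itself.
  side-genus : ∀ (S : VSet) a (a∈ : S a ≡ true) (closed : ∀ v w → S v ≡ true → S w ≡ false → a ≢ v → mult v w ≡ 0) →
               ∀ {x} → S x ≡ true → a ≢ x → 1ℤ ≤ genus (Side.side G S a a∈ closed)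
  side-genus S a a∈ closed {x} x∈ a≢x = ℤ.≮⇒≥ λ g<1 → ℤ.<⇒≱ { -[1+ 1 ]} { -1ℤ} (-<- (s≤s z≤n)) (ℤ.≤-trans below (small g<1))
    where
    open Side G S a a∈ closed
    g : ℤ
    g = genus side
    small : g < 1ℤ → sum S.canonical ≤ -[1+ 1 ]
    small g<1 = ℤ.≤-trans (ℤ.≤-reflexive S.deg-canonical) (ℤ.+-mono-≤ g-1≤ g-1≤)
      where
      g-1≤ : g - 1ℤ ≤ -1ℤ
      g-1≤ = ℤ.+-monoˡ-≤ -1ℤ (ℤ.i<j⇒i≤pred[j] g<1)
    outside : Vertex → ℤ
    outside w = if S w then 0ℤ else 1ℤ
    C : VSet
    C v = S v ∧ not (is-a v)
    adjacent : ∃[ w ] S w ≡ true × a ≢ w × 1ℤ ≤ m w a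
    adjacent = from-edge (boundary-edge C {x} {a} (cong₂ _∧_ x∈ (cong not (dec-false (a Fin.≟ x) a≢x))) (trans (cong (λ b → S a ∧ not b) (dec-true (a Fin.≟ a) refl)) (Bool.∧-zeroʳ (S a))))
      where
      from-edge : (∃[ v ] ∃[ w ] C v ≡ true × C w ≡ false × 1ℤ ≤ m v w) → ∃[ w ] S w ≡ true × a ≢ w × 1ℤ ≤ m w a
      from-edge (v , w , v∈ , w∉ , adj) = v , v∈S , a≢v , subst (λ z → 1ℤ ≤ m v z) (sym (w≡a (status (S w)) (a Fin.≟ w))) adj
        where
        v∈S : S v ≡ true
        v∈S = ∩-left S (λ u → not (is-a u)) v v∈
        a≢v : a ≢ v
        a≢v = does⇒¬ (a Fin.≟ v) (trans (sym (Bool.not-involutive (is-a v))) (cong not (∩-right S (λ u → not (is-a u)) v v∈)))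
        w≡a : (S w ≡ true) ⊎ (S w ≡ false) → Dec (a ≡ w) → a ≡ w
        w≡a _ (yes eq) = eq
        w≡a (inj₂ w∉S) (no _) = ⊥-elim (ℤ.<⇒≱ {0ℤ} {1ℤ} (+<+ (s≤s z≤n)) (subst (1ℤ ≤_) (cong +_ (closed v w v∈S w∉S a≢v)) adj))
        w≡a (inj₁ w∈S) (no a≢w) = ⊥-elim (true≢false (cong₂ _∧_ w∈S (cong not (dec-false (a Fin.≟ w) a≢w))) w∉)
    w₀ : Vertex
    w₀ = proj₁ adjacent
    val-a : sum outside + 1ℤ ≤ sum (S.m a)
    val-a = subst (_≤ sum (S.m a)) (trans (∑-distrib-+ outside (pt w₀)) (cong (_+_ (sum outside)) (sum-pt w₀))) (sum-mono λ w → edge-a w (status (S w)) (w₀ Fin.≟ w))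
      where
      edge-a : ∀ w → (S w ≡ true) ⊎ (S w ≡ false) → Dec (w₀ ≡ w) → outside w + pt w₀ w ≤ S.m a w
      edge-a w (inj₂ w∉) (yes refl) = ⊥-elim (true≢false (proj₁ (proj₂ adjacent)) w∉)
      edge-a w (inj₂ w∉) (no p) = ℤ.≤-reflexive (trans (cong₂ _+_ (cong (λ b → if b then 0ℤ else 1ℤ) w∉) (pt-other p))
        (sym (trans (S.m-sym a w) (cong +_ (trans (mult-out w∉) (cong (λ b → if b then 1 else 0) (dec-true (a Fin.≟ a) refl)))))))
      edge-a w (inj₁ w∈) (no p) = subst (_≤ S.m a w) (sym (cong₂ _+_ (cong (λ b → if b then 0ℤ else 1ℤ) w∈) (pt-other p))) (S.m≥0 a w)
      edge-a w (inj₁ w∈) (yes refl) = subst₂ _≤_ (sym (cong₂ _+_ (cong (λ b → if b then 0ℤ else 1ℤ) w∈) (pt-self w₀)))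
        (trans (sym (cong +_ (mult-in w∈ (proj₁ (proj₂ (proj₂ adjacent)))))) (S.m-sym w₀ a)) (proj₂ (proj₂ (proj₂ adjacent)))
    below : -1ℤ ≤ sum S.canonical
    below = subst (_≤ sum S.canonical) (trans (sum-sub (single a (sum outside - 1ℤ)) outside) (trans (cong (_- sum outside) (sum-single a (sum outside - 1ℤ))) (cancel (sum outside))))
        (sum-mono λ v → bound v (status (S v)) (a Fin.≟ v))
      where
      cancel : ∀ x → x - 1ℤ - x ≡ -1ℤ
      cancel = solve-∀
      canonical≡ : ∀ v → S.canonical v ≡ sum (S.m v) - + 2
      canonical≡ v = cong (_- + 2) (sum-ℕ (mult′ v))
      bound : ∀ v → (S v ≡ true) ⊎ (S v ≡ false) → Dec (a ≡ v) → single a (sum outside - 1ℤ) v - outside v ≤ S.canonical v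
      bound v _ (yes refl) = subst₂ _≤_ (trans (regroup (sum outside)) (sym (cong₂ _-_ (single-eq a (sum outside - 1ℤ)) (cong (λ b → if b then 0ℤ else 1ℤ) a∈)))) (sym (canonical≡ a))
          (ℤ.+-monoˡ-≤ (- + 2) val-a)
        where
        regroup : ∀ x → x + 1ℤ - + 2 ≡ x - 1ℤ - 0ℤ
        regroup = solve-∀
      bound v (inj₁ v∈) (no a≢v) = subst₂ _≤_ (sym (cong₂ _-_ (single-neq a (sum outside - 1ℤ) a≢v) (cong (λ b → if b then 0ℤ else 1ℤ) v∈))) (sym (canonical≡ v))
          (subst (λ z → 0ℤ ≤ z - + 2) (sum-cong-≗ {suc n} {m v} {S.m v} λ w → cong +_ (sym (mult-in {v} {w} v∈ a≢v))) (ℤ.i≤j⇒0≤j-i (valency≥2 {v} {a} (λ eq → a≢v (sym eq)))))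
      bound v (inj₂ v∉) (no a≢v) = ℤ.≤-reflexive (trans (cong₂ _-_ (single-neq a (sum outside - 1ℤ) a≢v) (cong (λ b → if b then 0ℤ else 1ℤ) v∉))
          (sym (trans (canonical≡ v) (cong (_- + 2) (trans (sum-cong-≗ λ w → trans (cong +_ (mult-out v∉)) (float (is-a w))) (sum-single a 1ℤ))))))
        where
        float : ∀ b → + (if b then 1 else 0) ≡ (if b then 1ℤ else 0ℤ)
        float true  = refl
        float false = refl

  module _ (genus5 : genus G ≡ + 5) (D : Divisor G) (degD : deg G D ≡ + 4) (rank2 : Rank≥ D 2) where

    separable : ∀ A a → CutVertex A a → PencilOn G
    separable A a (a∈ , closed , (x , x∈ , a≢x) , (y , y∉)) = wedge-pencil G A B a a∈ a∈B closedA closedB opposite D rank2 degD genus5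
        (side-genus A a a∈ closedA x∈ a≢x) (side-genus B a a∈B closedB y∈B a≢y)
      where
      B : VSet
      B v = does (a Fin.≟ v) ∨ not (A v)
      a≢y : a ≢ y
      a≢y refl = true≢false a∈ y∉
      a∈B : B a ≡ true
      a∈B = cong (_∨ not (A a)) (dec-true (a Fin.≟ a) refl)
      y∈B : B y ≡ true
      y∈B = trans (cong (λ b → does (a Fin.≟ y) ∨ not b) y∉) (Bool.∨-zeroʳ (does (a Fin.≟ y)))
      closedA : ∀ v w → A v ≡ true → A w ≡ false → a ≢ v → mult v w ≡ 0
      closedA v w v∈ w∉ a≢v = ℤ.+-injective (ℤ.≤-antisym (subst₂ _≤_ (cong (λ b → if b then 0ℤ else m v w) w∉) (closed v v∈ a≢v)
        (term≤sum {f = λ w → if A w then 0ℤ else m v w} (λ w → nonneg (A w) (m≥0 v w)) w)) (m≥0 v w))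
        where
        nonneg : ∀ b {x : ℤ} → 0ℤ ≤ x → 0ℤ ≤ (if b then 0ℤ else x)
        nonneg true  p = ℤ.≤-refl
        nonneg false p = p
      B-other : ∀ {v} → a ≢ v → B v ≡ not (A v)
      B-other {v} a≢v = cong (_∨ not (A v)) (dec-false (a Fin.≟ v) a≢v)
      opposite : ∀ v → a ≢ v → (A v ≡ true × B v ≡ false) ⊎ (A v ≡ false × B v ≡ true)
      opposite v a≢v = here (status (A v))
        where
        here : (A v ≡ true) ⊎ (A v ≡ false) → (A v ≡ true × B v ≡ false) ⊎ (A v ≡ false × B v ≡ true)
        here (inj₁ v∈) = inj₁ (v∈ , trans (B-other a≢v) (cong not v∈))
        here (inj₂ v∉) = inj₂ (v∉ , trans (B-other a≢v) (cong not v∉))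
      closedB : ∀ v w → B v ≡ true → B w ≡ false → a ≢ v → mult v w ≡ 0
      closedB v w v∈ w∉ a≢v = here (a Fin.≟ w) (opposite v a≢v)
        where
        here : Dec (a ≡ w) → (A v ≡ true × B v ≡ false) ⊎ (A v ≡ false × B v ≡ true) → mult v w ≡ 0
        here (yes refl) _ = ⊥-elim (true≢false a∈B w∉)
        here (no _) (inj₁ (_ , v∉B)) = ⊥-elim (true≢false v∈ v∉B)
        here (no a≢w) (inj₂ (v∉ , _)) = trans (symmetric v w) (closedA w v (w∈ (opposite w a≢w)) v∉ a≢w)
          where
          w∈ : (A w ≡ true × B w ≡ false) ⊎ (A w ≡ false × B w ≡ true) → A w ≡ true
          w∈ (inj₁ (p , _)) = p
          w∈ (inj₂ (_ , q)) = ⊥-elim (true≢false q w∉)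

    module Inseparable (none : ¬ (∃[ A ] ∃[ a ] CutVertex A a)) where

      no-cut-vertex : ∀ A a → A a ≡ true → (∀ v → A v ≡ true → a ≢ v → out A v ≡ 0ℤ) → ∀ {y} → A y ≡ false → ∀ {v} → A v ≡ true → a ≡ v
      no-cut-vertex A a a∈ closed {y} y∉ {v} v∈ = here (a Fin.≟ v)
        where
        here : Dec (a ≡ v) → a ≡ v
        here (yes eq) = eq
        here (no a≢v) = ⊥-elim (none (A , a , a∈ , closed , (v , v∈ , a≢v) , (y , y∉)))

      -- If only one edge left `A`, its end `x` would be a cut vertex unless `A` is `x` alone; in
      -- that case `x` is a leaf.
      cut≥2 : ∀ A {v w} → A v ≡ true → A w ≡ false → + 2 ≤ cut A
      cut≥2 A {v} {w} v∈ w∉ = ℤ.≮⇒≥ λ lt → from-edge (ℤ.i<j⇒i≤pred[j] lt) (boundary-edge A v∈ w∉)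
        where
        from-edge : cut A ≤ 1ℤ → (∃[ x ] ∃[ y ] A x ≡ true × A y ≡ false × 1ℤ ≤ m x y) → ⊥
        from-edge le (x , y , x∈ , y∉ , adj) = no-leaf x (trans (sym lonely) (trans (sym (∂-in A x∈)) (trans (sym (tails x)) (pt-self x))))
          where
          x≢y : x ≢ y
          x≢y = separated {A} x∈ y∉
          out≥1 : 1ℤ ≤ ∂ A x
          out≥1 = subst (1ℤ ≤_) (sym (∂-in A x∈)) (ℤ.≤-trans adj (subst (_≤ out A x) (cong (λ b → if b then 0ℤ else m x y) y∉)
            (term≤sum {f = λ w → if A w then 0ℤ else m x w} (λ w → nonneg (A w) (m≥0 x w)) y)))
            where
            nonneg : ∀ b {x : ℤ} → 0ℤ ≤ x → 0ℤ ≤ (if b then 0ℤ else x)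
            nonneg true  p = ℤ.≤-refl
            nonneg false p = p
          tails : ∀ u → pt x u ≡ ∂ A u
          tails = squeeze pointwise (ℤ.≤-trans le (ℤ.≤-reflexive (sym (sum-pt x))))
            where
            pointwise : ∀ u → pt x u ≤ ∂ A u
            pointwise u = here (x Fin.≟ u)
              where
              here : Dec (x ≡ u) → pt x u ≤ ∂ A u
              here (yes refl) = subst (_≤ ∂ A x) (sym (pt-self x)) out≥1
              here (no p) = subst (_≤ ∂ A u) (sym (pt-other p)) (∂≥0 A u)
          only : ∀ {u} → A u ≡ true → x ≡ u
          only = no-cut-vertex A x x∈ (λ u u∈ x≢u → trans (sym (∂-in A u∈)) (trans (sym (tails u)) (pt-other x≢u))) y∉
          lonely : out A x ≡ sum (m x)
          lonely = sum-cong-≗ λ u → here u (status (A u))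
            where
            here : ∀ u → (A u ≡ true) ⊎ (A u ≡ false) → (if A u then 0ℤ else m x u) ≡ m x u
            here u (inj₂ u∉) = cong (λ b → if b then 0ℤ else m x u) u∉
            here u (inj₁ u∈) = trans (cong (λ b → if b then 0ℤ else m x u) u∈) (trans (sym (m-loop x)) (cong (m x) (only u∈)))

      open Meeting G cut≥2 no-cut-vertex D rank2 degD

      total : sum (λ v → valency v - + 2) ≡ + 8
      total = trans (sum-cong-≗ λ v → cong (_- + 2) (sym (sum-ℕ (mult v)))) (trans deg-canonical (cong (λ g → (g - 1ℤ) + (g - 1ℤ)) genus5))

      Essential : VSet → Set
      Essential A = cut A ≤ + 2 × (∃[ x ] A x ≡ true × Branching x) × (∃[ y ] A y ≡ false × Branching y)

      essential? : ∀ A → Dec (Essential A)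
      essential? A = (cut A ℤ.≤? + 2) ×-dec (Fin.any? (λ x → (A x Bool.≟ true) ×-dec branching? x) ×-dec Fin.any? (λ y → (A y Bool.≟ false) ×-dec branching? y))

      essential-resp : ∀ {A B} → (∀ v → A v ≡ B v) → Essential A → Essential B
      essential-resp {A} {B} eq (small , (x , x∈ , brx) , (y , y∉ , bry)) = subst (_≤ + 2) (sum-cong-≗ ∂-eq) small ,
        (x , trans (sym (eq x)) x∈ , brx) , (y , trans (sym (eq y)) y∉ , bry)
        where
        ∂-eq : ∀ v → ∂ A v ≡ ∂ B v
        ∂-eq v = cong₂ (λ b o → if b then o else 0ℤ) (eq v) (sum-cong-≗ λ w → cong (λ b → if b then 0ℤ else m v w) (eq w))

      inseparable : PencilOn G
      inseparable = decide (any-subset? Essential (λ {A} {B} → essential-resp {A} {B}) essential?)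
        where
        decide : Dec (∃[ A ] Essential A) → PencilOn G
        decide (yes (A , small , (x , x∈ , brx) , (y , y∉ , bry))) = essential-cut total {A} {x} {y} (ℤ.≤-antisym small (cut≥2 A x∈ y∉)) x∈ brx y∉ bry
        decide (no none′) = NoEssentialCut.three-connected (λ {A} {x} {y} small x∈ brx y∉ bry → none′ (A , small , (x , x∈ , brx) , (y , y∉ , bry))) total

    leafless : PencilOn G
    leafless = decide (any-subset? (λ A → ∃[ a ] CutVertex A a) (λ { {A} {B} eq (a , c) → a , cutVertex-resp {A} {B} a eq c }) (λ A → Fin.any? (cutVertex? A)))
      where
      decide : Dec (∃[ A ] ∃[ a ] CutVertex A a) → PencilOn G
      decide (yes (A , a , c)) = separable A a c
      decide (no none) = Inseparable.inseparable none

-- Equality in Clifford's inequality. The recursion deletes a leaf each time, with `k` counting the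
-- vertices; genus, degree and rank survive the deletion.
clifford-equality : ∀ k (G : Graph) → Graph.n G ≡ k → genus G ≡ + 5 → ∀ D → deg G D ≡ + 4 → Theory.Rank≥ G D 2 → PencilOn G
clifford-equality k G n≡k genus5 D degD rank2 = by-leaf k G n≡k genus5 D degD rank2 (Fin.any? λ v → sum (Theory.m G v) ℤ.≟ 1ℤ)
  where
  by-leaf : ∀ k (G : Graph) → Graph.n G ≡ k → genus G ≡ + 5 → ∀ D → deg G D ≡ + 4 → Theory.Rank≥ G D 2 →
            Dec (∃[ v ] sum (Theory.m G v) ≡ 1ℤ) → PencilOn G
  by-leaf k G n≡ g5 D degD rank2 (no none) = Leafless.leafless G (λ v eq → none (v , eq)) g5 D degD rank2
  by-leaf zero record { loopless = loopless } refl g5 D degD rank2 (yes (zero , eq)) with () ← trans (sym eq) (trans (ℤ.+-identityʳ _) (cong +_ (loopless zero)))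
  by-leaf (suc k) record { mult = mult ; symmetric = symmetric ; loopless = loopless ; connected = connected } refl g5 D degD rank2 (yes (ℓ , leaf)) =
      lifted (clifford-equality k L.G′ refl (trans L.genus-down g5) (L.down D) (trans (L.deg-down D) degD) (L.rank-down {D} rank2))
    where
    module L = Delete mult symmetric loopless connected ℓ leaf
    lifted : PencilOn L.G′ → PencilOn L.G
    lifted (h , deg2 , eff) = L.up h , trans (L.deg-up h) deg2 , L.pencil-up {h} eff

-- Gonalities of a graph of given genus

module Gonality (G : Graph) where
  open Graph G
  open Theory G
  open Firing G
  open Ranks G

  -- Burning decides rank 0; each further unit of rank is a test over the finitely many vertices.
  rank? : ∀ r X → Dec (Rank≥ X r)
  rank? zero X = decide (effClass? X)
    where
    decide : Dec (EffClass X) → Dec (Rank≥ X 0)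
    decide (yes e) = yes (zero-rank {X} e)
    decide (no ¬e) = no λ rank → ¬e (rank-zero {X} rank)
  rank? (suc r) X = decide (Fin.all? λ w → rank? r (λ v → X v - pt w v))
    where
    decide : Dec (∀ w → Rank≥ (λ v → X v - pt w v) r) → Dec (Rank≥ X (suc r))
    decide (yes all) = yes (rank-suc {X} {r} all)
    decide (no ¬all) = no λ rank → ¬all (rank-pred {X} {r} rank)

  to-equivalent : ∀ {X} → EffClass X → EquivalentToEffective G X
  to-equivalent {X} (E , E≥0 , X≋E) = E , E≥0 , to-∼ {X} {E} X≋E

  from-equivalent : ∀ {X} → EquivalentToEffective G X → EffClass X
  from-equivalent {X} (E , E≥0 , X∼E) = E , E≥0 , from-∼ {X} {E} X∼E

  to-survives : ∀ {X r} → Rank≥ X r → SurvivesRemoving G X r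
  to-survives {X} rank E E≥0 degE = to-equivalent {λ v → X v - E v} (rank E E≥0 degE)

  from-survives : ∀ {X r} → SurvivesRemoving G X r → Rank≥ X r
  from-survives {X} sv E E≥0 degE = from-equivalent {λ v → X v - E v} (sv E E≥0 degE)

  from-rank : ∀ {X r} → RankAtLeast G X r → Rank≥ X r
  from-rank (_ , rank-−1 _ , ())
  from-rank {X} {r} (_ , rank-max {s} _ sv _ , +≤+ r≤s) = rank-≤ {X} {s} {r} r≤s (from-survives {X} {s} sv)

  -- `RankAtLeast` asks for the exact rank. It is found by searching upwards from `r`, and the
  -- degree bounds the search.
  to-rank : ∀ {X r} → Rank≥ X r → RankAtLeast G X r
  to-rank {X} {r} rank = search ∣ deg G X - + r ∣ r rank (ℤ.≤-reflexive (sym (trans (cong (_+_ (+ r)) (ℤ.0≤i⇒+∣i∣≡i (ℤ.i≤j⇒0≤j-i (rank≤deg {X} {r} rank)))) (cancel (+ r) (deg G X))))) ℕ.≤-refl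
    where
    cancel : ∀ a b → a + (b - a) ≡ b
    cancel = solve-∀
    search : ∀ fuel s → Rank≥ X s → deg G X ≤ + s + + fuel → r ℕ.≤ s → RankAtLeast G X r
    search fuel s rk deg≤ r≤s = decide fuel deg≤ (rank? (suc s) X)
      where
      decide : ∀ fuel → deg G X ≤ + s + + fuel → Dec (Rank≥ X (suc s)) → RankAtLeast G X r
      decide _ _ (no top) = + s , rank-max (to-equivalent {X} (rank-zero {X} (rank-≤ {X} {s} {0} z≤n rk))) (to-survives {X} {s} rk)
        (λ t sv → ℕ.≮⇒≥ λ s<t → top (rank-≤ {X} {t} {suc s} s<t (from-survives {X} {t} sv))) , +≤+ r≤s
      decide zero deg≤ (yes rk′) = ⊥-elim (ℤ.<⇒≱ (+<+ (ℕ.n<1+n s)) (ℤ.≤-trans (rank≤deg {X} {suc s} rk′) (subst (deg G X ≤_) (ℤ.+-identityʳ (+ s)) deg≤)))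
      decide (suc fuel) deg≤ (yes rk′) = search fuel (suc s) rk′ (subst (deg G X ≤_) (cong +_ (ℕ.+-suc s fuel)) deg≤) (ℕ.m≤n⇒m≤1+n r≤s)

  Gon : ℕ → ℤ → Set
  Gon r d = (∃[ X ] Rank≥ X r × deg G X ≡ d) × (∀ X → Rank≥ X r → d ≤ deg G X)

  to-gon : ∀ {r d} → Gon r d → IsGon G r d
  to-gon {r} ((X , rank , degX) , least) = (X , to-rank {X} {r} rank , degX) , λ Y rk → least Y (from-rank {Y} {r} rk)

  from-gon : ∀ {r d} → IsGon G r d → Gon r d
  from-gon {r} ((X , rank , degX) , least) = (X , from-rank {X} {r} rank , degX) , λ Y rk → least Y (to-rank {Y} {r} rk)

  module OfGenus {g : ℕ} (genus≡ : genus G ≡ + g) where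

    dual : ∀ {X r} s → Rank≥ X r → + s ≡ + r - deg G X + (+ g - 1ℤ) → Rank≥ (λ v → canonical v - X v) s
    dual {X} {r} s rank eq = riemann-roch X r s rank (trans eq (cong (λ z → + r - deg G X + (z - 1ℤ)) (sym genus≡)))

    deg-dual : ∀ X → deg G (λ v → canonical v - X v) ≡ (+ g - 1ℤ) + (+ g - 1ℤ) - deg G X
    deg-dual X = trans (deg-K- X) (cong (λ z → (z - 1ℤ) + (z - 1ℤ) - deg G X) genus≡)

    special : ∀ {X r} → deg G X < + g + + r → ∃[ s ] + s ≡ + r - deg G X + (+ g - 1ℤ)
    special {X} {r} lt = ∣ z ∣ , ℤ.0≤i⇒+∣i∣≡i (subst (0ℤ ≤_) (regroup (+ g) (+ r) (deg G X)) (ℤ.i≤j⇒0≤j-i (ℤ.i<j⇒i≤pred[j] lt)))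
      where
      z : ℤ
      z = + r - deg G X + (+ g - 1ℤ)
      regroup : ∀ g r d → -1ℤ + (g + r) - d ≡ r - d + (g - 1ℤ)
      regroup = solve-∀

    -- In degree below `g + r` the dual divisor would have a rank exceeding its degree as soon as
    -- `r ≥ g`.
    nonspecial-gon : ∀ {r} → g ℕ.≤ r → Gon r (+ g + + r)
    nonspecial-gon {r} g≤r = (D , riemann D r (ℤ.≤-reflexive (trans (ℤ.+-comm (+ r) (genus G)) (trans (cong (_+ + r) genus≡) (sym degD)))) , degD) , λ X rank → ℤ.≮⇒≥ λ lt → too-small X rank (special {X} {r} lt)
      where
      o : Vertex
      o = zero
      D : Divisor G
      D = single o (+ g + + r)
      degD : deg G D ≡ + g + + r
      degD = sum-single o (+ g + + r)
      too-small : ∀ X → Rank≥ X r → ∃[ s ] + s ≡ + r - deg G X + (+ g - 1ℤ) → ⊥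
      too-small X rank (s , eq) = ℤ.<⇒≱ (-<+ {0}) (ℤ.≤-trans (ℤ.i≤j⇒0≤j-i (ℤ.≤-trans (rank≤deg {λ v → canonical v - X v} {s} (dual {X} {r} s rank eq)) (ℤ.≤-reflexive (deg-dual X))))
        (ℤ.≤-trans (ℤ.≤-reflexive (trans (cong (λ z → (+ g - 1ℤ) + (+ g - 1ℤ) - deg G X - z) eq) (regroup (+ g) (deg G X) (+ r)))) (ℤ.+-monoˡ-≤ -1ℤ (ℤ.i≤j⇒i-j≤0 (+≤+ g≤r)))))
        where
        regroup : ∀ g d r → (g - 1ℤ) + (g - 1ℤ) - d - (r - d + (g - 1ℤ)) ≡ g - r + -1ℤ
        regroup = solve-∀

    clifford-bound : ∀ {X r} → Rank≥ X r → r ℕ.< g → + r + + r ≤ deg G X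
    clifford-bound {X} {r} rank r<g = ℤ.≮⇒≥ λ lt → too-small lt (special {X} {r} (ℤ.<-trans lt (ℤ.+-monoˡ-< (+ r) (+<+ r<g))))
      where
      too-small : deg G X < + r + + r → ∃[ s ] + s ≡ + r - deg G X + (+ g - 1ℤ) → ⊥
      too-small lt (s , eq) = clifford {X} {r} s rank (trans eq (cong (λ z → + r - deg G X + (z - 1ℤ)) (sym genus≡)))
        (subst₂ _≤_ (sym genus≡) (cong (_+_ (+ r)) (sym eq)) (ℤ.i-j≤0⇒i≤j (subst (_≤ 0ℤ) (regroup (+ g) (+ r) (deg G X)) (ℤ.i≤j⇒i-j≤0 (ℤ.i<j⇒suc[i]≤j lt)))))
        where
        regroup : ∀ g r d → (1ℤ + d) - (r + r) ≡ g - (r + (r - d + (g - 1ℤ)))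
        regroup = solve-∀

    -- Duality applied to the effective divisor `E`, of which only rank 0 is used.
    canonical-minus : ∀ {E} r → Effective G E → + r + 1ℤ + deg G E ≡ + g → Rank≥ (λ v → canonical v - E v) r
    canonical-minus {E} r E≥0 eq = dual {E} {0} r (zero-rank {E} (E , E≥0 , ≋-refl)) (solve (+ r) (deg G E) (+ g) eq)
      where
      solve : ∀ r d g → r + 1ℤ + d ≡ g → r ≡ 0ℤ - d + (g - 1ℤ)
      solve r d .(r + 1ℤ + d) refl = simplify r d
        where
        simplify : ∀ r d → r ≡ 0ℤ - d + (r + 1ℤ + d - 1ℤ)
        simplify = solve-∀

    canonical-gon : ∀ r → suc r ≡ g → Gon r (+ r + + r)
    canonical-gon r refl = (K , canonical-minus {λ _ → 0ℤ} r (λ _ → ℤ.≤-refl) (trans (cong (_+_ (+ r + 1ℤ)) (sum-replicate-zero (suc n))) (trans (ℤ.+-identityʳ _) (ℤ.+-comm (+ r) 1ℤ))) , degK) ,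
        λ X rank → clifford-bound {X} {r} rank ℕ.≤-refl
      where
      K : Divisor G
      K v = canonical v - 0ℤ
      degK : deg G K ≡ + r + + r
      degK = trans (deg-dual (λ _ → 0ℤ)) (trans (cong (_-_ ((+ suc r - 1ℤ) + (+ suc r - 1ℤ))) (sum-replicate-zero (suc n))) (regroup (+ r)))
        where
        regroup : ∀ r → (1ℤ + r - 1ℤ) + (1ℤ + r - 1ℤ) - 0ℤ ≡ r + r
        regroup = solve-∀

    module _ {d : ℤ} (gon₁ : Gon 1 d) where
      private
        X₁ : Divisor G
        X₁ = proj₁ (proj₁ gon₁)
        rank₁ : Rank≥ X₁ 1
        rank₁ = proj₁ (proj₂ (proj₁ gon₁))
        deg₁ : deg G X₁ ≡ d
        deg₁ = proj₂ (proj₂ (proj₁ gon₁))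

        o : Vertex
        o = zero

      no-small-pencil : ∀ {X k} → Rank≥ X 1 → deg G X ≡ k → ¬ (d ≤ k) → ⊥
      no-small-pencil {X} rank eq d≰k = d≰k (subst (d ≤_) eq (proj₂ gon₁ X rank))

      multiple : ∀ r → ∃[ X ] Rank≥ X r × deg G X ≡ + r * d
      multiple zero = (λ _ → 0ℤ) , zero-rank {λ _ → 0ℤ} ((λ _ → 0ℤ) , (λ _ → ℤ.≤-refl) , ≋-refl) , sum-replicate-zero (suc n)
      multiple (suc r) = add (multiple r)
        where
        add : (∃[ X ] Rank≥ X r × deg G X ≡ + r * d) → ∃[ X ] Rank≥ X (suc r) × deg G X ≡ + suc r * d
        add (X , rank , degX) = (λ v → X₁ v + X v) , superadditive 1 r {X₁} {X} rank₁ rank ,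
          trans (∑-distrib-+ X₁ X) (trans (cong₂ _+_ deg₁ degX) (sym (ℤ.suc-* (+ r) d)))

      d≡2 : 1 ℕ.< g → d ≤ + 2 → + 2 ≡ d
      d≡2 1<g d≤2 = ℤ.≤-antisym (subst (+ 2 ≤_) deg₁ (clifford-bound {X₁} {1} rank₁ 1<g)) d≤2

      -- Multiples of a divisor of degree 2 and rank 1 attain Clifford's bound.
      hyperelliptic-gon : ∀ r → 1 ℕ.< g → d ≤ + 2 → r ℕ.< g → Gon r (+ r + + r)
      hyperelliptic-gon r 1<g d≤2 r<g = attained (multiple r) , λ X rank → clifford-bound {X} {r} rank r<g
        where
        attained : (∃[ X ] Rank≥ X r × deg G X ≡ + r * d) → ∃[ X ] Rank≥ X r × deg G X ≡ + r + + r
        attained (X , rank , degX) = X , rank , trans degX (trans (cong (_*_ (+ r)) (sym (d≡2 1<g d≤2))) (regroup (+ r)))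
          where
          regroup : ∀ r → r * + 2 ≡ r + r
          regroup = solve-∀

      -- Otherwise degree 2 (g - 2) is excluded by duality, and K - o has degree one more.
      canonical-minus-point-gon : ∀ r → suc (suc r) ≡ g → ¬ (d ≤ + 2) → Gon r (+ r + + r + 1ℤ)
      canonical-minus-point-gon r refl d≰2 = ((λ v → canonical v - pt o v) , canonical-minus {pt o} r (pt≥0 o) (trans (cong (_+_ (+ r + 1ℤ)) (sum-pt o)) (regroup₁ (+ r))) ,
          trans (deg-dual (pt o)) (trans (cong (_-_ ((+ suc (suc r) - 1ℤ) + (+ suc (suc r) - 1ℤ))) (sum-pt o)) (regroup₂ (+ r)))) , least
        where
        regroup₁ : ∀ r → r + 1ℤ + 1ℤ ≡ + 2 + r
        regroup₁ = solve-∀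
        regroup₂ : ∀ r → (+ 2 + r - 1ℤ) + (+ 2 + r - 1ℤ) - 1ℤ ≡ r + r + 1ℤ
        regroup₂ = solve-∀
        least : ∀ X → Rank≥ X r → + r + + r + 1ℤ ≤ deg G X
        least X rank = subst (_≤ deg G X) (ℤ.+-comm 1ℤ (+ r + + r)) (ℤ.i<j⇒suc[i]≤j (ℤ.≤∧≢⇒< (clifford-bound {X} {r} rank (ℕ.m≤n⇒m≤1+n ℕ.≤-refl)) λ eq →
            no-small-pencil {λ v → canonical v - X v} {+ 2} (dual {X} {r} 1 rank (trans (regroup₃ (+ r)) (cong (λ z → + r - z + (+ suc (suc r) - 1ℤ)) eq)))
              (trans (deg-dual X) (trans (cong (_-_ ((+ suc (suc r) - 1ℤ) + (+ suc (suc r) - 1ℤ))) (sym eq)) (regroup₄ (+ r)))) d≰2))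
          where
          regroup₃ : ∀ r → 1ℤ ≡ r - (r + r) + (+ 2 + r - 1ℤ)
          regroup₃ = solve-∀
          regroup₄ : ∀ r → (+ 2 + r - 1ℤ) + (+ 2 + r - 1ℤ) - (r + r) ≡ + 2
          regroup₄ = solve-∀

  module Genus5 (genus≡ : genus G ≡ + 5) {d : ℤ} (gon₁ : Gon 1 d) where
    open OfGenus {5} genus≡

    private
      at-least-5 : ¬ (d ≤ + 2) → ∀ X → Rank≥ X 2 → + 5 ≤ deg G X
      at-least-5 d≰2 X rank = ℤ.i<j⇒suc[i]≤j (ℤ.≤∧≢⇒< (clifford-bound {X} {2} rank (s≤s (s≤s (s≤s z≤n)))) λ eq →
        pencil (clifford-equality n G refl genus≡ X (sym eq) rank))
        where
        pencil : PencilOn G → ⊥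
        pencil (h , deg2 , eff) = no-small-pencil gon₁ {h} (rank-from-points {h} eff) deg2 d≰2

    -- The dual of a divisor of degree 3 and rank 1 has degree 5 and rank 2.
    trigonal-gon : ¬ (d ≤ + 2) → d ≤ + 3 → Gon 2 (+ 5)
    trigonal-gon d≰2 d≤3 = ((λ v → canonical v - X v) , dual {X} {1} 2 rank (trans refl (cong (λ z → 1ℤ - z + (+ 5 - 1ℤ)) (sym deg3))) , trans (deg-dual X) (cong (_-_ (+ 8)) deg3)) , at-least-5 d≰2
      where
      X : Divisor G
      X = proj₁ (proj₁ gon₁)
      rank : Rank≥ X 1
      rank = proj₁ (proj₂ (proj₁ gon₁))
      deg3 : deg G X ≡ + 3
      deg3 = trans (proj₂ (proj₂ (proj₁ gon₁))) (ℤ.≤-antisym d≤3 (ℤ.i<j⇒suc[i]≤j (ℤ.≰⇒> d≰2)))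

    -- Degree 5 is excluded since its dual would have degree 3 and rank 1; `K` minus two chips
    -- attains 6.
    general-gon : ¬ (d ≤ + 3) → Gon 2 (+ 6)
    general-gon d≰3 = ((λ v → canonical v - E v) , canonical-minus {E} 2 (λ v → ℤ.+-mono-≤ (pt≥0 o v) (pt≥0 o v)) (cong (_+_ (+ 3)) degE) , trans (deg-dual E) (cong (_-_ (+ 8)) degE)) , least
      where
      o : Vertex
      o = zero
      E : Divisor G
      E v = pt o v + pt o v
      degE : deg G E ≡ + 2
      degE = trans (∑-distrib-+ (pt o) (pt o)) (cong₂ _+_ (sum-pt o) (sum-pt o))
      least : ∀ X → Rank≥ X 2 → + 6 ≤ deg G X
      least X rank = ℤ.i<j⇒suc[i]≤j (ℤ.≤∧≢⇒< (at-least-5 (λ d≤2 → d≰3 (ℤ.≤-trans d≤2 (+≤+ (s≤s (s≤s z≤n))))) X rank) λ eq →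
        no-small-pencil gon₁ {λ v → canonical v - X v} {+ 3} (dual {X} {2} 1 rank (trans refl (cong (λ z → + 2 - z + (+ 5 - 1ℤ)) eq)))
          (trans (deg-dual X) (cong (_-_ (+ 8)) (sym eq))) d≰3)

-- Graphs of genus at most 5

module _ (G G′ : Graph) where
  private
    module A = Gonality G
    module B = Gonality G′

  same : ∀ {r d} → A.Gon r d → B.Gon r d → SameGon G G′ r
  same {r} {d} gA gB = d , A.to-gon gA , B.to-gon gB

  same-gonality : ∀ (g : ℕ) → g ℕ.≤ 5 → genus G ≡ + g → genus G′ ≡ + g → SameGon G G′ 1 → ∀ r → 1 ℕ.≤ r → SameGon G G′ r
  same-gonality g g≤5 genusG genusG′ same₁@(d , isA , isB) r 1≤r = by-rank (g ℕ.≤? r) (suc r ℕ.≟ g)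
    where
    module X = A.OfGenus {g} genusG
    module Y = B.OfGenus {g} genusG′
    gonA : A.Gon 1 d
    gonA = A.from-gon isA
    gonB : B.Gon 1 d
    gonB = B.from-gon isB
    penultimate : suc (suc r) ≡ g → 1 ℕ.< g → r ℕ.< g → Dec (d ≤ + 2) → SameGon G G′ r
    penultimate eq 1<g r<g (yes d≤2) = same (X.hyperelliptic-gon gonA r 1<g d≤2 r<g) (Y.hyperelliptic-gon gonB r 1<g d≤2 r<g)
    penultimate eq _ _ (no d≰2) = same (X.canonical-minus-point-gon gonA r eq d≰2) (Y.canonical-minus-point-gon gonB r eq d≰2)
    -- With `1 ≤ r ≤ g - 3` and `g ≤ 5` either `r = 1`, or `r = 2` and `g = 5`.
    middle : ∀ g r → g ℕ.≤ 5 → genus G ≡ + g → genus G′ ≡ + g → 1 ℕ.≤ r → suc (suc (suc r)) ℕ.≤ g → Dec (d ≤ + 2) → Dec (d ≤ + 3) → SameGon G G′ r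
    middle g 1 _ _ _ _ _ _ _ = same₁
    middle g 2 g≤5 gA gB _ 5≤g (yes d≤2) _ = same (A.OfGenus.hyperelliptic-gon {g} gA gonA 2 (ℕ.≤-trans (s≤s (s≤s z≤n)) 5≤g) d≤2 (ℕ.≤-trans (s≤s (s≤s (s≤s z≤n))) 5≤g))
      (B.OfGenus.hyperelliptic-gon {g} gB gonB 2 (ℕ.≤-trans (s≤s (s≤s z≤n)) 5≤g) d≤2 (ℕ.≤-trans (s≤s (s≤s (s≤s z≤n))) 5≤g))
    middle g 2 g≤5 gA gB _ 5≤g (no d≰2) (yes d≤3) = same (A.Genus5.trigonal-gon gA′ gonA d≰2 d≤3) (B.Genus5.trigonal-gon gB′ gonB d≰2 d≤3)
      where
      gA′ : genus G ≡ + 5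
      gA′ = trans gA (cong +_ (ℕ.≤-antisym g≤5 5≤g))
      gB′ : genus G′ ≡ + 5
      gB′ = trans gB (cong +_ (ℕ.≤-antisym g≤5 5≤g))
    middle g 2 g≤5 gA gB _ 5≤g (no d≰2) (no d≰3) = same (A.Genus5.general-gon gA′ gonA d≰3) (B.Genus5.general-gon gB′ gonB d≰3)
      where
      gA′ : genus G ≡ + 5
      gA′ = trans gA (cong +_ (ℕ.≤-antisym g≤5 5≤g))
      gB′ : genus G′ ≡ + 5
      gB′ = trans gB (cong +_ (ℕ.≤-antisym g≤5 5≤g))
    middle g (suc (suc (suc r))) g≤5 _ _ _ 6≤g _ _ = ⊥-elim (ℕ.<⇒≱ (ℕ.≤-trans (s≤s (s≤s (s≤s (s≤s (s≤s (s≤s z≤n)))))) 6≤g) g≤5)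
    by-rank : Dec (g ℕ.≤ r) → Dec (suc r ≡ g) → SameGon G G′ r
    by-rank (yes g≤r) _ = same (X.nonspecial-gon g≤r) (Y.nonspecial-gon g≤r)
    by-rank (no _) (yes eq) = same (X.canonical-gon r eq) (Y.canonical-gon r eq)
    by-rank (no g≰r) (no neq) = by-middle (suc (suc r) ℕ.≟ g)
      where
      r<g : r ℕ.< g
      r<g = ℕ.≰⇒> g≰r
      by-middle : Dec (suc (suc r) ≡ g) → SameGon G G′ r
      by-middle (yes eq) = penultimate eq (subst (1 ℕ.<_) eq (s≤s (s≤s z≤n))) r<g (d ℤ.≤? + 2)
      by-middle (no neq′) = middle g r g≤5 genusG genusG′ 1≤r (ℕ.≤∧≢⇒< (ℕ.≤∧≢⇒< r<g neq) neq′) (d ℤ.≤? + 2) (d ℤ.≤? + 3)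

-- The path u = v = w with a edges between u and v and b edges between v and w.
module DoublePath (a b : ℕ) (a>0 : 0 ℕ.< a) (b>0 : 0 ℕ.< b) where

  mult : Fin 3 → Fin 3 → ℕ
  mult zero             (suc zero)       = a
  mult (suc zero)       zero             = a
  mult (suc zero)       (suc (suc zero)) = b
  mult (suc (suc zero)) (suc zero)       = b
  mult zero             zero             = 0
  mult zero             (suc (suc zero)) = 0
  mult (suc zero)       (suc zero)       = 0
  mult (suc (suc zero)) zero             = 0
  mult (suc (suc zero)) (suc (suc zero)) = 0

  symmetric : ∀ v w → mult v w ≡ mult w v
  symmetric zero             (suc zero)       = refl
  symmetric (suc zero)       zero             = refl
  symmetric (suc zero)       (suc (suc zero)) = refl
  symmetric (suc (suc zero)) (suc zero)       = refl
  symmetric zero             zero             = refl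
  symmetric zero             (suc (suc zero)) = refl
  symmetric (suc zero)       (suc zero)       = refl
  symmetric (suc (suc zero)) zero             = refl
  symmetric (suc (suc zero)) (suc (suc zero)) = refl

  loopless : ∀ v → mult v v ≡ 0
  loopless zero             = refl
  loopless (suc zero)       = refl
  loopless (suc (suc zero)) = refl

  to-middle : ∀ v → Star (λ v w → 0 ℕ.< mult v w) v (suc zero)
  to-middle zero             = a>0 ◅ ε
  to-middle (suc zero)       = ε
  to-middle (suc (suc zero)) = b>0 ◅ ε

  path : Graph
  path = record { n = 2 ; mult = mult ; symmetric = symmetric ; loopless = loopless
    ; connected = λ v w → to-middle v ◅◅ reverse (λ {x} {y} → subst (0 ℕ.<_) (symmetric x y)) (to-middle w) }

  open Theory path
  open Firing path
  open Ranks path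
  open Gonality path

  u v w : Fin 3
  u = zero
  v = suc zero
  w = suc (suc zero)

  genus-path : genus path ≡ + a + + b - + 2
  genus-path = trans (cong (λ e → + e - + 3 + 1ℤ) edges) (trans (cong (λ e → e - + 3 + 1ℤ) (ℤ.pos-+ a b)) (regroup (+ a) (+ b)))
    where
    edges : ∣E∣ path ≡ a ℕ.+ b
    edges = cong₂ ℕ._+_ (ℕ.+-identityʳ a) (trans (ℕ.+-identityʳ (b ℕ.+ 0)) (ℕ.+-identityʳ b))
    regroup : ∀ a b → a + b - + 3 + 1ℤ ≡ a + b - + 2
    regroup = solve-∀

  lap-u : ∀ f → lap f u ≡ + a * (f u - f v)
  lap-u f = simplify (f u - f u) (+ a * (f u - f v)) (f u - f w)
    where
    simplify : ∀ x y z → 0ℤ * x + (y + (0ℤ * z + 0ℤ)) ≡ y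
    simplify = solve-∀

  lap-v : ∀ f → lap f v ≡ + a * (f v - f u) + + b * (f v - f w)
  lap-v f = simplify (+ a * (f v - f u)) (f v - f v) (+ b * (f v - f w))
    where
    simplify : ∀ x y z → x + (0ℤ * y + (z + 0ℤ)) ≡ x + z
    simplify = solve-∀

  lap-w : ∀ f → lap f w ≡ + b * (f w - f v)
  lap-w f = simplify (f w - f u) (+ b * (f w - f v)) (f w - f w)
    where
    simplify : ∀ x y z → 0ℤ * x + (y + (0ℤ * z + 0ℤ)) ≡ y
    simplify = solve-∀

  divisor : ℤ → ℤ → ℤ → Divisor path
  divisor x y z zero             = x
  divisor x y z (suc zero)       = y
  divisor x y z (suc (suc zero)) = z

  deg-divisor : ∀ X → deg path X ≡ X u + X v + X w
  deg-divisor X = simplify (X u) (X v) (X w)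
    where
    simplify : ∀ x y z → x + (y + (z + 0ℤ)) ≡ x + y + z
    simplify = solve-∀

  -- Chips cross only the edges between `u` and `v`: up to a constant, the set of `v` and `w` is
  -- fired `k` times, with `k` of any sign.
  fire-v : ∀ {X} k → 0ℤ ≤ X u + + a * k → 0ℤ ≤ X v - + a * k → 0ℤ ≤ X w → EffClass X
  fire-v {X} k pu pv pw = E , E≥0 , f , X≡
    where
    E f : Divisor path
    E = divisor (X u + + a * k) (X v - + a * k) (X w)
    f = divisor (- k) 0ℤ 0ℤ
    E≥0 : Effective path E
    E≥0 zero             = pu
    E≥0 (suc zero)       = pv
    E≥0 (suc (suc zero)) = pw
    X≡ : ∀ x → X x ≡ E x + lap f x
    X≡ zero = trans (at-u (X u) (+ a) k) (cong (_+_ (E u)) (sym (lap-u f)))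
      where
      at-u : ∀ x a k → x ≡ x + a * k + a * (- k - 0ℤ)
      at-u = solve-∀
    X≡ (suc zero) = trans (at-v (X v) (+ a) (+ b) k) (cong (_+_ (E v)) (sym (lap-v f)))
      where
      at-v : ∀ x a b k → x ≡ x - a * k + (a * (0ℤ - - k) + b * (0ℤ - 0ℤ))
      at-v = solve-∀
    X≡ (suc (suc zero)) = trans (at-w (X w) (+ b)) (cong (_+_ (E w)) (sym (lap-w f)))
      where
      at-w : ∀ x b → x ≡ x + b * (0ℤ - 0ℤ)
      at-w = solve-∀

  -- A negative `k` would bring the value down to at most `l - m`, which is negative. The residues
  -- at `u` modulo `a` and at `w` modulo `b` are invariant under firing.
  residue≤ : ∀ {m l} → l ℕ.< m → ∀ k → 0ℤ ≤ + l + + m * k → + l ≤ + l + + m * k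
  residue≤ {m} {l} l<m (+ k) p = subst (_≤ + l + + m * + k) (ℤ.+-identityʳ (+ l)) (ℤ.+-monoʳ-≤ (+ l) (subst (0ℤ ≤_) (ℤ.pos-* m k) (+≤+ z≤n)))
  residue≤ {m} {l} l<m -[1+ k ] p = ⊥-elim (ℤ.<⇒≱ (ℤ.≤-<-trans below (subst (+ l - + m <_) (ℤ.+-inverseʳ (+ m)) (ℤ.+-monoˡ-< (- + m) (+<+ l<m)))) p)
    where
    below : + l + + m * -[1+ k ] ≤ + l - + m
    below = ℤ.+-monoʳ-≤ (+ l) (subst₂ _≤_ (ℤ.neg-distribʳ-* (+ m) (+ suc k)) refl (ℤ.neg-mono-≤ (subst (_≤ + m * + suc k) (ℤ.*-identityʳ (+ m)) (ℤ.*-monoˡ-≤-nonNeg (+ m) (+≤+ (s≤s z≤n))))))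

  -- Remove i chips at u and j chips at w: at least l resp. l′ chips remain there.
  rank-bound : ∀ {X r} → Rank≥ X r → ∀ {i j c l l′} → i ℕ.+ (c ℕ.+ j) ≡ r → l ℕ.< a → l′ ℕ.< b →
               ∀ s t → X u ≡ + i + + l + + a * s → X w ≡ + j + + l′ + + b * t → + l + + l′ + + r ≤ deg path X
  rank-bound {X} {r} rank {i} {j} {c} {l} {l′} total l<a l′<b s t Xu Xw = count (rank E E≥0 degE)
    where
    E : Divisor path
    -- The remaining `c` removals are spent at the middle vertex, where they do not affect the
    -- residues at the ends.
    E = divisor (+ i) (+ c) (+ j)
    E≥0 : Effective path E
    E≥0 zero             = +≤+ z≤n
    E≥0 (suc zero)       = +≤+ z≤n
    E≥0 (suc (suc zero)) = +≤+ z≤n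
    degE : deg path E ≡ + r
    degE = cong +_ (trans (cong (λ x → i ℕ.+ (c ℕ.+ x)) (ℕ.+-identityʳ j)) total)
    count : EffClass (λ x → X x - E x) → + l + + l′ + + r ≤ deg path X
    count (F , F≥0 , f , eq) = subst (+ l + + l′ + + r ≤_) degrees (ℤ.+-monoˡ-≤ (+ r)
        (ℤ.≤-trans (subst (_≤ F u + F w) refl (ℤ.+-mono-≤ Fu Fw)) (subst₂ _≤_ (ℤ.+-identityʳ (F u + F w)) (regroup (F u) (F v) (F w)) (ℤ.+-monoʳ-≤ (F u + F w) (F≥0 v)))))
      where
      regroup : ∀ x y z → x + z + y ≡ x + (y + (z + 0ℤ))
      regroup = solve-∀
      degrees : deg path F + + r ≡ deg path X
      degrees = trans (cong₂ _+_ (trans (sym (≋-deg {λ x → X x - E x} {F} (f , eq))) (sum-sub X E)) (sym degE)) (cancel (sum X) (sum E))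
        where
        cancel : ∀ x e → x - e + e ≡ x
        cancel = solve-∀
      solve : ∀ x i l a s F m → x ≡ i + l + a * s → x - i ≡ F + a * m → F ≡ l + a * (s - m)
      solve .(i + l + a * s) i l a s F m refl eq = trans (cancel F (a * m)) (trans (cong (_- a * m) (sym eq)) (collect i l a s m))
        where
        cancel : ∀ F x → F ≡ F + x - x
        cancel = solve-∀
        collect : ∀ i l a s m → i + l + a * s - i - a * m ≡ l + a * (s - m)
        collect = solve-∀
      Fu≡ : F u ≡ + l + + a * (s - (f u - f v))
      Fu≡ = solve (X u) (+ i) (+ l) (+ a) s (F u) (f u - f v) Xu (trans (eq u) (cong (_+_ (F u)) (lap-u f)))
      Fw≡ : F w ≡ + l′ + + b * (t - (f w - f v))
      Fw≡ = solve (X w) (+ j) (+ l′) (+ b) t (F w) (f w - f v) Xw (trans (eq w) (cong (_+_ (F w)) (lap-w f)))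
      Fu : + l ≤ F u
      Fu = subst (+ l ≤_) (sym Fu≡) (residue≤ l<a (s - (f u - f v)) (subst (0ℤ ≤_) Fu≡ (F≥0 u)))
      Fw : + l′ ≤ F w
      Fw = subst (+ l′ ≤_) (sym Fw≡) (residue≤ l′<b (t - (f w - f v)) (subst (0ℤ ≤_) Fw≡ (F≥0 w)))

  residue : ∀ m .{{_ : ℕ.NonZero m}} x → ∃[ p ] ∃[ s ] p ℕ.< m × x ≡ + p + + m * s
  residue m x = x %ℕ m , x /ℕ m , n%ℕd<d x m , trans (a≡a%ℕn+[a/ℕn]*n x m) (cong (_+_ (+ (x %ℕ m))) (ℤ.*-comm (x /ℕ m) (+ m)))

-- Two graphs of genus `6 + k`

module _ (k : ℕ) where

  module P = DoublePath 2 (6 ℕ.+ k) (s≤s z≤n) (s≤s z≤n)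
  module Q = DoublePath 3 (5 ℕ.+ k) (s≤s z≤n) (s≤s z≤n)
  module GP = Gonality P.path
  module GQ = Gonality Q.path
  module TP = Theory P.path
  module TQ = Theory Q.path

  -- Allows more chips to be removed from an end than its residue: after borrowing `m` a large
  -- residue remains.
  borrow : ∀ m c s → + c + + m * s ≡ + (c ℕ.+ m) + + m * (s - 1ℤ)
  borrow m c s = trans (regroup (+ c) (+ m) s) (cong (_+ + m * (s - 1ℤ)) (sym (ℤ.pos-+ c m)))
    where
    regroup : ∀ c m s → c + m * s ≡ (c + m) + m * (s - 1ℤ)
    regroup = solve-∀

  weaken : ∀ {x y : ℕ} {d} → x ℕ.≤ y → + y ≤ d → + x ≤ d
  weaken x≤y p = ℤ.≤-trans (+≤+ x≤y) p

  pencil-bound-P : ∀ X → TP.Rank≥ X 1 → + 3 ≤ deg P.path X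
  pencil-bound-P X rank = cases (P.residue 2 (X P.u)) (P.residue (6 ℕ.+ k) (X P.w))
    where
    cases : (∃[ p ] ∃[ s ] p ℕ.< 2 × X P.u ≡ + p + + 2 * s) → (∃[ q ] ∃[ t ] q ℕ.< 6 ℕ.+ k × X P.w ≡ + q + + (6 ℕ.+ k) * t) → + 3 ≤ deg P.path X
    cases (p , s , p<2 , Xu) (zero , t , _ , Xw) = weaken (ℕ.≤-trans (s≤s (s≤s (s≤s z≤n))) (ℕ.≤-trans (ℕ.m≤n+m (5 ℕ.+ k) p) (ℕ.m≤m+n (p ℕ.+ (5 ℕ.+ k)) 1)))
      (P.rank-bound {X} {1} rank {0} {1} {0} {p} {5 ℕ.+ k} refl p<2 ℕ.≤-refl s (t - 1ℤ) Xu (trans Xw (borrow (6 ℕ.+ k) 0 t)))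
    cases (0 , s , _ , Xu) (suc q , t , q<b , Xw) = weaken (s≤s (s≤s (ℕ.m≤n+m 1 q)))
      (P.rank-bound {X} {1} rank {1} {0} {0} {1} {suc q} refl (s≤s (s≤s z≤n)) q<b (s - 1ℤ) t (trans Xu (borrow 2 0 s)) Xw)
    cases (1 , s , _ , Xu) (suc q , t , q<b , Xw) = weaken (s≤s (s≤s (ℕ.m≤n+m 1 q)))
      (P.rank-bound {X} {1} rank {0} {0} {1} {1} {suc q} refl (s≤s (s≤s z≤n)) q<b s t Xu Xw)
    cases (suc (suc p) , _ , s≤s (s≤s ()) , _) (suc q , _)

  -- Residue 0 or 1 at `w` becomes `5 + k` when one or two chips are removed there. Otherwise at
  -- least 2 remain at `w`, and at most one removal makes the residue at `u` equal to 1, so the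
  -- degree is at least `1 + 2 + 2`.
  net-bound-P : ∀ X → TP.Rank≥ X 2 → + 5 ≤ deg P.path X
  net-bound-P X rank = cases (P.residue 2 (X P.u)) (P.residue (6 ℕ.+ k) (X P.w))
    where
    large : ∀ p → 5 ℕ.≤ p ℕ.+ (5 ℕ.+ k) ℕ.+ 2
    large p = ℕ.≤-trans (s≤s (s≤s (s≤s (s≤s (s≤s z≤n))))) (ℕ.≤-trans (ℕ.m≤n+m (5 ℕ.+ k) p) (ℕ.m≤m+n (p ℕ.+ (5 ℕ.+ k)) 2))
    cases : (∃[ p ] ∃[ s ] p ℕ.< 2 × X P.u ≡ + p + + 2 * s) → (∃[ q ] ∃[ t ] q ℕ.< 6 ℕ.+ k × X P.w ≡ + q + + (6 ℕ.+ k) * t) → + 5 ≤ deg P.path X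
    cases (p , s , p<2 , Xu) (0 , t , _ , Xw) = weaken (large p)
      (P.rank-bound {X} {2} rank {0} {1} {1} {p} {5 ℕ.+ k} refl p<2 ℕ.≤-refl s (t - 1ℤ) Xu (trans Xw (borrow (6 ℕ.+ k) 0 t)))
    cases (p , s , p<2 , Xu) (1 , t , _ , Xw) = weaken (large p)
      (P.rank-bound {X} {2} rank {0} {2} {0} {p} {5 ℕ.+ k} refl p<2 ℕ.≤-refl s (t - 1ℤ) Xu (trans Xw (borrow (6 ℕ.+ k) 1 t)))
    cases (0 , s , _ , Xu) (suc (suc q) , t , q<b , Xw) = weaken (s≤s (s≤s (s≤s (ℕ.m≤n+m 2 q))))
      (P.rank-bound {X} {2} rank {1} {0} {1} {1} {suc (suc q)} refl (s≤s (s≤s z≤n)) q<b (s - 1ℤ) t (trans Xu (borrow 2 0 s)) Xw)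
    cases (1 , s , _ , Xu) (suc (suc q) , t , q<b , Xw) = weaken (s≤s (s≤s (s≤s (ℕ.m≤n+m 2 q))))
      (P.rank-bound {X} {2} rank {0} {0} {2} {1} {suc (suc q)} refl (s≤s (s≤s z≤n)) q<b s t Xu Xw)
    cases (suc (suc p) , _ , s≤s (s≤s ()) , _) (suc (suc q) , _)

  pencil-bound-Q : ∀ X → TQ.Rank≥ X 1 → + 3 ≤ deg Q.path X
  pencil-bound-Q X rank = cases (Q.residue 3 (X Q.u)) (Q.residue (5 ℕ.+ k) (X Q.w))
    where
    cases : (∃[ p ] ∃[ s ] p ℕ.< 3 × X Q.u ≡ + p + + 3 * s) → (∃[ q ] ∃[ t ] q ℕ.< 5 ℕ.+ k × X Q.w ≡ + q + + (5 ℕ.+ k) * t) → + 3 ≤ deg Q.path X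
    cases (p , s , p<3 , Xu) (zero , t , _ , Xw) = weaken (ℕ.≤-trans (s≤s (s≤s (s≤s z≤n))) (ℕ.≤-trans (ℕ.m≤n+m (4 ℕ.+ k) p) (ℕ.m≤m+n (p ℕ.+ (4 ℕ.+ k)) 1)))
      (Q.rank-bound {X} {1} rank {0} {1} {0} {p} {4 ℕ.+ k} refl p<3 ℕ.≤-refl s (t - 1ℤ) Xu (trans Xw (borrow (5 ℕ.+ k) 0 t)))
    cases (0 , s , _ , Xu) (suc q , t , q<b , Xw) = weaken (s≤s (s≤s (s≤s z≤n)))
      (Q.rank-bound {X} {1} rank {1} {0} {0} {2} {suc q} refl (s≤s (s≤s (s≤s z≤n))) q<b (s - 1ℤ) t (trans Xu (borrow 3 0 s)) Xw)
    cases (1 , s , _ , Xu) (suc q , t , q<b , Xw) = weaken (s≤s (s≤s (ℕ.m≤n+m 1 q)))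
      (Q.rank-bound {X} {1} rank {0} {0} {1} {1} {suc q} refl (s≤s (s≤s z≤n)) q<b s t Xu Xw)
    cases (2 , s , _ , Xu) (suc q , t , q<b , Xw) = weaken (s≤s (s≤s (s≤s z≤n)))
      (Q.rank-bound {X} {1} rank {0} {0} {1} {2} {suc q} refl (s≤s (s≤s (s≤s z≤n))) q<b s t Xu Xw)
    cases (suc (suc (suc p)) , _ , s≤s (s≤s (s≤s ())) , _) (suc q , _)

  -- As for `P`, but with three edges at `u` at most two removals bring the residue there to 2. This
  -- is the source of the difference: `2 + 2 + 2` instead of `1 + 2 + 2`.
  net-bound-Q : ∀ X → TQ.Rank≥ X 2 → + 6 ≤ deg Q.path X
  net-bound-Q X rank = cases (Q.residue 3 (X Q.u)) (Q.residue (5 ℕ.+ k) (X Q.w))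
    where
    large : ∀ p → 6 ℕ.≤ p ℕ.+ (4 ℕ.+ k) ℕ.+ 2
    large p = ℕ.≤-trans (ℕ.m≤n+m 6 (p ℕ.+ k)) (ℕ.≤-reflexive (regroup p k))
      where
      regroup : ∀ p k → p ℕ.+ k ℕ.+ 6 ≡ p ℕ.+ (4 ℕ.+ k) ℕ.+ 2
      regroup = ℕ-solve-∀
    two : 2 ℕ.< 3
    two = s≤s (s≤s (s≤s z≤n))
    enough : ∀ q → 6 ℕ.≤ 2 ℕ.+ suc (suc q) ℕ.+ 2
    enough q = s≤s (s≤s (s≤s (s≤s (ℕ.m≤n+m 2 q))))
    cases : (∃[ p ] ∃[ s ] p ℕ.< 3 × X Q.u ≡ + p + + 3 * s) → (∃[ q ] ∃[ t ] q ℕ.< 5 ℕ.+ k × X Q.w ≡ + q + + (5 ℕ.+ k) * t) → + 6 ≤ deg Q.path X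
    cases (p , s , p<3 , Xu) (0 , t , _ , Xw) = weaken (large p)
      (Q.rank-bound {X} {2} rank {0} {1} {1} {p} {4 ℕ.+ k} refl p<3 ℕ.≤-refl s (t - 1ℤ) Xu (trans Xw (borrow (5 ℕ.+ k) 0 t)))
    cases (p , s , p<3 , Xu) (1 , t , _ , Xw) = weaken (large p)
      (Q.rank-bound {X} {2} rank {0} {2} {0} {p} {4 ℕ.+ k} refl p<3 ℕ.≤-refl s (t - 1ℤ) Xu (trans Xw (borrow (5 ℕ.+ k) 1 t)))
    cases (0 , s , _ , Xu) (suc (suc q) , t , q<b , Xw) = weaken (enough q)
      (Q.rank-bound {X} {2} rank {1} {0} {1} {2} {suc (suc q)} refl two q<b (s - 1ℤ) t (trans Xu (borrow 3 0 s)) Xw)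
    cases (1 , s , _ , Xu) (suc (suc q) , t , q<b , Xw) = weaken (enough q)
      (Q.rank-bound {X} {2} rank {2} {0} {0} {2} {suc (suc q)} refl two q<b (s - 1ℤ) t (trans Xu (borrow 3 1 s)) Xw)
    cases (2 , s , _ , Xu) (suc (suc q) , t , q<b , Xw) = weaken (enough q)
      (Q.rank-bound {X} {2} rank {0} {0} {2} {2} {suc (suc q)} refl two q<b s t Xu Xw)
    cases (suc (suc (suc p)) , _ , s≤s (s≤s (s≤s ())) , _) (suc (suc q) , _)

  -- No vertex of an effective divisor of degree `r` carries more than `r` chips.
  uniform : ∀ r → TQ.Rank≥ (λ _ → + r) r
  uniform r E E≥0 degE = (λ x → + r - E x) , (λ x → ℤ.i≤j⇒0≤j-i (subst (E x ≤_) degE (term≤sum E≥0 x))) , TQ.≋-refl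

  -- The divisor `2v + w`: a chip wanted at `u` is met by sending the two chips of `v` along the two
  -- edges to `u`.
  pencil-P : TP.Rank≥ (P.divisor 0ℤ (+ 2) 1ℤ) 1
  pencil-P E E≥0 degE = P.fire-v {λ x → P.divisor 0ℤ (+ 2) 1ℤ x - E x} (E P.u)
      (subst (0ℤ ≤_) (at-u (E P.u)) (E≥0 P.u))
      (subst (0ℤ ≤_) (trans (at-v (E P.u) (E P.v) (E P.w)) (cong (λ d → + 2 * d - E P.v - + 2 * E P.u) total)) (ℤ.+-mono-≤ (E≥0 P.v) (ℤ.+-mono-≤ (E≥0 P.w) (E≥0 P.w))))
      (subst (0ℤ ≤_) (trans (at-w (E P.u) (E P.v) (E P.w)) (cong (_- E P.w) total)) (ℤ.+-mono-≤ (E≥0 P.u) (E≥0 P.v)))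
    where
    total : E P.u + E P.v + E P.w ≡ 1ℤ
    total = trans (sym (P.deg-divisor E)) degE
    at-u : ∀ x → x ≡ 0ℤ - x + + 2 * x
    at-u = solve-∀
    at-v : ∀ x y z → y + (z + z) ≡ + 2 * (x + y + z) - y - + 2 * x
    at-v = solve-∀
    at-w : ∀ x y z → x + y ≡ (x + y + z) - z
    at-w = solve-∀

  -- The divisor `3v + 2w`: sending two chips from `v` to `u` once meets a demand of one or two
  -- chips at `u`, and leaves one chip at `v`.
  net-P : TP.Rank≥ (P.divisor 0ℤ (+ 3) (+ 2)) 2
  net-P E E≥0 degE = at-u (1ℤ ℤ.≤? E P.u)
    where
    X : Divisor P.path
    X x = P.divisor 0ℤ (+ 3) (+ 2) x - E x
    total : E P.u + E P.v + E P.w ≡ + 2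
    total = trans (sym (P.deg-divisor E)) degE
    Xw : 0ℤ ≤ X P.w
    Xw = subst (0ℤ ≤_) (trans (regroup (E P.u) (E P.v) (E P.w)) (cong (_- E P.w) total)) (ℤ.+-mono-≤ (E≥0 P.u) (E≥0 P.v))
      where
      regroup : ∀ x y z → x + y ≡ (x + y + z) - z
      regroup = solve-∀
    at-u : Dec (1ℤ ≤ E P.u) → TP.EffClass X
    at-u (yes 1≤) = P.fire-v {X} 1ℤ
        (subst (0ℤ ≤_) (trans (on-u (E P.u) (E P.v) (E P.w)) (cong (λ d → 0ℤ - E P.u + d) total)) (ℤ.+-mono-≤ (E≥0 P.v) (E≥0 P.w)))
        (subst (0ℤ ≤_) (trans (on-v (E P.u) (E P.v) (E P.w)) (cong (λ d → d + 1ℤ - E P.v - + 2 * 1ℤ) total)) (ℤ.+-mono-≤ (ℤ.i≤j⇒0≤j-i 1≤) (E≥0 P.w))) Xw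
      where
      on-u : ∀ x y z → y + z ≡ 0ℤ - x + (x + y + z)
      on-u = solve-∀
      on-v : ∀ x y z → (x - 1ℤ) + z ≡ (x + y + z) + 1ℤ - y - + 2 * 1ℤ
      on-v = solve-∀
    at-u (no ≱1) = P.fire-v {X} 0ℤ (ℤ.≤-reflexive (trans (sym (on-u 0ℤ)) (cong (λ x → 0ℤ - x + + 2 * 0ℤ) (sym zero-u))))
        (subst (0ℤ ≤_) (trans (on-v (E P.u) (E P.v) (E P.w)) (cong (λ d → d + 1ℤ - E P.v - + 2 * 0ℤ) total)) (ℤ.+-mono-≤ (ℤ.+-mono-≤ (E≥0 P.u) (E≥0 P.w)) (+≤+ {0} {1} z≤n))) Xw
      where
      zero-u : E P.u ≡ 0ℤ
      zero-u = ℤ.≤-antisym (ℤ.≮⇒≥ λ lt → ≱1 (ℤ.i<j⇒suc[i]≤j lt)) (E≥0 P.u)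
      on-u : ∀ x → 0ℤ - x + + 2 * 0ℤ ≡ - x
      on-u = solve-∀
      on-v : ∀ x y z → (x + z) + 1ℤ ≡ (x + y + z) + 1ℤ - y - + 2 * 0ℤ
      on-v = solve-∀

  gon₁-P : GP.Gon 1 (+ 3)
  gon₁-P = (P.divisor 0ℤ (+ 2) 1ℤ , pencil-P , refl) , pencil-bound-P

  gon₂-P : GP.Gon 2 (+ 5)
  gon₂-P = (P.divisor 0ℤ (+ 3) (+ 2) , net-P , refl) , net-bound-P

  gon₁-Q : GQ.Gon 1 (+ 3)
  gon₁-Q = ((λ _ → + 1) , uniform 1 , refl) , pencil-bound-Q

  gon₂-Q : GQ.Gon 2 (+ 6)
  gon₂-Q = ((λ _ → + 2) , uniform 2 , refl) , net-bound-Q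

  genus-P : genus P.path ≡ + (6 ℕ.+ k)
  genus-P = trans P.genus-path (cancel (+ (6 ℕ.+ k)))
    where
    cancel : ∀ x → + 2 + x - + 2 ≡ x
    cancel = solve-∀

  genus-Q : genus Q.path ≡ + (6 ℕ.+ k)
  genus-Q = trans Q.genus-path (cancel (+ (5 ℕ.+ k)))
    where
    cancel : ∀ x → + 3 + x - + 2 ≡ 1ℤ + x
    cancel = solve-∀

  same-first-gonality : SameGon P.path Q.path 1
  same-first-gonality = + 3 , GP.to-gon gon₁-P , GQ.to-gon gon₁-Q

  different-second-gonality : DifferentGon P.path Q.path 2
  different-second-gonality = + 5 , + 6 , GP.to-gon gon₂-P , GQ.to-gon gon₂-Q , λ ()

theorem1p4 : (g : ℕ) →
    (g ℕ.≤ 5 →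
      (G G′ : Graph) → genus G ≡ + g → genus G′ ≡ + g →
      SameGon G G′ 1 →
      (r : ℕ) → 1 ℕ.≤ r → SameGon G G′ r)
    ×
    (6 ℕ.≤ g →
      ∃[ G ] ∃[ H ] genus G ≡ + g × genus H ≡ + g ×
        SameGon G H 1 ×
        (∃[ r ] 1 ℕ.≤ r × DifferentGon G H r))
theorem1p4 g = (λ g≤5 G G′ genusG genusG′ → same-gonality G G′ g g≤5 genusG genusG′) , examples
  where
  examples : 6 ℕ.≤ g → ∃[ G ] ∃[ H ] genus G ≡ + g × genus H ≡ + g × SameGon G H 1 × (∃[ r ] 1 ℕ.≤ r × DifferentGon G H r)
  examples 6≤g = P.path k , Q.path k , trans (genus-P k) (cong +_ g≡) , trans (genus-Q k) (cong +_ g≡) ,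
      same-first-gonality k , (2 , s≤s z≤n , different-second-gonality k)
    where
    k : ℕ
    k = g ℕ.∸ 6
    g≡ : 6 ℕ.+ k ≡ g
    g≡ = ℕ.m+[n∸m]≡n 6≤g
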